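{- For every integer $t$ there exists an integer $\tau$ (depending only on $t$) such that the following holds. Let $G\in\mathcal{C}_{tt}$, let $(T,\chi)$ be a structured tree decomposition of $G$, let $v\in V(T)$, and let $Y\subseteq\chi(v)\setminus\operatorname{Hub}(G)$ be a stable set. Then $|Y|\leq 4\tau$.
   Context: Graphs are finite and simple; a path is an induced path and $P^*$ its interior. A hole is an induced cycle on at least four vertices; a theta is three internally vertex-disjoint paths between two vertices, each of length at least 2, with pairwise anticomplete interiors; a prism consists of three vertex-disjoint paths $a_i\text{ - }\dots\text{ - }b_i$, each of length at least 1, with $a_1a_2a_3$, $b_1b_2b_3$ triangles and no other edges between them; a wheel $(H,x)$ is a hole $H$ and a vertex $x$ with at least three neighbors in $H$, even if that number is even. $\mathcal{C}$: graphs with no induced $C_4$, theta, prism or even wheel; $\mathcal{C}_t$: those with no clique of size $t$; $\mathcal{C}_{tt}$: those in $\mathcal{C}_t$ with no induced generalized $t$-pyramid, where a generalized $k$-pyramid is a graph whose vertex set is the disjoint union of paths $P,Q,R_1,\dots,R_k$ such that $P\cup Q$ is a hole; $R_i$ has ends $a_i,b_i$; $a_i$ has exactly two neighbors $x_i,y_i$ in $P$, both in $P^*$ and adjacent; $b_i$ has exactly one neighbor $z_i$ in $Q$; $R_i\setminus\{a_i,b_i\}$ is anticomplete to $P\cup Q$; distinct $R_i$ are pairwise anticomplete; $P$ traverses $x_1,y_1,\dots,x_k,y_k$ in order; $Q$ traverses $z_1,\dots,z_k$ in order (some may coincide); $y_i\neq x_{i+1}$. A wheel $(H,x)$ is a twin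 wheel if $N(x)\cap H$ induces a path of length two, a short pyramid if $|N(x)\cap H|=3$ and $x$ has exactly two adjacent neighbors in $H$, proper otherwise; $\operatorname{Hub}(G)$ is the set of $x$ with $(H,x)$ a proper wheel for some hole $H$. A potential maximal clique (PMC) of $G$ is a maximal clique of some minimal chordal completion of $G$ (a chordal graph obtained from $G$ by adding an inclusion-wise minimal set of non-edges); a tree decomposition is structured if every bag is a PMC of $G$. -}

module Defs where

open import Data.Nat using (ℕ; zero; suc; _+_; _≤_; _<_; _≥_)
open import Data.Nat.Divisibility using (_∣_)
open import Data.Bool using (Bool; true; false; if_then_else_)
open import Data.Fin using (Fin; toℕ; fromℕ)
import Data.Fin as F
open import Data.Fin.Subset using (Subset; _∈_; _∉_)
open import Data.Product using (Σ; ∃; _×_; _,_)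
open import Data.Sum using (_⊎_)
open import Data.Unit using (⊤)
open import Relation.Nullary using (¬_)
open import Relation.Binary.PropositionalEquality using (_≡_; _≢_)
open import Function.Definitions using (Injective)
open import Function.Bundles using (_⇔_)

record Graph (n : ℕ) : Set where
  field
    adj     : Fin n → Fin n → Bool
    adj-sym : ∀ u v → adj u v ≡ adj v u
    adj-irr : ∀ v → adj v v ≡ false
open Graph public

Edge : ∀ {n} → Graph n → Fin n → Fin n → Set
Edge G u v = adj G u v ≡ true

countB : ∀ {m} → (Fin m → Bool) → ℕ
countB {zero}  f = 0
countB {suc m} f = (if f F.zero then 1 else 0) + countB (λ i → f (F.suc i))

LinAdj : ∀ {m} → Fin m → Fin m → Set
LinAdj i j = toℕ j ≡ suc (toℕ i) ⊎ toℕ i ≡ suc (toℕ j)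

CycAdj : ∀ {m} → Fin m → Fin m → Set
CycAdj {m} i j = LinAdj i j
  ⊎ (toℕ i ≡ 0 × suc (toℕ j) ≡ m)
  ⊎ (toℕ j ≡ 0 × suc (toℕ i) ≡ m)

module _ {n : ℕ} (G : Graph n) where

  record Path : Set where
    field
      len     : ℕ
      vert    : Fin (suc len) → Fin n
      inj     : Injective _≡_ _≡_ vert
      induced : ∀ i j → Edge G (vert i) (vert j) ⇔ LinAdj i j

  record Hole : Set where
    field
      k       : ℕ
      vert    : Fin (4 + k) → Fin n
      inj     : Injective _≡_ _≡_ vert
      induced : ∀ i j → Edge G (vert i) (vert j) ⇔ CycAdj i j

  record Cycle : Set where
    field
      k     : ℕ
      vert  : Fin (3 + k) → Fin n
      inj   : Injective _≡_ _≡_ vert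
      edges : ∀ i j → CycAdj i j → Edge G (vert i) (vert j)

open Path public
open Hole public

module _ {n : ℕ} {G : Graph n} where

  start end : Path G → Fin n
  start P = vert P F.zero
  end   P = vert P (fromℕ (len P))

  OnPath : Path G → Fin n → Set
  OnPath P v = ∃ λ i → vert P i ≡ v

  Interior : (P : Path G) → Fin (suc (len P)) → Set
  Interior P i = 0 < toℕ i × toℕ i < len P

  InInterior : Path G → Fin n → Set
  InInterior P v = ∃ λ i → Interior P i × vert P i ≡ v

  OnHole : Hole G → Fin n → Set
  OnHole H v = ∃ λ i → Hole.vert H i ≡ v

PairOrder : ∀ {kk m} → (ℕ → ℕ → Set) → (Fin kk → Fin m) → (Fin kk → Fin m) → Set
PairOrder rel xs ys = (∀ i → rel (toℕ (xs i)) (toℕ (ys i))) ×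
  (∀ i j → toℕ j ≡ suc (toℕ i) → rel (toℕ (ys i)) (toℕ (xs j)))

Chain : ∀ {kk m} → (ℕ → ℕ → Set) → (Fin kk → Fin m) → Set
Chain rel zs = ∀ i j → toℕ j ≡ suc (toℕ i) → rel (toℕ (zs i)) (toℕ (zs j))

module _ {n : ℕ} (G : Graph n) where

  C4 : Set
  C4 = Σ (Hole G) λ H → k H ≡ 0

  Theta : Set
  Theta = Σ (Fin n) λ a → Σ (Fin n) λ b → Σ (Fin 3 → Path G) λ P →
    (∀ i → 2 ≤ len (P i) × start (P i) ≡ a × end (P i) ≡ b) ×
    (∀ i j → i ≢ j → ∀ u w → InInterior (P i) u → InInterior (P j) w →
       u ≢ w × ¬ Edge G u w)

  Prism : Set
  Prism = Σ (Fin 3 → Path G) λ P →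
    (∀ i → 1 ≤ len (P i)) ×
    (∀ i j → i ≢ j →
       Edge G (start (P i)) (start (P j)) ×
       Edge G (end (P i)) (end (P j)) ×
       (∀ u w → OnPath (P i) u → OnPath (P j) w →
          u ≢ w ×
          (Edge G u w → (u ≡ start (P i) × w ≡ start (P j))
                      ⊎ (u ≡ end (P i) × w ≡ end (P j)))))

  -- |N(x) ∩ V(H)|  (H is injective)
  nbrCount : Hole G → Fin n → ℕ
  nbrCount H x = countB (λ i → adj G x (Hole.vert H i))

  IsWheel : Hole G → Fin n → Set
  IsWheel H x = 3 ≤ nbrCount H x

  EvenWheel : Set
  EvenWheel = Σ (Hole G) λ H → Σ (Fin n) λ x → IsWheel H x × 2 ∣ nbrCount H x

  NbrIn : Hole G → Fin n → Fin n → Set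
  NbrIn H x v = Edge G x v × OnHole H v

  TwinWheel : Hole G → Fin n → Set
  TwinWheel H x = Σ (Fin n) λ u → Σ (Fin n) λ v → Σ (Fin n) λ w →
    u ≢ v × v ≢ w × u ≢ w ×
    (∀ z → NbrIn H x z ⇔ (z ≡ u ⊎ z ≡ v ⊎ z ≡ w)) ×
    Edge G u v × Edge G v w × ¬ Edge G u w

  ShortPyramid : Hole G → Fin n → Set
  ShortPyramid H x = nbrCount H x ≡ 3 ×
    (Σ (Fin n) λ u → Σ (Fin n) λ v →
      NbrIn H x u × NbrIn H x v × Edge G u v ×
      (∀ p q → NbrIn H x p → NbrIn H x q → Edge G p q →
         (p ≡ u × q ≡ v) ⊎ (p ≡ v × q ≡ u)))

  ProperWheel : Hole G → Fin n → Set
  ProperWheel H x = IsWheel H x × ¬ TwinWheel H x × ¬ ShortPyramid H x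

  Hub : Fin n → Set
  Hub x = Σ (Hole G) λ H → ProperWheel H x

  Clique : ℕ → Set
  Clique t = Σ (Fin t → Fin n) λ f → Injective _≡_ _≡_ f ×
    (∀ i j → i ≢ j → Edge G (f i) (f j))

  record GenPyramid (kk : ℕ) : Set where
    field
      P Q     : Path G
      PQ-disj : ∀ u → OnPath P u → ¬ OnPath Q u
      H       : Hole G
      H-vs    : ∀ v → OnHole H v ⇔ (OnPath P v ⊎ OnPath Q v)
      R       : Fin kk → Path G
      RP-disj : ∀ i u → OnPath (R i) u → ¬ OnPath P u
      RQ-disj : ∀ i u → OnPath (R i) u → ¬ OnPath Q u
      RR-disj : ∀ i j → i ≢ j → ∀ u → OnPath (R i) u → ¬ OnPath (R j) u
      x y     : Fin kk → Fin (suc (len P))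
      z       : Fin kk → Fin (suc (len Q))
      a-nbrs  : ∀ i j → Edge G (start (R i)) (vert P j) ⇔ (j ≡ x i ⊎ j ≡ y i)
      xy-int  : ∀ i → Interior P (x i) × Interior P (y i)
      xy-adj  : ∀ i → Edge G (vert P (x i)) (vert P (y i))
      b-nbr   : ∀ i j → Edge G (end (R i)) (vert Q j) ⇔ (j ≡ z i)
      R-int   : ∀ i l → Interior (R i) l → ∀ v → (OnPath P v ⊎ OnPath Q v) →
                  ¬ Edge G (vert (R i) l) v
      R-anti  : ∀ i j → i ≢ j → ∀ u w → OnPath (R i) u → OnPath (R j) w →
                  ¬ Edge G u w
      -- P traverses x_1,y_1,...,x_k,y_k in order (in one of its two directions)
      P-order : PairOrder _≤_ x y ⊎ PairOrder _≥_ x y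
      Q-order : Chain _≤_ z ⊎ Chain _≥_ z
      y≢x     : ∀ i j → toℕ j ≡ suc (toℕ i) → y i ≢ x j

  InC : Set
  InC = ¬ C4 × ¬ Theta × ¬ Prism × ¬ EvenWheel

  InCt : ℕ → Set
  InCt t = InC × ¬ Clique t

  InCtt : ℕ → Set
  InCtt t = InCt t × ¬ GenPyramid t

  Stable : Subset n → Set
  Stable Y = ∀ u v → u ∈ Y → v ∈ Y → ¬ Edge G u v

  data WalkIn (S : Fin n → Set) : Fin n → Fin n → Set where
    here : ∀ {u} → S u → WalkIn S u u
    step : ∀ {u w v} → S u → Edge G u w → WalkIn S w v → WalkIn S u v

  ConnectedSet : (Fin n → Set) → Set
  ConnectedSet S = ∀ u v → S u → S v → WalkIn S u v

  IsTree : Set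
  IsTree = ConnectedSet (λ _ → ⊤) × ¬ Cycle G

  Chordal : Set
  Chordal = ¬ Hole G

  MaximalClique : Subset n → Set
  MaximalClique K = (∀ u v → u ∈ K → v ∈ K → u ≢ v → Edge G u v) ×
    (∀ w → w ∉ K → ¬ (∀ u → u ∈ K → Edge G w u))

ChordalCompletion : ∀ {n} → Graph n → Graph n → Set
ChordalCompletion {n} G H = (∀ u v → Edge G u v → Edge H u v) × Chordal H

MinimalChordalCompletion : ∀ {n} → Graph n → Graph n → Set
MinimalChordalCompletion {n} G H = ChordalCompletion G H ×
  (∀ (H' : Graph n) → ChordalCompletion G H' →
     (∀ u v → Edge H' u v → Edge H u v) →
     ∀ u v → Edge H u v → Edge H' u v)

PMC : ∀ {n} → Graph n → Subset n → Set
PMC {n} G K = Σ (Graph n) λ H → MinimalChordalCompletion G H × MaximalClique H K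

TreeDecomposition : ∀ {n m} → Graph n → Graph m → (Fin m → Subset n) → Set
TreeDecomposition G T χ = IsTree T ×
  (∀ u → ∃ λ s → u ∈ χ s) ×
  (∀ u w → Edge G u w → ∃ λ s → u ∈ χ s × w ∈ χ s) ×
  (∀ u → ConnectedSet T (λ s → u ∈ χ s))

StructuredTD : ∀ {n m} → Graph n → Graph m → (Fin m → Subset n) → Set
StructuredTD G T χ = TreeDecomposition G T χ × (∀ s → PMC G (χ s))

{-# OPTIONS --safe #-}

-- Any two nonadjacent vertices of a PMC K attach to a common component of G ∖ K, and no component attaches to all
-- of K. If every component attached to few vertices of Y, three suitable components would give a theta once
-- |Y| > 4τ. So it suffices to bound a stable set of non-hubs ("labels") every one of which attaches to each of two
-- connected, anticomplete sets D and E.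
--
-- After passing to many labels, each side either contains a connected set in which every label has exactly one
-- neighbour, or an induced path on which the labels have at least two neighbours and pairwise disjoint hulls. If
-- both sides are of the second kind, three labels in the same order along both paths close up to a hole for which
-- the middle label is a hub. Otherwise fix a label y₀ : for any two further labels each side contains a subdivided
-- claw or the line graph of one with these three ends; two claws give a theta or a hub, two line graphs a prism, so
-- by Ramsey's theorem one side is claw-free and the other is free of line graphs.
--
-- Inside a side, a minimal connected set X that still reaches the labels around each of its vertices is chordal,
-- since a hole would give a theta through the other side. In its dominator tree the children of a vertex form a
-- clique (claw-free case) or a stable set (line-graph-free case), so following the subtree with most labels yields
-- a path with teeth hanging on its edges, or on its vertices. Two such combs with the same labels, made monotone by
-- Ramsey's theorem and closed up at the first and the last label, form a generalized pyramid.

module Submission where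

open import Defs
open import Data.Nat using (ℕ; zero; suc; _+_; _*_; _∸_; _≤_; _<_; _≥_; z≤n; s≤s; s≤s⁻¹; _≤?_; _<?_; pred)
open import Data.Nat.Properties
  using ( ≤-refl; ≤-reflexive; ≤-trans; ≤-antisym; <-irrefl; <-trans; <⇒≤; <⇒≢; ≤∧≢⇒<; ≰⇒>; ≮⇒≥; <⇒≱; n<1+n; n≤1+n
        ; ≤-<-trans; <-≤-trans; m≤m+n; m≤n+m; m<n⇒m<1+n; +-comm; +-suc; +-identityʳ; +-mono-≤; +-monoˡ-≤
        ; +-monoʳ-≤; +-cancelˡ-≤; +-cancelˡ-≡; suc-injective; m≤n⇒m<n∨m≡n; <-cmp
        ; *-mono-≤; m≤n⇒m≤1+n; m+[n∸m]≡n; ∸-monoˡ-≤; 1+n≰n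
        ; m≤m*n; +-monoʳ-<)
import Data.Nat.Properties as ℕₚ
open import Data.Bool using (Bool; true; false; if_then_else_; not; _∧_)
import Data.Bool as Bool
open import Data.Fin using (Fin; toℕ; fromℕ; fromℕ<)
import Data.Fin as F
import Data.Fin.Properties as Fₚ
open import Data.Fin.Subset using (Subset; _⊆_; ∣_∣) renaming (_∈_ to _∈ₛ_; _∉_ to _∉ₛ_)
import Data.Fin.Subset.Properties as Subsetₚ
open import Data.List using (List; []; _∷_; _++_; length; filter; reverse; lookup; map; allFin)
import Data.List.Properties as Listₚ
open import Data.List.Membership.Propositional using (_∈_; _∉_)
import Data.List.Membership.Propositional.Properties as ∈ₚ
open import Data.List.Relation.Unary.Any using (here; there)
open import Data.List.Relation.Unary.All using (All; []; _∷_)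
import Data.List.Relation.Unary.All as All
import Data.List.Relation.Unary.Any.Properties as Anyₚ
open import Data.List.Relation.Unary.AllPairs using (AllPairs; []; _∷_)
import Data.List.Relation.Unary.AllPairs as AllPairs
import Data.List.Relation.Unary.AllPairs.Properties as AllPairsₚ
open import Data.Vec using ([]; _∷_)
import Data.Vec as Vec
open import Data.Product using (Σ; ∃; ∃₂; Σ-syntax; _×_; _,_; proj₁; proj₂)
open import Data.Sum using (_⊎_; inj₁; inj₂; [_,_]′)
import Data.Sum as Sum
open import Data.Empty using (⊥; ⊥-elim)
open import Relation.Nullary using (¬_; Dec; yes; no; does; contradiction; ¬?; _×-dec_; _⊎-dec_)
open import Relation.Nullary.Decidable using (dec-true; dec-false; map′; decidable-stable)
open import Relation.Unary using (Decidable)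
open import Relation.Binary.Definitions using (tri<; tri≈; tri>)
open import Relation.Binary.PropositionalEquality
  using (_≡_; _≢_; refl; sym; trans; cong; cong₂; subst; subst₂)
open import Function using (_∘_; id; flip; case_of_)
open import Function.Bundles using (_⇔_; mk⇔; Equivalence)

-- The shape of the excluded pyramid dictates the dichotomy between claws and line graphs of claws.
-- Its rungs end in a triangle on `P` and in a single vertex on `Q`, so over the same labels one
-- comb must have its teeth on edges and the other on vertices. Two claws facing each other, or two
-- line graphs, are exactly what thetas, hubs and prisms exclude; one of each kind is what remains.
-- Fixing `y₀` turns a statement about triples into a colouring of pairs. Later the neighbour of
-- `y₀` is the root of the dominator tree, and the way back to this root is the third leg of every
-- claw or line graph found there. The bound on cliques enters through the edge comb: children of a
-- vertex are pairwise adjacent there, hence fewer than `t`, and one child inherits a fixed share of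
-- the labels. A pyramid asks that consecutive triangles share no vertex of `P`, so labels are first
-- restricted to positions of one parity. Two labels beyond the `t` rungs are spent on closing the
-- hole.

infix 4 _⊑_
_⊑_ : {A : Set} → List A → List A → Set
ys ⊑ xs = ∀ z → z ∈ ys → z ∈ xs

-- Lists: splitting, Ramsey, pigeonhole, extremal choices and counting.

length-split : {A : Set} {P : A → Set} (P? : Decidable P) (xs : List A) →
  length xs ≡ length (filter P? xs) + length (filter (λ x → ¬? (P? x)) xs)
length-split P? [] = refl
length-split P? (x ∷ xs) with P? x
... | yes _ = cong suc (length-split P? xs)
... | no  _ = trans (cong suc (length-split P? xs)) (sym (+-suc _ _))

split-large : {A : Set} {P : A → Set} (P? : Decidable P) (xs : List A) (a b : ℕ) → a + b ≤ length xs →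
  a ≤ length (filter P? xs) ⊎ b ≤ length (filter (λ x → ¬? (P? x)) xs)
split-large P? xs a b le with a ≤? length (filter P? xs)
... | yes p = inj₁ p
... | no ¬p = inj₂ (+-cancelˡ-≤ a _ _ (≤-trans le (≤-trans (≤-reflexive (length-split P? xs))
                (+-monoˡ-≤ _ (<⇒≤ (≰⇒> ¬p))))))

split-large< : {A : Set} {P : A → Set} (P? : Decidable P) (xs : List A) (a b : ℕ) → a + b < length xs →
  a < length (filter P? xs) ⊎ b < length (filter (λ x → ¬? (P? x)) xs)
split-large< P? xs a b lt with suc a ≤? length (filter P? xs)
... | yes p = inj₁ p
... | no ¬p = inj₂ (+-cancelˡ-≤ a _ _ (≤-trans (≤-reflexive (+-suc a b)) (≤-trans lt (≤-trans (≤-reflexive (length-split P? xs))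
                (+-monoˡ-≤ _ (s≤s⁻¹ (≰⇒> ¬p)))))))

filter-∈ : {A : Set} {P : A → Set} (P? : Decidable P) (xs : List A) {z : A} → z ∈ filter P? xs → z ∈ xs
filter-∈ P? xs z∈ = proj₁ (∈ₚ.∈-filter⁻ P? {xs = xs} z∈)

filter-holds : {A : Set} {P : A → Set} (P? : Decidable P) (xs : List A) {z : A} → z ∈ filter P? xs → P z
filter-holds P? xs z∈ = proj₂ (∈ₚ.∈-filter⁻ P? {xs = xs} z∈)

-- The recursion of Erdős and Szekeres, with an extra 1 for the pivot by whose colours the other
-- elements are split.
ramseyBound : ℕ → ℕ → ℕ
ramseyBound zero b = 0
ramseyBound (suc a) zero = 0
ramseyBound (suc a) (suc b) = suc (ramseyBound a (suc b) + ramseyBound (suc a) b)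

-- Colours are read off pairs in list order. Since `ys` keeps this order, the pairwise relation `Q`
-- of the input (distinctness, or an ordering) is inherited.
ramsey : {A : Set} {Q C : A → A → Set} (C? : ∀ x y → Dec (C x y)) (a b : ℕ) (xs : List A) → AllPairs Q xs →
  ramseyBound a b ≤ length xs →
  Σ[ ys ∈ List A ] ys ⊑ xs × AllPairs Q ys ×
    ((length ys ≡ a × AllPairs C ys) ⊎ (length ys ≡ b × AllPairs (λ x y → ¬ C x y) ys))
ramsey C? zero b xs q le = [] , (λ _ ()) , [] , inj₁ (refl , [])
ramsey C? (suc a) zero xs q le = [] , (λ _ ()) , [] , inj₂ (refl , [])
ramsey C? (suc a) (suc b) (x ∷ xs) (qx ∷ q) (s≤s le)
  with split-large (C? x) xs (ramseyBound a (suc b)) (ramseyBound (suc a) b) le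
... | inj₁ large with ramsey C? a (suc b) (filter (C? x) xs) (AllPairsₚ.filter⁺ (C? x) q) large
...   | ys , sub , qys , inj₂ r = ys , (λ z z∈ → there (filter-∈ (C? x) xs (sub z z∈))) , qys , inj₂ r
...   | ys , sub , qys , inj₁ (len , c) =
        x ∷ ys , (λ { z (here e) → here e ; z (there z∈) → there (filter-∈ (C? x) xs (sub z z∈)) }) ,
        All.tabulate (λ z → All.lookup qx (filter-∈ (C? x) xs (sub _ z))) ∷ qys ,
        inj₁ (cong suc len , All.tabulate (λ z → filter-holds (C? x) xs (sub _ z)) ∷ c)
ramsey C? (suc a) (suc b) (x ∷ xs) (qx ∷ q) (s≤s le)
    | inj₂ large with ramsey C? (suc a) b (filter (λ y → ¬? (C? x y)) xs) (AllPairsₚ.filter⁺ _ q) large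
...   | ys , sub , qys , inj₁ r = ys , (λ z z∈ → there (filter-∈ _ xs (sub z z∈))) , qys , inj₁ r
...   | ys , sub , qys , inj₂ (len , c) =
        x ∷ ys , (λ { z (here e) → here e ; z (there z∈) → there (filter-∈ _ xs (sub z z∈)) }) ,
        All.tabulate (λ z → All.lookup qx (filter-∈ _ xs (sub _ z))) ∷ qys ,
        inj₂ (cong suc len , All.tabulate (λ z → filter-holds _ xs (sub _ z)) ∷ c)

PigeonResult : {A B : Set} → (A → A → Set) → (A → B) → ℕ → ℕ → List A → Set
PigeonResult {A} {B} Q c d q xs =
  (Σ[ k ∈ B ] Σ[ ys ∈ List A ] (∀ z → z ∈ ys → z ∈ xs × c z ≡ k) × AllPairs Q ys × q < length ys) ⊎
  (Σ[ ys ∈ List A ] ys ⊑ xs × AllPairs (λ x y → Q x y × c x ≢ c y) ys × length ys ≡ suc d)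

-- Induction on `d`: either the class of the first element has more than `q` members, or discarding
-- it leaves more than `d * q` elements, and `x` represents the discarded class.
pigeonhole : {A B : Set} {Q : A → A → Set} (_≟ᵇ_ : (x y : B) → Dec (x ≡ y)) (c : A → B) (d q : ℕ) (xs : List A) →
  AllPairs Q xs → d * q < length xs → PigeonResult Q c d q xs
pigeonhole _≟ᵇ_ c zero q (x ∷ xs) _ _ =
  inj₂ (x ∷ [] , (λ { z (here e) → here e }) , [] ∷ [] , refl)
pigeonhole {Q = Q} _≟ᵇ_ c (suc d) q (x ∷ xs) (qx ∷ qs) lt
  with split-large< (λ y → c x ≟ᵇ c y) (x ∷ xs) q (d * q) lt
... | inj₁ large = inj₁ (c x , filter P? (x ∷ xs) ,
        (λ _ z → filter-∈ P? (x ∷ xs) z , sym (filter-holds P? (x ∷ xs) z)) , AllPairsₚ.filter⁺ P? (qx ∷ qs) , large)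
  where P? = λ y → c x ≟ᵇ c y
... | inj₂ large = next (pigeonhole _≟ᵇ_ c d q xs′ (AllPairsₚ.filter⁺ N? (qx ∷ qs)) large)
  where
  N? = λ y → ¬? (c x ≟ᵇ c y)
  xs′ = filter N? (x ∷ xs)
  rest : ∀ {z} → z ∈ xs′ → z ∈ xs
  rest z with filter-∈ N? (x ∷ xs) z
  ... | here refl = contradiction refl (filter-holds N? (x ∷ xs) z)
  ... | there z∈ = z∈
  next : PigeonResult Q c d q xs′ → PigeonResult Q c (suc d) q (x ∷ xs)
  next (inj₁ (k , ys , sub , qys , len)) =
    inj₁ (k , ys , (λ _ z → there (rest (proj₁ (sub _ z))) , proj₂ (sub _ z)) , qys , len)
  next (inj₂ (ys , sub , qys , len)) = inj₂ (x ∷ ys , (λ { z (here e) → here e ; _ (there z) → there (rest (sub _ z)) }) ,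
    All.tabulate (λ z → All.lookup qx (rest (sub _ z)) , filter-holds N? (x ∷ xs) (sub _ z)) ∷ qys , cong suc len)

argmin : {A : Set} (g : A → ℕ) (x : A) (xs : List A) → Σ[ y ∈ A ] y ∈ x ∷ xs × (∀ z → z ∈ x ∷ xs → g y ≤ g z)
argmin g x [] = x , here refl , λ { _ (here refl) → ≤-refl }
argmin g x (x′ ∷ xs) with argmin g x′ xs
... | y , y∈ , min with g x ≤? g y
...   | yes le = x , here refl , λ { _ (here refl) → ≤-refl ; _ (there z) → ≤-trans le (min _ z) }
...   | no ¬le = y , there y∈ , λ { _ (here refl) → <⇒≤ (≰⇒> ¬le) ; _ (there z) → min _ z }

AllPairs-lookup : {A : Set} {R : A → A → Set} {xs : List A} → AllPairs R xs →
  ∀ (i j : Fin (length xs)) → toℕ i < toℕ j → R (lookup xs i) (lookup xs j)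
AllPairs-lookup (r ∷ rs) F.zero (F.suc j) lt = All.lookup r (∈ₚ.∈-lookup j)
AllPairs-lookup (r ∷ rs) (F.suc i) (F.suc j) (s≤s lt) = AllPairs-lookup rs i j lt

AllPairs-total : ∀ {ℓ} {A : Set} {R : A → A → Set ℓ} {xs : List A} → AllPairs R xs → ∀ {x y} → x ∈ xs → y ∈ xs → x ≢ y → R x y ⊎ R y x
AllPairs-total (r ∷ rs) (here refl) (here refl) ne = contradiction refl ne
AllPairs-total (r ∷ rs) (here refl) (there y∈) ne = inj₁ (All.lookup r y∈)
AllPairs-total (r ∷ rs) (there x∈) (here refl) ne = inj₂ (All.lookup r x∈)
AllPairs-total (r ∷ rs) (there x∈) (there y∈) ne = AllPairs-total rs x∈ y∈ ne

least : {P : ℕ → Set} → Decidable P → ∀ n → P n → Σ[ i ∈ ℕ ] i ≤ n × P i × (∀ j → j < i → ¬ P j)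
least P? zero p = 0 , z≤n , p , λ j ()
least P? (suc n) p with P? 0
... | yes p₀ = 0 , z≤n , p₀ , λ j ()
... | no ¬p₀ with least (λ j → P? (suc j)) n p
...   | i , i≤n , pi , min = suc i , s≤s i≤n , pi , λ { zero _ → ¬p₀ ; (suc j) (s≤s lt) → min j lt }

greatest : {P : ℕ → Set} → Decidable P → ∀ a n → a ≤ n → P a →
  Σ[ i ∈ ℕ ] a ≤ i × i ≤ n × P i × (∀ j → i < j → j ≤ n → ¬ P j)
greatest P? a n a≤n p with P? n
... | yes pn = n , a≤n , ≤-refl , pn , λ j n<j j≤n → contradiction j≤n (<⇒≱ n<j)
... | no ¬pn with m≤n⇒m<n∨m≡n a≤n
...   | inj₂ refl = contradiction p ¬pn
greatest P? a (suc n) a≤n p | no ¬pn | inj₁ (s≤s a≤) with greatest P? a n a≤ p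
... | i , ai , i≤n , pi , max = i , ai , m≤n⇒m≤1+n i≤n , pi , max′
  where
  max′ : ∀ j → i < j → j ≤ suc n → _
  max′ j i<j j≤ with m≤n⇒m<n∨m≡n j≤
  ... | inj₁ (s≤s j≤n) = max j i<j j≤n
  ... | inj₂ refl = ¬pn

without : ∀ {m} → (Fin m → Bool) → Fin m → Fin m → Bool
without f i j = f j ∧ not (does (j Fₚ.≟ i))

without-true : ∀ {m} (f : Fin m → Bool) {i j} → f j ≡ true → j ≢ i → without f i j ≡ true
without-true f {i} {j} fj j≢i rewrite fj with j Fₚ.≟ i
... | yes e = contradiction e j≢i
... | no _ = refl

countB-cong : ∀ {m} (f g : Fin m → Bool) → (∀ i → f i ≡ g i) → countB f ≡ countB g
countB-cong {zero} f g h = refl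
countB-cong {suc m} f g h = cong₂ _+_ (cong (λ b → if b then 1 else 0) (h F.zero)) (countB-cong _ _ (λ i → h (F.suc i)))

countB-without : ∀ {m} (f : Fin m → Bool) i → f i ≡ true → countB f ≡ suc (countB (without f i))
countB-without {suc m} f F.zero fi rewrite fi =
  cong suc (countB-cong (λ j → f (F.suc j)) (λ j → f (F.suc j) ∧ true) (λ j → sym (∧true (f (F.suc j)))))
  where
  ∧true : ∀ b → b ∧ true ≡ b
  ∧true true = refl
  ∧true false = refl
countB-without {suc m} f (F.suc i) fi with f F.zero
... | true = cong suc (trans (countB-without (λ j → f (F.suc j)) i fi)
               (cong suc (countB-cong _ _ (λ j → cong (λ b → f (F.suc j) ∧ not b) (suc-≟ j)))))
  where
  suc-≟ : ∀ j → does (j Fₚ.≟ i) ≡ does (F.suc j Fₚ.≟ F.suc i)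
  suc-≟ j with j Fₚ.≟ i
  ... | yes _ = refl
  ... | no _ = refl
... | false = trans (countB-without (λ j → f (F.suc j)) i fi)
               (cong suc (countB-cong _ _ (λ j → cong (λ b → f (F.suc j) ∧ not b) (suc-≟ j))))
  where
  suc-≟ : ∀ j → does (j Fₚ.≟ i) ≡ does (F.suc j Fₚ.≟ F.suc i)
  suc-≟ j with j Fₚ.≟ i
  ... | yes _ = refl
  ... | no _ = refl

countB-mono : ∀ {m} (f g : Fin m → Bool) → (∀ i → f i ≡ true → g i ≡ true) → countB f ≤ countB g
countB-mono {zero} f g h = z≤n
countB-mono {suc m} f g h = +-mono-≤ (bit (f F.zero) (g F.zero) (h F.zero)) (countB-mono _ _ (λ i → h (F.suc i)))
  where
  bit : ∀ a b → (a ≡ true → b ≡ true) → (if a then 1 else 0) ≤ (if b then 1 else 0)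
  bit false b _ = z≤n
  bit true b e rewrite e refl = ≤-refl

length≤countB : ∀ {m} (f : Fin m → Bool) (l : List (Fin m)) → AllPairs _≢_ l → All (λ i → f i ≡ true) l → length l ≤ countB f
length≤countB f [] _ _ = z≤n
length≤countB f (i ∷ l) (i≢ ∷ u) (fi ∷ fl) rewrite countB-without f i fi =
  s≤s (length≤countB (without f i) l u
    (All.tabulate (λ z → without-true f (All.lookup fl z) (λ e → All.lookup i≢ z (sym e)))))

forall∈? : {A : Set} {P : A → Set} → Decidable P → (xs : List A) →
  (∀ x → x ∈ xs → P x) ⊎ (Σ[ x ∈ A ] x ∈ xs × ¬ P x)
forall∈? P? [] = inj₁ λ x ()
forall∈? P? (x ∷ xs) with P? x | forall∈? P? xs
... | no ¬p | _ = inj₂ (x , here refl , ¬p)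
... | yes p | inj₁ all = inj₁ λ { y (here refl) → p ; y (there y∈) → all y y∈ }
... | yes p | inj₂ (y , y∈ , ¬p) = inj₂ (y , there y∈ , ¬p)

AllPairs-reverse : ∀ {ℓ} {A : Set} {R : A → A → Set ℓ} {xs : List A} → AllPairs R xs → AllPairs (flip R) (reverse xs)
AllPairs-reverse {xs = []} [] = []
AllPairs-reverse {R = R} {xs = x ∷ xs} (r ∷ rs) = subst (AllPairs (flip R)) (sym (Listₚ.unfold-reverse x xs))
  (AllPairsₚ.++⁺ (AllPairs-reverse rs) ([] ∷ []) (All.tabulate λ z∈ → All.lookup r (Anyₚ.reverse⁻ z∈) ∷ []))

-- If Ramsey returns a list on which `R` fails for every pair in list order, totality gives the
-- opposite relation, and the reversed list is increasing.
monotone : {A : Set} {R : A → A → Set} (R? : ∀ x y → Dec (R x y)) (xs : List A) → AllPairs _≢_ xs →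
  (∀ x y → x ∈ xs → y ∈ xs → x ≢ y → R x y ⊎ R y x) → ∀ m → ramseyBound m m ≤ length xs →
  Σ[ ys ∈ List A ] ys ⊑ xs × AllPairs (λ x y → x ≢ y × R x y) ys × length ys ≡ m
monotone {R = R} R? xs u total m le with ramsey R? m m xs u le
... | ys , sub , uy , inj₁ (len , rs) = ys , sub , AllPairs.zip (uy , rs) , len
... | ys , sub , uy , inj₂ (len , ¬rs) = reverse ys , (λ z z∈ → sub z (Anyₚ.reverse⁻ z∈)) ,
      pairs (reverse ys) (λ z z∈ → sub z (Anyₚ.reverse⁻ z∈)) (AllPairs-reverse (AllPairs.zip (uy , ¬rs))) , trans (Listₚ.length-reverse ys) len
  where
  pairs : ∀ zs → zs ⊑ xs → AllPairs (λ x y → y ≢ x × ¬ R y x) zs → AllPairs (λ x y → x ≢ y × R x y) zs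
  pairs [] _ [] = []
  pairs (z ∷ zs) sub′ (r ∷ rs) = All.tabulate (λ {w} w∈ → (proj₁ (All.lookup r w∈) ∘ sym) ,
      [ id , (λ b → contradiction b (proj₂ (All.lookup r w∈))) ]′ (total z w (sub′ z (here refl)) (sub′ w (there w∈)) (proj₁ (All.lookup r w∈) ∘ sym)))
    ∷ pairs zs (λ w w∈ → sub′ w (there w∈)) rs

-- Parity and the numerical bounds.

parity : ℕ → Bool
parity zero = true
parity (suc n) = not (parity n)

-- Spine edges that start at distinct positions of one parity have no common vertex; this is how
-- `y≢x` of a generalized pyramid is met.
parity-gap : ∀ {a b} → parity a ≡ parity b → a < b → 2 + a ≤ b
parity-gap {a} {b} e lt with m≤n⇒m<n∨m≡n lt
... | inj₁ r = r
... | inj₂ refl = contradiction e (flips (parity a))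
  where
  flips : ∀ c → c ≢ not c
  flips true ()
  flips false ()

-- `pointBound` counts labels around one path vertex: `m` adjacent to it, `m` sharing the last
-- neighbour before it, `m` sharing the first one after it, and one more that would give a theta.
-- `sideBound` is the pigeonhole bound over leaves of a dominator tree; a large class splits into
-- labels with one neighbour on a path and labels with several.
pointBound hullBound sideBound : ℕ → ℕ
pointBound m = m + (m + (m + 1))
hullBound m = m * pointBound m
sideBound m = suc (suc m * (m + hullBound m))

-- One label singles out a child subtree; of the others, enough lie inside it or enough lie outside.
vertexBound : ℕ → ℕ
vertexBound zero = 0
vertexBound (suc m) = suc (vertexBound m + vertexBound m)

-- `d` bounds the number of children among which the labels are distributed. The two units guarantee
-- two labels, so that none is attached to the root of the current subtree (`terminal-alone`).
edgeBound : ℕ → ℕ → ℕ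
edgeBound d zero = 0
edgeBound d (suc m) = suc (suc (d * edgeBound d m))

-- The two summands are the two parities. Among `r₂` labels in monotone position along the edge
-- comb, `2 + t` are monotone along the vertex comb: `t` rungs and the two labels that close the
-- hole.
selectBound : ℕ → ℕ
selectBound t = ramseyBound r₂ r₂ + ramseyBound r₂ r₂
  where
  r₂ = ramseyBound (2 + t) (2 + t)

teethBound : ℕ → ℕ
teethBound K = vertexBound K + ramseyBound (suc K) (suc K)

-- The summands of `secondSide` serve, in this order: unique neighbours on both sides, hulls on the
-- first side only, hulls on the second side only, hulls on both. In `hullCount` each half is one
-- kind of hull, long or short, with one label spent on `y₀`.
edgeLabels hullLabels hullCount secondSide : ℕ → ℕ → ℕ
edgeLabels t′ K = edgeBound t′ (teethBound K)
hullLabels t′ K = edgeLabels t′ K + vertexBound K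
hullCount t′ K = suc (hullLabels t′ K) + suc (hullLabels t′ K)
secondSide t′ K = suc (ramseyBound (edgeLabels t′ K) (edgeLabels t′ K)) +
  (ramseyBound (hullCount t′ K) (hullCount t′ K) + (hullCount t′ K + ramseyBound 3 3))

coreBound : ℕ → ℕ
coreBound zero = 0
coreBound (suc t′) = sideBound (sideBound (secondSide t′ (selectBound (suc t′))))

-- Walks, induced paths, and how they assemble into holes, thetas and prisms.

module GraphBasics {n : ℕ} (G : Graph n) where

  V : Set
  V = Fin n

  infix 4 _~_
  _~_ : V → V → Set
  u ~ v = Edge G u v

  ~-sym : ∀ {u v} → u ~ v → v ~ u
  ~-sym {u} {v} e = trans (adj-sym G v u) e

  ~-irr : ∀ {u v} → u ~ v → u ≢ v
  ~-irr {u} e refl with trans (sym e) (adj-irr G u)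
  ... | ()

  _~?_ : ∀ u v → Dec (u ~ v)
  u ~? v = adj G u v Bool.≟ true

  _≟_ : (u v : V) → Dec (u ≡ v)
  _≟_ = Fₚ._≟_

  _∈?_ : (v : V) (l : List V) → Dec (v ∈ l)
  v ∈? [] = no λ ()
  v ∈? (x ∷ l) with v ≟ x | v ∈? l
  ... | yes e | _ = yes (here e)
  ... | no ¬e | yes v∈ = yes (there v∈)
  ... | no ¬e | no v∉ = no λ { (here e) → ¬e e ; (there v∈) → v∉ v∈ }

  VSet : Set₁
  VSet = V → Set

  Anti : VSet → VSet → Set
  Anti S T = ∀ u w → S u → T w → u ≢ w × ¬ (u ~ w)

  Anti-sym : ∀ {S T} → Anti S T → Anti T S
  Anti-sym a u w Tu Sw = (λ e → proj₁ (a w u Sw Tu) (sym e)) , (λ e → proj₂ (a w u Sw Tu) (~-sym e))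

  _∖_ : VSet → V → VSet
  (S ∖ a) v = S v × v ≢ a

  ∖-dec : ∀ {S} → Decidable S → ∀ a → Decidable (S ∖ a)
  ∖-dec S? a v = S? v ×-dec ¬? (v ≟ a)

  Walk : VSet → V → V → Set
  Walk = WalkIn G

  walk-map : ∀ {S T : VSet} → (∀ x → S x → T x) → ∀ {u v} → Walk S u v → Walk T u v
  walk-map f (here s) = here (f _ s)
  walk-map f (step s e p) = step (f _ s) e (walk-map f p)

  walk-trans : ∀ {S u v w} → Walk S u v → Walk S v w → Walk S u w
  walk-trans (here _) q = q
  walk-trans (step s e p) q = step s e (walk-trans p q)

  walk-start : ∀ {S u v} → Walk S u v → S u
  walk-start (here s) = s
  walk-start (step s _ _) = s

  walk-end : ∀ {S u v} → Walk S u v → S v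
  walk-end (here s) = s
  walk-end (step _ _ p) = walk-end p

  walk-snoc : ∀ {S u v w} → Walk S u v → v ~ w → S w → Walk S u w
  walk-snoc p e s = walk-trans p (step (walk-end p) e (here s))

  walk-reverse : ∀ {S u v} → Walk S u v → Walk S v u
  walk-reverse (here s) = here s
  walk-reverse (step s e p) = walk-snoc (walk-reverse p) (~-sym e) s

  walk-closed : ∀ {S : VSet} (T : VSet) → (∀ u w → T u → u ~ w → S w → T w) →
    ∀ {u v} → Walk S u v → T u → Walk (λ x → S x × T x) u v
  walk-closed T cl (here s) t = here (s , t)
  walk-closed T cl (step s e p) t = step (s , t) e (walk-closed T cl p (cl _ _ t e (walk-start p)))

  -- The walk is cut at its last visit to `a`; what remains avoids `a`.
  walk-after : ∀ {S u v} a → Walk S u v →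
    Walk (S ∖ a) u v ⊎ a ≡ v ⊎ (Σ[ w ∈ V ] a ~ w × Walk (S ∖ a) w v)
  walk-after {u = u} a (here s) with u ≟ a
  ... | yes e = inj₂ (inj₁ (sym e))
  ... | no u≢a = inj₁ (here (s , u≢a))
  walk-after {u = u} a (step {w = w} s e p) with walk-after a p
  ... | inj₂ r = inj₂ r
  ... | inj₁ q with u ≟ a
  ...   | yes refl = inj₂ (inj₂ (w , e , q))
  ...   | no u≢a = inj₁ (step (s , u≢a) e q)

  walk-avoid : ∀ {S u v} a → Walk S u v → Walk (S ∖ a) u v ⊎ Walk S u a
  walk-avoid {u = u} a (here s) with u ≟ a
  ... | yes refl = inj₂ (here s)
  ... | no u≢a = inj₁ (here (s , u≢a))
  walk-avoid {u = u} a (step s e p) with u ≟ a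
  ... | yes refl = inj₂ (here s)
  ... | no u≢a with walk-avoid a p
  ...   | inj₁ q = inj₁ (step (s , u≢a) e q)
  ...   | inj₂ q = inj₂ (step s e q)

  walk-until : ∀ {S T : VSet} → Decidable T → ∀ {u v} → Walk S u v → T v →
    Σ[ z ∈ V ] T z × Walk (λ x → S x × (x ≡ z ⊎ ¬ T x)) u z
  walk-until {T = T} T? {u} p t with T? u
  walk-until T? p t | yes tu = _ , tu , here (walk-start p , inj₁ refl)
  walk-until T? (here s) t | no ¬tu = contradiction t ¬tu
  walk-until T? (step s e p) t | no ¬tu with walk-until T? p t
  ... | z , tz , q = z , tz , step (s , inj₂ ¬tu) e q

  size : ∀ {S : VSet} → Decidable S → ℕ
  size S? = countB (λ v → does (S? v))

  does-true : ∀ {P : Set} (d : Dec P) → does d ≡ true → P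
  does-true (yes p) _ = p

  size-∖ : ∀ {S : VSet} (S? : Decidable S) a → S a → size S? ≡ suc (size (∖-dec S? a))
  size-∖ S? a s = countB-without (λ v → does (S? v)) a (dec-true (S? a) s)

  size-mono : ∀ {S T : VSet} (S? : Decidable S) (T? : Decidable T) → (∀ v → S v → T v) → size S? ≤ size T?
  size-mono S? T? f = countB-mono _ _ λ v s → dec-true (T? v) (f v (does-true (S? v) s))

  size-< : ∀ {S T : VSet} (S? : Decidable S) (T? : Decidable T) a → (∀ v → S v → T v) → ¬ S a → T a → size S? < size T?
  size-< S? T? a f ¬s t rewrite size-∖ T? a t =
    s≤s (size-mono S? (∖-dec T? a) λ v s → f v s , λ { refl → ¬s s })

  -- A walk from `u` may be assumed never to return to `u`, so the search goes on in `S ∖ u`, whose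
  -- size bounds the recursion.
  walk?-fuel : ∀ k {S : VSet} (S? : Decidable S) → size S? ≤ k → ∀ u v → Dec (Walk S u v)
  walk?-fuel k S? le u v with S? u
  walk?-fuel k S? le u v | no ¬s = no λ p → ¬s (walk-start p)
  walk?-fuel zero S? le u v | yes s = contradiction (subst (_≤ 0) (size-∖ S? u s) le) λ ()
  walk?-fuel (suc k) {S} S? le u v | yes s with u ≟ v
  ... | yes refl = yes (here s)
  ... | no u≢v with Fₚ.any? (λ w → u ~? w ×-dec walk?-fuel k (∖-dec S? u) (s≤s⁻¹ (subst (_≤ suc k) (size-∖ S? u s) le)) w v)
  ...   | yes (w , e , p) = yes (step s e (walk-map (λ _ → proj₁) p))
  ...   | no none = no impossible
    where
    impossible : ¬ Walk S u v
    impossible p with walk-after u p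
    ... | inj₁ q = proj₂ (walk-start q) refl
    ... | inj₂ (inj₁ e) = u≢v e
    ... | inj₂ (inj₂ r) = none r

  walk? : ∀ {S : VSet} (S? : Decidable S) u v → Dec (Walk S u v)
  walk? S? = walk?-fuel _ S? ≤-refl

  data IPath : V → V → List V → Set where
    [-] : ∀ {u} → IPath u u (u ∷ [])
    cons : ∀ {u w v l} → u ~ w → (∀ z → z ∈ l → u ≢ z × (u ~ z → z ≡ w)) → IPath w v l → IPath u v (u ∷ l)

  first∈ : ∀ {u v l} → IPath u v l → u ∈ l
  first∈ [-] = here refl
  first∈ (cons _ _ _) = here refl

  last∈ : ∀ {u v l} → IPath u v l → v ∈ l
  last∈ [-] = here refl
  last∈ (cons _ _ p) = there (last∈ p)

  -- Jumping from `u` straight to its last neighbour on an induced path leaves an induced path.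
  -- Walks are shortened in this way, and holes through `u` are found with it.
  last-contact : ∀ u {w v l} → IPath w v l → (∀ z → z ∈ l → u ≢ z × ¬ (u ~ z)) ⊎
    (∃₂ λ z l′ → IPath z v l′ × l′ ⊑ l × (u ≡ z ⊎ (u ~ z × ∀ x → x ∈ l′ → u ≢ x × (u ~ x → x ≡ z))))
  last-contact u {w} [-] with u ≟ w | u ~? w
  ... | yes e | _ = inj₂ (w , _ , [-] , (λ _ z → z) , inj₁ e)
  ... | no _ | yes e = inj₂ (w , _ , [-] , (λ _ z → z) , inj₂ (e , λ { x (here refl) → ~-irr e , λ _ → refl }))
  ... | no ne | no na = inj₁ λ { z (here refl) → ne , na }
  last-contact u {w} (cons ew ind p) with last-contact u p
  ... | inj₂ (z , l′ , q , sub , r) = inj₂ (z , l′ , q , (λ x x∈ → there (sub x x∈)) , r)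
  ... | inj₁ none with u ≟ w | u ~? w
  ...   | yes e | _ = inj₂ (w , _ , cons ew ind p , (λ _ z → z) , inj₁ e)
  ...   | no _ | yes e = inj₂ (w , _ , cons ew ind p , (λ _ z → z) , inj₂ (e ,
            λ { x (here refl) → ~-irr e , (λ _ → refl) ; x (there x∈) → proj₁ (none x x∈) , λ a → contradiction a (proj₂ (none x x∈)) }))
  ...   | no ne | no na = inj₁ λ { z (here refl) → ne , na ; z (there z∈) → none z z∈ }

  walk→path : ∀ {S u v} → Walk S u v → Σ[ l ∈ List V ] IPath u v l × (∀ z → z ∈ l → S z)
  walk→path (here s) = _ , [-] , λ { z (here refl) → s }
  walk→path {S} {u} (step s e p) with walk→path p
  ... | l , q , inS with last-contact u q
  ...   | inj₁ none = contradiction e (proj₂ (none _ (first∈ q)))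
  ...   | inj₂ (z , l′ , r , sub , inj₁ refl) = l′ , r , λ x x∈ → inS x (sub x x∈)
  ...   | inj₂ (z , l′ , r , sub , inj₂ (a , ind)) =
            u ∷ l′ , cons a ind r , λ { x (here refl) → s ; x (there x∈) → inS x (sub x x∈) }

  path→walk-from : ∀ {u v l} → IPath u v l → ∀ z → z ∈ l → Walk (_∈ l) u z
  path→walk-from [-] z (here refl) = here (here refl)
  path→walk-from (cons _ _ p) z (here refl) = here (here refl)
  path→walk-from (cons e _ p) z (there z∈) = step (here refl) e (walk-map (λ _ → there) (path→walk-from p z z∈))

  path→walk : ∀ {u v l} → IPath u v l → Walk (_∈ l) u v
  path→walk p = path→walk-from p _ (last∈ p)

  path-until : ∀ {T : VSet} → Decidable T → ∀ {u v l} → IPath u v l → T v →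
    ∃₂ λ c l′ → IPath u c l′ × T c × l′ ⊑ l × (∀ z → z ∈ l′ → T z → z ≡ c)
  path-until T? {u} p t with T? u
  path-until T? p t | yes tu = _ , _ , [-] , tu , (λ { z (here refl) → first∈ p }) , λ { z (here e) _ → e }
  path-until T? [-] t | no ¬tu = contradiction t ¬tu
  path-until T? (cons {w = w} e ind p) t | no ¬tu with path-until T? p t
  ... | c , l′ , q , tc , sub , only = c , _ , cons e (λ z z∈ → ind z (sub z z∈)) q , tc ,
        (λ { z (here r) → here r ; z (there z∈) → there (sub z z∈) }) ,
        λ { z (here refl) tz → contradiction tz ¬tu ; z (there z∈) tz → only z z∈ tz }

  path-++ : ∀ {a b c d l₁ l₂} → IPath a b l₁ → IPath c d l₂ → b ~ c →
    (∀ u w → u ∈ l₁ → w ∈ l₂ → u ≢ w × (u ~ w → u ≡ b × w ≡ c)) → IPath a d (l₁ ++ l₂)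
  path-++ [-] q e x = cons e (λ z z∈ → proj₁ (x _ z (here refl) z∈) , λ a → proj₂ (proj₂ (x _ z (here refl) z∈) a)) q
  path-++ {l₂ = l₂} (cons {l = l} f ind p) q e x =
    cons f both (path-++ p q e (λ u w u∈ w∈ → x u w (there u∈) w∈))
    where
    both : ∀ z → z ∈ l ++ l₂ → _
    both z z∈ with ∈ₚ.∈-++⁻ l z∈
    ... | inj₁ z∈l = ind z z∈l
    ... | inj₂ z∈l₂ = proj₁ (x _ z (here refl) z∈l₂) , λ a →
          contradiction (proj₁ (proj₂ (x _ z (here refl) z∈l₂) a)) (proj₁ (ind _ (last∈ p)))

  ∈-reverse⁻ : ∀ {z : V} l → z ∈ reverse l → z ∈ l
  ∈-reverse⁻ l z∈ = Anyₚ.reverse⁻ z∈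

  path-reverse : ∀ {u v l} → IPath u v l → IPath v u (reverse l)
  path-reverse [-] = [-]
  path-reverse (cons {u = u} {l = l} e ind p) = subst (IPath _ u) (sym (Listₚ.unfold-reverse u l))
    (path-++ (path-reverse p) [-] (~-sym e)
      λ { x y x∈ (here refl) → (λ r → proj₁ (ind x (∈-reverse⁻ l x∈)) (sym r)) ,
                                λ a → proj₂ (ind x (∈-reverse⁻ l x∈)) (~-sym a) , refl })

  -- The positional form of an induced path. Indices are plain naturals, so segments and offsets
  -- need no `Fin` arithmetic; values of `sp` beyond `N` carry no meaning.
  record Spine : Set where
    field
      sp  : ℕ → V
      N   : ℕ
      spE : ∀ i → i < N → sp i ~ sp (suc i)
      spI : ∀ i j → i ≤ N → j ≤ N → sp i ~ sp j → j ≡ suc i ⊎ i ≡ suc j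
      spJ : ∀ i j → i ≤ N → j ≤ N → sp i ≡ sp j → i ≡ j
  open Spine public

  Seg : Spine → ℕ → ℕ → VSet
  Seg s a b v = Σ[ i ∈ ℕ ] a ≤ i × i ≤ b × sp s i ≡ v

  nth : V → List V → ℕ → V
  nth d [] _ = d
  nth d (x ∷ l) zero = x
  nth d (x ∷ l) (suc i) = nth d l i

  nth-∈ : ∀ d l i → i < length l → nth d l i ∈ l
  nth-∈ d (x ∷ l) zero _ = here refl
  nth-∈ d (x ∷ l) (suc i) (s≤s lt) = there (nth-∈ d l i lt)

  ∈-nth : ∀ d l {z} → z ∈ l → Σ[ i ∈ ℕ ] i < length l × nth d l i ≡ z
  ∈-nth d (x ∷ l) (here e) = 0 , s≤s z≤n , sym e
  ∈-nth d (x ∷ l) (there z∈) with ∈-nth d l z∈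
  ... | i , lt , e = suc i , s≤s lt , e

  nth-++ʳ : ∀ d l₁ l₂ i → nth d (l₁ ++ l₂) (length l₁ + i) ≡ nth d l₂ i
  nth-++ʳ d [] l₂ i = refl
  nth-++ʳ d (x ∷ l₁) l₂ i = nth-++ʳ d l₁ l₂ i

  nth-++ˡ : ∀ d l₁ l₂ i → i < length l₁ → nth d (l₁ ++ l₂) i ≡ nth d l₁ i
  nth-++ˡ d (x ∷ l₁) l₂ zero _ = refl
  nth-++ˡ d (x ∷ l₁) l₂ (suc i) (s≤s lt) = nth-++ˡ d l₁ l₂ i lt

  length-path : ∀ {u v l} → IPath u v l → length l ≡ suc (pred (length l))
  length-path [-] = refl
  length-path (cons _ _ _) = refl

  nth-first : ∀ {d u v l} → IPath u v l → nth d l 0 ≡ u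
  nth-first [-] = refl
  nth-first (cons _ _ _) = refl

  nth-last : ∀ {d u v l} → IPath u v l → nth d l (pred (length l)) ≡ v
  nth-last [-] = refl
  nth-last {d} {v = v} {l = u ∷ l} (cons _ _ p) = subst (λ k → nth d (u ∷ l) k ≡ v) (sym (length-path p)) (nth-last p)

  nth-E : ∀ {d u v l} → IPath u v l → ∀ i → suc i < length l → nth d l i ~ nth d l (suc i)
  nth-E [-] i (s≤s ())
  nth-E {d} {u} (cons e _ p) zero _ = subst (u ~_) (sym (nth-first p)) e
  nth-E (cons _ _ p) (suc i) (s≤s lt) = nth-E p i lt

  nth-J : ∀ {d u v l} → IPath u v l → ∀ i j → i < length l → j < length l → nth d l i ≡ nth d l j → i ≡ j
  nth-J p zero zero _ _ _ = refl
  nth-J [-] zero (suc j) _ (s≤s ()) _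
  nth-J [-] (suc i) _ (s≤s ()) _ _
  nth-J {d} (cons {l = l} _ ind p) zero (suc j) _ (s≤s lt) e = contradiction e (proj₁ (ind _ (nth-∈ d l j lt)))
  nth-J {d} (cons {l = l} _ ind p) (suc i) zero (s≤s lt) _ e = contradiction (sym e) (proj₁ (ind _ (nth-∈ d l i lt)))
  nth-J (cons _ _ p) (suc i) (suc j) (s≤s a) (s≤s b) e = cong suc (nth-J p i j a b e)

  nth-I : ∀ {d u v l} → IPath u v l → ∀ i j → i < length l → j < length l → nth d l i ~ nth d l j → j ≡ suc i ⊎ i ≡ suc j
  nth-I p zero zero _ _ a = contradiction refl (~-irr a)
  nth-I [-] zero (suc j) _ (s≤s ()) _
  nth-I [-] (suc i) _ (s≤s ()) _ _
  nth-I {d} (cons {l = l} _ ind p) zero (suc j) _ (s≤s lt) a =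
    inj₁ (cong suc (nth-J {d} p j 0 lt (≤-<-trans z≤n lt) (trans (proj₂ (ind _ (nth-∈ d l j lt)) a) (sym (nth-first p)))))
  nth-I {d} (cons {l = l} _ ind p) (suc i) zero (s≤s lt) _ a =
    inj₂ (cong suc (nth-J {d} p i 0 lt (≤-<-trans z≤n lt) (trans (proj₂ (ind _ (nth-∈ d l i lt)) (~-sym a)) (sym (nth-first p)))))
  nth-I (cons _ _ p) (suc i) (suc j) (s≤s a) (s≤s b) e with nth-I p i j a b e
  ... | inj₁ r = inj₁ (cong suc r)
  ... | inj₂ r = inj₂ (cong suc r)

  ≤pred : ∀ {u v l} → IPath u v l → ∀ {i} → i ≤ pred (length l) → i < length l
  ≤pred p le = subst (_ <_) (sym (length-path p)) (s≤s le)

  toSpine : ∀ {u v l} → IPath u v l → Spine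
  toSpine {u} {l = l} p = record
    { sp = nth u l ; N = pred (length l)
    ; spE = λ i lt → nth-E p i (subst (suc i <_) (sym (length-path p)) (s≤s lt))
    ; spI = λ i j a b → nth-I p i j (≤pred p a) (≤pred p b)
    ; spJ = λ i j a b → nth-J p i j (≤pred p a) (≤pred p b) }

  <length : ∀ {u v l} → IPath u v l → ∀ {i} → i < length l → i ≤ pred (length l)
  <length p lt = s≤s⁻¹ (subst (_ <_) (length-path p) lt)

  toPath : Spine → Path G
  toPath s = record
    { len = N s
    ; vert = λ i → sp s (toℕ i)
    ; inj = λ {i} {j} e → Fₚ.toℕ-injective (spJ s (toℕ i) (toℕ j) (Fₚ.toℕ≤pred[n] i) (Fₚ.toℕ≤pred[n] j) e)
    ; induced = λ i j → mk⇔ (spI s (toℕ i) (toℕ j) (Fₚ.toℕ≤pred[n] i) (Fₚ.toℕ≤pred[n] j))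
        λ { (inj₁ e) → subst (λ k → sp s (toℕ i) ~ sp s k) (sym e)
                          (spE s (toℕ i) (subst (_≤ N s) e (Fₚ.toℕ≤pred[n] j)))
          ; (inj₂ e) → ~-sym (subst (λ k → sp s (toℕ j) ~ sp s k) (sym e)
                          (spE s (toℕ j) (subst (_≤ N s) e (Fₚ.toℕ≤pred[n] i)))) } }

  end-toPath : ∀ s → end (toPath s) ≡ sp s (N s)
  end-toPath s = cong (sp s) (Fₚ.toℕ-fromℕ (N s))

  mkHole : (s : Spine) (h : V) (k : ℕ) → N s ≡ 2 + k → (∀ i → i ≤ N s → h ≢ sp s i) →
    h ~ sp s 0 → h ~ sp s (N s) → (∀ i → i ≤ N s → h ~ sp s i → i ≡ 0 ⊎ i ≡ N s) →
    Σ[ H ∈ Hole G ] (∀ v → OnHole H v ⇔ (v ≡ h ⊎ Seg s 0 (N s) v))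
  mkHole s h k refl ≢h e₀ eₙ only = H , λ v → mk⇔ (to v) (from v)
    where
    vt : Fin (4 + k) → V
    vt F.zero = h
    vt (F.suc i) = sp s (toℕ i)
    bd : (i : Fin (3 + k)) → toℕ i ≤ 2 + k
    bd i = Fₚ.toℕ≤pred[n] i
    inj′ : ∀ {i j} → vt i ≡ vt j → i ≡ j
    inj′ {F.zero} {F.zero} _ = refl
    inj′ {F.zero} {F.suc j} e = contradiction e (≢h _ (bd j))
    inj′ {F.suc i} {F.zero} e = contradiction (sym e) (≢h _ (bd i))
    inj′ {F.suc i} {F.suc j} e = cong F.suc (Fₚ.toℕ-injective (spJ s _ _ (bd i) (bd j) e))
    ind₀ : ∀ (j : Fin (3 + k)) → h ~ sp s (toℕ j) ⇔ CycAdj (F.zero {3 + k}) (F.suc j)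
    ind₀ j = mk⇔ (λ a → [ (λ e → inj₁ (inj₁ (cong suc e))) , (λ e → inj₂ (inj₁ (refl , cong (suc ∘ suc) e))) ]′ (only _ (bd j) a))
      λ { (inj₁ (inj₁ e)) → subst (λ i → h ~ sp s i) (sym (suc-injective e)) e₀
        ; (inj₁ (inj₂ ()))
        ; (inj₂ (inj₁ (_ , e))) → subst (λ i → h ~ sp s i) (sym (suc-injective (suc-injective e))) eₙ
        ; (inj₂ (inj₂ (() , _))) }
    swap : ∀ {i j : Fin (4 + k)} → CycAdj i j → CycAdj j i
    swap (inj₁ (inj₁ e)) = inj₁ (inj₂ e)
    swap (inj₁ (inj₂ e)) = inj₁ (inj₁ e)
    swap (inj₂ (inj₁ e)) = inj₂ (inj₂ e)
    swap (inj₂ (inj₂ e)) = inj₂ (inj₁ e)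
    ind′ : ∀ i j → vt i ~ vt j ⇔ CycAdj i j
    ind′ F.zero F.zero = mk⇔ (λ a → contradiction refl (~-irr a))
      λ { (inj₁ (inj₁ ())) ; (inj₁ (inj₂ ())) ; (inj₂ (inj₁ (_ , ()))) ; (inj₂ (inj₂ (_ , ()))) }
    ind′ F.zero (F.suc j) = ind₀ j
    ind′ (F.suc i) F.zero = mk⇔ (λ a → swap (Equivalence.to (ind₀ i) (~-sym a))) λ c → ~-sym (Equivalence.from (ind₀ i) (swap c))
    ind′ (F.suc i) (F.suc j) = mk⇔ (λ a → inj₁ (Sum.map (cong suc) (cong suc) (spI s _ _ (bd i) (bd j) a)))
      λ { (inj₁ l) → Equivalence.from (induced (toPath s) i j) (Sum.map suc-injective suc-injective l)
        ; (inj₂ (inj₁ (() , _))) ; (inj₂ (inj₂ (() , _))) }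
    H : Hole G
    H = record { k = k ; vert = vt ; inj = inj′ ; induced = ind′ }
    to : ∀ v → OnHole H v → v ≡ h ⊎ Seg s 0 (2 + k) v
    to v (F.zero , e) = inj₁ (sym e)
    to v (F.suc i , e) = inj₂ (toℕ i , z≤n , bd i , e)
    from : ∀ v → v ≡ h ⊎ Seg s 0 (2 + k) v → OnHole H v
    from v (inj₁ e) = F.zero , sym e
    from v (inj₂ (i , _ , le , e)) = F.suc (fromℕ< (s≤s le)) , trans (cong (sp s) (Fₚ.toℕ-fromℕ< (s≤s le))) e

  closeHole : ∀ {a b l} h → IPath a b l → 3 ≤ length l → (∀ z → z ∈ l → h ≢ z × (h ~ z → z ≡ a ⊎ z ≡ b)) → h ~ a → h ~ b →
    Σ[ H ∈ Hole G ] (∀ v → OnHole H v ⇔ (v ∈ h ∷ l))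
  closeHole {a} {b} {l} h p 3≤ out ha hb = proj₁ hole , λ v → mk⇔ (λ o → to v (Equivalence.to (proj₂ hole v) o)) λ v∈ → Equivalence.from (proj₂ hole v) (from v v∈)
    where
    s = toSpine p
    N′ : N s ≡ 2 + (N s ∸ 2)
    N′ = sym (m+[n∸m]≡n (<length p 3≤))
    only : ∀ i → i ≤ N s → h ~ sp s i → i ≡ 0 ⊎ i ≡ N s
    only i le e with proj₂ (out _ (nth-∈ a l i (≤pred p le))) e
    ... | inj₁ r = inj₁ (spJ s i 0 le z≤n (trans r (sym (nth-first p))))
    ... | inj₂ r = inj₂ (spJ s i (N s) le ≤-refl (trans r (sym (nth-last p))))
    hole = mkHole s h (N s ∸ 2) N′ (λ i le → proj₁ (out _ (nth-∈ a l i (≤pred p le))))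
      (subst (h ~_) (sym (nth-first p)) ha) (subst (h ~_) (sym (nth-last p)) hb) only
    to : ∀ v → v ≡ h ⊎ Seg s 0 (N s) v → v ∈ h ∷ l
    to v (inj₁ e) = here e
    to v (inj₂ (i , _ , le , refl)) = there (nth-∈ a l i (≤pred p le))
    from : ∀ v → v ∈ h ∷ l → v ≡ h ⊎ Seg s 0 (N s) v
    from v (here e) = inj₁ e
    from v (there v∈) with ∈-nth a l v∈
    ... | i , lt , e = inj₂ (i , z≤n , <length p lt , e)

  three : ∀ {ℓ} {A : Set ℓ} → A → A → A → Fin 3 → A
  three x y z F.zero = x
  three x y z (F.suc F.zero) = y
  three x y z (F.suc (F.suc F.zero)) = z

  data Pair₃ : Fin 3 → Fin 3 → Set where
    p01 : Pair₃ F.zero (F.suc F.zero)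
    p02 : Pair₃ F.zero (F.suc (F.suc F.zero))
    p12 : Pair₃ (F.suc F.zero) (F.suc (F.suc F.zero))

  pair₃ : ∀ i j → i ≢ j → Pair₃ i j ⊎ Pair₃ j i
  pair₃ F.zero F.zero ne = contradiction refl ne
  pair₃ F.zero (F.suc F.zero) ne = inj₁ p01
  pair₃ F.zero (F.suc (F.suc F.zero)) ne = inj₁ p02
  pair₃ (F.suc F.zero) F.zero ne = inj₂ p01
  pair₃ (F.suc F.zero) (F.suc F.zero) ne = contradiction refl ne
  pair₃ (F.suc F.zero) (F.suc (F.suc F.zero)) ne = inj₁ p12
  pair₃ (F.suc (F.suc F.zero)) F.zero ne = inj₂ p02
  pair₃ (F.suc (F.suc F.zero)) (F.suc F.zero) ne = inj₂ p12
  pair₃ (F.suc (F.suc F.zero)) (F.suc (F.suc F.zero)) ne = contradiction refl ne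

  -- Walks are enough: shortening a walk to an induced path stays inside its vertex set, and since
  -- `a` and `b` are distinct and nonadjacent every such path has length at least 2.
  theta : ∀ {a b} → a ≢ b → ¬ (a ~ b) → (S : Fin 3 → VSet) → (∀ i j → Pair₃ i j → Anti (S i) (S j)) →
    (∀ i → Walk (λ v → v ≡ a ⊎ v ≡ b ⊎ S i v) a b) → Theta G
  theta {a} {b} a≢b a≁b S anti walks = a , b , (λ i → toPath (s i)) ,
    (λ i → long i , nth-first (path i) , trans (end-toPath (s i)) (nth-last (path i))) ,
    λ i j i≢j u w u∈ w∈ → anti′ i j i≢j u w (inS i u u∈) (inS j w w∈)
    where
    list : Fin 3 → List V
    list i = proj₁ (walk→path (walks i))
    path : ∀ i → IPath a b (list i)
    path i = proj₁ (proj₂ (walk→path (walks i)))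
    within : ∀ i z → z ∈ list i → z ≡ a ⊎ z ≡ b ⊎ S i z
    within i = proj₂ (proj₂ (walk→path (walks i)))
    s : Fin 3 → Spine
    s i = toSpine (path i)
    anti′ : ∀ i j → i ≢ j → Anti (S i) (S j)
    anti′ i j ne with pair₃ i j ne
    ... | inj₁ p = anti i j p
    ... | inj₂ p = Anti-sym (anti j i p)
    2≤pred : ∀ {l} → IPath a b l → 2 ≤ pred (length l)
    2≤pred [-] = contradiction refl a≢b
    2≤pred (cons e _ [-]) = contradiction e a≁b
    2≤pred (cons _ _ (cons _ _ p)) = subst (2 ≤_) (sym (cong suc (length-path p))) (s≤s (s≤s z≤n))
    long : ∀ i → 2 ≤ N (s i)
    long i = 2≤pred (path i)
    inS : ∀ i u → InInterior (toPath (s i)) u → S i u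
    inS i u (j , (0<j , j<N) , refl) with within i _ (nth-∈ a (list i) (toℕ j) (≤pred (path i) (<⇒≤ j<N)))
    ... | inj₁ e = contradiction (spJ (s i) _ 0 (<⇒≤ j<N) z≤n (trans e (sym (nth-first (path i))))) λ r → <-irrefl (sym r) 0<j
    ... | inj₂ (inj₁ e) = contradiction (spJ (s i) _ (N (s i)) (<⇒≤ j<N) ≤-refl (trans e (sym (nth-last (path i))))) λ r → <-irrefl r j<N
    ... | inj₂ (inj₂ r) = r

  prism : (a b : Fin 3 → V) (S : Fin 3 → VSet) → (∀ i → a i ≢ b i) →
    (∀ i j → Pair₃ i j → a i ~ a j × b i ~ b j ×
      (∀ u w → S i u → S j w → u ≢ w × (u ~ w → (u ≡ a i × w ≡ a j) ⊎ (u ≡ b i × w ≡ b j)))) →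
    (∀ i → Walk (S i) (a i) (b i)) → Prism G
  prism a b S ne cross walks = (λ i → toPath (s i)) , long , cross′
    where
    list : Fin 3 → List V
    list i = proj₁ (walk→path (walks i))
    path : ∀ i → IPath (a i) (b i) (list i)
    path i = proj₁ (proj₂ (walk→path (walks i)))
    within : ∀ i z → z ∈ list i → S i z
    within i = proj₂ (proj₂ (walk→path (walks i)))
    s : Fin 3 → Spine
    s i = toSpine (path i)
    1≤pred : ∀ {u v l} → IPath u v l → u ≢ v → 1 ≤ pred (length l)
    1≤pred [-] ne = contradiction refl ne
    1≤pred (cons _ _ p) ne = subst (1 ≤_) (sym (length-path p)) (s≤s z≤n)
    long : ∀ i → 1 ≤ N (s i)
    long i = 1≤pred (path i) (ne i)
    first : ∀ i → start (toPath (s i)) ≡ a i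
    first i = nth-first (path i)
    last : ∀ i → end (toPath (s i)) ≡ b i
    last i = trans (end-toPath (s i)) (nth-last (path i))
    on : ∀ i u → OnPath (toPath (s i)) u → S i u
    on i u (j , refl) = within i _ (nth-∈ (a i) (list i) (toℕ j) (≤pred (path i) (Fₚ.toℕ≤pred[n] j)))
    full : ∀ i j → i ≢ j → a i ~ a j × b i ~ b j ×
      (∀ u w → S i u → S j w → u ≢ w × (u ~ w → (u ≡ a i × w ≡ a j) ⊎ (u ≡ b i × w ≡ b j)))
    full i j i≢j with pair₃ i j i≢j
    ... | inj₁ p = cross i j p
    ... | inj₂ p with cross j i p
    ...   | aa , bb , x = ~-sym aa , ~-sym bb , λ u w su sw → (λ e → proj₁ (x w u sw su) (sym e)) ,
              λ e → Sum.map (λ { (r , t) → t , r }) (λ { (r , t) → t , r }) (proj₂ (x w u sw su) (~-sym e))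
    cross′ : _
    cross′ i j i≢j rewrite first i | first j | last i | last j =
      proj₁ (full i j i≢j) , proj₁ (proj₂ (full i j i≢j)) , λ u w u∈ w∈ → proj₂ (proj₂ (full i j i≢j)) u w (on i u u∈) (on j w w∈)

clamp : ∀ m → ℕ → Fin (suc m)
clamp m zero = F.zero
clamp zero (suc i) = F.zero
clamp (suc m) (suc i) = F.suc (clamp m i)

toℕ-clamp : ∀ m i → i ≤ m → toℕ (clamp m i) ≡ i
toℕ-clamp m zero _ = refl
toℕ-clamp (suc m) (suc i) (s≤s le) = cong suc (toℕ-clamp m i le)

-- Segments of paths, holes cut open, and cliques in chordal graphs.

module Segments {n : ℕ} (G : Graph n) where
  open GraphBasics G

  segList : Spine → ℕ → ℕ → List V
  segList s a zero = sp s a ∷ []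
  segList s a (suc m) = sp s a ∷ segList s (suc a) m

  ∈-segList⁻ : ∀ s a m {z} → z ∈ segList s a m → Σ[ i ∈ ℕ ] a ≤ i × i ≤ a + m × sp s i ≡ z
  ∈-segList⁻ s a zero (here e) = a , ≤-refl , m≤m+n a 0 , sym e
  ∈-segList⁻ s a (suc m) (here e) = a , ≤-refl , m≤m+n a _ , sym e
  ∈-segList⁻ s a (suc m) (there z∈) with ∈-segList⁻ s (suc a) m z∈
  ... | i , le , le′ , e = i , <⇒≤ le , ≤-trans le′ (≤-reflexive (sym (+-suc a m))) , e

  ∈-segList⁺ : ∀ s a m i → a ≤ i → i ≤ a + m → sp s i ∈ segList s a m
  ∈-segList⁺ s a zero i le le′ = here (cong (sp s) (≤-antisym (≤-trans le′ (≤-reflexive (+-identityʳ a))) le))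
  ∈-segList⁺ s a (suc m) i le le′ with m≤n⇒m<n∨m≡n le
  ... | inj₂ refl = here refl
  ... | inj₁ lt = there (∈-segList⁺ s (suc a) m i lt (≤-trans le′ (≤-reflexive (+-suc a m))))

  seg-path : ∀ s a m → a + m ≤ N s → IPath (sp s a) (sp s (a + m)) (segList s a m)
  seg-path s a zero le = subst (λ k → IPath (sp s a) (sp s k) (sp s a ∷ [])) (sym (+-identityʳ a)) [-]
  seg-path s a (suc m) le = subst (λ k → IPath (sp s a) (sp s k) (segList s a (suc m))) (sym (+-suc a m))
    (cons (spE s a (≤-trans (s≤s (m≤m+n a m)) le′)) ind (seg-path s (suc a) m le′))
    where
    le′ : suc a + m ≤ N s
    le′ = subst (_≤ N s) (+-suc a m) le
    ind : ∀ z → z ∈ segList s (suc a) m → sp s a ≢ z × (sp s a ~ z → z ≡ sp s (suc a))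
    ind z z∈ with ∈-segList⁻ s (suc a) m z∈
    ... | i , lo , hi , refl = (λ e → <-irrefl (spJ s a i a≤N i≤N e) lo) , λ e → [ cong (sp s) , (λ r → contradiction (≤-trans (≤-reflexive (sym r)) (<⇒≤ lo)) 1+n≰n) ]′ (spI s a i a≤N i≤N e)
      where
      i≤N = ≤-trans hi le′
      a≤N = ≤-trans (<⇒≤ lo) i≤N

  length-segList : ∀ s a m → length (segList s a m) ≡ suc m
  length-segList s a zero = refl
  length-segList s a (suc m) = cong suc (length-segList s (suc a) m)

  nth-segList : ∀ d s a m i → i ≤ m → nth d (segList s a m) i ≡ sp s (a + i)
  nth-segList d s a zero zero le = cong (sp s) (sym (+-identityʳ a))
  nth-segList d s a (suc m) zero le = cong (sp s) (sym (+-identityʳ a))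
  nth-segList d s a (suc m) (suc i) (s≤s le) = trans (nth-segList d s (suc a) m i le) (cong (sp s) (sym (+-suc a i)))

  -- Inverse to `closeHole`: cutting at vertex number 0 turns arguments about a cycle into arguments
  -- about an induced path and one further vertex.
  openHole : (H : Hole G) → Σ[ l ∈ List V ] Σ[ a ∈ V ] Σ[ b ∈ V ] IPath a b l × 3 ≤ length l ×
    (∀ z → z ∈ l → Hole.vert H F.zero ≢ z × (Hole.vert H F.zero ~ z → z ≡ a ⊎ z ≡ b)) ×
    Hole.vert H F.zero ~ a × Hole.vert H F.zero ~ b × (∀ i → Hole.vert H i ∈ Hole.vert H F.zero ∷ l)
  openHole H = l , _ , _ , seg-path s 0 (N s) ≤-refl , subst (3 ≤_) (sym (length-segList s 0 (N s))) (s≤s (s≤s (s≤s z≤n))) ,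
      out , Equivalence.from (Hole.induced H F.zero (F.suc F.zero)) (inj₁ (inj₁ refl)) ,
      Equivalence.from (Hole.induced H F.zero (ix (2 + m))) (inj₂ (inj₁ (refl , cong (suc ∘ suc) (toℕ-clamp _ _ ≤-refl)))) , on
    where
    m = Hole.k H
    vt = Hole.vert H
    ix : ℕ → Fin (4 + m)
    ix i = F.suc (clamp (2 + m) i)
    tx : ∀ {i} → i ≤ 2 + m → toℕ (ix i) ≡ suc i
    tx le = cong suc (toℕ-clamp _ _ le)
    s : Spine
    s = record
      { sp = vt ∘ ix ; N = 2 + m
      ; spE = λ i lt → Equivalence.from (Hole.induced H (ix i) (ix (suc i))) (inj₁ (inj₁ (trans (tx lt) (cong suc (sym (tx (<⇒≤ lt)))))))
      ; spI = λ i j a b e → case Equivalence.to (Hole.induced H (ix i) (ix j)) e of λ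
          { (inj₁ (inj₁ r)) → inj₁ (suc-injective (trans (sym (tx b)) (trans r (cong suc (tx a)))))
          ; (inj₁ (inj₂ r)) → inj₂ (suc-injective (trans (sym (tx a)) (trans r (cong suc (tx b)))))
          ; (inj₂ (inj₁ (r , _))) → contradiction (trans (sym (tx a)) r) λ ()
          ; (inj₂ (inj₂ (r , _))) → contradiction (trans (sym (tx b)) r) λ () }
      ; spJ = λ i j a b e → suc-injective (trans (sym (tx a)) (trans (cong toℕ (Hole.inj H e)) (tx b))) }
    l = segList s 0 (N s)
    out : ∀ z → z ∈ l → _
    out z z∈ with ∈-segList⁻ s 0 (N s) z∈
    ... | i , _ , le , refl = (λ e → contradiction (cong toℕ (Hole.inj H e)) λ ()) , λ e → case Equivalence.to (Hole.induced H F.zero (ix i)) e of λ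
          { (inj₁ (inj₁ r)) → inj₁ (cong (sp s) {y = 0} (suc-injective (trans (sym (tx le)) r)))
          ; (inj₁ (inj₂ ()))
          ; (inj₂ (inj₁ (_ , r))) → inj₂ (cong (sp s) (suc-injective (suc-injective (trans (sym (cong suc (tx le))) r))))
          ; (inj₂ (inj₂ (() , _))) }
    on : ∀ i → vt i ∈ vt F.zero ∷ l
    on F.zero = here refl
    on (F.suc i) = there (subst (λ j → vt j ∈ l) (cong F.suc (Fₚ.toℕ-injective (toℕ-clamp _ _ (Fₚ.toℕ≤pred[n] i))))
      (∈-segList⁺ s 0 (N s) (toℕ i) z≤n (Fₚ.toℕ≤pred[n] i)))

  -- A clique meets a hole in at most two consecutive vertices, so what is left of the hole is a
  -- path. This is used for a clique that separates a completion, and for a single vertex, where it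
  -- says that a hole is two-connected.
  module CycleMinusClique {h a b : V} {l : List V} (p : IPath a b l) (3≤ : 3 ≤ length l)
    (out : ∀ z → z ∈ l → h ≢ z × (h ~ z → z ≡ a ⊎ z ≡ b)) (ha : h ~ a) (hb : h ~ b)
    (Q : VSet) (Q? : Decidable Q)
    (clique : ∀ u v → u ∈ h ∷ l → v ∈ h ∷ l → Q u → Q v → u ≢ v → u ~ v) where

    Free : VSet
    Free z = z ∈ h ∷ l × ¬ Q z

    private
      after-first : ∀ {w b l} → IPath w b l → ∀ z → z ∈ l → z ≢ w → Walk (λ x → x ∈ l × x ≢ w) z b
      after-first [-] z (here e) z≢ = contradiction e z≢
      after-first (cons _ _ _) z (here e) z≢ = contradiction e z≢
      after-first (cons _ ind p) z (there z∈) _ =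
        walk-map (λ x x∈ → there x∈ , λ e → proj₁ (ind x x∈) (sym e))
          (walk-trans (walk-reverse (path→walk-from p z z∈)) (path→walk p))

      to-end : ∀ {u v l′} → IPath u v l′ → l′ ⊑ l → (∀ x → x ∈ l′ → Q x → x ≡ u) →
        ∀ z → z ∈ l′ → ¬ Q z → Walk Free z v
      to-end {u} p′ sub only z z∈ ¬q with z ≟ u
      ... | yes refl = walk-map (λ x x∈ → there (sub x x∈) , λ q → ¬q (subst Q (only x x∈ q) q)) (path→walk p′)
      ... | no z≢u = walk-map (λ x x∈ → there (sub x (proj₁ x∈)) , λ q → proj₂ x∈ (only x (proj₁ x∈) q)) (after-first p′ z z∈ z≢u)

      to-either : ∀ {u v l′} → IPath u v l′ → l′ ⊑ l → ∀ z → z ∈ l′ → ¬ Q z → Walk Free z u ⊎ Walk Free z v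
      to-either {u} p′ sub z z∈ ¬q with z ≟ u
      to-either p′ sub z z∈ ¬q | yes refl = inj₁ (here (there (sub z z∈) , ¬q))
      to-either [-] sub z (here e) ¬q | no ne = contradiction e ne
      to-either (cons _ _ _) sub z (here e) ¬q | no ne = contradiction e ne
      to-either {u} (cons {w = w} e ind p′) sub z (there z∈) ¬q | no ne with Q? u
      ... | no ¬qu = Sum.map₁ (λ wk → walk-snoc wk (~-sym e) (there (sub u (here refl)) , ¬qu)) (to-either p′ (λ x x∈ → sub x (there x∈)) z z∈ ¬q)
      ... | yes qu = inj₂ (to-end p′ (λ x x∈ → sub x (there x∈)) (λ x x∈ qx → proj₂ (ind x x∈)
                (clique u x (there (sub u (here refl))) (there (sub x (there x∈))) qu qx (proj₁ (ind x x∈)))) z z∈ ¬q)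

      a≢b : ∀ {a b l} → IPath a b l → 3 ≤ length l → a ≢ b × ¬ (a ~ b)
      a≢b [-] (s≤s ())
      a≢b (cons _ _ [-]) (s≤s (s≤s ()))
      a≢b (cons _ ind (cons _ ind′ p)) _ = proj₁ (ind _ (there (last∈ p))) ,
        λ e → proj₁ (ind′ _ (last∈ p)) (sym (proj₂ (ind _ (there (last∈ p))) e))

      adjacent-to-h : Q h → ∀ z → z ∈ l → Q z → z ≡ a ⊎ z ≡ b
      adjacent-to-h qh z z∈ qz = proj₂ (out z z∈) (clique h z (here refl) (there z∈) qh qz (proj₁ (out z z∈)))

    connected : ∀ u v → u ∈ h ∷ l → v ∈ h ∷ l → ¬ Q u → ¬ Q v → Walk Free u v
    -- The two walks meet at `h` if it lies outside the clique; otherwise at `b`, or at `a` if `b`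
    -- is in the clique, because `a` and `b` are not adjacent.
    connected u v u∈ v∈ ¬qu ¬qv with Q? h
    ... | no ¬qh = walk-trans (to-h u u∈ ¬qu) (walk-reverse (to-h v v∈ ¬qv))
      where
      to-h : ∀ z → z ∈ h ∷ l → ¬ Q z → Walk Free z h
      to-h z (here refl) ¬q = here (here refl , ¬q)
      to-h z (there z∈) ¬q with to-either p (λ _ x → x) z z∈ ¬q
      ... | inj₁ wk = walk-snoc wk (~-sym ha) (here refl , ¬qh)
      ... | inj₂ wk = walk-snoc wk (~-sym hb) (here refl , ¬qh)
    connected u v (here refl) v∈ ¬qu ¬qv | yes qh = contradiction qh ¬qu
    connected u v (there u∈) (here refl) ¬qu ¬qv | yes qh = contradiction qh ¬qv
    connected u v (there u∈) (there v∈) ¬qu ¬qv | yes qh with Q? b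
    ... | no ¬qb = walk-trans (go u u∈ ¬qu) (walk-reverse (go v v∈ ¬qv))
      where
      go = to-end p (λ _ x → x) λ x x∈ qx → [ id , (λ { refl → contradiction qx ¬qb }) ]′ (adjacent-to-h qh x x∈ qx)
    ... | yes qb = walk-trans (go u u∈ ¬qu) (walk-reverse (go v v∈ ¬qv))
      where
      ¬qa : ¬ Q a
      ¬qa qa = proj₂ (a≢b p 3≤) (clique a b (there (first∈ p)) (there (last∈ p)) qa qb (proj₁ (a≢b p 3≤)))
      go : ∀ z → z ∈ l → ¬ Q z → Walk Free z a
      go z z∈ = to-end (path-reverse p) (λ x x∈ → ∈-reverse⁻ l x∈)
        (λ x x∈ qx → [ (λ { refl → contradiction qx ¬qa }) , id ]′ (adjacent-to-h qh x (∈-reverse⁻ l x∈) qx)) z (Anyₚ.reverse⁺ z∈)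

  -- Induction on the clique. Let `d` see all of it but `k`, and follow an induced path in `D` from
  -- `d` to the first neighbour `e` of `k`. A clique vertex `u` that misses `e` would close a hole
  -- with `k` and the path from its own last neighbour `z` to `e`.
  chordal-domination : Chordal G → (D : VSet) → (∀ u v → D u → D v → Walk D u v) → (ks : List V) →
    (∀ u v → u ∈ ks → v ∈ ks → u ≢ v → u ~ v) → (∀ k → k ∈ ks → ¬ D k) → (∀ k → k ∈ ks → Σ[ d ∈ V ] D d × k ~ d) →
    ∀ d₀ → D d₀ → Σ[ d ∈ V ] D d × (∀ k → k ∈ ks → k ~ d)
  chordal-domination ch D conn [] cl out nb d₀ D₀ = d₀ , D₀ , λ k ()
  chordal-domination ch D conn (k ∷ ks) cl out nb d₀ D₀
    with chordal-domination ch D conn ks (λ u v u∈ v∈ → cl u v (there u∈) (there v∈)) (λ u u∈ → out u (there u∈)) (λ u u∈ → nb u (there u∈)) d₀ D₀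
       | nb k (here refl)
  ... | d , Dd , all | f , Df , kf with walk→path (conn d f Dd Df)
  ...   | l , p , inD with path-until (k ~?_) p kf
  ...     | e , l′ , q , ke , sub , only = e , inD e (sub e (last∈ q)) , covered
    where
    covered : ∀ u → u ∈ k ∷ ks → u ~ e
    covered u (here refl) = ke
    covered u (there u∈) with u ~? e | u ≟ k
    ... | yes ue | _ = ue
    ... | no _ | yes refl = ke
    ... | no u≁e | no u≢k with last-contact u q
    ...   | inj₁ none = contradiction (all u u∈) (proj₂ (none d (first∈ q)))
    ...   | inj₂ (z , l″ , r , sub′ , inj₁ refl) = contradiction (inD z (sub z (sub′ z (first∈ r)))) (out z (there u∈))
    ...   | inj₂ (z , l″ , r , sub′ , inj₂ (uz , ind)) = ⊥-elim (ch (proj₁ (closeHole u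
              (path-++ r [-] (~-sym ke) cross) (long r) fits uz (cl u k (there u∈) (here refl) u≢k))))
      where
      inD″ : ∀ x → x ∈ l″ → D x
      inD″ x x∈ = inD x (sub x (sub′ x x∈))
      cross : ∀ x y → x ∈ l″ → y ∈ k ∷ [] → x ≢ y × (x ~ y → x ≡ e × y ≡ k)
      cross x y x∈ (here refl) = (λ { refl → out k (here refl) (inD″ k x∈) }) , λ a → only x (sub′ x x∈) (~-sym a) , refl
      long : ∀ {l} → IPath z e l → 3 ≤ length (l ++ k ∷ [])
      long [-] = contradiction uz u≁e
      long (cons _ _ [-]) = s≤s (s≤s (s≤s z≤n))
      long (cons _ _ (cons {l = m} _ _ _)) = s≤s (s≤s (subst (1 ≤_) (sym (Listₚ.length-++ m)) (m≤n+m 1 _)))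
      fits : ∀ x → x ∈ l″ ++ k ∷ [] → u ≢ x × (u ~ x → x ≡ z ⊎ x ≡ k)
      fits x x∈ with ∈ₚ.∈-++⁻ l″ x∈
      ... | inj₁ x∈l = proj₁ (ind x x∈l) , λ a → inj₁ (proj₂ (ind x x∈l) a)
      ... | inj₂ (here refl) = u≢k , λ _ → inj₂ refl

-- Components around a potential maximal clique.

module PotentialMaximalCliques {n : ℕ} (G : Graph n) (K : Subset n) (pmc : PMC G K) where
  open GraphBasics G

  private
    H : Graph n
    H = proj₁ pmc
    module H = GraphBasics H
    module HS = Segments H
    chordal : Chordal H
    chordal = proj₂ (proj₁ (proj₁ (proj₂ pmc)))
    G⊆H : ∀ u v → u ~ v → u H.~ v
    G⊆H = proj₁ (proj₁ (proj₁ (proj₂ pmc)))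
    minimal : ∀ (H′ : Graph n) → ChordalCompletion G H′ → (∀ u v → Edge H′ u v → Edge H u v) → ∀ u v → Edge H u v → Edge H′ u v
    minimal = proj₂ (proj₁ (proj₂ pmc))
    clique : ∀ u v → u ∈ₛ K → v ∈ₛ K → u ≢ v → u H.~ v
    clique = proj₁ (proj₂ (proj₂ pmc))

  Out : VSet
  Out v = v ∉ₛ K

  In? : Decidable (_∈ₛ K)
  In? v = v Subsetₚ.∈? K

  Out? : Decidable Out
  Out? v = ¬? (In? v)

  Component : V → VSet
  Component d v = Walk Out d v

  Component? : ∀ d → Decidable (Component d)
  Component? d = walk? Out? d

  Attached : V → VSet
  Attached d v = Σ[ c ∈ V ] Component d c × c ~ v

  Attached? : ∀ d → Decidable (Attached d)
  Attached? d v = Fₚ.any? λ c → Component? d c ×-dec c ~? v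

  -- If the component were attached to all of `K`, `chordal-domination` in the completion would give
  -- a vertex of it that is complete to `K` there, against the maximality of the clique.
  not-full : ∀ d → Out d → Σ[ k ∈ V ] k ∈ₛ K × ¬ Attached d k
  not-full d od with Fₚ.any? (λ k → In? k ×-dec ¬? (Attached? d k))
  ... | yes r = r
  ... | no none with HS.chordal-domination chordal (Component d) conn ks
          (λ u v u∈ v∈ → clique u v (inK u u∈) (inK v v∈)) (λ k k∈ c → walk-end c (inK k k∈)) near d (here od)
    where
    ks = filter In? (allFin n)
    inK : ∀ k → k ∈ ks → k ∈ₛ K
    inK k k∈ = filter-holds In? (allFin n) k∈
    lift : ∀ {u v} → Component d u → Walk Out u v → H.Walk (Component d) u v
    lift c (here s) = here c
    lift c (step s e p) = step c (G⊆H _ _ e) (lift (walk-snoc c e (walk-start p)) p)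
    conn : ∀ u v → Component d u → Component d v → H.Walk (Component d) u v
    conn u v cu cv = lift cu (walk-trans (walk-reverse cu) cv)
    near : ∀ k → k ∈ ks → Σ[ c ∈ V ] Component d c × k H.~ c
    near k k∈ with Attached? d k
    ... | yes (c , cc , e) = c , cc , H.~-sym (G⊆H _ _ e)
    ... | no ¬a = contradiction (k , inK k k∈ , ¬a) none
  ...   | e , ce , all = contradiction (λ u u∈ → H.~-sym (all u (∈ₚ.∈-filter⁺ In? (∈ₚ.∈-allFin u) u∈)))
                            (proj₂ (proj₂ (proj₂ pmc)) e (walk-end ce))

  Common : V → V → Set
  Common x y = Σ[ c ∈ V ] (Out c × x ~ c) × Attached c y

  Common? : ∀ x y → Dec (Common x y)
  Common? x y = Fₚ.any? λ c → (Out? c ×-dec x ~? c) ×-dec Attached? c y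

  -- If x and y had no common component, deleting from H the edge xy and all edges between distinct components,
  -- or between a component and a vertex not attached to it, would leave a chordal completion.
  module Delete (x y : V) (x∈ : x ∈ₛ K) (y∈ : y ∈ₛ K) (x≢y : x ≢ y) (x≁y : ¬ (x ~ y)) (none : ¬ Common x y) where

    IsXY : V → V → Set
    IsXY u v = (u ≡ x × v ≡ y) ⊎ (u ≡ y × v ≡ x)

    Near : V → VSet
    Near u v = Component u v ⊎ Attached u v

    Ok : V → V → Set
    Ok u v = (u ∈ₛ K × v ∈ₛ K × ¬ IsXY u v) ⊎ (Out u × Near u v) ⊎ (Out v × Near v u)

    Ok? : ∀ u v → Dec (Ok u v)
    Ok? u v = (In? u ×-dec In? v ×-dec ¬? ((u ≟ x ×-dec v ≟ y) ⊎-dec (u ≟ y ×-dec v ≟ x)))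
      ⊎-dec (Out? u ×-dec (Component? u v ⊎-dec Attached? u v)) ⊎-dec (Out? v ×-dec (Component? v u ⊎-dec Attached? v u))

    Ok-sym : ∀ {u v} → Ok u v → Ok v u
    Ok-sym (inj₁ (a , b , c)) = inj₁ (b , a , λ { (inj₁ (r , s)) → c (inj₂ (s , r)) ; (inj₂ (r , s)) → c (inj₁ (s , r)) })
    Ok-sym (inj₂ (inj₁ r)) = inj₂ (inj₂ r)
    Ok-sym (inj₂ (inj₂ r)) = inj₂ (inj₁ r)

    kept : V → V → Bool
    kept u v = does (u H.~? v ×-dec Ok? u v)

    does-⇔ : ∀ {P Q : Set} (p : Dec P) (q : Dec Q) → (P → Q) → (Q → P) → does p ≡ does q
    does-⇔ (yes p) q f g = sym (dec-true q (f p))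
    does-⇔ (no ¬p) q f g = sym (dec-false q (λ q → ¬p (g q)))

    H′ : Graph n
    H′ = record
      { adj = kept
      ; adj-sym = λ u v → does-⇔ (u H.~? v ×-dec Ok? u v) (v H.~? u ×-dec Ok? v u)
          (λ { (a , o) → H.~-sym a , Ok-sym o }) (λ { (a , o) → H.~-sym a , Ok-sym o })
      ; adj-irr = λ v → dec-false (v H.~? v ×-dec Ok? v v) λ { (a , _) → H.~-irr a refl } }

    module H′ = GraphBasics H′

    H′⁻ : ∀ {u v} → Edge H′ u v → u H.~ v × Ok u v
    H′⁻ {u} {v} = does-true (u H.~? v ×-dec Ok? u v)

    H′⁺ : ∀ {u v} → u H.~ v → Ok u v → Edge H′ u v
    H′⁺ {u} {v} a o = dec-true (u H.~? v ×-dec Ok? u v) (a , o)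

    G⊆H′ : ∀ u v → u ~ v → Edge H′ u v
    G⊆H′ u v e = H′⁺ (G⊆H u v e) ok
      where
      ok : Ok u v
      ok with In? u | In? v
      ... | no ou | _ = inj₂ (inj₁ (ou , inj₂ (u , here ou , e)))
      ... | yes _ | no ov = inj₂ (inj₂ (ov , inj₂ (v , here ov , ~-sym e)))
      ... | yes iu | yes iv = inj₁ (iu , iv , λ { (inj₁ (refl , refl)) → x≁y e ; (inj₂ (refl , refl)) → x≁y (~-sym e) })

    -- A hole inside `K` is impossible: only the pair `x`, `y` is missing there, while a hole has
    -- two disjoint nonadjacent pairs. A hole through a component `C` stays within `C` and the
    -- clique `Q` of vertices of `K` attached to `C`, since deleting a clique leaves it connected
    -- and no edge leaves `C` except to `Q`. On that set the two completions agree, so it would be a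
    -- hole of `H`.
    chordal′ : Chordal H′
    chordal′ h with Fₚ.any? (λ i → Out? (Hole.vert h i))
    ... | no allIn = clash (badPair F.zero (F.suc (F.suc F.zero)) (λ ()) λ { (inj₁ (inj₁ ())) ; (inj₁ (inj₂ ())) ; (inj₂ (inj₁ (_ , ()))) ; (inj₂ (inj₂ (() , _))) })
                           (badPair (F.suc F.zero) (F.suc (F.suc (F.suc F.zero))) (λ ()) λ { (inj₁ (inj₁ ())) ; (inj₁ (inj₂ ())) ; (inj₂ (inj₁ (() , _))) ; (inj₂ (inj₂ (() , _))) })
      where
      vt = Hole.vert h
      inK : ∀ i → vt i ∈ₛ K
      inK i = decidable-stable (In? (vt i)) λ o → allIn (i , o)
      badPair : ∀ i j → i ≢ j → ¬ CycAdj i j → IsXY (vt i) (vt j)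
      badPair i j i≢j na with (vt i ≟ x ×-dec vt j ≟ y) ⊎-dec (vt i ≟ y ×-dec vt j ≟ x)
      ... | yes r = r
      ... | no ¬r = contradiction (Equivalence.to (Hole.induced h i j)
                (H′⁺ (clique _ _ (inK i) (inK j) λ e → i≢j (Hole.inj h e)) (inj₁ (inK i , inK j , ¬r)))) na
      same : ∀ {i j z} → vt i ≡ z → vt j ≡ z → i ≡ j
      same p q = Hole.inj h (trans p (sym q))
      clash : IsXY (vt F.zero) (vt (F.suc (F.suc F.zero))) → IsXY (vt (F.suc F.zero)) (vt (F.suc (F.suc (F.suc F.zero)))) → ⊥
      clash (inj₁ (a , _)) (inj₁ (b , _)) with same a b
      ... | ()
      clash (inj₁ (a , _)) (inj₂ (_ , b)) with same a b
      ... | ()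
      clash (inj₂ (a , _)) (inj₁ (_ , b)) with same a b
      ... | ()
      clash (inj₂ (a , _)) (inj₂ (b , _)) with same a b
      ... | ()
    ... | yes (i₀ , o₀) = chordal (record { k = Hole.k h ; vert = vt ; inj = Hole.inj h ; induced = ind })
      where
      vt = Hole.vert h
      v₀ = vt i₀
      C = Component v₀
      open Σ (Segments.openHole H′ h) renaming (proj₁ to l; proj₂ to form)
      p = proj₁ (proj₂ (proj₂ form))
      rest = proj₂ (proj₂ (proj₂ form))
      Q : VSet
      Q z = z ∈ₛ K × Attached v₀ z
      Q? : Decidable Q
      Q? z = In? z ×-dec Attached? v₀ z
      common : ∀ {u v} → Attached v₀ u → Attached v₀ v → Common u v
      common (c , cc , cu) (d , cd , dv) = c , (walk-end cc , ~-sym cu) , d , walk-trans (walk-reverse cc) cd , dv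
      Q-ok : ∀ {u v} → Q u → Q v → Ok u v
      Q-ok (iu , au) (iv , av) = inj₁ (iu , iv , λ { (inj₁ (refl , refl)) → none (common au av) ; (inj₂ (refl , refl)) → none (common av au) })
      module M = Segments.CycleMinusClique H′ p (proj₁ rest) (proj₁ (proj₂ rest)) (proj₁ (proj₂ (proj₂ rest))) (proj₁ (proj₂ (proj₂ (proj₂ rest))))
                   Q Q? (λ u v _ _ qu qv u≢v → H′⁺ (clique u v (proj₁ qu) (proj₁ qv) u≢v) (Q-ok qu qv))
      on = proj₂ (proj₂ (proj₂ (proj₂ rest)))
      stay : ∀ u w → C u → Edge H′ u w → M.Free w → C w
      stay u w cu e (_ , ¬q) with proj₂ (H′⁻ e)
      ... | inj₁ (iu , _) = contradiction iu (walk-end cu)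
      ... | inj₂ (inj₁ (_ , inj₁ p)) = walk-trans cu p
      ... | inj₂ (inj₁ (_ , inj₂ (c , p , cw))) with In? w
      ...   | yes iw = contradiction (iw , c , walk-trans cu p , cw) ¬q
      ...   | no ow = walk-snoc (walk-trans cu p) cw ow
      stay u w cu e (_ , ¬q) | inj₂ (inj₂ (ow , inj₁ p)) = walk-trans cu (walk-reverse p)
      stay u w cu e (_ , ¬q) | inj₂ (inj₂ (ow , inj₂ (c , p , cu′))) = walk-trans (walk-snoc cu (~-sym cu′) (walk-end p)) (walk-reverse p)
      inCQ : ∀ i → C (vt i) ⊎ Q (vt i)
      inCQ i with Q? (vt i)
      ... | yes q = inj₂ q
      ... | no ¬q = inj₁ (proj₂ (H′.walk-end (H′.walk-closed C stay (M.connected v₀ (vt i) (on i₀) (on i) (λ q → o₀ (proj₁ q)) ¬q) (here o₀))))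
      ok : ∀ {u v} → C u ⊎ Q u → C v ⊎ Q v → Ok u v
      ok (inj₂ qu) (inj₂ qv) = Q-ok qu qv
      ok (inj₁ cu) (inj₁ cv) = inj₂ (inj₁ (walk-end cu , inj₁ (walk-trans (walk-reverse cu) cv)))
      ok (inj₁ cu) (inj₂ (_ , c , p , e)) = inj₂ (inj₁ (walk-end cu , inj₂ (c , walk-trans (walk-reverse cu) p , e)))
      ok (inj₂ (_ , c , p , e)) (inj₁ cv) = inj₂ (inj₂ (walk-end cv , inj₂ (c , walk-trans (walk-reverse cv) p , e)))
      ind : ∀ i j → Edge H (vt i) (vt j) ⇔ CycAdj i j
      ind i j = mk⇔ (λ e → Equivalence.to (Hole.induced h i j) (H′⁺ e (ok (inCQ i) (inCQ j))))
        λ c → proj₁ (H′⁻ (Equivalence.from (Hole.induced h i j) c))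

    impossible : ⊥
    impossible with proj₂ (H′⁻ (minimal H′ (G⊆H′ , chordal′) (λ u v e → proj₁ (H′⁻ e)) x y (clique x y x∈ y∈ x≢y)))
    ... | inj₁ (_ , _ , ¬xy) = ¬xy (inj₁ (refl , refl))
    ... | inj₂ (inj₁ (ox , _)) = ox x∈
    ... | inj₂ (inj₂ (oy , _)) = oy y∈

  common-component : ∀ x y → x ∈ₛ K → y ∈ₛ K → x ≢ y → ¬ (x ~ y) → Common x y
  common-component x y x∈ y∈ x≢y x≁y = decidable-stable (Common? x y) (Delete.impossible x y x∈ y∈ x≢y x≁y)

module OneGraph {n : ℕ} (G : Graph n) where
  open GraphBasics G
  open Segments G

  record TwoSides (ys : List (Fin n)) : Set₁ where
    field
      D E    : VSet
      D?     : Decidable D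
      E?     : Decidable E
      D-conn : ∀ u v → D u → D v → Walk D u v
      E-conn : ∀ u v → E u → E v → Walk E u v
      D-E    : Anti D E
      unique : AllPairs _≢_ ys
      stable : ∀ u v → u ∈ ys → v ∈ ys → ¬ (u ~ v)
      off-D  : ∀ y → y ∈ ys → ¬ D y
      off-E  : ∀ y → y ∈ ys → ¬ E y
      att-D  : ∀ y → y ∈ ys → Σ[ d ∈ V ] D d × y ~ d
      att-E  : ∀ y → y ∈ ys → Σ[ d ∈ V ] E d × y ~ d

  -- Stable sets in a potential maximal clique: three components give a theta.

  module StableSetInPMC (no-theta : ¬ Theta G) (K : Subset n) (pmc : PMC G K)
    (ys : List (Fin n)) (unique : AllPairs _≢_ ys) (inK : ∀ y → y ∈ ys → y ∈ₛ K)
    (stable : ∀ u v → u ∈ ys → v ∈ ys → ¬ Edge G u v) (τ : ℕ)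
    (bound : ∀ zs → zs ⊑ ys → TwoSides zs → length zs ≤ τ) where
    open PotentialMaximalCliques G K pmc

    private
      walk-reached : ∀ {S u v} → Walk S u v → Walk (λ x → S x × Walk S u x) u v
      walk-reached p = walk-closed _ (λ _ _ q e s → walk-snoc q e s) p (here (walk-start p))

      unreached : ∀ d u w → Component d u → u ~ w → ¬ Component d w → w ∈ₛ K × Attached d w
      unreached d u w cu e ¬c = decidable-stable (In? w) (λ ow → ¬c (walk-snoc cu e ow)) , u , cu , e

    -- The first side is the component. For the second, take `k₀` in `K` not attached to it and the
    -- connected piece around `k₀` outside the component and its neighbourhood. A label not adjacent
    -- to `k₀` shares another component with `k₀`, and that component lies wholly in this piece.
    component-bound : ∀ d → Out d → ∀ zs → zs ⊑ ys → AllPairs _≢_ zs → (∀ z → z ∈ zs → Attached d z) → length zs ≤ τ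
    component-bound d od zs sub uz att with not-full d od
    ... | k₀ , k₀∈ , ¬ak = bound zs sub (record
      { D = Component d ; E = E ; D? = Component? d ; E? = walk? (λ v → ¬? (Component? d v) ×-dec ¬? (In? v ×-dec Attached? d v)) k₀
      ; D-conn = λ u v p q → walk-map (λ _ r → walk-trans p (proj₂ r)) (walk-reached (walk-trans (walk-reverse p) q))
      ; E-conn = λ u v p q → walk-map (λ _ r → walk-trans p (proj₂ r)) (walk-reached (walk-trans (walk-reverse p) q))
      ; D-E = λ u w cu ew → (λ { refl → proj₁ (walk-end ew) cu }) ,
          λ e → proj₂ (walk-end ew) (unreached d u w cu e (proj₁ (walk-end ew)))
      ; unique = uz ; stable = λ u v u∈ v∈ → stable u v (sub u u∈) (sub v v∈)
      ; off-D = λ y y∈ c → walk-end c (inK y (sub y y∈))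
      ; off-E = λ y y∈ e → proj₂ (walk-end e) (inK y (sub y y∈) , att y y∈)
      ; att-D = λ y y∈ → proj₁ (att y y∈) , proj₁ (proj₂ (att y y∈)) , ~-sym (proj₂ (proj₂ (att y y∈)))
      ; att-E = far })
      where
      Rest : VSet
      Rest v = ¬ Component d v × ¬ (v ∈ₛ K × Attached d v)
      E : VSet
      E v = Walk Rest k₀ v
      rest₀ : Rest k₀
      rest₀ = (λ c → walk-end c k₀∈) , λ a → ¬ak (proj₂ a)
      far : ∀ y → y ∈ zs → Σ[ e ∈ V ] E e × y ~ e
      far y y∈ with y ~? k₀
      ... | yes e = k₀ , here rest₀ , e
      ... | no ¬e with common-component y k₀ (inK y (sub y y∈)) k₀∈ (λ { refl → ¬ak (att y y∈) }) ¬e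
      ...   | c , (oc , yc) , c₂ , p , e₂ = c , step rest₀ (~-sym e₂) (walk-map rest (walk-reached (walk-reverse p))) , yc
        where
        rest : ∀ x → Out x × Walk Out c₂ x → Rest x
        rest x (ox , q) = (λ cx → ¬ak (c₂ , walk-trans cx (walk-reverse q) , e₂)) , λ a → ox (proj₁ a)

    module _ (large : 4 * suc τ < length ys) where
      private
        -- Each listed component is attached to at most `τ` labels, so discarding these leaves a
        -- label. No more than three components are ever listed, hence the factor 4 in the bound.
        escape : ∀ ds zs → zs ⊑ ys → AllPairs _≢_ zs → (∀ d → d ∈ ds → Out d) → length ds * τ < length zs →
          Σ[ v ∈ V ] v ∈ zs × (∀ d → d ∈ ds → ¬ Attached d v)
        escape [] (z ∷ zs) sub u o lt = z , here refl , λ d ()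
        escape (d ∷ ds) zs sub u o lt with split-large< (Attached? d) zs τ (length ds * τ) lt
        ... | inj₁ big = contradiction (component-bound d (o d (here refl)) _ (λ z z∈ → sub z (filter-∈ (Attached? d) zs z∈))
                  (AllPairsₚ.filter⁺ (Attached? d) u) (λ z z∈ → filter-holds (Attached? d) zs z∈)) (<⇒≱ big)
        ... | inj₂ big with escape ds _ (λ z z∈ → sub z (filter-∈ _ zs z∈)) (AllPairsₚ.filter⁺ _ u) (λ e e∈ → o e (there e∈)) big
        ...   | v , v∈ , none = v , filter-∈ _ zs v∈ , λ { e (here refl) → filter-holds _ zs v∈ ; e (there e∈) → none e e∈ }

        avoid : ∀ ds → length ds ≤ 3 → (∀ d → d ∈ ds → Out d) → Σ[ v ∈ V ] v ∈ ys × (∀ d → d ∈ ds → ¬ Attached d v)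
        avoid ds le o = escape ds ys (λ _ z → z) unique o
          (≤-<-trans (*-mono-≤ (≤-trans le (n≤1+n 3)) (n≤1+n τ)) large)

        Comp : V → VSet
        Comp = Component

        apart : ∀ {d e z} → Attached d z → ¬ Attached e z → Anti (Comp d) (Comp e)
        apart {d} {e} {z} (c , cc , cz) ¬a u w cu ew = (λ { refl → same (walk-trans ew (walk-reverse cu)) }) ,
            λ r → same (walk-trans (walk-snoc ew (~-sym r) (walk-end cu)) (walk-reverse cu))
          where
          same : ¬ Walk Out e d
          same p = ¬a (c , walk-trans p cc , cz)

        -- A route between two labels through a third label `v` and components joining `v` to both;
        -- it can serve as the interior of a theta path just like a single component.
        data Bridge (f v g : V) : VSet where
          inl : ∀ {u} → Comp f u → Bridge f v g u
          mid : Bridge f v g v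
          inr : ∀ {u} → Comp g u → Bridge f v g u

        not-seen : ∀ {d v} → v ∈ₛ K → ¬ Attached d v → ∀ u → Comp d u → u ≢ v × ¬ (u ~ v)
        not-seen iv ¬a u c = (λ { refl → walk-end c iv }) , λ e → ¬a (u , c , e)

        apart-bridge : ∀ {d f v g} → v ∈ₛ K → ¬ Attached d v → Attached f v → Attached g v → Anti (Comp d) (Bridge f v g)
        apart-bridge iv ¬a af ag u w cu (inl c) = Anti-sym (apart af ¬a) u w cu c
        apart-bridge iv ¬a af ag u w cu mid = not-seen iv ¬a u cu
        apart-bridge iv ¬a af ag u w cu (inr c) = Anti-sym (apart ag ¬a) u w cu c

        Link : VSet → V → V → Set
        Link S x y = Walk (λ v → v ≡ x ⊎ v ≡ y ⊎ S v) x y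

        through : ∀ {d x y} → Attached d x → Attached d y → Walk (λ v → v ≡ x ⊎ v ≡ y ⊎ Comp d v) x y
        through {d} (c , cc , cx) (e , ce , ey) = step (inj₁ refl) (~-sym cx)
          (walk-snoc (walk-map (λ v r → inj₂ (inj₂ (walk-trans cc (proj₂ r)))) (walk-reached (walk-trans (walk-reverse cc) ce))) ey (inj₂ (inj₁ refl)))

        link : ∀ {d x y} → Attached d x → Attached d y → Link (Comp d) x y
        link = through

        link-bridge : ∀ {f v g x y} → Attached f x → Attached f v → Attached g v → Attached g y → Link (Bridge f v g) x y
        link-bridge fx fv gv gy = walk-trans
          (walk-map (λ { _ (inj₁ e) → inj₁ e ; _ (inj₂ (inj₁ refl)) → inj₂ (inj₂ mid) ; _ (inj₂ (inj₂ c)) → inj₂ (inj₂ (inl c)) }) (through fx fv))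
          (walk-map (λ { _ (inj₁ refl) → inj₂ (inj₂ mid) ; _ (inj₂ (inj₁ e)) → inj₂ (inj₁ e) ; _ (inj₂ (inj₂ c)) → inj₂ (inj₂ (inr c)) }) (through gv gy))

        no-three : ∀ {x y S₁ S₂ S₃} → x ∈ ys → y ∈ ys → x ≢ y → Anti S₁ S₂ → Anti S₁ S₃ → Anti S₂ S₃ →
          Link S₁ x y → Link S₂ x y → Link S₃ x y → ⊥
        no-three {S₁ = S₁} {S₂} {S₃} x∈ y∈ x≢y a b c l₁ l₂ l₃ = no-theta (theta x≢y (stable _ _ x∈ y∈) (three S₁ S₂ S₃)
          (λ { _ _ p01 → a ; _ _ p02 → b ; _ _ p12 → c })
          (λ { F.zero → l₁ ; (F.suc F.zero) → l₂ ; (F.suc (F.suc F.zero)) → l₃ }))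

        record Joined (x y : V) : Set where
          constructor joint
          field
            d  : V
            od : Out d
            dx : Attached d x
            dy : Attached d y

        joined : ∀ x y → x ∈ ys → y ∈ ys → x ≢ y → Joined x y
        joined x y x∈ y∈ x≢y with common-component x y (inK x x∈) (inK y y∈) x≢y (stable x y x∈ y∈)
        ... | c , (oc , xc) , ay = joint c oc (c , here oc , ~-sym xc) ay

        differ : ∀ {d x y} → Attached d x → ¬ Attached d y → x ≢ y
        differ a ¬a refl = ¬a a

        -- Besides `d` and `e` there is a third route from `x` to `y`, through a label `v` attached
        -- to neither of them. The components used on this route are attached to `v`, hence differ
        -- from `d` and `e`.
        share-one : ∀ {d e x y} → Out d → Out e → Anti (Comp d) (Comp e) → x ∈ ys → y ∈ ys → x ≢ y →
          Attached d x → Attached d y → Attached e x → Attached e y → ⊥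
        share-one {d} {e} {x} {y} od oe ap x∈ y∈ x≢y dx dy ex ey =
          outside (avoid (d ∷ e ∷ []) (n≤1+n 2) (λ { _ (here refl) → od ; _ (there (here refl)) → oe }))
          where
          finish : ∀ v → v ∈ ys → ¬ Attached d v → ¬ Attached e v → Joined x v → Joined v y → ⊥
          finish v v∈ ¬dv ¬ev (joint f _ fx fv) (joint g _ gv gy) = no-three x∈ y∈ x≢y ap
            (apart-bridge (inK v v∈) ¬dv fv gv) (apart-bridge (inK v v∈) ¬ev fv gv) (link dx dy) (link ex ey) (link-bridge fx fv gv gy)
          outside : Σ[ v ∈ V ] v ∈ ys × (∀ c → c ∈ d ∷ e ∷ [] → ¬ Attached c v) → ⊥
          outside (v , v∈ , no-v) = finish v v∈ ¬dv (no-v e (there (here refl))) (joined x v x∈ v∈ (differ dx ¬dv)) (joined v y v∈ y∈ (differ dy ¬dv ∘ sym))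
            where ¬dv = no-v d (here refl)

        -- Three routes form a theta: a component joining `x` and `y`, a bridge through `w`, and a
        -- bridge through `z`, where `w` and `z` avoid all components used before. That the last
        -- bridge is also not attached to `w` is `share-one`.
        from-pair : ∀ x y → x ∈ ys → y ∈ ys → x ≢ y → ⊥
        from-pair x y x∈ y∈ x≢y = via (joined x y x∈ y∈ x≢y)
          where
          finish : (j₁ : Joined x y) → ∀ w → w ∈ ys → ¬ Attached (Joined.d j₁) w → (j₃ : Joined x w) (j₄ : Joined w y) →
            ∀ z → z ∈ ys → ¬ Attached (Joined.d j₁) z → ¬ Attached (Joined.d j₃) z → ¬ Attached (Joined.d j₄) z → Joined x z → Joined z y → ⊥
          finish (joint d₁ o₁ d₁x d₁y) w w∈ w₁ (joint d₃ o₃ d₃x d₃w) (joint d₄ o₄ d₄w d₄y) z z∈ z₁ z₃ z₄ (joint d₅ o₅ d₅x d₅z) (joint d₆ o₆ d₆z d₆y) =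
            no-three x∈ y∈ x≢y (apart-bridge (inK w w∈) w₁ d₃w d₄w) (apart-bridge (inK z z∈) z₁ d₅z d₆z) bridges
              (link d₁x d₁y) (link-bridge d₃x d₃w d₄w d₄y) (link-bridge d₅x d₅z d₆z d₆y)
            where
            w₅ : ¬ Attached d₅ w
            w₅ a = share-one o₅ o₃ (apart d₅z z₃) x∈ w∈ (differ d₁x w₁) d₅x a d₃x d₃w
            w₆ : ¬ Attached d₆ w
            w₆ a = share-one o₆ o₄ (apart d₆z z₄) w∈ y∈ (differ d₁y w₁ ∘ sym) a d₆y d₄w d₄y
            bridges : Anti (Bridge d₃ w d₄) (Bridge d₅ z d₆)
            bridges u v (inl c) b = apart-bridge (inK z z∈) z₃ d₅z d₆z u v c b
            bridges u v (inr c) b = apart-bridge (inK z z∈) z₄ d₅z d₆z u v c b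
            bridges u v mid (inl c) = (λ r → proj₁ (not-seen (inK w w∈) w₅ v c) (sym r)) , λ r → proj₂ (not-seen (inK w w∈) w₅ v c) (~-sym r)
            bridges u v mid (inr c) = (λ r → proj₁ (not-seen (inK w w∈) w₆ v c) (sym r)) , λ r → proj₂ (not-seen (inK w w∈) w₆ v c) (~-sym r)
            bridges u v mid mid = differ d₃w z₃ , stable w z w∈ z∈
          second : (j₁ : Joined x y) → ∀ w → w ∈ ys → ¬ Attached (Joined.d j₁) w → Joined x w → Joined w y → ⊥
          second j₁ w w∈ w₁ j₃ j₄ = outside (avoid (Joined.d j₁ ∷ Joined.d j₃ ∷ Joined.d j₄ ∷ []) ≤-refl
              (λ { _ (here refl) → Joined.od j₁ ; _ (there (here refl)) → Joined.od j₃ ; _ (there (there (here refl))) → Joined.od j₄ }))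
            where
            outside : _ → ⊥
            outside (z , z∈ , no-z) = finish j₁ w w∈ w₁ j₃ j₄ z z∈ z₁ (no-z _ (there (here refl))) (no-z _ (there (there (here refl))))
                (joined x z x∈ z∈ (differ (Joined.dx j₁) z₁)) (joined z y z∈ y∈ (differ (Joined.dy j₁) z₁ ∘ sym))
              where z₁ = no-z _ (here refl)
          via : Joined x y → ⊥
          via j₁ = outside (avoid (Joined.d j₁ ∷ []) (s≤s z≤n) (λ { _ (here refl) → Joined.od j₁ }))
            where
            outside : _ → ⊥
            outside (w , w∈ , no-w) = second j₁ w w∈ w₁ (joined x w x∈ w∈ (differ (Joined.dx j₁) w₁)) (joined w y w∈ y∈ (differ (Joined.dy j₁) w₁ ∘ sym))
              where w₁ = no-w _ (here refl)

      too-large : ⊥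
      too-large = two ys unique (≤-trans (s≤s (s≤s z≤n)) (≤-trans (s≤s (m≤m*n 4 (suc τ))) large)) (λ _ z → z)
        where
        two : ∀ zs → AllPairs _≢_ zs → 2 ≤ length zs → zs ⊑ ys → ⊥
        two (x ∷ y ∷ zs) ((x≢y ∷ _) ∷ _) _ sub = from-pair x y (sub x (here refl)) (sub y (there (here refl))) x≢y
        two (x ∷ []) _ (s≤s ()) sub

    stable-bound : length ys ≤ 4 * suc τ
    stable-bound = decidable-stable (length ys ≤? 4 * suc τ) λ ¬le → too-large (≰⇒> ¬le)

  -- Critical sets and their dominator order.

  module Critical where

    Reaches : VSet → V → V → Set
    Reaches X s y = Σ[ w ∈ V ] y ~ w × Walk X s w

    Reaches? : ∀ {X} → Decidable X → ∀ s y → Dec (Reaches X s y)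
    Reaches? X? s y = Fₚ.any? λ w → y ~? w ×-dec walk? X? s w

    record CriticalSet (D : VSet) (ys : List V) (s : V) : Set₁ where
      field
        X     : VSet
        X?    : Decidable X
        X⊆D   : ∀ v → X v → D v
        s∈X   : X s
        reach : ∀ y → y ∈ ys → Reaches X s y
        crit  : ∀ v → X v → v ≢ s → Σ[ y ∈ V ] y ∈ ys × ¬ Reaches (X ∖ v) s y

    private
      shrink : ∀ k {D X : VSet} (ys : List V) (s : V) (X? : Decidable X) → size X? ≤ k → (∀ v → X v → D v) → X s →
        (∀ y → y ∈ ys → Reaches X s y) → CriticalSet D ys s
      shrink k {D} {X} ys s X? le sub s∈ r with Fₚ.any? (λ v → (X? v ×-dec ¬? (v ≟ s)) ×-dec useless? v)
        where
        useless? : ∀ v → Dec (∀ y → y ∈ ys → Reaches (X ∖ v) s y)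
        useless? v with forall∈? (Reaches? (∖-dec X? v) s) ys
        ... | inj₁ all = yes all
        ... | inj₂ (y , y∈ , ¬p) = no λ all → ¬p (all y y∈)
      ... | no none = record { X = X ; X? = X? ; X⊆D = sub ; s∈X = s∈ ; reach = r ; crit = crit }
        where
        crit : ∀ v → X v → v ≢ s → _
        crit v xv v≢s with forall∈? (Reaches? (∖-dec X? v) s) ys
        ... | inj₁ all = contradiction (v , (xv , v≢s) , all) none
        ... | inj₂ p = p
      shrink zero ys s X? le sub s∈ r | yes (v , (xv , _) , _) = contradiction (subst (_≤ 0) (size-∖ X? v xv) le) λ ()
      shrink (suc k) ys s X? le sub s∈ r | yes (v , (xv , v≢s) , all) =
        shrink k ys s (∖-dec X? v) (s≤s⁻¹ (subst (_≤ suc k) (size-∖ X? v xv) le)) (λ w → sub w ∘ proj₁) (s∈ , v≢s ∘ sym) all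

    critical : ∀ {D} (D? : Decidable D) ys s → D s → (∀ y → y ∈ ys → Reaches D s y) → CriticalSet D ys s
    critical D? ys s Ds r = shrink _ ys s D? ≤-refl (λ _ d → d) Ds r

    module Dominators {D : VSet} {ys : List V} {s₀ : V} (C : CriticalSet D ys s₀) where
      open CriticalSet C public

      -- `W v` is the set of vertices dominated by `v` in the sense of flow graphs with root `s₀`:
      -- every walk in `X` from the root to them passes through `v`. These sets are the subtrees of
      -- the dominator tree.
      W : V → VSet
      W v x = X v × X x × ¬ Walk (X ∖ v) s₀ x

      W? : ∀ v → Decidable (W v)
      W? v x = X? v ×-dec X? x ×-dec ¬? (walk? (∖-dec X? v) s₀ x)

      reachable : ∀ x → X x → Walk X s₀ x
      reachable x xx with x ≟ s₀
      ... | yes refl = here xx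
      ... | no ne with crit x xx ne
      ...   | y , y∈ , ¬r with reach y y∈
      ...     | w , yw , p with walk-avoid x p
      ...       | inj₁ q = contradiction (w , yw , q) ¬r
      ...       | inj₂ q = q

      dom-refl : ∀ v → X v → W v v
      dom-refl v xv = xv , xv , λ p → proj₂ (walk-end p) refl

      dom-s₀ : ∀ x → X x → W s₀ x
      dom-s₀ x xx = s∈X , xx , λ p → proj₂ (walk-start p) refl

      free : ∀ {v x} → X v → X x → ¬ W v x → Walk (X ∖ v) s₀ x
      free {v} {x} xv xx ¬w = decidable-stable (walk? (∖-dec X? v) s₀ x) λ ¬p → ¬w (xv , xx , ¬p)

      dom-trans : ∀ {s k x} → W s k → W k x → W s x
      dom-trans {s} {k} (xs , _ , ¬p) (_ , xx , ¬q) = xs , xx , bad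
        where
        bad : ¬ Walk (X ∖ s) s₀ _
        bad r with walk-avoid k r
        ... | inj₁ q = ¬q (walk-map (λ _ z → proj₁ (proj₁ z) , proj₂ z) q)
        ... | inj₂ p = ¬p p

      -- A walk from the root, stopped at the first of `a` and `b`, reaches that vertex without the
      -- other.
      dom-antisym : ∀ {a b} → W a b → W b a → a ≡ b
      dom-antisym {a} {b} (xa , _ , ¬p) (xb , _ , ¬q) with a ≟ b
      ... | yes e = e
      ... | no a≢b with walk-until {T = λ x → x ≡ a ⊎ x ≡ b} (λ x → (x ≟ a) ⊎-dec (x ≟ b)) (reachable a xa) (inj₁ refl)
      ...   | z , inj₁ refl , r = contradiction (walk-map (λ { x (xx , inj₁ refl) → xx , a≢b ; x (xx , inj₂ ne) → xx , λ e → ne (inj₂ e) }) r) ¬q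
      ...   | z , inj₂ refl , r = contradiction (walk-map (λ { x (xx , inj₁ refl) → xx , a≢b ∘ sym ; x (xx , inj₂ ne) → xx , λ e → ne (inj₁ e) }) r) ¬p

      -- The part of a walk after its last visit to `s` stays in `W s`: a vertex reachable without
      -- `s` would make `x` reachable without `s` along the rest of the walk.
      inside-via : ∀ {S : VSet} {s x} → (∀ v → S v → X v) → W s x → Walk S s₀ x → Walk (λ z → S z × W s z) s x
      inside-via {S} {s} {x} sub (xs , xx , ¬p) r with walk-after s r
      ... | inj₁ q = contradiction (walk-map (λ v z → sub v (proj₁ z) , proj₂ z) q) ¬p
      ... | inj₂ (inj₁ refl) = here (walk-end r , dom-refl s xs)
      ... | inj₂ (inj₂ (w , e , q)) = step (on-walk , dom-refl s xs) e
            (walk-map (λ z r → proj₁ (proj₁ r) , xs , sub z (proj₁ (proj₁ r)) , proj₂ (proj₂ r)) (walk-reverse back))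
        where
        on-walk : S s
        on-walk with walk-avoid s r
        ... | inj₁ q′ = contradiction (walk-map (λ v z → sub v (proj₁ z) , proj₂ z) q′) ¬p
        ... | inj₂ q′ = walk-end q′
        back = walk-closed (λ z → (X ∖ s) z × ¬ Walk (X ∖ s) s₀ z)
          (λ { u v (xu , ¬u) a (sv , v≢s) → (sub v sv , v≢s) , λ r′ → ¬u (walk-snoc r′ (~-sym a) xu) })
          (walk-reverse q) ((xx , proj₂ (walk-end q)) , ¬p)

      inside : ∀ {s x} → W s x → Walk (W s) s x
      inside w = walk-map (λ _ → proj₂) (inside-via (λ _ x → x) w (reachable _ (proj₁ (proj₂ w))))

      exit : ∀ {a u w} → W a u → X w → ¬ W a w → u ~ w → u ≡ a
      exit {a} {u} {w} (xa , xu , ¬p) xw ¬d e with u ≟ a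
      ... | yes r = r
      ... | no ne = contradiction (walk-snoc (free xa xw ¬d) (~-sym e) (xu , ne)) ¬p

      disjoint : ∀ {a b} → ¬ W a b → ∀ {u} → W a u → W b u → W b a
      disjoint {a} {b} ¬ab {u} wa wb = decidable-stable (W? b a) λ ¬ba →
        proj₂ (proj₂ wb) (walk-trans (free (proj₁ wb) (proj₁ wa) ¬ba)
          (walk-map (λ { z wz → proj₁ (proj₂ wz) , λ { refl → ¬ab wz } }) (inside wa)))

      -- Edges leave `W a` only at `a` and `W b` only at `b`, so between two incomparable subtrees
      -- only their roots can be adjacent.
      separate : ∀ {a b} → ¬ W a b → ¬ W b a → ∀ u w → W a u → W b w → u ≢ w × (u ~ w → u ≡ a × w ≡ b)
      separate ¬ab ¬ba u w wa wb = (λ { refl → ¬ba (disjoint ¬ab wa wb) }) , λ e →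
        exit wa (proj₁ (proj₂ wb)) (λ d → ¬ba (disjoint ¬ab d wb)) e ,
        exit wb (proj₁ (proj₂ wa)) (λ d → ¬ab (disjoint ¬ba d wa)) (~-sym e)

      Stem : V → VSet
      Stem s v = X v × (v ≡ s ⊎ Walk (X ∖ s) s₀ v)

      stem : ∀ s → X s → Walk (Stem s) s₀ s
      stem s xs = go (reachable s xs) start′
        where
        start′ : s₀ ≡ s ⊎ Walk (X ∖ s) s₀ s₀
        start′ with s₀ ≟ s
        ... | yes e = inj₁ e
        ... | no ne = inj₂ (here (s∈X , ne))
        go : ∀ {u} → Walk X u s → (u ≡ s ⊎ Walk (X ∖ s) s₀ u) → Walk (Stem s) u s
        go p (inj₁ refl) = here (xs , inj₁ refl)
        go (here _) (inj₂ q) = here (xs , inj₁ refl)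
        go (step {w = w} xu e p) (inj₂ q) = step (xu , inj₂ q) e (go p next)
          where
          next : w ≡ s ⊎ Walk (X ∖ s) s₀ w
          next with w ≟ s
          ... | yes e′ = inj₁ e′
          ... | no ne = inj₂ (walk-snoc q e (walk-start p , ne))

      stem-out : ∀ {s v} → Stem s v → W s v → v ≡ s
      stem-out (_ , inj₁ e) _ = e
      stem-out (_ , inj₂ p) (_ , _ , ¬p) = contradiction p ¬p

      -- Minimality names a label that is cut off by deleting `v`; every neighbour of this label in
      -- `X` must then be dominated by `v`.
      private-terminal : ∀ v → X v → v ≢ s₀ → Σ[ y ∈ V ] y ∈ ys × (∀ w → X w → y ~ w → W v w) × (Σ[ w ∈ V ] y ~ w × W v w)
      private-terminal v xv v≢ with crit v xv v≢
      ... | y , y∈ , ¬r = y , y∈ , dom , w , yw , dom w (walk-end p) yw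
        where
        dom : ∀ w → X w → y ~ w → W v w
        dom w xw yw = xv , xw , λ p → ¬r (w , yw , p)
        w = proj₁ (reach y y∈)
        yw = proj₁ (proj₂ (reach y y∈))
        p = proj₂ (proj₂ (reach y y∈))

      module TwoConnected (C₀ : VSet) (C₀⊆X : ∀ v → C₀ v → X v)
        (conn : ∀ u z₁ z₂ → C₀ z₁ → C₀ z₂ → z₁ ≢ u → z₂ ≢ u → Walk (λ z → C₀ z × z ≢ u) z₁ z₂) where

        -- A good vertex dominates no other vertex of the two-connected set `C₀`. Reaching one other
        -- vertex of `C₀` without `u` is enough, and by antisymmetry at most one vertex of `C₀` is
        -- not good.
        Good : V → Set
        Good u = ∀ z → C₀ z → z ≢ u → Walk (X ∖ u) s₀ z

        reach-good : ∀ {u z} → C₀ z → z ≢ u → Walk (X ∖ u) s₀ z → Good u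
        reach-good {u} {z} cz z≢ p z′ cz′ z′≢ =
          walk-trans p (walk-map (λ v r → C₀⊆X v (proj₁ r) , proj₂ r) (conn u z z′ cz cz′ z≢ z′≢))

        good-either : ∀ u v → C₀ u → C₀ v → u ≢ v → Good u ⊎ Good v
        good-either u v cu cv u≢v with walk? (∖-dec X? u) s₀ v | walk? (∖-dec X? v) s₀ u
        ... | yes p | _ = inj₁ (reach-good cv (u≢v ∘ sym) p)
        ... | no _ | yes q = inj₂ (reach-good cu u≢v q)
        ... | no ¬p | no ¬q = contradiction (dom-antisym (C₀⊆X u cu , C₀⊆X v cv , ¬p) (C₀⊆X v cv , C₀⊆X u cu , ¬q)) u≢v

        good-out : ∀ {u z} → Good u → C₀ z → z ≢ u → ¬ W u z
        good-out g cz z≢ (_ , _ , ¬p) = ¬p (g _ cz z≢)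

        good≢s₀ : ∀ {u v} → C₀ v → v ≢ u → Good u → u ≢ s₀
        good≢s₀ cv v≢ g e = proj₂ (walk-start (g _ cv v≢)) (sym e)

  -- A critical set induces a chordal subgraph: all but one vertex of a hole have pendant terminals, and two of these
  -- can be joined through E, which gives a theta.
  module NoHole (no-theta : ¬ Theta G) {ys : List (Fin n)} (TS : TwoSides ys)
    {s₀ : Fin n} (C : Critical.CriticalSet (TwoSides.D TS) ys s₀) where
    open Critical
    open TwoSides TS
    open Dominators C

    module _ (C₀ : VSet) (C₀⊆X : ∀ v → C₀ v → X v)
      (conn : ∀ u z₁ z₂ → C₀ z₁ → C₀ z₂ → z₁ ≢ u → z₂ ≢ u → Walk (λ z → C₀ z × z ≢ u) z₁ z₂) where
      open TwoConnected C₀ C₀⊆X conn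

      two-arcs : ∀ {p q} → C₀ p → C₀ q → p ≢ q → ¬ (p ~ q) → Good p → Good q → (A B : VSet) →
        (∀ z → A z → C₀ z × z ≢ p × z ≢ q) → (∀ z → B z → C₀ z × z ≢ p × z ≢ q) → Anti A B →
        Walk (λ v → v ≡ p ⊎ v ≡ q ⊎ A v) p q → Walk (λ v → v ≡ p ⊎ v ≡ q ⊎ B v) p q → ⊥
      two-arcs {p} {q} cp cq p≢q p≁q gp gq A B Ain Bin anti wA wB = no-theta (theta p≢q p≁q (three A B Third)
          (λ { _ _ p01 → anti ; _ _ p02 → third A Ain ; _ _ p12 → third B Bin })
          (λ { F.zero → wA ; (F.suc F.zero) → wB ; (F.suc (F.suc F.zero)) → link }))
        where
        pt = private-terminal p (C₀⊆X p cp) (good≢s₀ cq (p≢q ∘ sym) gp)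
        qt = private-terminal q (C₀⊆X q cq) (good≢s₀ cp p≢q gq)
        y = proj₁ pt
        y′ = proj₁ qt
        -- The third path runs from `p` through the vertices it dominates to its private label,
        -- across `E`, and from the private label of `q` up to `q`.
        Third : VSet
        Third v = (W p v × v ≢ p) ⊎ (W q v × v ≢ q) ⊎ v ≡ y ⊎ v ≡ y′ ⊎ E v
        third : (A : VSet) → (∀ z → A z → C₀ z × z ≢ p × z ≢ q) → Anti A Third
        third A Ain u w Au t with Ain u Au
        ... | cu , u≢p , u≢q = go t
          where
          xu = C₀⊆X u cu
          go : Third w → u ≢ w × ¬ (u ~ w)
          go (inj₁ (wp , w≢p)) = (λ { refl → good-out gp cu u≢p wp }) , λ e → w≢p (exit wp xu (good-out gp cu u≢p) (~-sym e))
          go (inj₂ (inj₁ (wq , w≢q))) = (λ { refl → good-out gq cu u≢q wq }) , λ e → w≢q (exit wq xu (good-out gq cu u≢q) (~-sym e))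
          go (inj₂ (inj₂ (inj₁ refl))) = (λ { refl → off-D y (proj₁ (proj₂ pt)) (X⊆D u xu) }) ,
              λ e → good-out gp cu u≢p (proj₁ (proj₂ (proj₂ pt)) u xu (~-sym e))
          go (inj₂ (inj₂ (inj₂ (inj₁ refl)))) = (λ { refl → off-D y′ (proj₁ (proj₂ qt)) (X⊆D u xu) }) ,
              λ e → good-out gq cu u≢q (proj₁ (proj₂ (proj₂ qt)) u xu (~-sym e))
          go (inj₂ (inj₂ (inj₂ (inj₂ ew)))) = D-E u w (X⊆D u xu) ew
        Big : VSet
        Big v = v ≡ p ⊎ v ≡ q ⊎ Third v
        toP : ∀ x → W p x → Big x
        toP x w with x ≟ p
        ... | yes e = inj₁ e
        ... | no ne = inj₂ (inj₂ (inj₁ (w , ne)))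
        toQ : ∀ x → W q x → Big x
        toQ x w with x ≟ q
        ... | yes e = inj₂ (inj₁ e)
        ... | no ne = inj₂ (inj₂ (inj₂ (inj₁ (w , ne))))
        tE : ∀ x → E x → Big x
        tE x e = inj₂ (inj₂ (inj₂ (inj₂ (inj₂ (inj₂ e)))))
        yB : Big y
        yB = inj₂ (inj₂ (inj₂ (inj₂ (inj₁ refl))))
        y′B : Big y′
        y′B = inj₂ (inj₂ (inj₂ (inj₂ (inj₂ (inj₁ refl)))))
        link : Walk Big p q
        link with proj₂ (proj₂ (proj₂ pt)) | proj₂ (proj₂ (proj₂ qt)) | att-E y (proj₁ (proj₂ pt)) | att-E y′ (proj₁ (proj₂ qt))
        ... | w , yw , dw | w′ , yw′ , dw′ | e , ee , ye | e′ , ee′ , ye′ =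
          walk-trans (walk-snoc (walk-map toP (inside dw)) (~-sym yw) yB)
            (step yB ye (walk-trans (walk-map tE (E-conn e e′ ee ee′))
              (step (tE e′ ee′) (~-sym ye′) (step y′B yw′ (walk-map toQ (walk-reverse (inside dw′)))))))

    -- At most one vertex of the hole fails to be good, so one of the disjoint nonadjacent pairs
    -- `h`, `c` and `a`, `b` consists of good vertices. That pair supplies the ends of the theta,
    -- and the two arcs of the hole between them its first two paths.
    no-hole : ∀ {h a b l} → IPath a b l → 3 ≤ length l → (∀ z → z ∈ l → h ≢ z × (h ~ z → z ≡ a ⊎ z ≡ b)) →
      h ~ a → h ~ b → (∀ z → z ∈ h ∷ l → X z) → ⊥
    no-hole [-] (s≤s ()) out ha hb sub
    no-hole (cons _ _ [-]) (s≤s (s≤s ())) out ha hb sub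
    no-hole {h} {a} {b} (cons e ind (cons {u = c} {l = l″} e₂ ind₂ p)) 3≤ out ha hb sub = go
      where
      l = a ∷ c ∷ l″
      path : IPath a b l
      path = cons e ind (cons e₂ ind₂ p)
      C₀ : VSet
      C₀ v = v ∈ h ∷ l
      conn : ∀ u z₁ z₂ → C₀ z₁ → C₀ z₂ → z₁ ≢ u → z₂ ≢ u → Walk (λ z → C₀ z × z ≢ u) z₁ z₂
      conn u z₁ z₂ c₁ c₂ n₁ n₂ = CycleMinusClique.connected path 3≤ out ha hb (_≡ u) (_≟ u)
        (λ { _ _ _ _ refl refl ne → contradiction refl ne }) z₁ z₂ c₁ c₂ n₁ n₂
      open TwoConnected C₀ sub conn
      b∈ = last∈ p
      c≢b : c ≢ b
      c≢b = proj₁ (ind₂ b b∈)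
      a≢c = proj₁ (ind c (here refl))
      a≢b = proj₁ (ind b (there b∈))
      h≁c : ¬ (h ~ c)
      h≁c x with proj₂ (out c (there (here refl))) x
      ... | inj₁ r = a≢c (sym r)
      ... | inj₂ r = c≢b r
      a≁b : ¬ (a ~ b)
      a≁b x = c≢b (sym (proj₂ (ind b (there b∈)) x))
      h≢ : ∀ {z} → z ∈ l → z ≢ h
      h≢ z∈ r = proj₁ (out _ z∈) (sym r)
      first-pair : Good h → Good c → ⊥
      first-pair gh gc = two-arcs C₀ sub conn (here refl) (there (there (here refl))) (proj₁ (out c (there (here refl)))) h≁c gh gc
        (_≡ a) (_∈ l″) (λ { z refl → there (here refl) , h≢ (here refl) , a≢c })
        (λ z z∈ → there (there (there z∈)) , h≢ (there (there z∈)) , λ r → proj₁ (ind₂ z z∈) (sym r))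
        (λ { u v refl v∈ → proj₁ (ind v (there v∈)) , λ x → proj₁ (ind₂ v v∈) (sym (proj₂ (ind v (there v∈)) x)) })
        (step (inj₁ refl) ha (step (inj₂ (inj₂ refl)) e (here (inj₂ (inj₁ refl)))))
        (step (inj₁ refl) hb (walk-reverse (step (inj₂ (inj₁ refl)) e₂ (walk-map (λ _ r → inj₂ (inj₂ r)) (path→walk p)))))
      second-pair : Good a → Good b → ⊥
      second-pair ga gb = two-arcs C₀ sub conn (there (here refl)) (there (there (there b∈))) a≢b a≁b ga gb
        (_≡ h) (λ z → z ∈ l × z ≢ a × z ≢ b) (λ { z refl → here refl , h≢ (here refl) ∘ sym , h≢ (there (there b∈)) ∘ sym })
        (λ z r → there (proj₁ r) , proj₂ r)
        (λ { u v refl (v∈ , v≢a , v≢b) → proj₁ (out v v∈) , λ x → [ v≢a , v≢b ]′ (proj₂ (out v v∈) x) })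
        (step (inj₁ refl) (~-sym ha) (step (inj₂ (inj₂ refl)) hb (here (inj₂ (inj₁ refl)))))
        (walk-map classify (path→walk path))
        where
        classify : ∀ z → z ∈ l → z ≡ a ⊎ z ≡ b ⊎ (z ∈ l × z ≢ a × z ≢ b)
        classify z z∈ with z ≟ a | z ≟ b
        ... | yes r | _ = inj₁ r
        ... | no _ | yes r = inj₂ (inj₁ r)
        ... | no r | no r′ = inj₂ (inj₂ (z∈ , r , r′))
      go : ⊥
      go with good-either h c (here refl) (there (there (here refl))) (proj₁ (out c (there (here refl))))
            | good-either a b (there (here refl)) (there (there (there b∈))) a≢b
            | good-either h a (here refl) (there (here refl)) (proj₁ (out a (here refl)))
            | good-either h b (here refl) (there (there (there b∈))) (proj₁ (out b (there (there b∈))))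
            | good-either c a (there (there (here refl))) (there (here refl)) (a≢c ∘ sym)
            | good-either c b (there (there (here refl))) (there (there (there b∈))) c≢b
      ... | inj₁ gh | inj₁ ga | _ | _ | inj₁ gc | _ = first-pair gh gc
      ... | inj₁ gh | inj₁ ga | _ | _ | inj₂ _ | inj₁ gc = first-pair gh gc
      ... | inj₁ gh | inj₁ ga | _ | _ | inj₂ _ | inj₂ gb = second-pair ga gb
      ... | inj₁ gh | inj₂ gb | _ | _ | inj₁ gc | _ = first-pair gh gc
      ... | inj₁ gh | inj₂ gb | _ | _ | inj₂ ga | _ = second-pair ga gb
      ... | inj₂ gc | inj₁ ga | inj₁ gh | _ | _ | _ = first-pair gh gc
      ... | inj₂ gc | inj₁ ga | inj₂ _ | inj₁ gh | _ | _ = first-pair gh gc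
      ... | inj₂ gc | inj₁ ga | inj₂ _ | inj₂ gb | _ | _ = second-pair ga gb
      ... | inj₂ gc | inj₂ gb | inj₁ gh | _ | _ | _ = first-pair gh gc
      ... | inj₂ gc | inj₂ gb | inj₂ ga | _ | _ | _ = second-pair ga gb

  -- Labels along an induced path.

  module OnSpine where

    seg-walk : ∀ (s : Spine) i j → i ≤ j → j ≤ N s → Walk (Seg s i j) (sp s i) (sp s j)
    seg-walk s i j i≤j j≤N = path (j ∸ i) i (m+[n∸m]≡n i≤j)
      where
      path : ∀ k i → i + k ≡ j → Walk (Seg s i j) (sp s i) (sp s j)
      path zero i e rewrite trans (sym (+-identityʳ i)) e = here (j , ≤-refl , ≤-refl , refl)
      path (suc k) i e = step (i , ≤-refl , i≤ , refl) (spE s i (≤-trans i< j≤N))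
        (walk-map (λ { _ (x , lo , hi , r) → x , <⇒≤ lo , hi , r }) (path k (suc i) (trans (sym (+-suc i k)) e)))
        where
        i< : suc i ≤ j
        i< = ≤-trans (s≤s (m≤m+n i k)) (≤-reflexive (trans (sym (+-suc i k)) e))
        i≤ = <⇒≤ i<

    seg-anti : ∀ (s : Spine) i j k l → suc j < k → l ≤ N s → Anti (Seg s i j) (Seg s k l)
    seg-anti s i j k l far l≤N _ _ (x , _ , x≤j , refl) (y , k≤y , y≤l , refl) =
      (λ e → <-irrefl (spJ s x y x≤N y≤N e) x<y) ,
      λ e → [ (λ r → <-irrefl (sym r) (≤-<-trans (s≤s x≤j) (≤-trans far k≤y))) , (λ r → <-irrefl r (m<n⇒m<1+n x<y)) ]′ (spI s x y x≤N y≤N e)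
      where
      x<y : x < y
      x<y = ≤-trans (s≤s x≤j) (≤-trans (<⇒≤ far) k≤y)
      y≤N = ≤-trans y≤l l≤N
      x≤N = ≤-trans (<⇒≤ x<y) y≤N

    abstract
      contact? : (s : Spine) (y : V) (a b : ℕ) → Dec (Σ[ i ∈ ℕ ] i < suc b × a ≤ i × y ~ sp s i)
      contact? s y a b = ℕₚ.anyUpTo? (λ i → a ≤? i ×-dec y ~? sp s i) (suc b)

      -- The value 0 is junk when y has no neighbour in the range.
      firstIn lastIn : Spine → V → ℕ → ℕ → ℕ
      firstIn s y a b with contact? s y a b
      ... | yes (i , _ , a≤i , e) = proj₁ (least (λ j → a ≤? j ×-dec y ~? sp s j) i (a≤i , e))
      ... | no _ = 0
      lastIn s y a b with contact? s y a b
      ... | yes (i , i<b , _ , e) = proj₁ (greatest (λ j → y ~? sp s j) i b (s≤s⁻¹ i<b) e)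
      ... | no _ = 0

      firstIn-spec : ∀ s y a b {i} → a ≤ i → i ≤ b → y ~ sp s i →
        a ≤ firstIn s y a b × firstIn s y a b ≤ i × y ~ sp s (firstIn s y a b) ×
        (∀ j → a ≤ j → j < firstIn s y a b → ¬ (y ~ sp s j))
      firstIn-spec s y a b {i} a≤i i≤b e with contact? s y a b
      ... | no none = contradiction (i , s≤s i≤b , a≤i , e) none
      ... | yes (i′ , _ , a≤i′ , e′) with least (λ j → a ≤? j ×-dec y ~? sp s j) i′ (a≤i′ , e′)
      ...   | f , _ , (a≤f , ef) , min = a≤f , ℕₚ.≮⇒≥ (λ lt → min i lt (a≤i , e)) , ef , λ j a≤j lt x → min j lt (a≤j , x)

      lastIn-spec : ∀ s y a b {i} → a ≤ i → i ≤ b → y ~ sp s i →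
        i ≤ lastIn s y a b × lastIn s y a b ≤ b × y ~ sp s (lastIn s y a b) ×
        (∀ j → lastIn s y a b < j → j ≤ b → ¬ (y ~ sp s j))
      lastIn-spec s y a b {i} a≤i i≤b e with contact? s y a b
      ... | no none = contradiction (i , s≤s i≤b , a≤i , e) none
      ... | yes (i′ , i′<b , _ , e′) with greatest (λ j → y ~? sp s j) i′ b (s≤s⁻¹ i′<b) e′
      ...   | g , _ , g≤b , eg , max = ℕₚ.≮⇒≥ (λ lt → max i lt i≤b e) , g≤b , eg , max

  record SingleSide (D : Fin n → Set) (ys : List (Fin n)) : Set₁ where
    field
      S    : VSet
      S?   : Decidable S
      S⊆D  : ∀ v → S v → D v
      conn : ∀ u v → S u → S v → Walk S u v
      nb   : ∀ y → y ∈ ys → Σ[ d ∈ V ] S d × y ~ d × (∀ d′ → S d′ → y ~ d′ → d′ ≡ d)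

  -- The hull of a label is the interval from its first to its last neighbour on `P`. Through
  -- `hulls`, the order of the list is the order along `P`.
  record HullSide (D : Fin n → Set) (ys : List (Fin n)) : Set₁ where
    field
      P   : Spine
      P⊆D : ∀ i → i ≤ N P → D (sp P i)
      f g : V → ℕ
      f<g : ∀ y → y ∈ ys → f y < g y
      g≤N : ∀ y → y ∈ ys → g y ≤ N P
      y~f : ∀ y → y ∈ ys → y ~ sp P (f y)
      y~g : ∀ y → y ∈ ys → y ~ sp P (g y)
      f≤  : ∀ y → y ∈ ys → ∀ i → i ≤ N P → y ~ sp P i → f y ≤ i
      ≤g  : ∀ y → y ∈ ys → ∀ i → i ≤ N P → y ~ sp P i → i ≤ g y
      hulls : AllPairs (λ y y′ → g y < f y′) ys

  SideResult : (D : Fin n → Set) (ys : List (Fin n)) → ℕ → Set₁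
  SideResult D ys m = Σ[ zs ∈ List (Fin n) ] zs ⊑ ys × AllPairs _≢_ zs × m ≤ length zs × (SingleSide D zs ⊎ HullSide D zs)

  module PathSide (no-theta : ¬ Theta G) {ys : List (Fin n)} (TS : TwoSides ys)
    (P : Spine) (P⊆D : ∀ i → i ≤ Spine.N P → TwoSides.D TS (Spine.sp P i)) where
    open OnSpine
    open TwoSides TS

    private
      p : ℕ → V
      p = sp P
      n₀ : ℕ
      n₀ = N P

      E-link : ∀ {y y′} → y ∈ ys → y′ ∈ ys → Walk (λ v → v ≡ y ⊎ v ≡ y′ ⊎ E v) y y′
      E-link {y} {y′} y∈ y′∈ with att-E y y∈ | att-E y′ y′∈
      ... | e , ee , ye | e′ , ee′ , ye′ = step (inj₁ refl) ye
          (walk-snoc (walk-map (λ _ r → inj₂ (inj₂ r)) (E-conn e e′ ee ee′)) (~-sym ye′) (inj₂ (inj₁ refl)))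

      seg-E : ∀ i j → j ≤ n₀ → Anti (Seg P i j) E
      seg-E i j j≤ _ w (x , _ , x≤ , refl) ew = D-E _ w (P⊆D x (≤-trans x≤ j≤)) ew

      y≢p : ∀ {y} → y ∈ ys → ∀ i → i ≤ n₀ → y ≢ p i
      y≢p y∈ i le refl = off-D _ y∈ (P⊆D i le)

    Linked : V → V → ℕ → ℕ → Set
    Linked y y′ i j = i ≤ j × ((y ~ p i × y′ ~ p j) ⊎ (y′ ~ p i × y ~ p j))

    -- Two segments of the path that are not adjacent and `E` are three anticomplete connections
    -- between the labels, hence a theta.
    two-links : ∀ {y y′ i j k l} → y ∈ ys → y′ ∈ ys → y ≢ y′ → Linked y y′ i j → Linked y y′ k l → suc j < k → l ≤ n₀ → ⊥
    two-links {y} {y′} {i} {j} {k} {l} y∈ y′∈ ne L₁ L₂ far l≤ = no-theta (theta ne (stable _ _ y∈ y′∈)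
        (three (Seg P i j) (Seg P k l) E)
        (λ { _ _ p01 → seg-anti P i j k l far l≤ ; _ _ p02 → seg-E i j j≤ ; _ _ p12 → seg-E k l l≤ })
        (λ { F.zero → link L₁ j≤ ; (F.suc F.zero) → link L₂ l≤ ; (F.suc (F.suc F.zero)) → E-link y∈ y′∈ }))
      where
      j≤ : j ≤ n₀
      j≤ = ≤-trans (≤-trans (n≤1+n j) (<⇒≤ far)) (≤-trans (proj₁ L₂) l≤)
      link : ∀ {i j} → Linked y y′ i j → j ≤ n₀ → Walk (λ v → v ≡ y ⊎ v ≡ y′ ⊎ Seg P i j v) y y′
      link (i≤j , inj₁ (yi , y′j)) j≤ = step (inj₁ refl) yi
        (walk-snoc (walk-map (λ _ r → inj₂ (inj₂ r)) (seg-walk P _ _ i≤j j≤)) (~-sym y′j) (inj₂ (inj₁ refl)))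
      link (i≤j , inj₂ (y′i , yj)) j≤ = step (inj₁ refl) yj
        (walk-snoc (walk-map (λ _ r → inj₂ (inj₂ r)) (walk-reverse (seg-walk P _ _ i≤j j≤))) (~-sym y′i) (inj₂ (inj₁ refl)))

    -- A theta between `y` and the path vertex at `c`: along the path from `u`, along the path from
    -- `v`, and through `E` and `y′`, which meets the stretch from `u` to `v` only at `c`.
    single-inside : ∀ {y y′ u v} c → y ∈ ys → y′ ∈ ys → u < c → c < v → v ≤ n₀ → y ~ p u → y ~ p v → ¬ (y ~ p c) →
      y′ ~ p c → (∀ i → u ≤ i → i ≤ v → y′ ~ p i → i ≡ c) → ⊥
    single-inside {y} {y′} {u} {v} (suc c) y∈ y′∈ (s≤s u≤c) c<v v≤ yu yv y≁c y′c only = no-theta (theta (y≢p y∈ _ c≤) y≁c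
        (three (Seg P u c) (Seg P (suc (suc c)) v) (λ x → x ≡ y′ ⊎ E x))
        (λ { _ _ p01 → seg-anti P u c (suc (suc c)) v ≤-refl v≤
           ; _ _ p02 → side u c (λ _ a → a) (λ _ b → ≤-trans b (≤-trans (n≤1+n c) (<⇒≤ c<v))) (≤-trans (n≤1+n c) c≤) (λ i _ i≤ e → <-irrefl e (s≤s i≤))
           ; _ _ p12 → side (suc (suc c)) v (λ _ a → ≤-trans u≤c (≤-trans (n≤1+n c) (≤-trans (n≤1+n _) a))) (λ _ b → b) v≤ (λ i ≤i _ e → <-irrefl (sym e) ≤i) })
        (λ { F.zero → step (inj₁ refl) yu (walk-snoc (walk-map (λ _ r → inj₂ (inj₂ r)) (seg-walk P u c u≤c (≤-trans (n≤1+n c) c≤))) (spE P c c≤) (inj₂ (inj₁ refl)))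
           ; (F.suc F.zero) → step (inj₁ refl) yv (walk-snoc (walk-map (λ _ r → inj₂ (inj₂ r)) (walk-reverse (seg-walk P _ v c<v v≤))) (~-sym (spE P (suc c) (≤-trans c<v v≤))) (inj₂ (inj₁ refl)))
           ; (F.suc (F.suc F.zero)) → walk-snoc (walk-map (λ { _ (inj₁ e) → inj₁ e ; _ (inj₂ (inj₁ e)) → inj₂ (inj₂ (inj₁ e)) ; _ (inj₂ (inj₂ e)) → inj₂ (inj₂ (inj₂ e)) }) (E-link y∈ y′∈)) y′c (inj₂ (inj₁ refl)) }))
      where
      c≤ : suc c ≤ n₀
      c≤ = ≤-trans (<⇒≤ c<v) v≤
      side : ∀ i j → (∀ x → i ≤ x → u ≤ x) → (∀ x → x ≤ j → x ≤ v) → j ≤ n₀ → (∀ x → i ≤ x → x ≤ j → x ≢ suc c) → Anti (Seg P i j) (λ x → x ≡ y′ ⊎ E x)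
      side i j lo hi j≤ ne _ w (x , i≤x , x≤j , refl) (inj₁ refl) = (λ e → y≢p y′∈ x (≤-trans x≤j j≤) (sym e)) , λ e → ne x i≤x x≤j (only x (lo x i≤x) (hi x x≤j) (~-sym e))
      side i j lo hi j≤ ne u′ w s (inj₂ ew) = seg-E i j j≤ u′ w s ew

    record Gap (q : ℕ) (y : V) (u v : ℕ) : Set where
      field
        u<q : u < q
        q<v : q < v
        v≤n : v ≤ n₀
        yu  : y ~ p u
        yv  : y ~ p v
        gap : ∀ i → u < i → i < v → ¬ (y ~ p i)
    open Gap

    -- If the gap of `y′` lies inside that of `y`, there is a link on either side of `q`. If they
    -- cross, let `a` be the first neighbour of `y′` from `u` on and `c` the last neighbour of `y`
    -- up to `v′`: either one of these is the end of its gap and `single-inside` applies, or there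
    -- are links from `u` to `a` and from `c` to `v′`.
    overlapping-gaps : ∀ {q y y′ u v u′ v′} → y ∈ ys → y′ ∈ ys → y ≢ y′ → Gap q y u v → Gap q y′ u′ v′ → u < u′ → v ≢ v′ → ⊥
    overlapping-gaps {q} {y} {y′} {u} {v} {u′} {v′} y∈ y′∈ ne γ γ′ u<u′ v≢v′
      with firstIn-spec P y′ u u′ (<⇒≤ u<u′) ≤-refl (yu γ′) | <-cmp v v′
    ... | u≤a , a≤u′ , y′a , before-a | tri≈ _ e _ = v≢v′ e
    ... | u≤a , a≤u′ , y′a , before-a | tri> _ _ v′<v = two-links y∈ y′∈ ne (u≤a , inj₁ (yu γ , y′a)) (<⇒≤ v′<v , inj₂ (yv γ′ , yv γ))
          (≤-<-trans (≤-trans (s≤s a≤u′) (u<q γ′)) (q<v γ′)) (v≤n γ)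
    ... | u≤a , a≤u′ , y′a , before-a | tri< v<v′ _ _
        with lastIn-spec P y v v′ ≤-refl (<⇒≤ v<v′) (yv γ) | m≤n⇒m<n∨m≡n a≤u′
    ...   | v≤c , c≤v′ , yc , after-c | inj₂ a≡u′ = single-inside u′ y∈ y′∈ u<u′ (<-trans (u<q γ′) (q<v γ)) (v≤n γ) (yu γ) (yv γ)
              (gap γ u′ u<u′ (<-trans (u<q γ′) (q<v γ))) (yu γ′) only
            where
            only : ∀ i → u ≤ i → i ≤ v → y′ ~ p i → i ≡ u′
            only i u≤i i≤v e with <-cmp i u′
            ... | tri< lt _ _ = contradiction e (before-a i u≤i (subst (i <_) (sym a≡u′) lt))
            ... | tri≈ _ r _ = r
            ... | tri> _ _ gt = contradiction e (gap γ′ i gt (≤-<-trans i≤v v<v′))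
    ...   | v≤c , c≤v′ , yc , after-c | inj₁ a<u′ with m≤n⇒m<n∨m≡n v≤c
    ...     | inj₂ v≡c = single-inside v y′∈ y∈ (<-trans (u<q γ′) (q<v γ)) v<v′ (v≤n γ′) (yu γ′) (yv γ′)
              (gap γ′ v (<-trans (u<q γ′) (q<v γ)) v<v′) (yv γ) only
            where
            only : ∀ i → u′ ≤ i → i ≤ v′ → y ~ p i → i ≡ v
            only i u′≤i i≤v′ e with <-cmp i v
            ... | tri< lt _ _ = contradiction e (gap γ i (<-≤-trans u<u′ u′≤i) lt)
            ... | tri≈ _ r _ = r
            ... | tri> _ _ gt = contradiction e (after-c i (subst (_< i) v≡c gt) i≤v′)
    ...     | inj₁ v<c = two-links y∈ y′∈ ne (u≤a , inj₁ (yu γ , y′a)) (c≤v′ , inj₁ (yc , yv γ′))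
                (<-trans (≤-<-trans a<u′ (u<q γ′)) (<-trans (q<v γ) v<c)) (v≤n γ′)

    Result : List V → ℕ → Set₁
    Result = SideResult D

    private
      F G′ : V → ℕ
      F y = firstIn P y 0 n₀
      G′ y = lastIn P y 0 n₀

    at-vertex : ∀ {m} zs → zs ⊑ ys → AllPairs _≢_ zs → m ≤ length zs → ∀ i → i ≤ n₀ → (∀ z → z ∈ zs → z ~ p i) → Result ys m
    at-vertex zs sub u le i i≤ all = zs , sub , u , le , inj₁ (record
      { S = _≡ p i ; S? = _≟ p i ; S⊆D = λ { v refl → P⊆D i i≤ } ; conn = λ { u v refl refl → here refl }
      ; nb = λ y y∈ → p i , refl , all y y∈ , λ { d refl _ → refl } })

    Touches : V → Set
    Touches y = Σ[ i ∈ ℕ ] i ≤ n₀ × y ~ p i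

    -- Labels whose hull contains `q` either see `q` or have a gap around it. By `overlapping-gaps`,
    -- every gap shares an end with the gap of a fixed label, so in each case many labels have a
    -- common neighbour on the path.
    at-point : ∀ m zs → zs ⊑ ys → AllPairs _≢_ zs → ∀ q → q ≤ n₀ →
      (∀ z → z ∈ zs → Touches z × F z ≤ q × q ≤ G′ z) → pointBound m ≤ length zs → Result ys m
    at-point m zs sub u q q≤ hit le with split-large (_~? p q) zs m (m + (m + 1)) le
    ... | inj₁ big = at-vertex _ (λ z z∈ → sub z (filter-∈ (_~? p q) zs z∈)) (AllPairsₚ.filter⁺ (_~? p q) u) big q q≤ λ z → filter-holds (_~? p q) zs
    ... | inj₂ big = rest (filter (λ z → ¬? (z ~? p q)) zs) (λ z → filter-∈ (λ z → ¬? (z ~? p q)) zs) (AllPairsₚ.filter⁺ (λ z → ¬? (z ~? p q)) u)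
            (λ z → filter-holds (λ z → ¬? (z ~? p q)) zs) big
      where
      lo hi : V → ℕ
      lo y = lastIn P y 0 q
      hi y = firstIn P y q n₀
      lo? : ∀ x z → Dec (lo z ≡ lo x)
      hi? : ∀ x z → Dec (hi z ≡ hi x)
      lo? x z = lo z ℕₚ.≟ lo x
      hi? x z = hi z ℕₚ.≟ hi x
      lo≢? : ∀ x z → Dec (lo z ≢ lo x)
      lo≢? x z = ¬? (lo? x z)
      hi≢? : ∀ x z → Dec (hi z ≢ hi x)
      hi≢? x z = ¬? (hi? x z)
      rest : ∀ xs → xs ⊑ zs → AllPairs _≢_ xs → (∀ z → z ∈ xs → ¬ (z ~ p q)) → m + (m + 1) ≤ length xs → Result ys m
      rest [] _ _ _ le′ = contradiction (≤-trans (≤-trans (m≤n+m 1 m) (m≤n+m (m + 1) m)) le′) λ ()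
      rest (x ∷ xs) sub′ u′ no-q le′ = go
        where
        gapOf : ∀ z → z ∈ x ∷ xs → Gap q z (lo z) (hi z)
        gapOf z z∈ with hit z (sub′ z z∈)
        ... | (i , i≤ , zi) , Fz≤q , q≤Gz
            with firstIn-spec P z 0 n₀ z≤n i≤ zi | lastIn-spec P z 0 n₀ z≤n i≤ zi
        ...   | _ , _ , zF , _ | _ , G≤ , zG , _ with lastIn-spec P z 0 q z≤n Fz≤q zF | firstIn-spec P z q n₀ q≤Gz G≤ zG
        ...     | _ , l≤q , zl , maxl | q≤h , h≤G , zh , minh = record
                  { u<q = ≤∧≢⇒< l≤q (λ r → no-q z z∈ (subst (λ k → z ~ p k) r zl))
                  ; q<v = ≤∧≢⇒< q≤h (λ r → no-q z z∈ (subst (λ k → z ~ p k) (sym r) zh))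
                  ; v≤n = ≤-trans h≤G G≤ ; yu = zl ; yv = zh
                  ; gap = λ j l<j j<h → case j ≤? q of λ { (yes j≤q) → maxl j l<j j≤q ; (no j≰q) → minh j (<⇒≤ (≰⇒> j≰q)) j<h } }
        many : ∀ ws → ws ⊑ x ∷ xs → AllPairs _≢_ ws → ∀ i → i ≤ n₀ → (∀ z → z ∈ ws → z ~ p i) → m ≤ length ws → Result ys m
        many ws sub″ u″ i i≤ all le″ = at-vertex ws (λ z z∈ → sub z (sub′ z (sub″ z z∈))) u″ le″ i i≤ all
        γ₀ = gapOf x (here refl)
        lo≤ : lo x ≤ n₀
        lo≤ = ≤-trans (<⇒≤ (u<q γ₀)) q≤
        go : Result ys m
        rest₁ = filter (lo≢? x) (x ∷ xs)
        in₁ : ∀ z → z ∈ rest₁ → z ∈ x ∷ xs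
        in₁ z = filter-∈ (lo≢? x) (x ∷ xs)
        rest₂ = filter (hi≢? x) rest₁
        differ : ∀ w → w ∈ rest₂ → ⊥
        differ w w∈₂ = clash (<-cmp (lo x) (lo w))
          where
          w∈₁ = filter-∈ (hi≢? x) rest₁ w∈₂
          w∈ = in₁ w w∈₁
          lo≢ : lo w ≢ lo x
          lo≢ = filter-holds (lo≢? x) (x ∷ xs) w∈₁
          hi≢ : hi w ≢ hi x
          hi≢ = filter-holds (hi≢? x) rest₁ w∈₂
          x∈ys = sub x (sub′ x (here refl))
          w∈ys = sub w (sub′ w w∈)
          clash : _ → ⊥
          clash (tri< lt _ _) = overlapping-gaps x∈ys w∈ys (λ { refl → lo≢ refl }) γ₀ (gapOf w w∈) lt (hi≢ ∘ sym)
          clash (tri≈ _ e _) = lo≢ (sym e)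
          clash (tri> _ _ gt) = overlapping-gaps w∈ys x∈ys (λ { refl → lo≢ refl }) (gapOf w w∈) γ₀ gt hi≢
        none-left : ∀ ws → (∀ w → w ∈ ws → ⊥) → 1 ≤ length ws → Result ys m
        none-left (w ∷ _) no-w _ = ⊥-elim (no-w w (here refl))
        go with split-large (lo? x) (x ∷ xs) m (m + 1) le′
        ... | inj₁ b = many _ (λ z → filter-∈ (lo? x) (x ∷ xs)) (AllPairsₚ.filter⁺ (lo? x) u′) (lo x) lo≤
                (λ z z∈ → subst (λ k → z ~ p k) (filter-holds (lo? x) (x ∷ xs) z∈) (yu (gapOf z (filter-∈ (lo? x) (x ∷ xs) z∈)))) b
        ... | inj₂ b with split-large (hi? x) rest₁ m 1 b
        ...   | inj₁ c = many _ (λ z z∈ → in₁ z (filter-∈ (hi? x) rest₁ z∈)) (AllPairsₚ.filter⁺ (hi? x) (AllPairsₚ.filter⁺ (lo≢? x) u′)) (hi x) (v≤n γ₀)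
                (λ z z∈ → subst (λ k → z ~ p k) (filter-holds (hi? x) rest₁ z∈) (yv (gapOf z (in₁ z (filter-∈ (hi? x) rest₁ z∈))))) c
        ...   | inj₂ c = none-left rest₂ differ c

    private
      near? : ∀ y z → Dec (F z ≤ G′ y)
      near? y z = F z ≤? G′ y
      beyond? : ∀ y z → Dec (¬ (F z ≤ G′ y))
      beyond? y z = ¬? (near? y z)

    -- Greedy choice of disjoint intervals: the hull that ends first is taken. The hulls that start
    -- before its end all contain that end, so many of them are handled by `at-point`; otherwise
    -- they are discarded.
    disjoint-hulls : ∀ m k zs → zs ⊑ ys → AllPairs _≢_ zs → (∀ z → z ∈ zs → Touches z) → k * pointBound m ≤ length zs →
      Result ys m ⊎ (Σ[ ws ∈ List V ] ws ⊑ zs × AllPairs (λ y y′ → G′ y < F y′) ws × AllPairs _≢_ ws × length ws ≡ k)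
    disjoint-hulls m zero zs sub u t le = inj₂ ([] , (λ z ()) , [] , [] , refl)
    disjoint-hulls m (suc k) [] sub u t le = contradiction
      (≤-trans (≤-trans (≤-trans (m≤n+m 1 m) (m≤n+m (m + 1) m)) (m≤n+m (m + (m + 1)) m)) (≤-trans (m≤m+n (pointBound m) _) le)) λ ()
    disjoint-hulls m (suc k) (x ∷ xs) sub u t le with argmin G′ x xs
    ... | y , y∈ , min with split-large (near? y) (x ∷ xs) (pointBound m) (k * pointBound m) le
    ...   | inj₁ big = inj₁ (at-point m _ (λ z z∈ → sub z (filter-∈ (near? y) (x ∷ xs) z∈)) (AllPairsₚ.filter⁺ (near? y) u) (G′ y) G≤
              (λ z z∈ → t z (filter-∈ (near? y) (x ∷ xs) z∈) , filter-holds (near? y) (x ∷ xs) z∈ , min z (filter-∈ (near? y) (x ∷ xs) z∈)) big)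
      where
      G≤ : G′ y ≤ n₀
      G≤ = proj₁ (proj₂ (lastIn-spec P y 0 n₀ z≤n (proj₁ (proj₂ (t y y∈))) (proj₂ (proj₂ (t y y∈)))))
    ...   | inj₂ big with disjoint-hulls m k (filter (beyond? y) (x ∷ xs)) (λ z z∈ → sub z (filter-∈ (beyond? y) (x ∷ xs) z∈))
                            (AllPairsₚ.filter⁺ (beyond? y) u) (λ z z∈ → t z (filter-∈ (beyond? y) (x ∷ xs) z∈)) big
    ...     | inj₁ r = inj₁ r
    ...     | inj₂ (ws , subw , hulls , uw , len) = inj₂ (y ∷ ws ,
                (λ { z (here refl) → y∈ ; z (there z∈) → filter-∈ (beyond? y) (x ∷ xs) (subw z z∈) }) ,
                All.tabulate (λ {z} z∈ → ≰⇒> (far z z∈)) ∷ hulls ,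
                All.tabulate (λ {z} z∈ e → far z z∈ (subst (λ v → F v ≤ G′ y) e F≤G)) ∷ uw , cong suc len)
      where
      far : ∀ z → z ∈ ws → ¬ (F z ≤ G′ y)
      far z z∈ = filter-holds (beyond? y) (x ∷ xs) (subw z z∈)
      F≤G : F y ≤ G′ y
      F≤G with t y y∈
      ... | i , i≤ , yi = ≤-trans (proj₁ (proj₂ (firstIn-spec P y 0 n₀ z≤n i≤ yi))) (proj₁ (lastIn-spec P y 0 n₀ z≤n i≤ yi))

    private
      one? : ∀ z → Dec (F z ≡ G′ z)
      one? z = F z ℕₚ.≟ G′ z
      more? : ∀ z → Dec (F z ≢ G′ z)
      more? z = ¬? (one? z)

    path-side : ∀ m zs → zs ⊑ ys → AllPairs _≢_ zs → (∀ z → z ∈ zs → Touches z) → m + hullBound m ≤ length zs → Result ys m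
    path-side m zs sub u t le with split-large one? zs m (hullBound m) le
    ... | inj₁ big = _ , (λ z z∈ → sub z (filter-∈ one? zs z∈)) , AllPairsₚ.filter⁺ one? u , big , inj₁ (record
        { S = Seg P 0 n₀ ; S? = λ v → map′ (λ { (i , lt , e) → i , z≤n , s≤s⁻¹ lt , e }) (λ { (i , _ , le , e) → i , s≤s le , e }) (ℕₚ.anyUpTo? (λ i → p i ≟ v) (suc n₀))
        ; S⊆D = λ { v (i , _ , le , refl) → P⊆D i le }
        ; conn = λ { u v (i , _ , i≤ , refl) (j , _ , j≤ , refl) → walk-trans
            (walk-map (λ { _ (k , a , b , e) → k , z≤n , ≤-trans b i≤ , e }) (walk-reverse (seg-walk P 0 i z≤n i≤)))
            (walk-map (λ { _ (k , a , b , e) → k , z≤n , ≤-trans b j≤ , e }) (seg-walk P 0 j z≤n j≤)) }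
        ; nb = nb })
      where
      nb : ∀ z → z ∈ filter one? zs → Σ[ d ∈ V ] Seg P 0 n₀ d × z ~ d × (∀ d′ → Seg P 0 n₀ d′ → z ~ d′ → d′ ≡ d)
      nb z z∈ with t z (filter-∈ one? zs z∈)
      ... | i , i≤ , zi with firstIn-spec P z 0 n₀ z≤n i≤ zi
      ...   | _ , F≤i , zF , minF = p (F z) , (F z , z≤n , ≤-trans F≤i i≤ , refl) , zF , λ { d (j , _ , j≤ , refl) zj →
                cong p (≤-antisym (≤-trans (proj₁ (lastIn-spec P z 0 n₀ z≤n j≤ zj)) (≤-reflexive (sym (filter-holds one? zs z∈))))
                  (proj₁ (proj₂ (firstIn-spec P z 0 n₀ z≤n j≤ zj)))) }
    ... | inj₂ big with disjoint-hulls m m (filter more? zs) (λ z z∈ → sub z (filter-∈ more? zs z∈)) (AllPairsₚ.filter⁺ more? u) (λ z z∈ → t z (filter-∈ more? zs z∈)) big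
    ...   | inj₁ r = r
    ...   | inj₂ (ws , subw , hulls , uw , len) = ws , (λ z z∈ → sub z (filter-∈ more? zs (subw z z∈))) , uw , ≤-reflexive (sym len) , inj₂ (record
        { P = P ; P⊆D = P⊆D ; f = F ; g = G′
        ; f<g = λ y y∈ → ≤∧≢⇒< (≤-trans (proj₁ (proj₂ (F-spec y y∈))) (proj₁ (G-spec y y∈))) (filter-holds more? zs (subw y y∈))
        ; g≤N = λ y y∈ → proj₁ (proj₂ (G-spec y y∈))
        ; y~f = λ y y∈ → proj₁ (proj₂ (proj₂ (F-spec y y∈))) ; y~g = λ y y∈ → proj₁ (proj₂ (proj₂ (G-spec y y∈)))
        ; f≤ = λ y y∈ i i≤ yi → proj₁ (proj₂ (firstIn-spec P y 0 n₀ z≤n i≤ yi))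
        ; ≤g = λ y y∈ i i≤ yi → proj₁ (lastIn-spec P y 0 n₀ z≤n i≤ yi)
        ; hulls = hulls })
      where
      tw : ∀ y → y ∈ ws → Touches y
      tw y y∈ = t y (filter-∈ more? zs (subw y y∈))
      F-spec = λ y y∈ → firstIn-spec P y 0 n₀ z≤n (proj₁ (proj₂ (tw y y∈))) (proj₂ (proj₂ (tw y y∈)))
      G-spec = λ y y∈ → lastIn-spec P y 0 n₀ z≤n (proj₁ (proj₂ (tw y y∈))) (proj₂ (proj₂ (tw y y∈)))

  -- One side: unique neighbours or disjoint hulls.

  module SideLemma (no-theta : ¬ Theta G) {ys : List (Fin n)} (TS : TwoSides ys) where
    open TwoSides TS
    open Critical

    module _ {s₀ : V} (C : CriticalSet D ys s₀) where
      open Dominators C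

      Leaf : V → Set
      Leaf v = X v × (∀ z → W v z → z ≡ v)

      Leaf? : Decidable Leaf
      Leaf? v = X? v ×-dec Fₚ.all? λ z → implies (W? v z) (z ≟ v)
        where
        implies : ∀ {A B : Set} → Dec A → Dec B → Dec (A → B)
        implies _ (yes b) = yes λ _ → b
        implies (no ¬a) (no _) = yes λ a → contradiction a ¬a
        implies (yes a) (no ¬b) = no λ h → ¬b (h a)

      leaf-below : ∀ k v → size (W? v) ≤ k → X v → Σ[ l ∈ V ] Leaf l × W v l
      leaf-below k v le xv with Fₚ.any? (λ z → W? v z ×-dec ¬? (z ≟ v))
      ... | no none = v , (xv , λ z w → decidable-stable (z ≟ v) λ ne → none (z , w , ne)) , dom-refl v xv
      leaf-below zero v le xv | yes _ = contradiction (subst (_≤ 0) (size-∖ (W? v) v (dom-refl v xv)) le) λ ()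
      leaf-below (suc k) v le xv | yes (z , w , ne) with leaf-below k z (s≤s⁻¹ (≤-trans
          (size-< (W? z) (W? v) v (λ x → dom-trans w) (λ w′ → ne (dom-antisym w′ w)) (dom-refl v xv)) le)) (proj₁ (proj₂ w))
      ... | l , lf , w′ = l , lf , dom-trans w w′

      Hangs : V → V → Set
      Hangs y l = Leaf l × Σ[ x ∈ V ] y ~ x × W x l

      Hangs? : ∀ y l → Dec (Hangs y l)
      Hangs? y l = Leaf? l ×-dec Fₚ.any? λ x → y ~? x ×-dec W? x l

      -- A choice of one leaf per label. The value `y` is a placeholder, and `leaf-spec` shows that
      -- labels never receive it for want of a leaf.
      leaf : V → V
      leaf y with Fₚ.any? (Hangs? y)
      ... | yes (l , _) = l
      ... | no _ = y

      leaf-spec : ∀ y → y ∈ ys → Hangs y (leaf y)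
      leaf-spec y y∈ with Fₚ.any? (Hangs? y)
      ... | yes (_ , h) = h
      ... | no none with reach y y∈
      ...   | x , yx , p with leaf-below _ x ≤-refl (walk-end p)
      ...     | l , lf , w = contradiction (l , lf , x , yx , w) none

      X-conn : ∀ u v → X u → X v → Walk X u v
      X-conn u v xu xv = walk-trans (walk-reverse (reachable u xu)) (reachable v xv)

      Private : V → V → Set
      Private l z = z ∈ ys × z ~ l × (∀ w → X w → z ~ w → w ≡ l)

      private-leaf : ∀ l → Leaf l → l ≢ s₀ → Σ[ z ∈ V ] Private l z
      private-leaf l (xl , only) ne with private-terminal l xl ne
      ... | z , z∈ , dom , w , zw , dw = z , z∈ , subst (z ~_) (only w dw) zw , λ w′ xw′ e → only w′ (dom w′ xw′ e)

      privates : ∀ L → AllPairs (λ a b → leaf a ≢ leaf b) L → (∀ y → y ∈ L → Leaf (leaf y) × leaf y ≢ s₀) →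
        Σ[ zs ∈ List V ] length zs ≡ length L × (∀ z → z ∈ zs → Σ[ y ∈ V ] y ∈ L × Private (leaf y) z) × AllPairs _≢_ zs
      privates [] _ _ = [] , refl , (λ z ()) , []
      privates (x ∷ L) (d ∷ ds) ok with privates L ds (λ y y∈ → ok y (there y∈)) | private-leaf (leaf x) (proj₁ (ok x (here refl))) (proj₂ (ok x (here refl)))
      ... | zs , len , pr , uz | z , pz = z ∷ zs , cong suc len ,
          (λ { w (here refl) → x , here refl , pz ; w (there w∈) → proj₁ (pr w w∈) , there (proj₁ (proj₂ (pr w w∈))) , proj₂ (proj₂ (pr w w∈)) }) ,
          All.tabulate (λ {w} w∈ e → All.lookup d (proj₁ (proj₂ (pr w w∈)))
            (sym (proj₂ (proj₂ pz) _ (proj₁ (proj₁ (ok _ (there (proj₁ (proj₂ (pr w w∈))))))) (subst (_~ _) (sym e) (proj₁ (proj₂ (proj₂ (proj₂ (pr w w∈))))))))) ∷ uz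

      -- If many labels choose the same leaf `l`, each has a neighbour that dominates `l`; such
      -- vertices lie on every path from the root to `l`, so all these labels touch one induced
      -- path. If many leaves occur, each has a label whose only neighbour in `X` is that leaf, and
      -- `X` itself is the set with unique neighbours.
      from-critical : ∀ m → sideBound m ≤ length ys → SideResult D ys m
      from-critical m le with pigeonhole _≟_ leaf (suc m) (m + hullBound m) ys unique le
      ... | inj₁ (l , zs , sub , u , big) = on-path (walk→path (reachable l xl))
        where
        xl : X l
        xl = nonempty zs big sub
          where
          nonempty : ∀ zs → suc (m + hullBound m) ≤ length zs → (∀ z → z ∈ zs → z ∈ ys × leaf z ≡ l) → X l
          nonempty [] ()
          nonempty (z ∷ _) _ sub = subst X (proj₂ (sub z (here refl))) (proj₁ (proj₁ (leaf-spec z (proj₁ (sub z (here refl))))))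
        on-path : Σ[ pl ∈ List V ] IPath s₀ l pl × (∀ z → z ∈ pl → X z) → SideResult D ys m
        on-path (pl , pa , inX) = PathSide.path-side no-theta TS (toSpine pa)
            (λ i i≤ → X⊆D _ (inX _ (nth-∈ _ pl i (≤pred pa i≤)))) m zs (λ z z∈ → proj₁ (sub z z∈)) u touch (<⇒≤ big)
          where
          touch : ∀ z → z ∈ zs → Σ[ i ∈ ℕ ] i ≤ pred (length pl) × z ~ nth s₀ pl i
          touch z z∈ with leaf-spec z (proj₁ (sub z z∈))
          ... | _ , x , zx , w with x ∈? pl
          ...   | yes x∈ with ∈-nth s₀ pl x∈
          ...     | i , lt , e = i , <length pa lt , subst (z ~_) (sym e) zx
          touch z z∈ | _ , x , zx , w | no x∉ = contradiction
              (walk-map (λ v v∈ → inX v v∈ , λ { refl → x∉ v∈ }) (path→walk pa))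
              (subst (λ k → ¬ Walk (X ∖ x) s₀ k) (proj₂ (sub z z∈)) (proj₂ (proj₂ w)))
      ... | inj₂ (L , sub , d , len) with privates L (AllPairs.map proj₂ d) ok
        where
        -- A leaf at the root means that the root dominates nothing else, and then all leaves
        -- coincide.
        root-only : ∀ y → y ∈ L → leaf y ≡ s₀ → ∀ z → z ∈ L → leaf z ≡ s₀
        root-only y y∈ e z z∈ = trans (proj₂ (proj₁ (leaf-spec y (sub y y∈))) (leaf z)
            (subst (λ k → W k (leaf z)) (sym e) (dom-s₀ _ (proj₁ (proj₁ (leaf-spec z (sub z z∈))))))) e
        distinct : ∀ L → AllPairs (λ x y → x ≢ y × leaf x ≢ leaf y) L → length L ≡ suc (suc m) → ¬ (∀ z → z ∈ L → leaf z ≡ s₀)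
        distinct (x ∷ y ∷ L) (((_ , ne) ∷ _) ∷ _) _ all = ne (trans (all x (here refl)) (sym (all y (there (here refl)))))
        ok : ∀ y → y ∈ L → Leaf (leaf y) × leaf y ≢ s₀
        ok y y∈ = proj₁ (leaf-spec y (sub y y∈)) , λ e → distinct L d len (root-only y y∈ e)
      ...   | zs , len′ , pr , uz = zs , (λ z z∈ → proj₁ (proj₂ (proj₂ (pr z z∈)))) , uz ,
                ≤-trans (≤-trans (n≤1+n m) (n≤1+n _)) (≤-reflexive (sym (trans len′ len))) , inj₁ (record
                { S = X ; S? = X? ; S⊆D = X⊆D ; conn = X-conn
                ; nb = λ z z∈ → leaf (proj₁ (pr z z∈)) , proj₁ (proj₁ (leaf-spec _ (sub _ (proj₁ (proj₂ (pr z z∈)))))) ,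
                    proj₁ (proj₂ (proj₂ (proj₂ (pr z z∈)))) , λ d xd e → proj₂ (proj₂ (proj₂ (proj₂ (pr z z∈)))) d xd e })

    side : ∀ m → sideBound m ≤ length ys → SideResult D ys m
    side m le = nonempty ys le att-D
      where
      nonempty : ∀ zs → sideBound m ≤ length zs → (∀ y → y ∈ zs → Σ[ d ∈ V ] D d × y ~ d) → SideResult D ys m
      nonempty [] () _
      nonempty (z ∷ _) _ att with att z (here refl)
      ... | s , ds , _ = from-critical (critical D? ys s ds λ y y∈ →
            proj₁ (att-D y y∈) , proj₂ (proj₂ (att-D y y∈)) , D-conn s _ ds (proj₁ (proj₂ (att-D y y∈)))) m le

  -- Hubs, and two sides with hulls.

  module HubCriterion where

    nbrCount≥ : (H : Hole G) (y : V) (l : List V) → AllPairs _≢_ l → (∀ v → v ∈ l → NbrIn G H y v) → length l ≤ nbrCount G H y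
    nbrCount≥ H y l u nb with indices l u nb
      where
      indices : ∀ l → AllPairs _≢_ l → (∀ v → v ∈ l → NbrIn G H y v) →
        Σ[ is ∈ List (Fin (4 + Hole.k H)) ] length is ≡ length l × (∀ i → i ∈ is → Hole.vert H i ∈ l × y ~ Hole.vert H i) × AllPairs _≢_ is
      indices [] _ _ = [] , refl , (λ i ()) , []
      indices (v ∷ l) (v≢ ∷ u) nb with indices l u (λ w w∈ → nb w (there w∈)) | nb v (here refl)
      ... | is , len , spec , ui | yv , i , refl = i ∷ is , cong suc len ,
          (λ { j (here refl) → here refl , yv ; j (there j∈) → there (proj₁ (spec j j∈)) , proj₂ (spec j j∈) }) ,
          All.tabulate (λ { j∈ refl → All.lookup v≢ (proj₁ (spec _ j∈)) refl }) ∷ ui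
    ... | is , len , spec , ui = subst (_≤ nbrCount G H y) len
          (length≤countB (λ i → adj G y (Hole.vert H i)) is ui (All.tabulate λ i∈ → proj₂ (spec _ i∈)))

    -- In a twin wheel each of the three neighbours is adjacent to another one, which `q` is not. A
    -- short pyramid has exactly three neighbours with one edge among them; a stable triple or a
    -- fourth neighbour excludes it.
    hub : (H : Hole G) {y p p′ q : V} → NbrIn G H y p → NbrIn G H y p′ → NbrIn G H y q → p ≢ p′ → p ≢ q → p′ ≢ q →
      ¬ (p ~ q) → ¬ (p′ ~ q) → (¬ (p ~ p′)) ⊎ (Σ[ q′ ∈ V ] NbrIn G H y q′ × q′ ≢ p × q′ ≢ p′ × q′ ≢ q) → Hub G y
    hub H {y} {p} {p′} {q} np np′ nq p≢p′ p≢q p′≢q p≁q p′≁q extra = H , three-nbrs , ¬twin , ¬short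
      where
      tri : AllPairs _≢_ (p ∷ p′ ∷ q ∷ [])
      tri = (p≢p′ ∷ p≢q ∷ []) ∷ (p′≢q ∷ []) ∷ [] ∷ []
      three-nbrs : 3 ≤ nbrCount G H y
      three-nbrs = nbrCount≥ H y _ tri λ { v (here refl) → np ; v (there (here refl)) → np′ ; v (there (there (here refl))) → nq }
      ¬twin : ¬ TwinWheel G H y
      ¬twin (u , v , w , _ , _ , _ , iff , uv , vw , _) =
        go (Equivalence.to (iff p) np) (Equivalence.to (iff p′) np′) (Equivalence.to (iff q) nq)
        where
        go : p ≡ u ⊎ p ≡ v ⊎ p ≡ w → p′ ≡ u ⊎ p′ ≡ v ⊎ p′ ≡ w → q ≡ u ⊎ q ≡ v ⊎ q ≡ w → ⊥
        go (inj₁ refl) _ (inj₁ e) = p≢q (sym e)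
        go (inj₂ (inj₁ refl)) _ (inj₁ refl) = p≁q (~-sym uv)
        go (inj₂ (inj₂ refl)) (inj₁ e) (inj₁ refl) = p′≢q e
        go (inj₂ (inj₂ refl)) (inj₂ (inj₁ refl)) (inj₁ refl) = p′≁q (~-sym uv)
        go (inj₂ (inj₂ refl)) (inj₂ (inj₂ e)) (inj₁ refl) = p≢p′ (sym e)
        go (inj₁ refl) _ (inj₂ (inj₁ refl)) = p≁q uv
        go (inj₂ (inj₁ refl)) _ (inj₂ (inj₁ e)) = p≢q (sym e)
        go (inj₂ (inj₂ refl)) _ (inj₂ (inj₁ refl)) = p≁q (~-sym vw)
        go (inj₁ refl) (inj₁ e) (inj₂ (inj₂ refl)) = p≢p′ (sym e)
        go (inj₁ refl) (inj₂ (inj₁ refl)) (inj₂ (inj₂ refl)) = p′≁q vw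
        go (inj₁ refl) (inj₂ (inj₂ e)) (inj₂ (inj₂ refl)) = p′≢q e
        go (inj₂ (inj₁ refl)) _ (inj₂ (inj₂ refl)) = p≁q vw
        go (inj₂ (inj₂ refl)) _ (inj₂ (inj₂ e)) = p≢q (sym e)
      four : ∀ z → NbrIn G H y z → z ≢ p → z ≢ p′ → z ≢ q → nbrCount G H y ≢ 3
      four z nz a b c e = 1+n≰n (subst (4 ≤_) e (nbrCount≥ H y (z ∷ p ∷ p′ ∷ q ∷ []) ((a ∷ b ∷ c ∷ []) ∷ tri)
        λ { v (here refl) → nz ; v (there (here refl)) → np ; v (there (there (here refl))) → np′ ; v (there (there (there (here refl)))) → nq }))
      ¬short : ¬ ShortPyramid G H y
      ¬short (c3 , u , v , nu , nv , uv , _) = [ stable , (λ { (q′ , nq′ , a , b , c) → four q′ nq′ a b c c3 }) ]′ extra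
        where
        stable : ¬ (p ~ p′) → ⊥
        stable p≁p′ = go (which u nu) (which v nv)
          where
          which : ∀ z → NbrIn G H y z → z ≡ p ⊎ z ≡ p′ ⊎ z ≡ q
          which z nz with z ≟ p | z ≟ p′ | z ≟ q
          ... | yes e | _ | _ = inj₁ e
          ... | no _ | yes e | _ = inj₂ (inj₁ e)
          ... | no _ | no _ | yes e = inj₂ (inj₂ e)
          ... | no a | no b | no c = contradiction c3 (four z nz a b c)
          go : u ≡ p ⊎ u ≡ p′ ⊎ u ≡ q → v ≡ p ⊎ v ≡ p′ ⊎ v ≡ q → ⊥
          go (inj₁ refl) (inj₁ refl) = ~-irr uv refl
          go (inj₁ refl) (inj₂ (inj₁ refl)) = p≁p′ uv
          go (inj₁ refl) (inj₂ (inj₂ refl)) = p≁q uv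
          go (inj₂ (inj₁ refl)) (inj₁ refl) = p≁p′ (~-sym uv)
          go (inj₂ (inj₁ refl)) (inj₂ (inj₁ refl)) = ~-irr uv refl
          go (inj₂ (inj₁ refl)) (inj₂ (inj₂ refl)) = p′≁q uv
          go (inj₂ (inj₂ refl)) (inj₁ refl) = p≁q (~-sym uv)
          go (inj₂ (inj₂ refl)) (inj₂ (inj₁ refl)) = p′≁q (~-sym uv)
          go (inj₂ (inj₂ refl)) (inj₂ (inj₂ refl)) = ~-irr uv refl

    record Arc (D : VSet) (y y′ : V) : Set where
      field
        {a b} : V
        l     : List V
        path  : IPath a b l
        l⊆D   : ∀ v → v ∈ l → D v
        y~a   : y ~ a
        y′~b  : y′ ~ b
        only  : ∀ v → v ∈ l → y ~ v → v ≡ a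
        only′ : ∀ v → v ∈ l → y′ ~ v → v ≡ b

    arc-reverse : ∀ {D y y′} → Arc D y y′ → Arc D y′ y
    arc-reverse A = record
      { l = reverse l ; path = path-reverse path ; l⊆D = λ v v∈ → l⊆D v (∈-reverse⁻ l v∈)
      ; y~a = y′~b ; y′~b = y~a
      ; only = λ v v∈ → only′ v (∈-reverse⁻ l v∈) ; only′ = λ v v∈ → only v (∈-reverse⁻ l v∈) }
      where open Arc A

    -- The hole runs from `y` through `D` to `y′` and back through `E`. Both labels see only the
    -- ends of the arcs, so it is induced.
    arc-hole : ∀ {D E y y′} → Anti D E → ¬ D y → ¬ E y → ¬ D y′ → ¬ E y′ → y ≢ y′ → ¬ (y ~ y′) →
      (A : Arc D y y′) (B : Arc E y y′) → Σ[ H ∈ Hole G ] (∀ v → v ∈ Arc.l A ⊎ v ∈ Arc.l B → OnHole H v)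
    arc-hole {y = y} {y′} D-E yD yE y′D y′E y≢y′ y≁y′ A B = proj₁ closed , λ v v∈ → Equivalence.from (proj₂ closed v) (there (member v v∈))
      where
      module A = Arc A
      module B = Arc (arc-reverse B)
      tail : IPath y′ B.b (y′ ∷ B.l)
      tail = cons B.y~a (λ z z∈ → (λ { refl → y′E (B.l⊆D z z∈) }) , B.only z z∈) B.path
      cross : ∀ u w → u ∈ A.l → w ∈ y′ ∷ B.l → u ≢ w × (u ~ w → u ≡ A.b × w ≡ y′)
      cross u w u∈ (here refl) = (λ { refl → y′D (A.l⊆D u u∈) }) , λ e → A.only′ u u∈ (~-sym e) , refl
      cross u w u∈ (there w∈) with D-E u w (A.l⊆D u u∈) (B.l⊆D w w∈)
      ... | ne , na = ne , λ e → contradiction e na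
      whole : IPath A.a B.b (A.l ++ y′ ∷ B.l)
      whole = path-++ A.path tail (~-sym A.y′~b) cross
      out : ∀ z → z ∈ A.l ++ y′ ∷ B.l → y ≢ z × (y ~ z → z ≡ A.a ⊎ z ≡ B.b)
      out z z∈ with ∈ₚ.∈-++⁻ A.l z∈
      ... | inj₁ z∈A = (λ { refl → yD (A.l⊆D z z∈A) }) , λ e → inj₁ (A.only z z∈A e)
      ... | inj₂ (here refl) = y≢y′ , λ e → contradiction e y≁y′
      ... | inj₂ (there z∈B) = (λ { refl → yE (B.l⊆D z z∈B) }) , λ e → inj₂ (B.only′ z z∈B e)
      long : 3 ≤ length (A.l ++ y′ ∷ B.l)
      long = subst (3 ≤_) (sym (Listₚ.length-++ A.l)) (+-mono-≤ (nonempty A.path) (s≤s (nonempty B.path)))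
        where
        nonempty : ∀ {u v l} → IPath u v l → 1 ≤ length l
        nonempty [-] = s≤s z≤n
        nonempty (cons _ _ _) = s≤s z≤n
      closed = closeHole y whole long out A.y~a B.y′~b
      member : ∀ v → v ∈ A.l ⊎ v ∈ Arc.l B → v ∈ A.l ++ y′ ∷ B.l
      member v (inj₁ v∈) = ∈ₚ.∈-++⁺ˡ v∈
      member v (inj₂ v∈) = ∈ₚ.∈-++⁺ʳ A.l (there (Anyₚ.reverse⁺ v∈))

  module Hulls {D : Fin n → Set} {ys : List (Fin n)} (H : HullSide D ys) where
    open HubCriterion
    open HullSide H public

    f≤N : ∀ y → y ∈ ys → f y ≤ N P
    f≤N y y∈ = ≤-trans (<⇒≤ (f<g y y∈)) (g≤N y y∈)

    Before : V → V → Set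
    Before y y′ = g y < f y′

    before-total : ∀ {y y′} → y ∈ ys → y′ ∈ ys → y ≢ y′ → Before y y′ ⊎ Before y′ y
    before-total = AllPairs-total hulls

    module _ {y y′ : V} (y∈ : y ∈ ys) (y′∈ : y′ ∈ ys) (lt : Before y y′) where
      private
        m : ℕ
        m = f y′ ∸ g y
        e : g y + m ≡ f y′
        e = m+[n∸m]≡n (<⇒≤ lt)

      hull-arc : Arc D y y′
      hull-arc = record
        { l = segList P (g y) m
        ; path = subst (λ k → IPath (sp P (g y)) (sp P k) (segList P (g y) m)) e (seg-path P (g y) m (subst (_≤ N P) (sym e) (f≤N y′ y′∈)))
        ; l⊆D = λ v v∈ → in-D v (∈-segList⁻ P (g y) m v∈)
        ; y~a = y~g y y∈ ; y′~b = y~f y′ y′∈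
        ; only = λ v v∈ → first v (∈-segList⁻ P (g y) m v∈) ; only′ = λ v v∈ → last v (∈-segList⁻ P (g y) m v∈) }
        where
        bound : ∀ {i} → i ≤ g y + m → i ≤ N P
        bound le = ≤-trans (subst (_ ≤_) e le) (f≤N y′ y′∈)
        in-D : ∀ v → Σ[ i ∈ ℕ ] g y ≤ i × i ≤ g y + m × sp P i ≡ v → D v
        in-D v (i , _ , le , refl) = P⊆D i (bound le)
        first : ∀ v → Σ[ i ∈ ℕ ] g y ≤ i × i ≤ g y + m × sp P i ≡ v → y ~ v → v ≡ sp P (g y)
        first v (i , lo , hi , refl) a = cong (sp P) (≤-antisym (≤g y y∈ i (bound hi) a) lo)
        last : ∀ v → Σ[ i ∈ ℕ ] g y ≤ i × i ≤ g y + m × sp P i ≡ v → y′ ~ v → v ≡ sp P (f y′)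
        last v (i , lo , hi , refl) a = cong (sp P) (≤-antisym (subst (i ≤_) e hi) (f≤ y′ y′∈ i (bound hi) a))

      in-arc : ∀ i → g y ≤ i → i ≤ f y′ → sp P i ∈ Arc.l hull-arc
      in-arc i lo hi = ∈-segList⁺ P (g y) m i lo (subst (i ≤_) (sym e) hi)

    hull-in-arc : ∀ {x y z} (x∈ : x ∈ ys) (y∈ : y ∈ ys) (z∈ : z ∈ ys) (xy : Before x y) (yz : Before y z) (xz : Before x z) →
      sp P (f y) ∈ Arc.l (hull-arc x∈ z∈ xz) × sp P (g y) ∈ Arc.l (hull-arc x∈ z∈ xz)
    hull-in-arc {x} {y} x∈ y∈ z∈ xy yz xz =
      in-arc x∈ z∈ xz (f y) (<⇒≤ xy) (≤-trans (<⇒≤ (f<g y y∈)) (<⇒≤ yz)) ,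
      in-arc x∈ z∈ xz (g y) (≤-trans (<⇒≤ xy) (<⇒≤ (f<g y y∈))) (<⇒≤ yz)

    f≢g : ∀ y → y ∈ ys → sp P (f y) ≢ sp P (g y)
    f≢g y y∈ e = <⇒≢ (f<g y y∈) (spJ P (f y) (g y) (f≤N y y∈) (g≤N y y∈) e)

  module TwoHullSides {ys zs ws : List (Fin n)} (TS : TwoSides ys)
    (non-hub : ∀ y → y ∈ ys → ¬ Hub G y) (zs⊑ : zs ⊑ ys) (ws⊑ : ws ⊑ zs)
    (H₁ : HullSide (TwoSides.D TS) zs) (H₂ : HullSide (TwoSides.E TS) ws)
    (unique-ws : AllPairs _≢_ ws) (large : ramseyBound 3 3 ≤ length ws) where
    open HubCriterion
    open TwoSides TS
    private
      module H₁ = Hulls H₁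
      module H₂ = Hulls H₂

      middle-hub : ∀ {x y z} → x ∈ ws → y ∈ ws → z ∈ ws → x ≢ z → (A : Arc D x z) →
        sp H₁.P (H₁.f y) ∈ Arc.l A × sp H₁.P (H₁.g y) ∈ Arc.l A →
        H₂.Before x y → H₂.Before y z → H₂.Before x z → ⊥
      middle-hub {x} {y} {z} x∈ y∈ z∈ x≢z A (f∈ , g∈) xy yz xz = non-hub y (up y∈)
          (hub H (H₁.y~f y y₁ , on _ (inj₁ f∈)) (H₁.y~g y y₁ , on _ (inj₁ g∈)) (H₂.y~f y y∈ , on _ (inj₂ (proj₁ in₂)))
            (H₁.f≢g y y₁) (proj₁ f-f) (proj₁ g-f) (proj₂ f-f) (proj₂ g-f)
            (inj₂ (_ , (H₂.y~g y y∈ , on _ (inj₂ (proj₂ in₂))) , proj₁ (cross _ _ f∈ (proj₂ in₂)) ∘ sym , proj₁ (cross _ _ g∈ (proj₂ in₂)) ∘ sym , H₂.f≢g y y∈ ∘ sym)))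
        where
        up : ∀ {v} → v ∈ ws → v ∈ ys
        up v∈ = zs⊑ _ (ws⊑ _ v∈)
        y₁ = ws⊑ y y∈
        B = H₂.hull-arc x∈ z∈ xz
        hole = arc-hole D-E (off-D x (up x∈)) (off-E x (up x∈)) (off-D z (up z∈)) (off-E z (up z∈)) x≢z (stable x z (up x∈) (up z∈)) A B
        H = proj₁ hole
        on = proj₂ hole
        in₂ = H₂.hull-in-arc x∈ y∈ z∈ xy yz xz
        cross : ∀ u w → u ∈ Arc.l A → w ∈ Arc.l B → u ≢ w × ¬ (u ~ w)
        cross u w u∈ w∈ = D-E u w (Arc.l⊆D A u u∈) (Arc.l⊆D B w w∈)
        f-f = cross _ _ f∈ (proj₁ in₂)
        g-f = cross _ _ g∈ (proj₁ in₂)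

    contradictory : ⊥
    -- The list is ordered along the path in `E`; the colour of a pair says whether the order along
    -- the path in `D` agrees. In the other colour the three labels are reversed there, and the arc
    -- is read backwards.
    contradictory with ramsey {Q = λ x y → x ≢ y × H₂.Before x y} (λ x y → H₁.g x <? H₁.f y) 3 3 ws (AllPairs.zip (unique-ws , H₂.hulls)) large
    ... | x ∷ y ∷ z ∷ [] , sub , ((_ , xy) ∷ (x≢z , xz) ∷ []) ∷ ((_ , yz) ∷ []) ∷ _ , inj₁ (refl , (axy ∷ axz ∷ []) ∷ (ayz ∷ []) ∷ _) =
          middle-hub x∈ y∈ z∈ x≢z (H₁.hull-arc (ws⊑ x x∈) (ws⊑ z z∈) axz) (H₁.hull-in-arc (ws⊑ x x∈) (ws⊑ y y∈) (ws⊑ z z∈) axy ayz axz) xy yz xz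
      where
      x∈ = sub x (here refl)
      y∈ = sub y (there (here refl))
      z∈ = sub z (there (there (here refl)))
    ... | x ∷ y ∷ z ∷ [] , sub , ((x≢y , xy) ∷ (x≢z , xz) ∷ []) ∷ ((y≢z , yz) ∷ []) ∷ _ , inj₂ (refl , (nxy ∷ nxz ∷ []) ∷ (nyz ∷ []) ∷ _) =
          middle-hub x∈ y∈ z∈ x≢z (arc-reverse A) (Anyₚ.reverse⁺ (proj₁ inA) , Anyₚ.reverse⁺ (proj₂ inA)) xy yz xz
      where
      x∈ = sub x (here refl)
      y∈ = sub y (there (here refl))
      z∈ = sub z (there (there (here refl)))
      flip-before : ∀ {u v} → u ∈ ws → v ∈ ws → u ≢ v → ¬ H₁.Before u v → H₁.Before v u
      flip-before u∈ v∈ ne nb = [ (λ b → contradiction b nb) , id ]′ (H₁.before-total (ws⊑ _ u∈) (ws⊑ _ v∈) ne)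
      zx = flip-before x∈ z∈ x≢z nxz
      A = H₁.hull-arc (ws⊑ z z∈) (ws⊑ x x∈) zx
      inA = H₁.hull-in-arc (ws⊑ z z∈) (ws⊑ y y∈) (ws⊑ x x∈) (flip-before y∈ z∈ y≢z nyz) (flip-before x∈ y∈ x≢y nxy) zx

  -- Claws and nets with prescribed ends.

  module Tripods where
    open OnSpine

    pair₃-≢ : ∀ {i j} → Pair₃ i j → i ≢ j
    pair₃-≢ p01 ()
    pair₃-≢ p02 ()
    pair₃-≢ p12 ()

    -- A subdivided claw with centre c and ends τ i; a leg is empty when τ i = c.
    record Claw (D : VSet) (τ : Fin 3 → V) : Set₁ where
      field
        c    : V
        Λ    : Fin 3 → VSet
        c∈D  : D c
        Λ⊆D  : ∀ i v → Λ i v → D v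
        c∉Λ  : ∀ i → ¬ Λ i c
        anti : ∀ i j → Pair₃ i j → Anti (Λ i) (Λ j)
        walk : ∀ i → Walk (λ v → v ≡ c ⊎ Λ i v) c (τ i)

      leg-own : ∀ i k → Λ i (τ k) → k ≡ i
      leg-own i k l with k Fₚ.≟ i
      ... | yes e = e
      ... | no ne with walk-end (walk k) | pair₃ k i ne
      ...   | inj₁ e | _ = contradiction (subst (Λ i) e l) (c∉Λ i)
      ...   | inj₂ l′ | inj₁ p = contradiction refl (proj₁ (anti k i p _ _ l′ l))
      ...   | inj₂ l′ | inj₂ p = contradiction refl (proj₁ (anti i k p _ _ l l′))

    -- The line graph of a subdivided claw: a triangle c with disjoint legs to the ends τ i.
    record Net (D : VSet) (τ : Fin 3 → V) : Set₁ where
      field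
        c     : Fin 3 → V
        Λ     : Fin 3 → VSet
        Λ⊆D   : ∀ i v → Λ i v → D v
        edges : ∀ i j → Pair₃ i j → c i ~ c j
        cross : ∀ i j → Pair₃ i j → ∀ u w → Λ i u → Λ j w → u ≢ w × (u ~ w → u ≡ c i × w ≡ c j)
        walk  : ∀ i → Walk (Λ i) (c i) (τ i)

      leg-own : ∀ i k → Λ i (τ k) → k ≡ i
      leg-own i k l with k Fₚ.≟ i
      ... | yes e = e
      ... | no ne with pair₃ k i ne
      ...   | inj₁ p = contradiction refl (proj₁ (cross k i p _ _ (walk-end (walk k)) l))
      ...   | inj₂ p = contradiction refl (proj₁ (cross i k p _ _ l (walk-end (walk k))))

    -- The only edges between the two sides join corresponding ends, so two tripods with these ends
    -- fit together without chords.
    Matched : VSet → VSet → (τ σ : Fin 3 → V) → Set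
    Matched A B τ σ = ∀ u w → A u → B w → u ≢ w × (u ~ w → Σ[ i ∈ Fin 3 ] u ≡ τ i × w ≡ σ i)

    claws-theta : ∀ {A B τ σ} → Matched A B τ σ → (∀ i → τ i ~ σ i) → (T : Claw A τ) (T′ : Claw B σ) →
      ¬ (Claw.c T ~ Claw.c T′) → Theta G
    claws-theta {τ = τ} {σ} match τσ T T′ c≁c′ = theta (proj₁ (match _ _ T.c∈D T′.c∈D)) c≁c′ S anti
        λ i → walk-trans (first i) (step (walk-end (first i)) (τσ i) (walk-reverse (second i)))
      where
      module T = Claw T
      module T′ = Claw T′
      S : Fin 3 → VSet
      S i v = T.Λ i v ⊎ T′.Λ i v
      Leg : Fin 3 → VSet
      Leg i v = v ≡ T.c ⊎ v ≡ T′.c ⊎ S i v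
      first : ∀ i → Walk (Leg i) T.c (τ i)
      first i = walk-map (λ { v (inj₁ e) → inj₁ e ; v (inj₂ l) → inj₂ (inj₂ (inj₁ l)) }) (T.walk i)
      second : ∀ i → Walk (Leg i) T′.c (σ i)
      second i = walk-map (λ { v (inj₁ e) → inj₂ (inj₁ e) ; v (inj₂ l) → inj₂ (inj₂ (inj₂ l)) }) (T′.walk i)
      mixed : ∀ i j → i ≢ j → Anti (T.Λ i) (T′.Λ j)
      mixed i j ne u w l l′ with match u w (T.Λ⊆D i u l) (T′.Λ⊆D j w l′)
      ... | u≢w , ends = u≢w , λ e → case ends e of λ { (k , refl , refl) → ne (trans (sym (T.leg-own i k l)) (T′.leg-own j k l′)) }
      anti : ∀ i j → Pair₃ i j → Anti (S i) (S j)
      anti i j p u w (inj₁ a) (inj₁ b) = T.anti i j p u w a b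
      anti i j p u w (inj₁ a) (inj₂ b) = mixed i j (pair₃-≢ p) u w a b
      anti i j p u w (inj₂ a) (inj₁ b) = Anti-sym (mixed j i (λ e → pair₃-≢ p (sym e))) u w a b
      anti i j p u w (inj₂ a) (inj₂ b) = T′.anti i j p u w a b

    nets-prism : ∀ {A B τ σ} → Matched A B τ σ → (∀ i → τ i ~ σ i) → Net A τ → Net B σ → Prism G
    nets-prism {τ = τ} {σ} match τσ T T′ = prism T.c T′.c S
        (λ i → proj₁ (match _ _ (T.Λ⊆D i _ (walk-start (T.walk i))) (T′.Λ⊆D i _ (walk-start (T′.walk i)))))
        (λ i j p → T.edges i j p , T′.edges i j p , cross i j p)
        λ i → walk-trans (walk-map (λ _ → inj₁) (T.walk i))
          (step (inj₁ (walk-end (T.walk i))) (τσ i) (walk-reverse (walk-map (λ _ → inj₂) (T′.walk i))))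
      where
      module T = Net T
      module T′ = Net T′
      S : Fin 3 → VSet
      S i v = T.Λ i v ⊎ T′.Λ i v
      mixed : ∀ i j → i ≢ j → Anti (T.Λ i) (T′.Λ j)
      mixed i j ne u w l l′ with match u w (T.Λ⊆D i u l) (T′.Λ⊆D j w l′)
      ... | u≢w , ends = u≢w , λ e → case ends e of λ { (k , refl , refl) → ne (trans (sym (T.leg-own i k l)) (T′.leg-own j k l′)) }
      cross : ∀ i j → Pair₃ i j → ∀ u w → S i u → S j w →
        u ≢ w × (u ~ w → (u ≡ T.c i × w ≡ T.c j) ⊎ (u ≡ T′.c i × w ≡ T′.c j))
      cross i j p u w (inj₁ a) (inj₁ b) with T.cross i j p u w a b
      ... | ne , r = ne , λ e → inj₁ (r e)
      cross i j p u w (inj₂ a) (inj₂ b) with T′.cross i j p u w a b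
      ... | ne , r = ne , λ e → inj₂ (r e)
      cross i j p u w (inj₁ a) (inj₂ b) with mixed i j (pair₃-≢ p) u w a b
      ... | ne , na = ne , λ e → contradiction e na
      cross i j p u w (inj₂ a) (inj₁ b) with Anti-sym (mixed j i (λ e → pair₃-≢ p (sym e))) u w a b
      ... | ne , na = ne , λ e → contradiction e na

    swap₁₂ : Fin 3 → Fin 3
    swap₁₂ = three F.zero (F.suc (F.suc F.zero)) (F.suc F.zero)

    claw-swap : ∀ {D a b d} → Claw D (three a b d) → Claw D (three a d b)
    claw-swap T = record { c = T.c ; Λ = λ i → T.Λ (swap₁₂ i) ; c∈D = T.c∈D ; Λ⊆D = λ i → T.Λ⊆D (swap₁₂ i) ; c∉Λ = λ i → T.c∉Λ (swap₁₂ i)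
        ; anti = λ { _ _ p01 → T.anti _ _ p02 ; _ _ p02 → T.anti _ _ p01 ; _ _ p12 → Anti-sym (T.anti _ _ p12) }
        ; walk = λ { F.zero → T.walk F.zero ; (F.suc F.zero) → T.walk (F.suc (F.suc F.zero)) ; (F.suc (F.suc F.zero)) → T.walk (F.suc F.zero) } }
      where module T = Claw T

    net-swap : ∀ {D a b d} → Net D (three a b d) → Net D (three a d b)
    net-swap T = record { c = λ i → T.c (swap₁₂ i) ; Λ = λ i → T.Λ (swap₁₂ i) ; Λ⊆D = λ i → T.Λ⊆D (swap₁₂ i)
        ; edges = λ { _ _ p01 → T.edges _ _ p02 ; _ _ p02 → T.edges _ _ p01 ; _ _ p12 → ~-sym (T.edges _ _ p12) }
        ; cross = λ { _ _ p01 → T.cross _ _ p02 ; _ _ p02 → T.cross _ _ p01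
                    ; _ _ p12 u w a b → (λ e → proj₁ (T.cross _ _ p12 w u b a) (sym e)) ,
                        λ e → case proj₂ (T.cross _ _ p12 w u b a) (~-sym e) of λ { (r , s) → s , r } }
        ; walk = λ { F.zero → T.walk F.zero ; (F.suc F.zero) → T.walk (F.suc (F.suc F.zero)) ; (F.suc (F.suc F.zero)) → T.walk (F.suc F.zero) } }
      where module T = Net T

    -- Labels lie between the sides. Appending them to the legs on one side leaves, towards the
    -- other side, only the edges from each label to its neighbour there, which is the form
    -- `Matched` asks for.
    module Extend {D : VSet} {τ : Fin 3 → V} (y : Fin 3 → V) (y∉D : ∀ i → ¬ D (y i)) (yτ : ∀ i → y i ~ τ i)
      (only : ∀ i d → D d → y i ~ d → d ≡ τ i) (y-anti : ∀ i j → i ≢ j → y i ≢ y j × ¬ (y i ~ y j)) where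

      D⁺ : VSet
      D⁺ v = D v ⊎ (Σ[ i ∈ Fin 3 ] v ≡ y i)

      extend-claw : Claw D τ → Claw D⁺ y
      extend-claw T = record
        { c = T.c ; Λ = λ i v → T.Λ i v ⊎ v ≡ y i ; c∈D = inj₁ T.c∈D
        ; Λ⊆D = λ { i v (inj₁ l) → inj₁ (T.Λ⊆D i v l) ; i v (inj₂ e) → inj₂ (i , e) }
        ; c∉Λ = λ { i (inj₁ l) → T.c∉Λ i l ; i (inj₂ e) → y∉D i (subst D e T.c∈D) }
        ; anti = λ { i j p u w (inj₁ a) (inj₁ b) → T.anti i j p u w a b
                   ; i j p u w (inj₁ a) (inj₂ refl) → leg-y i j (pair₃-≢ p) u a
                   ; i j p u w (inj₂ refl) (inj₁ b) → Anti-sym {S = T.Λ j} {T = _≡ y i} (λ { u w a refl → leg-y j i (λ e → pair₃-≢ p (sym e)) u a }) u w refl b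
                   ; i j p u w (inj₂ refl) (inj₂ refl) → y-anti i j (pair₃-≢ p) }
        ; walk = λ i → walk-snoc (walk-map (λ { v (inj₁ e) → inj₁ e ; v (inj₂ l) → inj₂ (inj₁ l) }) (T.walk i)) (~-sym (yτ i)) (inj₂ (inj₂ refl)) }
        where
        module T = Claw T
        leg-y : ∀ i j → i ≢ j → ∀ u → T.Λ i u → u ≢ y j × ¬ (u ~ y j)
        leg-y i j ne u l = (λ { refl → y∉D j (T.Λ⊆D i u l) }) ,
          λ e → ne (sym (T.leg-own i j (subst (T.Λ i) (only j u (T.Λ⊆D i u l) (~-sym e)) l)))

      extend-net : Net D τ → Net D⁺ y
      extend-net T = record
        { c = T.c ; Λ = λ i v → T.Λ i v ⊎ v ≡ y i
        ; Λ⊆D = λ { i v (inj₁ l) → inj₁ (T.Λ⊆D i v l) ; i v (inj₂ e) → inj₂ (i , e) }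
        ; edges = T.edges
        ; cross = λ { i j p u w (inj₁ a) (inj₁ b) → T.cross i j p u w a b
                    ; i j p u w (inj₁ a) (inj₂ refl) → none (leg-y i j (pair₃-≢ p) u a)
                    ; i j p u w (inj₂ refl) (inj₁ b) → none (Anti-sym {S = T.Λ j} {T = _≡ y i} (λ { u w a refl → leg-y j i (λ e → pair₃-≢ p (sym e)) u a }) u w refl b)
                    ; i j p u w (inj₂ refl) (inj₂ refl) → none (y-anti i j (pair₃-≢ p)) }
        ; walk = λ i → walk-snoc (walk-map (λ _ → inj₁) (T.walk i)) (~-sym (yτ i)) (inj₂ refl) }
        where
        module T = Net T
        none : ∀ {u w} {R : Set} → u ≢ w × ¬ (u ~ w) → u ≢ w × (u ~ w → R)
        none (ne , na) = ne , λ e → contradiction e na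
        leg-y : ∀ i j → i ≢ j → ∀ u → T.Λ i u → u ≢ y j × ¬ (u ~ y j)
        leg-y i j ne u l = (λ { refl → y∉D j (T.Λ⊆D i u l) }) ,
          λ e → ne (sym (T.leg-own i j (subst (T.Λ i) (only j u (T.Λ⊆D i u l) (~-sym e)) l)))

    module Attach {D : VSet} {a b d : V} (s : Spine) (s⊆D : ∀ i → i ≤ N s → D (sp s i)) (p₀ : sp s 0 ≡ a) (pN : sp s (N s) ≡ b)
      (Far : VSet) (Far⊆D : ∀ v → Far v → D v) (far-p : ∀ v i → Far v → i ≤ N s → sp s i ≢ v × ¬ (sp s i ~ v))
      (r : V) (Dr : D r) (r∉Far : ¬ Far r) (leg : Walk (λ v → v ≡ r ⊎ Far v) r d) where

      private
        p : ℕ → V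
        p = sp s
        Below Above : ℕ → VSet
        Below i v = Σ[ j ∈ ℕ ] j < i × p j ≡ v
        Above i v = Σ[ j ∈ ℕ ] i < j × j ≤ N s × p j ≡ v
        down : ∀ i → i ≤ N s → Walk (λ v → v ≡ p i ⊎ Below i v) (p i) a
        down i le = subst (Walk _ (p i)) p₀ (walk-reverse (walk-map classify (seg-walk s 0 i z≤n le)))
          where
          classify : ∀ v → Seg s 0 i v → v ≡ p i ⊎ Below i v
          classify v (j , _ , j≤ , refl) with m≤n⇒m<n∨m≡n j≤
          ... | inj₁ lt = inj₂ (j , lt , refl)
          ... | inj₂ refl = inj₁ refl
        up : ∀ i → i ≤ N s → Walk (λ v → v ≡ p i ⊎ Above i v) (p i) b
        up i le = subst (Walk _ (p i)) pN (walk-map classify (seg-walk s i (N s) le ≤-refl))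
          where
          classify : ∀ v → Seg s i (N s) v → v ≡ p i ⊎ Above i v
          classify v (j , i≤ , j≤ , refl) with m≤n⇒m<n∨m≡n i≤
          ... | inj₁ lt = inj₂ (j , lt , j≤ , refl)
          ... | inj₂ refl = inj₁ refl
        on-path : ∀ i → i ≤ N s → (Λ : VSet) → (∀ v → Λ v → D v) → ¬ Λ (p i) → (∀ j → j ≤ N s → j ≢ i → ∀ v → Λ v → p j ≢ v × ¬ (p j ~ v)) →
          Walk (λ v → v ≡ p i ⊎ Λ v) (p i) d → Claw D (three a b d)
        on-path i i≤ Λ Λ⊆D i∉ away walk-d = record
          { c = p i ; Λ = three (Below i) (Above i) Λ ; c∈D = s⊆D i i≤
          ; Λ⊆D = λ { F.zero v (j , j< , refl) → s⊆D j (≤-trans (<⇒≤ j<) i≤)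
                    ; (F.suc F.zero) v (j , _ , j≤ , refl) → s⊆D j j≤ ; (F.suc (F.suc F.zero)) → Λ⊆D }
          ; c∉Λ = λ { F.zero (j , j< , e) → <-irrefl (spJ s j i (≤-trans (<⇒≤ j<) i≤) i≤ e) j<
                    ; (F.suc F.zero) (j , j> , j≤ , e) → <-irrefl (sym (spJ s j i j≤ i≤ e)) j>
                    ; (F.suc (F.suc F.zero)) → i∉ }
          ; anti = λ { _ _ p01 _ _ (j , j< , refl) (k , k> , k≤ , refl) → seg-anti s j j k k (≤-trans (s≤s j<) k>) k≤ _ _ (j , ≤-refl , ≤-refl , refl) (k , ≤-refl , ≤-refl , refl)
                     ; _ _ p02 _ v (j , j< , refl) lv → away j (≤-trans (<⇒≤ j<) i≤) (<⇒≢ j<) v lv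
                     ; _ _ p12 _ v (j , j> , j≤ , refl) lv → away j j≤ (<⇒≢ j> ∘ sym) v lv }
          ; walk = λ { F.zero → down i i≤ ; (F.suc F.zero) → up i i≤ ; (F.suc (F.suc F.zero)) → walk-d } }
        R : VSet
        R v = v ≡ r ⊎ Far v
        R⊆D : ∀ v → R v → D v
        R⊆D v (inj₁ refl) = Dr
        R⊆D v (inj₂ f) = Far⊆D v f

      centred-on-path : ∀ i → i ≤ N s → p i ≡ r → Claw D (three a b d)
      centred-on-path i i≤ e = on-path i i≤ Far Far⊆D (λ f → r∉Far (subst Far e f)) (λ j j≤ _ v f → far-p v j f j≤)
        (subst (λ x → Walk (λ v → v ≡ x ⊎ Far v) x d) (sym e) leg)

      -- The neighbours of `r` on the path decide the shape: a single one is the centre of a claw,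
      -- two consecutive ones form the triangle of a net with `r`, and if the extreme ones are
      -- further apart then `r` is the centre of a claw whose legs start at these.
      module Beside (p≢r : ∀ j → j ≤ N s → p j ≢ r) (f g : ℕ) (f≤g : f ≤ g) (g≤ : g ≤ N s) (rf : r ~ p f) (rg : r ~ p g)
        (range : ∀ j → j ≤ N s → p j ~ r → f ≤ j × j ≤ g) where
        private
          f≤ : f ≤ N s
          f≤ = ≤-trans f≤g g≤
        attach : Claw D (three a b d) ⊎ Net D (three a b d)
        attach = shape (<-cmp g (suc f))
          where
          shape : _ → Claw D (three a b d) ⊎ Net D (three a b d)
          shape (tri< g≤f _ _) = inj₁ (on-path f f≤ R R⊆D
              (λ { (inj₁ e) → p≢r f f≤ e ; (inj₂ x) → proj₁ (far-p _ f x f≤) refl })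
              (λ { j j≤ j≢f v (inj₁ refl) → p≢r j j≤ , (λ e → j≢f (≤-antisym (≤-trans (proj₂ (range j j≤ e)) (s≤s⁻¹ g≤f)) (proj₁ (range j j≤ e))))
                 ; j j≤ j≢f v (inj₂ x) → far-p _ _ x j≤ })
              (step (inj₁ refl) (~-sym rf) (walk-map (λ _ → inj₂) leg)))
          shape (tri≈ _ g≡ _) = inj₂ (record
            { c = three (p f) (p g) r ; Λ = three (Seg s 0 f) (Seg s g (N s)) R
            ; Λ⊆D = λ { F.zero v (j , _ , j≤ , refl) → s⊆D j (≤-trans j≤ f≤) ; (F.suc F.zero) v (j , _ , j≤ , refl) → s⊆D j j≤ ; (F.suc (F.suc F.zero)) → R⊆D }
            ; edges = λ { _ _ p01 → subst (λ k → p f ~ p k) (sym g≡) (spE s f (subst (_≤ N s) g≡ g≤)) ; _ _ p02 → ~-sym rf ; _ _ p12 → ~-sym rg }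
            ; cross = λ { _ _ p01 _ _ (j , _ , j≤ , refl) (k , k≥ , k≤ , refl) →
                            (λ e → <-irrefl (spJ s j k (≤-trans j≤ f≤) k≤ e) (≤-trans (s≤s j≤) (≤-trans (≤-reflexive (sym g≡)) k≥))) ,
                            λ e → edge j k j≤ k≥ k≤ (spI s j k (≤-trans j≤ f≤) k≤ e)
                        ; _ _ p02 _ v (j , _ , j≤ , refl) lv → to-R (≤-trans j≤ f≤) lv λ rng → cong p (≤-antisym j≤ (proj₁ rng))
                        ; _ _ p12 _ v (j , j≥ , j≤ , refl) lv → to-R j≤ lv λ rng → cong p (≤-antisym (proj₂ rng) j≥) }
            ; walk = λ { F.zero → subst (Walk _ (p f)) p₀ (walk-reverse (seg-walk s 0 f z≤n f≤))
                       ; (F.suc F.zero) → subst (Walk _ (p g)) pN (seg-walk s g (N s) g≤ ≤-refl)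
                       ; (F.suc (F.suc F.zero)) → leg } })
            where
            edge : ∀ j k → j ≤ f → g ≤ k → k ≤ N s → k ≡ suc j ⊎ j ≡ suc k → p j ≡ p f × p k ≡ p g
            edge j k j≤ k≥ k≤ (inj₁ refl) = cong p j≡ , cong p (≤-antisym (≤-trans (s≤s j≤) (≤-reflexive (sym g≡))) k≥)
              where
              j≡ : j ≡ f
              j≡ = ≤-antisym j≤ (s≤s⁻¹ (≤-trans (≤-reflexive (sym g≡)) k≥))
            edge j k j≤ k≥ k≤ (inj₂ refl) = contradiction (≤-trans j≤ (≤-trans f≤g k≥)) 1+n≰n
            to-R : ∀ {j v x} → j ≤ N s → R v → (f ≤ j × j ≤ g → p j ≡ x) → p j ≢ v × (p j ~ v → p j ≡ x × v ≡ r)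
            to-R j≤ (inj₁ refl) k = p≢r _ j≤ , λ e → k (range _ j≤ e) , refl
            to-R j≤ (inj₂ x) k = proj₁ (far-p _ _ x j≤) , λ e → contradiction e (proj₂ (far-p _ _ x j≤))
          shape (tri> _ _ far) = inj₁ (record
            { c = r ; Λ = three (Seg s 0 f) (Seg s g (N s)) Far ; c∈D = Dr
            ; Λ⊆D = λ { F.zero v (j , _ , j≤ , refl) → s⊆D j (≤-trans j≤ f≤) ; (F.suc F.zero) v (j , _ , j≤ , refl) → s⊆D j j≤ ; (F.suc (F.suc F.zero)) → Far⊆D }
            ; c∉Λ = λ { F.zero (j , _ , j≤ , e) → p≢r j (≤-trans j≤ f≤) e ; (F.suc F.zero) (j , _ , j≤ , e) → p≢r j j≤ e
                      ; (F.suc (F.suc F.zero)) → r∉Far }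
            ; anti = λ { _ _ p01 → seg-anti s 0 f g (N s) far ≤-refl
                       ; _ _ p02 _ v (j , _ , j≤ , refl) x → far-p _ _ x (≤-trans j≤ f≤)
                       ; _ _ p12 _ v (j , _ , j≤ , refl) x → far-p _ _ x j≤ }
            ; walk = λ { F.zero → step (inj₁ refl) rf (walk-map (λ _ → inj₂) (subst (Walk _ (p f)) p₀ (walk-reverse (seg-walk s 0 f z≤n f≤))))
                       ; (F.suc F.zero) → step (inj₁ refl) rg (walk-map (λ _ → inj₂) (subst (Walk _ (p g)) pN (seg-walk s g (N s) g≤ ≤-refl)))
                       ; (F.suc (F.suc F.zero)) → leg } })

    -- Join `a` and `b` by an induced path and walk from `d` to the first vertex `r` on or next to
    -- it. The walk before `r` is anticomplete to the path, so `Attach` applies.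
    connector : ∀ {D : VSet} → (∀ u v → D u → D v → Walk D u v) → ∀ a b d → D a → D b → D d →
      Claw D (three a b d) ⊎ Net D (three a b d)
    connector {D} conn a b d Da Db Dd with walk→path (conn a b Da Db)
    ... | l , pa , l⊆D = reach (toSpine pa) (λ i i≤ → l⊆D _ (nth-∈ a l i (≤pred pa i≤))) (nth-first pa) (nth-last pa)
      where
      module _ (s : Spine) (s⊆D : ∀ i → i ≤ N s → D (sp s i)) (p₀ : sp s 0 ≡ a) (pN : sp s (N s) ≡ b) where
        Near : VSet
        Near v = Σ[ i ∈ ℕ ] i < suc (N s) × (sp s i ≡ v ⊎ v ~ sp s i)
        Near? : Decidable Near
        Near? v = ℕₚ.anyUpTo? (λ i → (sp s i ≟ v) ⊎-dec (v ~? sp s i)) (suc (N s))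
        Far : VSet
        Far v = D v × ¬ Near v
        far-p : ∀ v i → Far v → i ≤ N s → sp s i ≢ v × ¬ (sp s i ~ v)
        far-p v i (_ , f) le = (λ e → f (i , s≤s le , inj₁ e)) , λ e → f (i , s≤s le , inj₂ (~-sym e))
        reach : Claw D (three a b d) ⊎ Net D (three a b d)
        reach with walk-until Near? (conn d a Dd Da) (0 , s≤s z≤n , inj₁ p₀)
        ... | r , near , to-r = attach (Fₚ.any? (λ i → sp s (toℕ {suc (N s)} i) ≟ r))
          where
          leg : Walk (λ v → v ≡ r ⊎ Far v) r d
          leg = walk-reverse (walk-map (λ { v (_ , inj₁ e) → inj₁ e ; v (dv , inj₂ f) → inj₂ (dv , f) }) to-r)
          module A = Attach s s⊆D p₀ pN Far (λ _ → proj₁) far-p r (proj₁ (walk-end to-r)) (λ f → proj₂ f near) leg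
          attach : Dec (Σ[ i ∈ Fin (suc (N s)) ] sp s (toℕ i) ≡ r) → Claw D (three a b d) ⊎ Net D (three a b d)
          attach (yes (i , e)) = inj₁ (A.centred-on-path (toℕ i) (Fₚ.toℕ≤pred[n] i) e)
          attach (no off) = beside near
            where
            beside : Near r → Claw D (three a b d) ⊎ Net D (three a b d)
            beside (i , i< , inj₁ e) = contradiction (fromℕ< i< , trans (cong (sp s) (Fₚ.toℕ-fromℕ< i<)) e) off
            beside (i , s≤s i≤ , inj₂ ri) with firstIn-spec s r 0 (N s) z≤n i≤ ri | lastIn-spec s r 0 (N s) z≤n i≤ ri
            ... | _ , f≤i , rf , before | i≤g , g≤ , rg , after = A.Beside.attach
                    (λ j j≤ e → off (fromℕ< (s≤s j≤) , trans (cong (sp s) (Fₚ.toℕ-fromℕ< (s≤s j≤))) e)) _ _ (≤-trans f≤i i≤g) g≤ rf rg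
                    (λ j j≤ e → ℕₚ.≮⇒≥ (λ lt → before j z≤n lt (~-sym e)) , ℕₚ.≮⇒≥ (λ lt → after j lt j≤ (~-sym e)))

  flip-sides : ∀ {ys} → TwoSides ys → TwoSides ys
  flip-sides TS = record
    { D = E ; E = D ; D? = E? ; E? = D? ; D-conn = E-conn ; E-conn = D-conn ; D-E = Anti-sym D-E
    ; unique = unique ; stable = stable ; off-D = off-E ; off-E = off-D ; att-D = att-E ; att-E = att-D }
    where open TwoSides TS

  module SingleLabels {D : Fin n → Set} {ys : List (Fin n)} (SS : SingleSide D ys) where
    open SingleSide SS public

    x : V → V
    x y with Fₚ.any? (λ d → S? d ×-dec y ~? d)
    ... | yes (d , _) = d
    ... | no _ = y

    x-spec : ∀ y → y ∈ ys → S (x y) × y ~ x y × (∀ d → S d → y ~ d → d ≡ x y)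
    x-spec y y∈ with Fₚ.any? (λ d → S? d ×-dec y ~? d) | nb y y∈
    ... | no none | d , sd , yd , _ = contradiction (d , sd , yd) none
    ... | yes (d′ , sd′ , yd′) | d , sd , yd , only = sd′ , yd′ , λ e se ye → trans (only e se ye) (sym (only d′ sd′ yd′))

    open Tripods

    ClawFree NetFree : V → List V → Set₁
    ClawFree y₀ ws = ∀ i j → i ∈ ws → j ∈ ws → i ≢ j → ¬ Claw S (three (x y₀) (x i) (x j))
    NetFree y₀ ws = ∀ i j → i ∈ ws → j ∈ ws → i ≢ j → ¬ Net S (three (x y₀) (x i) (x j))

    ordered-claw-free : ∀ y₀ ws → AllPairs (λ i j → ¬ Claw S (three (x y₀) (x i) (x j))) ws → ClawFree y₀ ws
    ordered-claw-free y₀ ws ps i j i∈ j∈ ne c with AllPairs-total ps i∈ j∈ ne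
    ... | inj₁ no-claw = no-claw c
    ... | inj₂ no-claw = no-claw (claw-swap c)

    ordered-net-free : ∀ y₀ ws → AllPairs (λ i j → ¬ Net S (three (x y₀) (x i) (x j))) ws → NetFree y₀ ws
    ordered-net-free y₀ ws ps i j i∈ j∈ ne c with AllPairs-total ps i∈ j∈ ne
    ... | inj₁ no-net = no-net c
    ... | inj₂ no-net = no-net (net-swap c)

  module Triple {ys : List (Fin n)} (TS : TwoSides ys)
    (y₀ i j : Fin n) (y₀∈ : y₀ ∈ ys) (i∈ : i ∈ ys) (j∈ : j ∈ ys) (y₀≢i : y₀ ≢ i) (y₀≢j : y₀ ≢ j) (i≢j : i ≢ j) where
    open Tripods
    open TwoSides TS

    y : Fin 3 → V
    y = three y₀ i j

    y∈ : ∀ k → y k ∈ ys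
    y∈ F.zero = y₀∈
    y∈ (F.suc F.zero) = i∈
    y∈ (F.suc (F.suc F.zero)) = j∈

    y-≢ : ∀ k l → Pair₃ k l → y k ≢ y l
    y-≢ _ _ p01 = y₀≢i
    y-≢ _ _ p02 = y₀≢j
    y-≢ _ _ p12 = i≢j

    y-anti : ∀ k l → k ≢ l → y k ≢ y l × ¬ (y k ~ y l)
    y-anti k l ne with pair₃ k l ne
    ... | inj₁ p = y-≢ k l p , stable _ _ (y∈ k) (y∈ l)
    ... | inj₂ p = y-≢ l k p ∘ sym , stable _ _ (y∈ k) (y∈ l)

    With : VSet → VSet
    With B v = B v ⊎ (Σ[ k ∈ Fin 3 ] v ≡ y k)

    matched : ∀ {A B : VSet} {τ : Fin 3 → V} → (∀ v → A v → D v) → (∀ v → B v → E v) →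
      (∀ k d → A d → y k ~ d → d ≡ τ k) → Matched A (With B) τ y
    matched A⊆D B⊆E only u w Au (inj₁ Bw) with D-E u w (A⊆D u Au) (B⊆E w Bw)
    ... | ne , na = ne , λ e → contradiction e na
    matched A⊆D B⊆E only u w Au (inj₂ (k , refl)) =
      (λ { refl → off-D (y k) (y∈ k) (A⊆D u Au) }) , λ e → k , only k u Au (~-sym e) , refl

  module BothSingle (no-theta : ¬ Theta G) (no-prism : ¬ Prism G) {ys zs : List (Fin n)} (TS : TwoSides ys)
    (zs⊑ : zs ⊑ ys) (S₁ : SingleSide (TwoSides.D TS) zs) (S₂ : SingleSide (TwoSides.E TS) zs) where
    open Tripods
    open TwoSides TS
    private
      module S₁ = SingleLabels S₁
      module S₂ = SingleLabels S₂

      module _ {y₀ i j : V} (y₀∈ : y₀ ∈ zs) (i∈ : i ∈ zs) (j∈ : j ∈ zs) (y₀≢i : y₀ ≢ i) (y₀≢j : y₀ ≢ j) (i≢j : i ≢ j) where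
        open Triple TS y₀ i j (zs⊑ _ y₀∈) (zs⊑ _ i∈) (zs⊑ _ j∈) y₀≢i y₀≢j i≢j
        τ σ : Fin 3 → V
        τ = three (S₁.x y₀) (S₁.x i) (S₁.x j)
        σ = three (S₂.x y₀) (S₂.x i) (S₂.x j)
        yσ : ∀ k → y k ~ σ k
        yσ F.zero = proj₁ (proj₂ (S₂.x-spec y₀ y₀∈))
        yσ (F.suc F.zero) = proj₁ (proj₂ (S₂.x-spec i i∈))
        yσ (F.suc (F.suc F.zero)) = proj₁ (proj₂ (S₂.x-spec j j∈))
        only-σ : ∀ k d → S₂.S d → y k ~ d → d ≡ σ k
        only-σ F.zero = proj₂ (proj₂ (S₂.x-spec y₀ y₀∈))
        only-σ (F.suc F.zero) = proj₂ (proj₂ (S₂.x-spec i i∈))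
        only-σ (F.suc (F.suc F.zero)) = proj₂ (proj₂ (S₂.x-spec j j∈))
        module Ex = Extend {D = S₂.S} {τ = σ} y (λ k s → off-E (y k) (y∈ k) (S₂.S⊆D _ s)) yσ only-σ y-anti
        match : Matched S₁.S Ex.D⁺ τ y
        match = matched S₁.S⊆D S₂.S⊆D (λ { F.zero → proj₂ (proj₂ (S₁.x-spec y₀ y₀∈)) ; (F.suc F.zero) → proj₂ (proj₂ (S₁.x-spec i i∈)) ; (F.suc (F.suc F.zero)) → proj₂ (proj₂ (S₁.x-spec j j∈)) })
        τy : ∀ k → τ k ~ y k
        τy F.zero = ~-sym (proj₁ (proj₂ (S₁.x-spec y₀ y₀∈)))
        τy (F.suc F.zero) = ~-sym (proj₁ (proj₂ (S₁.x-spec i i∈)))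
        τy (F.suc (F.suc F.zero)) = ~-sym (proj₁ (proj₂ (S₁.x-spec j j∈)))

        no-claws : Claw S₁.S τ → Claw S₂.S σ → ⊥
        no-claws T T′ = no-theta (claws-theta match τy T (Ex.extend-claw T′)
          (proj₂ (D-E _ _ (S₁.S⊆D _ (Claw.c∈D T)) (S₂.S⊆D _ (Claw.c∈D T′)))))

        no-nets : Net S₁.S τ → Net S₂.S σ → ⊥
        no-nets T T′ = no-prism (nets-prism match τy T (Ex.extend-net T′))

        conn₁ : Claw S₁.S τ ⊎ Net S₁.S τ
        conn₁ = connector S₁.conn _ _ _ (proj₁ (S₁.x-spec y₀ y₀∈)) (proj₁ (S₁.x-spec i i∈)) (proj₁ (S₁.x-spec j j∈))

        conn₂ : Claw S₂.S σ ⊎ Net S₂.S σ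
        conn₂ = connector S₂.conn _ _ _ (proj₁ (S₂.x-spec y₀ y₀∈)) (proj₁ (S₂.x-spec i i∈)) (proj₁ (S₂.x-spec j j∈))

        Pure₁ Pure₂ : Set₁
        Pure₁ = ¬ Claw S₁.S τ × ¬ Net S₂.S σ
        Pure₂ = ¬ Net S₁.S τ × ¬ Claw S₂.S σ

        -- A second net would give a prism, so `connector` must yield a claw on the other side; with
        -- it, a claw on the first side would give a theta.
        net-first : Net S₁.S τ → Pure₁
        net-first T = [ (λ T′ → (λ c → no-claws c T′)) , (λ T′ → ⊥-elim (no-nets T T′)) ]′ conn₂ , λ T′ → no-nets T T′

        claw-first : Claw S₁.S τ → Pure₂
        claw-first T = [ (λ T′ → ⊥-elim (no-claws T T′)) , (λ T′ → (λ c → no-nets c T′)) ]′ conn₂ , λ T′ → no-claws T T′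

    PureSides : List V → ℕ → Set₁
    PureSides zs m = Σ[ y₀ ∈ V ] Σ[ ws ∈ List V ] y₀ ∈ zs × ws ⊑ zs × AllPairs _≢_ ws × (∀ w → w ∈ ws → y₀ ≢ w) × length ws ≡ m ×
      ((S₁.ClawFree y₀ ws × S₂.NetFree y₀ ws) ⊎ (S₁.NetFree y₀ ws × S₂.ClawFree y₀ ws))

    pure-sides : ∀ m xs → xs ⊑ zs → AllPairs _≢_ xs → ramseyBound m m < length xs → PureSides zs m
    pure-sides m (y₀ ∷ xs) sub (y₀≢ ∷ u) (s≤s large) = finish (ramsey kind? m m xs u large)
      where
      y₀∈ = sub y₀ (here refl)
      -- Existence of a claw is not decided; the colour of a pair is simply the alternative that
      -- `connector` returns on the first side, which by `net-first` or `claw-first` settles both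
      -- sides.
      kind : V → V → Bool
      kind i j with i ∈? xs | j ∈? xs | i ≟ j
      ... | yes i∈ | yes j∈ | no ne = [ (λ _ → false) , (λ _ → true) ]′ (conn₁ y₀∈ (sub i (there i∈)) (sub j (there j∈)) (All.lookup y₀≢ i∈) (All.lookup y₀≢ j∈) ne)
      ... | _ | _ | _ = false
      kind? : ∀ i j → Dec (kind i j ≡ true)
      kind? i j = kind i j Bool.≟ true
      module _ {i j : V} (i∈ : i ∈ xs) (j∈ : j ∈ xs) (ne : i ≢ j) where
        P₁ P₂ : Set₁
        P₁ = Pure₁ y₀∈ (sub i (there i∈)) (sub j (there j∈)) (All.lookup y₀≢ i∈) (All.lookup y₀≢ j∈) ne
        P₂ = Pure₂ y₀∈ (sub i (there i∈)) (sub j (there j∈)) (All.lookup y₀≢ i∈) (All.lookup y₀≢ j∈) ne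
        decide : (kind i j ≡ true → P₁) × (¬ (kind i j ≡ true) → P₂)
        decide with i ∈? xs | j ∈? xs | i ≟ j
        ... | no i∉ | _ | _ = contradiction i∈ i∉
        ... | yes _ | no j∉ | _ = contradiction j∈ j∉
        ... | yes _ | yes _ | yes e = contradiction e ne
        ... | yes a | yes b | no c with conn₁ y₀∈ (sub i (there a)) (sub j (there b)) (All.lookup y₀≢ a) (All.lookup y₀≢ b) c
        ...   | inj₁ T = (λ ()) , λ _ → claw-first y₀∈ (sub i (there i∈)) (sub j (there j∈)) (All.lookup y₀≢ i∈) (All.lookup y₀≢ j∈) ne T
        ...   | inj₂ T = (λ _ → net-first y₀∈ (sub i (there i∈)) (sub j (there j∈)) (All.lookup y₀≢ i∈) (All.lookup y₀≢ j∈) ne T) , λ f → contradiction refl f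
      finish : _ → PureSides zs m
      finish (ws , subw , uw , r) with r
      ... | inj₁ (len , col) = y₀ , ws , y₀∈ , (λ w w∈ → sub w (there (subw w w∈))) , uw , (λ w w∈ → All.lookup y₀≢ (subw w w∈)) , len ,
          inj₁ ((λ i j i∈ j∈ ne T → case AllPairs-total col i∈ j∈ ne of λ
                   { (inj₁ k) → proj₁ (proj₁ (decide (subw i i∈) (subw j j∈) ne) k) T
                   ; (inj₂ k) → proj₁ (proj₁ (decide (subw j j∈) (subw i i∈) (ne ∘ sym)) k) (claw-swap T) }) ,
                (λ i j i∈ j∈ ne T → case AllPairs-total col i∈ j∈ ne of λ
                   { (inj₁ k) → proj₂ (proj₁ (decide (subw i i∈) (subw j j∈) ne) k) T
                   ; (inj₂ k) → proj₂ (proj₁ (decide (subw j j∈) (subw i i∈) (ne ∘ sym)) k) (net-swap T) }))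
      ... | inj₂ (len , col) = y₀ , ws , y₀∈ , (λ w w∈ → sub w (there (subw w w∈))) , uw , (λ w w∈ → All.lookup y₀≢ (subw w w∈)) , len ,
          inj₂ ((λ i j i∈ j∈ ne T → case AllPairs-total col i∈ j∈ ne of λ
                   { (inj₁ k) → proj₁ (proj₂ (decide (subw i i∈) (subw j j∈) ne) k) T
                   ; (inj₂ k) → proj₁ (proj₂ (decide (subw j j∈) (subw i i∈) (ne ∘ sym)) k) (net-swap T) }) ,
                (λ i j i∈ j∈ ne T → case AllPairs-total col i∈ j∈ ne of λ
                   { (inj₁ k) → proj₂ (proj₂ (decide (subw i i∈) (subw j j∈) ne) k) T
                   ; (inj₂ k) → proj₂ (proj₂ (decide (subw j j∈) (subw i i∈) (ne ∘ sym)) k) (claw-swap T) }))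

  -- Unique neighbours on one side, hulls on the other.

  module SingleHull (no-theta : ¬ Theta G) (no-prism : ¬ Prism G) {ys zs ws : List (Fin n)} (TS : TwoSides ys)
    (non-hub : ∀ y → y ∈ ys → ¬ Hub G y) (zs⊑ : zs ⊑ ys) (ws⊑ : ws ⊑ zs)
    (S₁ : SingleSide (TwoSides.D TS) zs) (H₂ : HullSide (TwoSides.E TS) ws) where
    open Tripods
    open OnSpine
    open HubCriterion
    open TwoSides TS
    module S₁ = SingleLabels S₁
    module H₂ = Hulls H₂
    open H₂ using (P; f; g; Before)

    Long : V → Set
    Long y = suc (f y) < g y

    Long? : Decidable Long
    Long? y = suc (f y) <? g y

    module _ {y₀ i j : V} (y₀∈ : y₀ ∈ ws) (i∈ : i ∈ ws) (j∈ : j ∈ ws) (y₀≢i : y₀ ≢ i) (y₀≢j : y₀ ≢ j) (i≢j : i ≢ j)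
      (b₀ᵢ : Before y₀ i) (b₀ⱼ : Before y₀ j) (bᵢⱼ : Before i j) where
      private
        up : ∀ {y} → y ∈ ws → y ∈ ys
        up y∈ = zs⊑ _ (ws⊑ _ y∈)
      open Triple TS y₀ i j (up y₀∈) (up i∈) (up j∈) y₀≢i y₀≢j i≢j
      private
        x = S₁.x
        spec = λ {y} (y∈ : y ∈ ws) → S₁.x-spec y (ws⊑ y y∈)
        τ : Fin 3 → V
        τ = three (x y₀) (x i) (x j)
        τy : ∀ k → τ k ~ y k
        τy F.zero = ~-sym (proj₁ (proj₂ (spec y₀∈)))
        τy (F.suc F.zero) = ~-sym (proj₁ (proj₂ (spec i∈)))
        τy (F.suc (F.suc F.zero)) = ~-sym (proj₁ (proj₂ (spec j∈)))
        match : Matched S₁.S (With E) τ y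
        match = matched S₁.S⊆D (λ _ e → e) λ { F.zero → proj₂ (proj₂ (spec y₀∈)) ; (F.suc F.zero) → proj₂ (proj₂ (spec i∈)) ; (F.suc (F.suc F.zero)) → proj₂ (proj₂ (spec j∈)) }

        fᵢ≤ = H₂.f≤N i i∈
        fⱼ≤ = H₂.f≤N j j∈
        gᵢ≤ = H₂.g≤N i i∈
        f<gᵢ = H₂.f<g i i∈

        Left Right : VSet
        Left v = v ≡ y₀ ⊎ Seg P (g y₀) (f i) v
        Right v = v ≡ j ⊎ Seg P (g i) (f j) v

        Left⊆ : ∀ v → Left v → With E v
        Left⊆ v (inj₁ e) = inj₂ (F.zero , e)
        Left⊆ v (inj₂ (k , _ , k≤ , refl)) = inj₁ (H₂.P⊆D k (≤-trans k≤ fᵢ≤))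

        Right⊆ : ∀ v → Right v → With E v
        Right⊆ v (inj₁ e) = inj₂ (F.suc (F.suc F.zero) , e)
        Right⊆ v (inj₂ (k , _ , k≤ , refl)) = inj₁ (H₂.P⊆D k (≤-trans k≤ fⱼ≤))

        y≢p : ∀ {y} → y ∈ ws → ∀ k → k ≤ N P → y ≢ sp P k
        y≢p y∈ k k≤ refl = off-E _ (up y∈) (H₂.P⊆D k k≤)

        i-Left : ∀ v → Left v → i ≢ v × (i ~ v → v ≡ sp P (f i))
        i-Left v (inj₁ refl) = y₀≢i ∘ sym , λ e → contradiction e (stable i y₀ (up i∈) (up y₀∈))
        i-Left v (inj₂ (k , _ , k≤ , refl)) = y≢p i∈ k (≤-trans k≤ fᵢ≤) , λ e → cong (sp P) (≤-antisym k≤ (H₂.f≤ i i∈ k (≤-trans k≤ fᵢ≤) e))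

        i-Right : ∀ v → Right v → i ≢ v × (i ~ v → v ≡ sp P (g i))
        i-Right v (inj₁ refl) = i≢j , λ e → contradiction e (stable i j (up i∈) (up j∈))
        i-Right v (inj₂ (k , k≥ , k≤ , refl)) = y≢p i∈ k (≤-trans k≤ fⱼ≤) , λ e → cong (sp P) (≤-antisym (H₂.≤g i i∈ k (≤-trans k≤ fⱼ≤) e) k≥)

        Left-Right : ∀ u w → Left u → Right w → u ≢ w × (u ~ w →
          Σ[ k ∈ ℕ ] Σ[ l ∈ ℕ ] k ≤ f i × g i ≤ l × l ≤ N P × u ≡ sp P k × w ≡ sp P l × (l ≡ suc k ⊎ k ≡ suc l))
        Left-Right u w (inj₁ refl) (inj₁ refl) = y₀≢j , λ e → contradiction e (stable y₀ j (up y₀∈) (up j∈))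
        Left-Right u w (inj₁ refl) (inj₂ (l , l≥ , l≤ , refl)) = y≢p y₀∈ l (≤-trans l≤ fⱼ≤) ,
          λ e → contradiction (H₂.≤g y₀ y₀∈ l (≤-trans l≤ fⱼ≤) e) (<⇒≱ (≤-trans b₀ᵢ (≤-trans (<⇒≤ f<gᵢ) l≥)))
        Left-Right u w (inj₂ (k , _ , k≤ , refl)) (inj₁ refl) = (λ e → y≢p j∈ k (≤-trans k≤ fᵢ≤) (sym e)) ,
          λ e → contradiction (H₂.f≤ j j∈ k (≤-trans k≤ fᵢ≤) (~-sym e)) (<⇒≱ (≤-<-trans k≤ (<-trans f<gᵢ bᵢⱼ)))
        Left-Right u w (inj₂ (k , _ , k≤ , refl)) (inj₂ (l , l≥ , l≤ , refl)) =
          (λ e → <-irrefl (spJ P k l k≤N l≤N e) (≤-<-trans k≤ (<-≤-trans f<gᵢ l≥))) , λ e → k , l , k≤ , l≥ , l≤N , refl , refl , spI P k l k≤N l≤N e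
          where
          k≤N = ≤-trans k≤ fᵢ≤
          l≤N = ≤-trans l≤ fⱼ≤

        to-left : Walk Left (sp P (f i)) y₀
        to-left = walk-snoc (walk-map (λ _ → inj₂) (walk-reverse (seg-walk P _ _ (<⇒≤ b₀ᵢ) fᵢ≤))) (~-sym (H₂.y~g y₀ y₀∈)) (inj₁ refl)

        to-right : Walk Right (sp P (g i)) j
        to-right = walk-snoc (walk-map (λ _ → inj₂) (seg-walk P _ _ (<⇒≤ bᵢⱼ) fⱼ≤)) (~-sym (H₂.y~f j j∈)) (inj₁ refl)

      -- Label `i` forms a triangle with its two consecutive path neighbours, and the path leads
      -- from these to `y₀` and `j`: a net on the hull side. A net on the other side would complete
      -- a prism.
      no-net : g i ≡ suc (f i) → ¬ Net S₁.S (three (x y₀) (x i) (x j))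
      no-net g≡ T = no-prism (nets-prism match τy T (record
        { c = three (sp P (f i)) i (sp P (g i)) ; Λ = three Left (_≡ i) Right
        ; Λ⊆D = λ { F.zero → Left⊆ ; (F.suc F.zero) v e → inj₂ (F.suc F.zero , e) ; (F.suc (F.suc F.zero)) → Right⊆ }
        ; edges = λ { _ _ p01 → ~-sym (H₂.y~f i i∈) ; _ _ p02 → subst (λ k → sp P (f i) ~ sp P k) (sym g≡) (spE P (f i) (subst (_≤ N P) g≡ gᵢ≤)) ; _ _ p12 → H₂.y~g i i∈ }
        ; cross = λ { _ _ p01 u w l refl → proj₁ (i-Left u l) ∘ sym , λ e → proj₂ (i-Left u l) (~-sym e) , refl
                    ; _ _ p02 u w l r → proj₁ (Left-Right u w l r) , λ e → meet u w (proj₂ (Left-Right u w l r) e)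
                    ; _ _ p12 u w refl r → proj₁ (i-Right w r) , λ e → refl , proj₂ (i-Right w r) e }
        ; walk = λ { F.zero → to-left ; (F.suc F.zero) → here refl ; (F.suc (F.suc F.zero)) → to-right } }))
        where
        meet : ∀ u w → _ → u ≡ sp P (f i) × w ≡ sp P (g i)
        meet u w (k , l , k≤ , l≥ , l≤ , refl , refl , inj₁ refl) = cong (sp P) k≡ , cong (sp P) (trans (cong suc k≡) (sym g≡))
          where
          k≡ : k ≡ f i
          k≡ = ≤-antisym k≤ (s≤s⁻¹ (≤-trans (≤-reflexive (sym g≡)) l≥))
        meet u w (k , l , k≤ , l≥ , l≤ , refl , refl , inj₂ refl) = contradiction (≤-trans k≤ (≤-trans (<⇒≤ f<gᵢ) l≥)) 1+n≰n

      -- Label `i` is the centre of a claw on the hull side, with an empty leg to itself. Two claws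
      -- give a theta unless the centres are adjacent. In that case the legs of the first claw
      -- towards `y₀` and `j` and the path close up to a hole, on which `i` has three pairwise
      -- nonadjacent neighbours: its extreme path neighbours and the other centre.
      no-claw : Long i → ¬ Claw S₁.S (three (x y₀) (x i) (x j))
      no-claw far T with Claw.c T ~? i
      ... | no c≁i = no-theta (claws-theta match τy T T′ c≁i)
        where
        T′ : Claw (With E) y
        T′ = record
          { c = i ; Λ = three Left (λ _ → ⊥) Right ; c∈D = inj₂ (F.suc F.zero , refl)
          ; Λ⊆D = λ { F.zero → Left⊆ ; (F.suc F.zero) v () ; (F.suc (F.suc F.zero)) → Right⊆ }
          ; c∉Λ = λ { F.zero l → proj₁ (i-Left i l) refl ; (F.suc F.zero) () ; (F.suc (F.suc F.zero)) r → proj₁ (i-Right i r) refl }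
          ; anti = λ { _ _ p01 u w l () ; _ _ p12 u w () r
                     ; _ _ p02 u w l r → proj₁ (Left-Right u w l r) , λ e → apart (proj₂ (Left-Right u w l r) e) }
          ; walk = λ { F.zero → step (inj₁ refl) (H₂.y~f i i∈) (walk-map (λ _ → inj₂) to-left) ; (F.suc F.zero) → here (inj₁ refl)
                     ; (F.suc (F.suc F.zero)) → step (inj₁ refl) (H₂.y~g i i∈) (walk-map (λ _ → inj₂) to-right) } }
          where
          apart : ∀ {u w} → Σ[ k ∈ ℕ ] Σ[ l ∈ ℕ ] k ≤ f i × g i ≤ l × l ≤ N P × u ≡ sp P k × w ≡ sp P l × (l ≡ suc k ⊎ k ≡ suc l) → ⊥
          apart (k , l , k≤ , l≥ , _ , _ , _ , inj₁ refl) = 1+n≰n (≤-trans (≤-trans far l≥) (s≤s k≤))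
          apart (k , l , k≤ , l≥ , _ , _ , _ , inj₂ refl) = 1+n≰n (≤-trans k≤ (≤-trans (<⇒≤ f<gᵢ) l≥))
      ... | yes c~i = non-hub i (up i∈) (hub (proj₁ hole) (H₂.y~f i i∈ , proj₂ hole _ (inj₂ (proj₁ inB))) (H₂.y~g i i∈ , proj₂ hole _ (inj₂ (proj₂ inB)))
            (~-sym c~i , proj₂ hole _ (inj₁ c∈l)) (H₂.f≢g i i∈) (proj₁ cf ∘ sym) (proj₁ cg ∘ sym) (proj₂ cf ∘ ~-sym) (proj₂ cg ∘ ~-sym) (inj₁ f≁g))
        where
        module T = Claw T
        Legs : VSet
        Legs v = v ≡ T.c ⊎ T.Λ F.zero v ⊎ T.Λ (F.suc (F.suc F.zero)) v
        pw = walk→path {S = Legs} (walk-trans (walk-reverse (walk-map (λ { v (inj₁ e) → inj₁ e ; v (inj₂ l) → inj₂ (inj₁ l) }) (T.walk F.zero)))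
                                   (walk-map (λ { v (inj₁ e) → inj₁ e ; v (inj₂ l) → inj₂ (inj₂ l) }) (T.walk (F.suc (F.suc F.zero)))))
        l = proj₁ pw
        Legs⊆D : ∀ v → Legs v → D v
        Legs⊆D v (inj₁ refl) = S₁.S⊆D v T.c∈D
        Legs⊆D v (inj₂ (inj₁ s)) = S₁.S⊆D v (T.Λ⊆D _ v s)
        Legs⊆D v (inj₂ (inj₂ s)) = S₁.S⊆D v (T.Λ⊆D _ v s)
        Legs⊆S : ∀ v → Legs v → S₁.S v
        Legs⊆S v (inj₁ refl) = T.c∈D
        Legs⊆S v (inj₂ (inj₁ s)) = T.Λ⊆D _ v s
        Legs⊆S v (inj₂ (inj₂ s)) = T.Λ⊆D _ v s
        A : Arc D y₀ j
        A = record { l = l ; path = proj₁ (proj₂ pw) ; l⊆D = λ v v∈ → Legs⊆D v (proj₂ (proj₂ pw) v v∈)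
          ; y~a = proj₁ (proj₂ (spec y₀∈)) ; y′~b = proj₁ (proj₂ (spec j∈))
          ; only = λ v v∈ → proj₂ (proj₂ (spec y₀∈)) v (Legs⊆S v (proj₂ (proj₂ pw) v v∈))
          ; only′ = λ v v∈ → proj₂ (proj₂ (spec j∈)) v (Legs⊆S v (proj₂ (proj₂ pw) v v∈)) }
        -- The two legs are anticomplete, so a path from one to the other must use the centre.
        c∈l : T.c ∈ l
        c∈l with T.c ∈? l
        ... | yes c∈ = c∈
        ... | no c∉ = contradiction (T.leg-own F.zero (F.suc (F.suc F.zero)) (proj₂ (walk-end leftwards))) λ ()
          where
          in-leg : ∀ v → v ∈ l → T.Λ F.zero v ⊎ T.Λ (F.suc (F.suc F.zero)) v
          in-leg v v∈ with proj₂ (proj₂ pw) v v∈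
          ... | inj₁ refl = contradiction v∈ c∉
          ... | inj₂ r = r
          first-left : T.Λ F.zero (x y₀)
          first-left with walk-end (T.walk F.zero)
          ... | inj₁ e = contradiction (subst (_∈ l) e (first∈ (proj₁ (proj₂ pw)))) c∉
          ... | inj₂ r = r
          leftwards = walk-closed (T.Λ F.zero) (λ u w Λu e w∈ → [ id , (λ Λ₂w → contradiction e (proj₂ (T.anti _ _ p02 u w Λu Λ₂w))) ]′ (in-leg w w∈))
            (path→walk (proj₁ (proj₂ pw))) first-left
        B = H₂.hull-arc y₀∈ j∈ b₀ⱼ
        inB = H₂.hull-in-arc y₀∈ i∈ j∈ b₀ᵢ bᵢⱼ b₀ⱼ
        hole = arc-hole D-E (off-D y₀ (up y₀∈)) (off-E y₀ (up y₀∈)) (off-D j (up j∈)) (off-E j (up j∈)) y₀≢j (stable y₀ j (up y₀∈) (up j∈)) A B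
        cf = D-E T.c _ (S₁.S⊆D _ T.c∈D) (Arc.l⊆D B _ (proj₁ inB))
        cg = D-E T.c _ (S₁.S⊆D _ T.c∈D) (Arc.l⊆D B _ (proj₂ inB))
        f≁g : ¬ (sp P (f i) ~ sp P (g i))
        f≁g e with spI P _ _ fᵢ≤ gᵢ≤ e
        ... | inj₁ r = <-irrefl (sym r) far
        ... | inj₂ r = <-irrefl r (<-trans f<gᵢ (n<1+n _))

    PureHulls : ℕ → Set₁
    PureHulls m = Σ[ y₀ ∈ V ] Σ[ vs ∈ List V ] y₀ ∈ ws × vs ⊑ ws ×
      AllPairs (λ y y′ → y ≢ y′ × Before y y′) vs × (∀ w → w ∈ vs → y₀ ≢ w × Before y₀ w) × m ≤ length vs ×
      ((S₁.ClawFree y₀ vs × (∀ v → v ∈ vs → Long v)) ⊎ (S₁.NetFree y₀ vs × (∀ v → v ∈ vs → g v ≡ suc (f v))))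

    pure-hulls : ∀ m → suc m + suc m ≤ length ws → AllPairs _≢_ ws → PureHulls m
    pure-hulls m large u with split-large Long? ws (suc m) (suc m) large
    ... | inj₁ b = long (filter Long? ws) (λ z → filter-∈ Long? ws) (AllPairsₚ.filter⁺ Long? (AllPairs.zip (u , H₂.hulls))) (λ z → filter-holds Long? ws) b
      where
      long : ∀ xs → xs ⊑ ws → AllPairs (λ y y′ → y ≢ y′ × Before y y′) xs → (∀ x → x ∈ xs → Long x) → suc m ≤ length xs → PureHulls m
      long (y₀ ∷ vs) sub (r₀ ∷ rs) all (s≤s le) = y₀ , vs , sub y₀ (here refl) , (λ v v∈ → sub v (there v∈)) , rs , (λ w → All.lookup r₀) , le ,
        inj₁ (S₁.ordered-claw-free y₀ vs (pairs vs (λ v v∈ → sub v (there v∈)) (λ v → All.lookup r₀) (λ v v∈ → all v (there v∈)) rs) , λ v v∈ → all v (there v∈))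
        where
        pairs : ∀ vs → vs ⊑ ws → (∀ v → v ∈ vs → y₀ ≢ v × Before y₀ v) → (∀ v → v ∈ vs → Long v) → AllPairs (λ y y′ → y ≢ y′ × Before y y′) vs →
          AllPairs (λ i j → ¬ Claw S₁.S (three (S₁.x y₀) (S₁.x i) (S₁.x j))) vs
        pairs [] _ _ _ _ = []
        pairs (v ∷ vs) sv b lg (r ∷ rs) = All.tabulate (λ {w} w∈ → no-claw (sub y₀ (here refl)) (sv v (here refl)) (sv w (there w∈))
            (proj₁ (b v (here refl))) (proj₁ (b w (there w∈))) (proj₁ (All.lookup r w∈)) (proj₂ (b v (here refl))) (proj₂ (b w (there w∈))) (proj₂ (All.lookup r w∈)) (lg v (here refl)))
          ∷ pairs vs (λ w w∈ → sv w (there w∈)) (λ w w∈ → b w (there w∈)) (λ w w∈ → lg w (there w∈)) rs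
    ... | inj₂ b = short (filter ¬L? ws) (λ z → filter-∈ ¬L? ws) (AllPairsₚ.filter⁺ ¬L? (AllPairs.zip (u , H₂.hulls)))
          (λ z z∈ → ≤-antisym (s≤s⁻¹ (≰⇒> (filter-holds ¬L? ws z∈))) (H₂.f<g z (filter-∈ ¬L? ws z∈))) b
      where
      ¬L? = λ y → ¬? (Long? y)
      short : ∀ xs → xs ⊑ ws → AllPairs (λ y y′ → y ≢ y′ × Before y y′) xs → (∀ x → x ∈ xs → g x ≡ suc (f x)) → suc m ≤ length xs → PureHulls m
      short (y₀ ∷ vs) sub (r₀ ∷ rs) all (s≤s le) = y₀ , vs , sub y₀ (here refl) , (λ v v∈ → sub v (there v∈)) , rs , (λ w → All.lookup r₀) , le ,
        inj₂ (S₁.ordered-net-free y₀ vs (pairs vs (λ v v∈ → sub v (there v∈)) (λ v → All.lookup r₀) (λ v v∈ → all v (there v∈)) rs) , λ v v∈ → all v (there v∈))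
        where
        pairs : ∀ vs → vs ⊑ ws → (∀ v → v ∈ vs → y₀ ≢ v × Before y₀ v) → (∀ v → v ∈ vs → g v ≡ suc (f v)) → AllPairs (λ y y′ → y ≢ y′ × Before y y′) vs →
          AllPairs (λ i j → ¬ Net S₁.S (three (S₁.x y₀) (S₁.x i) (S₁.x j))) vs
        pairs [] _ _ _ _ = []
        pairs (v ∷ vs) sv b sh (r ∷ rs) = All.tabulate (λ {w} w∈ → no-net (sub y₀ (here refl)) (sv v (here refl)) (sv w (there w∈))
            (proj₁ (b v (here refl))) (proj₁ (b w (there w∈))) (proj₁ (All.lookup r w∈)) (proj₂ (b v (here refl))) (proj₂ (b w (there w∈))) (proj₂ (All.lookup r w∈)) (sh v (here refl)))
          ∷ pairs vs (λ w w∈ → sv w (there w∈)) (λ w w∈ → b w (there w∈)) (λ w w∈ → sh w (there w∈)) rs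

  -- The dominator tree when every label has a unique neighbour.

  module RootedSide {S : Fin n → Set} {ws : List (Fin n)} {s₀ : Fin n} (C : Critical.CriticalSet S ws s₀)
    (x : Fin n → Fin n) (attached : ∀ y → y ∈ ws → ∀ w → S w → Edge G y w → w ≡ x y)
    (no-hole : ∀ {h a b l} → IPath a b l → 3 ≤ length l → (∀ z → z ∈ l → h ≢ z × (Edge G h z → z ≡ a ⊎ z ≡ b)) →
      Edge G h a → Edge G h b → (∀ z → z ∈ h ∷ l → Critical.CriticalSet.X C z) → ⊥) where
    open Tripods
    open Critical
    open Dominators C public

    x∈X : ∀ {y} → y ∈ ws → X (x y)
    x∈X y∈ with reach _ y∈
    ... | w , yw , p = subst X (attached _ y∈ w (X⊆D w (walk-end p)) yw) (walk-end p)

    below : ∀ v → X v → v ≢ s₀ → Σ[ y ∈ V ] y ∈ ws × W v (x y)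
    below v xv ne with private-terminal v xv ne
    ... | y , y∈ , _ , w , yw , dw = y , y∈ , subst (W v) (attached y y∈ w (X⊆D w (proj₁ (proj₂ dw))) yw) dw

    Child : V → V → Set
    Child s k = s ~ k × W s k

    Child? : ∀ s k → Dec (Child s k)
    Child? s k = s ~? k ×-dec W? s k

    child-up : ∀ {s k} → Child s k → ¬ W k s
    child-up (e , w) w′ = ~-irr e (dom-antisym w w′)

    under≢s₀ : ∀ {s v} → W s v → v ≢ s → v ≢ s₀
    under≢s₀ w ne refl = ne (dom-antisym (dom-s₀ _ (proj₁ w)) w)

    child≢s₀ : ∀ {s k} → Child s k → k ≢ s₀
    child≢s₀ (e , w) = under≢s₀ w (~-irr e ∘ sym)

    -- k′ is reached through s, hence avoiding its sibling k.
    sibling : ∀ {s k k′} → Child s k → Child s k′ → k ≢ k′ → ¬ W k k′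
    sibling c (e′ , w′) ne d = proj₂ (proj₂ d) (walk-snoc (free (proj₁ (proj₂ (proj₂ c))) (proj₁ w′) (child-up c)) e′ (proj₁ (proj₂ w′) , ne ∘ sym))

    siblings-separate : ∀ {s k k′} → Child s k → Child s k′ → k ≢ k′ → ∀ u w → W k u → W k′ w → u ≢ w × (u ~ w → u ≡ k × w ≡ k′)
    siblings-separate c c′ ne = separate (sibling c c′ ne) (sibling c′ c (ne ∘ sym))

    only-child : ∀ {s k v} → Child s k → W k v → s ~ v → v ≡ k
    only-child {s} {k} {v} c w e with v ≟ k
    ... | yes r = r
    ... | no ne = contradiction w (sibling c (e , dom-trans (proj₂ c) w) (ne ∘ sym))

    stem-sees : ∀ {s u w} → Stem s u → W s w → w ≢ s → u ≢ w × (u ~ w → u ≡ s)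
    stem-sees st@(_ , inj₁ r) dw w≢s = (λ { refl → w≢s r }) , λ _ → r
    stem-sees st@(_ , inj₂ p) (_ , xw , ¬p) w≢s = (λ { refl → ¬p p }) , λ e → contradiction (walk-snoc p e (xw , w≢s)) ¬p

    private
      stem-split : ∀ {s v} → Stem s v → v ≡ s ⊎ (Stem s v × v ≢ s)
      stem-split {s} {v} st with v ≟ s
      ... | yes e = inj₁ e
      ... | no ne = inj₂ (st , ne)

    child≢ : ∀ {s k w} → Child s k → W k w → w ≢ s
    child≢ c w refl = child-up c w

    stem-walk : ∀ s → X s → Walk (λ v → v ≡ s ⊎ (Stem s v × v ≢ s)) s s₀
    stem-walk s xs = walk-map (λ _ → stem-split) (walk-reverse (stem s xs))

    -- Empty if y is attached to s itself.
    Leg : V → V → VSet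
    Leg s y v = Σ[ k ∈ V ] Child s k × W k (x y) × W k v

    -- A vertex of a dominator tree need not be adjacent to its tree children. This property lets
    -- the tree be followed along edges of the graph; it is proved separately in the claw-free and
    -- the net-free case, both times from the absence of holes.
    HasChildren : Set
    HasChildren = ∀ s v → W s v → v ≢ s → Σ[ k ∈ V ] Child s k × W k v

    leg-walk : HasChildren → ∀ s y → W s (x y) → Walk (λ v → v ≡ s ⊎ Leg s y v) s (x y)
    leg-walk hc s y w with x y ≟ s
    ... | yes e = subst (Walk _ s) (sym e) (here (inj₁ refl))
    ... | no ne with hc s (x y) w ne
    ...   | k , c , wk = step (inj₁ refl) (proj₁ c) (walk-map (λ v r → inj₂ (k , c , wk , r)) (inside wk))

    -- Two induced paths from s that diverge at the child k but see it again close up to a hole, or put a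
    -- second neighbour of k at distance two from s.
    module Diverge {s v : V} (w : W s v) (v≢s : v ≢ s) where

      record Detour : Set where
        field
          {k k′ c} : V
          M        : List V
          ck       : Child s k
          ck′      : Child s k′
          k≢k′     : k ≢ k′
          path     : IPath k′ c M
          k~c      : k ~ c
          s-only   : ∀ z → z ∈ M → s ≢ z × (s ~ z → z ≡ k′)
          c≢k′     : c ≢ k′
          M⊆       : ∀ z → z ∈ M → W s z × z ≢ k × Walk (X ∖ k) s₀ z

      private
        last-edge : ∀ {a b l} → IPath a b l → a ≢ b → Σ[ z ∈ V ] z ∈ l × z ≢ b × z ~ b
        last-edge [-] ne = contradiction refl ne
        last-edge {b = b} (cons {w = w} e ind p) ne with w ≟ b
        ... | yes refl = _ , here refl , ne , e
        ... | no w≢b with last-edge p w≢b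
        ...   | z , z∈ , z≢ , zb = z , there z∈ , z≢ , zb

      child-or-detour : (Σ[ k ∈ V ] Child s k × W k v) ⊎ Detour
      child-or-detour with walk→path (inside w)
      ... | _ , [-] , _ = contradiction refl v≢s
      ... | _ , cons {w = k} e ind p , inW with W? k v
      ...   | yes wk = inj₁ (k , (e , inW k (there (first∈ p))) , wk)
      ...   | no ¬wk with path-until (λ z → ¬? (W? k z)) p ¬wk
      ...     | c , l′ , q , ¬kc , sub , only with last-edge q (λ { refl → ¬kc (dom-refl k (proj₁ (proj₂ (inW k (there (first∈ p)))))) })
      ...       | z , z∈ , z≢c , zc = detour (walk→path (inside-via (λ _ → proj₁) wc kept))
        where
        ck : Child s k
        ck = e , inW k (there (first∈ p))
        xk : X k
        xk = proj₁ (proj₂ (proj₂ ck))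
        wc : W s c
        wc = inW c (there (sub c (last∈ q)))
        xc = proj₁ (proj₂ wc)
        kz : W k z
        kz = decidable-stable (W? k z) λ ¬kz → z≢c (only z z∈ ¬kz)
        -- `z` is the vertex before `c` on the path and still lies in `W k`; as an edge leaves `W k`
        -- only at `k`, it is `k` itself.
        k~c : k ~ c
        k~c = subst (_~ c) (exit kz xc ¬kc zc) zc
        s≁c : ¬ (s ~ c)
        s≁c a = ¬kc (subst (W k) (sym (proj₂ (ind c (sub c (last∈ q))) a)) (dom-refl k xk))
        kept : Walk (X ∖ k) s₀ c
        kept = free xk xc ¬kc
        s-kept : Walk (X ∖ k) s₀ s
        s-kept = free xk (proj₁ w) (child-up ck)
        detour : Σ[ l ∈ List V ] IPath s c l × (∀ z → z ∈ l → (X ∖ k) z × W s z) → _ ⊎ Detour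
        detour (_ , [-] , _) = contradiction refl (proj₁ (ind c (sub c (last∈ q))))
        detour (_ , cons {w = k′} {l = M} e′ ind′ p′ , inM) = inj₂ (record
          { M = M ; ck = ck ; ck′ = e′ , proj₂ (inM k′ (there (first∈ p′)))
          ; k≢k′ = λ r → proj₂ (proj₁ (inM k′ (there (first∈ p′)))) (sym r)
          ; path = p′ ; k~c = k~c ; s-only = ind′ ; c≢k′ = λ { refl → s≁c e′ }
          ; M⊆ = λ z z∈ → proj₂ (inM z (there z∈)) , proj₂ (proj₁ (inM z (there z∈))) ,
              walk-trans s-kept (step (proj₁ (inM s (here refl))) e′ (walk-map (λ u u∈ → proj₁ (inM u (there u∈))) (path→walk-from p′ z z∈))) })

    module ClawFreeSide (claw-free : ∀ i j → i ∈ ws → j ∈ ws → i ≢ j → ¬ Claw S (three s₀ (x i) (x j))) where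

      private
        legs : ∀ {s} → X s → (y y′ : V) → y ∈ ws → y′ ∈ ws → y ≢ y′ → (A B : VSet) →
          (∀ v → A v → W s v × v ≢ s) → (∀ v → B v → W s v × v ≢ s) → Anti A B →
          Walk (λ v → v ≡ s ⊎ A v) s (x y) → Walk (λ v → v ≡ s ⊎ B v) s (x y′) → ⊥
        legs {s} xs y y′ y∈ y′∈ ne A B inA inB anti wA wB = claw-free y y′ y∈ y′∈ ne (record
          { c = s ; Λ = three (λ v → Stem s v × v ≢ s) A B ; c∈D = X⊆D s xs
          ; Λ⊆D = λ { F.zero v r → X⊆D v (proj₁ (proj₁ r)) ; (F.suc F.zero) v r → X⊆D v (proj₁ (proj₂ (proj₁ (inA v r)))) ; (F.suc (F.suc F.zero)) v r → X⊆D v (proj₁ (proj₂ (proj₁ (inB v r)))) }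
          ; c∉Λ = λ { F.zero r → proj₂ r refl ; (F.suc F.zero) r → proj₂ (inA s r) refl ; (F.suc (F.suc F.zero)) r → proj₂ (inB s r) refl }
          ; anti = λ { _ _ p01 u w (st , u≢s) a → none u≢s (stem-sees st (proj₁ (inA w a)) (proj₂ (inA w a)))
                     ; _ _ p02 u w (st , u≢s) b → none u≢s (stem-sees st (proj₁ (inB w b)) (proj₂ (inB w b)))
                     ; _ _ p12 → anti }
          ; walk = λ { F.zero → stem-walk s xs ; (F.suc F.zero) → wA ; (F.suc (F.suc F.zero)) → wB } })
          where
          none : ∀ {u w} → u ≢ s → u ≢ w × (u ~ w → u ≡ s) → u ≢ w × ¬ (u ~ w)
          none u≢s (a , b) = a , λ e → u≢s (b e)

      -- Each child dominates the neighbour of some label, by minimality. Two nonadjacent children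
      -- with their subtrees, and the stem to the root, are the legs of a claw centred at `s`.
      children-adjacent : ∀ {s k k′} → Child s k → Child s k′ → k ≢ k′ → k ~ k′
      children-adjacent {s} {k} {k′} c c′ ne with k ~? k′
      ... | yes e = e
      ... | no k≁k′ with below k (proj₁ (proj₂ (proj₂ c))) (child≢s₀ c) | below k′ (proj₁ (proj₂ (proj₂ c′))) (child≢s₀ c′)
      ...   | y , y∈ , wy | y′ , y′∈ , wy′ = ⊥-elim (legs (proj₁ (proj₂ c)) y y′ y∈ y′∈
                (λ { refl → proj₁ (sep _ _ wy wy′) refl }) (W k) (W k′) (inW c) (inW c′)
                (λ u w a b → proj₁ (sep u w a b) , λ e → k≁k′ (subst₂ _~_ (proj₁ (proj₂ (sep u w a b) e)) (proj₂ (proj₂ (sep u w a b) e)) e))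
                (step (inj₁ refl) (proj₁ c) (walk-map (λ _ → inj₂) (inside wy))) (step (inj₁ refl) (proj₁ c′) (walk-map (λ _ → inj₂) (inside wy′))))
        where
        sep = siblings-separate c c′ ne
        inW : ∀ {k} → Child s k → ∀ v → W k v → W s v × v ≢ s
        inW c v d = dom-trans (proj₂ c) d , child≢ c d

      -- On a detour, `k` and `k′` are adjacent. Let `d` be the first neighbour of `k` on the detour
      -- after `k′`. If `d` is not the successor `m` of `k′`, there is a hole through `k` and `k′`;
      -- if it is, `k` is the centre of a claw with legs through `s`, into its own subtree and into
      -- that of `m`.
      has-children : HasChildren
      has-children s v w v≢s with Diverge.child-or-detour w v≢s
      ... | inj₁ r = r
      ... | inj₂ δ = ⊥-elim (absurd δ)
        where
        absurd : Diverge.Detour w v≢s → ⊥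
        absurd record { M = _ ; path = [-] ; c≢k′ = c≢k′ } = c≢k′ refl
        absurd record { k = k ; k′ = k′ ; ck = ck ; ck′ = ck′ ; k≢k′ = k≢k′ ; path = cons {w = m} e ind p ; k~c = k~c ; s-only = s-only ; M⊆ = M⊆ }
          with path-until (k ~?_) p k~c
        ... | d , M₃ , q , kd , sub , only with m ≟ d
        ...   | no m≢d = no-hole (cons e (λ z z∈ → ind z (sub z z∈)) q) (s≤s (two q m≢d))
                (λ { z (here refl) → k≢k′ , λ _ → inj₁ refl
                   ; z (there z∈) → (λ r → proj₁ (proj₂ (M⊆ z (there (sub z z∈)))) (sym r)) , λ a → inj₂ (only z z∈ a) })
                (children-adjacent ck ck′ k≢k′) kd
                (λ { z (here refl) → proj₁ (proj₂ (proj₂ ck)) ; z (there (here refl)) → proj₁ (proj₂ (proj₂ ck′))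
                   ; z (there (there z∈)) → proj₁ (proj₂ (proj₁ (M⊆ z (there (sub z z∈))))) })
          where
          two : ∀ {a b l} → IPath a b l → a ≢ b → 2 ≤ length l
          two [-] ne = contradiction refl ne
          two (cons _ _ [-]) _ = s≤s (s≤s z≤n)
          two (cons _ _ (cons _ _ _)) _ = s≤s (s≤s z≤n)
        -- `m` and `k` do not dominate each other, and `s` misses `m`, so the three legs at `k` are
        -- anticomplete. Labels below `k` and below `m` provide two ends of the claw.
        ...   | yes refl with below k (proj₁ (proj₂ (proj₂ ck))) (child≢s₀ ck) | below m xm (under≢s₀ wm m≢s)
          where
          wm : W s m
          wm = proj₁ (M⊆ m (there (first∈ p)))
          m≢s : m ≢ s
          m≢s r = proj₁ (s-only m (there (first∈ p))) (sym r)
          xm = proj₁ (proj₂ wm)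
        ...     | y , y∈ , wy | y′ , y′∈ , wy′ = claw-free y y′ y∈ y′∈ (λ { refl → proj₁ (sep _ _ wy wy′) refl }) (record
            { c = k ; Λ = three (Stem s) (λ v → W k v × v ≢ k) (W m) ; c∈D = X⊆D k xk
            ; Λ⊆D = λ { F.zero v st → X⊆D v (proj₁ st) ; (F.suc F.zero) v r → X⊆D v (proj₁ (proj₂ (proj₁ r))) ; (F.suc (F.suc F.zero)) v r → X⊆D v (proj₁ (proj₂ r)) }
            ; c∉Λ = λ { F.zero st → ~-irr (proj₁ ck) (sym (stem-out st (proj₂ ck))) ; (F.suc F.zero) r → proj₂ r refl ; (F.suc (F.suc F.zero)) → ¬mk }
            ; anti = λ { _ _ p01 u w st (a , w≢k) → stem-anti st (dom-trans (proj₂ ck) a) (child≢ ck a) (λ e → w≢k (only-child ck a e))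
                       ; _ _ p02 u w st b → stem-anti st (dom-trans wm b) (λ { refl → ¬ms b }) (λ e → s≁m (subst (s ~_) (exit b (proj₁ (proj₂ ck)) ¬ms (~-sym e)) e))
                       ; _ _ p12 u w (a , u≢k) b → proj₁ (sep u w a b) , λ e → u≢k (proj₁ (proj₂ (sep u w a b) e)) }
            ; walk = λ { F.zero → step (inj₁ refl) (~-sym (proj₁ ck)) (walk-map (λ _ → inj₂) (walk-reverse (stem s (proj₁ (proj₂ ck)))))
                       ; (F.suc F.zero) → walk-map (λ u → split u) (inside wy)
                       ; (F.suc (F.suc F.zero)) → step (inj₁ refl) kd (walk-map (λ _ → inj₂) (inside wy′)) } })
          where
          xk = proj₁ (proj₂ (proj₂ ck))
          m∈ = there (first∈ p)
          wm : W s m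
          wm = proj₁ (M⊆ m m∈)
          m≢s : m ≢ s
          m≢s r = proj₁ (s-only m m∈) (sym r)
          m≢k : m ≢ k
          m≢k = proj₁ (proj₂ (M⊆ m m∈))
          m≢k′ : m ≢ k′
          m≢k′ r = proj₁ (ind m (first∈ p)) (sym r)
          s≁m : ¬ (s ~ m)
          s≁m a = m≢k′ (proj₂ (s-only m m∈) a)
          ¬km : ¬ W k m
          ¬km (_ , _ , ¬p) = ¬p (proj₂ (proj₂ (M⊆ m m∈)))
          ¬ms : ¬ W m s
          ¬ms r = m≢s (sym (dom-antisym wm r))
          ¬mk : ¬ W m k
          ¬mk (xm , _ , ¬p) = ¬p (walk-snoc (free xm (proj₁ (proj₂ ck)) ¬ms) (proj₁ ck) (xk , m≢k ∘ sym))
          sep = separate ¬km ¬mk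
          split : ∀ u → W k u → u ≡ k ⊎ (W k u × u ≢ k)
          split u a with u ≟ k
          ... | yes r = inj₁ r
          ... | no r = inj₂ (a , r)
          stem-anti : ∀ {u w} → Stem s u → W s w → w ≢ s → ¬ (s ~ w) → u ≢ w × ¬ (u ~ w)
          stem-anti st dw w≢s s≁w with stem-sees st dw w≢s
          ... | a , b = a , λ e → s≁w (subst (_~ _) (b e) e)

      -- A claw centred at `s` with an empty leg to the label attached there, a leg to the other
      -- label and the stem.
      terminal-alone : ∀ {s} y y′ → y ∈ ws → y′ ∈ ws → y ≢ y′ → x y ≡ s → W s (x y′) → ⊥
      terminal-alone {s} y y′ y∈ y′∈ ne refl w = legs (proj₁ w) y y′ y∈ y′∈ ne (λ _ → ⊥) (Leg s y′) (λ v ())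
        (λ { v (k , c , _ , d) → dom-trans (proj₂ c) d , child≢ c d }) (λ u w ()) (here (inj₁ refl)) (leg-walk has-children s y′ w)

    module NetFreeSide (net-free : ∀ i j → i ∈ ws → j ∈ ws → i ≢ j → ¬ Net S (three s₀ (x i) (x j))) where

      -- Two adjacent children form a triangle with `s`; the stem and the two subtrees complete it
      -- to a net.
      children-apart : ∀ {s k k′} → Child s k → Child s k′ → k ≢ k′ → ¬ (k ~ k′)
      children-apart {s} {k} {k′} c c′ ne k~k′ with below k (proj₁ (proj₂ (proj₂ c))) (child≢s₀ c) | below k′ (proj₁ (proj₂ (proj₂ c′))) (child≢s₀ c′)
      ... | y , y∈ , wy | y′ , y′∈ , wy′ = net-free y y′ y∈ y′∈ (λ { refl → proj₁ (sep _ _ wy wy′) refl }) (record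
          { c = three s k k′ ; Λ = three (Stem s) (W k) (W k′)
          ; Λ⊆D = λ { F.zero v st → X⊆D v (proj₁ st) ; (F.suc F.zero) v r → X⊆D v (proj₁ (proj₂ r)) ; (F.suc (F.suc F.zero)) v r → X⊆D v (proj₁ (proj₂ r)) }
          ; edges = λ { _ _ p01 → proj₁ c ; _ _ p02 → proj₁ c′ ; _ _ p12 → k~k′ }
          ; cross = λ { _ _ p01 u w st a → stem-cross c st a ; _ _ p02 u w st b → stem-cross c′ st b ; _ _ p12 → sep }
          ; walk = λ { F.zero → walk-reverse (stem s (proj₁ (proj₂ c))) ; (F.suc F.zero) → inside wy ; (F.suc (F.suc F.zero)) → inside wy′ } })
        where
        sep = siblings-separate c c′ ne
        stem-cross : ∀ {k u w} → Child s k → Stem s u → W k w → u ≢ w × (u ~ w → u ≡ s × w ≡ k)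
        stem-cross c st d with stem-sees st (dom-trans (proj₂ c) d) (child≢ c d)
        ... | a , b = a , λ e → b e , only-child c d (subst (_~ _) (b e) e)

      -- The children `k` and `k′` are not adjacent, so the detour from `k′` to the first neighbour
      -- of `k` has at least two vertices and closes up to a hole through `k` and `s`.
      has-children : HasChildren
      has-children s v w v≢s with Diverge.child-or-detour w v≢s
      ... | inj₁ r = r
      ... | inj₂ δ = ⊥-elim (absurd δ)
        where
        absurd : Diverge.Detour w v≢s → ⊥
        absurd record { k = k ; k′ = k′ ; ck = ck ; ck′ = ck′ ; k≢k′ = k≢k′ ; path = p ; k~c = k~c ; s-only = s-only ; M⊆ = M⊆ }
          with path-until (k ~?_) p k~c
        ... | d , M′ , q , kd , sub , only = no-hole (cons (proj₁ ck′) (λ z z∈ → s-only z (sub z z∈)) q) (s≤s (two q))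
            (λ { z (here refl) → (λ r → ~-irr (proj₁ ck) (sym r)) , λ _ → inj₁ refl
               ; z (there z∈) → (λ r → proj₁ (proj₂ (M⊆ z (sub z z∈))) (sym r)) , λ a → inj₂ (only z z∈ a) })
            (~-sym (proj₁ ck)) kd
            (λ { z (here refl) → proj₁ (proj₂ (proj₂ ck)) ; z (there (here refl)) → proj₁ w
               ; z (there (there z∈)) → proj₁ (proj₂ (proj₁ (M⊆ z (sub z z∈)))) })
          where
          two : ∀ {l} → IPath k′ d l → 2 ≤ length l
          two [-] = contradiction kd (children-apart ck ck′ k≢k′)
          two (cons _ _ [-]) = s≤s (s≤s z≤n)
          two (cons _ _ (cons _ _ _)) = s≤s (s≤s z≤n)

  -- Combs: spines with teeth on vertices or on edges.

  module Combs where

    consSpine : (s : V) (P : Spine) → s ~ sp P 0 → (∀ i → i ≤ N P → s ≢ sp P i × (s ~ sp P i → i ≡ 0)) → Spine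
    consSpine s P e only = record
      { sp = λ { zero → s ; (suc i) → sp P i } ; N = suc (N P)
      ; spE = λ { zero _ → e ; (suc i) (s≤s lt) → spE P i lt }
      ; spI = λ { zero zero _ _ a → contradiction refl (~-irr a)
                ; zero (suc j) _ (s≤s b) a → inj₁ (cong suc (proj₂ (only j b) a))
                ; (suc i) zero (s≤s a) _ e → inj₂ (cong suc (proj₂ (only i a) (~-sym e)))
                ; (suc i) (suc j) (s≤s a) (s≤s b) e → Sum.map (cong suc) (cong suc) (spI P i j a b e) }
      ; spJ = λ { zero zero _ _ _ → refl
                ; zero (suc j) _ (s≤s b) r → contradiction r (proj₁ (only j b))
                ; (suc i) zero (s≤s a) _ r → contradiction (sym r) (proj₁ (only i a))
                ; (suc i) (suc j) (s≤s a) (s≤s b) r → cong suc (spJ P i j a b r) } }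

    trivialSpine : V → Spine
    trivialSpine s = record { sp = λ _ → s ; N = 0 ; spE = λ i () ; spI = λ { i j _ _ e → contradiction refl (~-irr e) } ; spJ = λ { zero zero _ _ _ → refl } }

    -- The spine vertex is kept out of `Λ`, so that a label attached to the spine itself can have an
    -- empty leg.
    record VertexTooth (τ : V → V) (P : Spine) (y : V) : Set₁ where
      field
        pos  : ℕ
        Λ    : VSet
        pos≤ : pos ≤ N P
        leg  : Walk (λ v → v ≡ sp P pos ⊎ Λ v) (sp P pos) (τ y)
        sees : ∀ u i → Λ u → i ≤ N P → u ≢ sp P i × (u ~ sp P i → i ≡ pos)

    record EdgeTooth (τ : V → V) (P : Spine) (y : V) : Set₁ where
      field
        pos  : ℕ
        Λ    : VSet
        r    : V
        pos< : pos < N P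
        r~   : r ~ sp P pos × r ~ sp P (suc pos)
        leg  : Walk Λ r (τ y)
        sees : ∀ u i → Λ u → i ≤ N P → u ≢ sp P i × (u ~ sp P i → u ≡ r × (i ≡ pos ⊎ i ≡ suc pos))

    record VertexComb (τ : V → V) (U : VSet) (J : List V) : Set₁ where
      field
        P     : Spine
        teeth : ∀ y → y ∈ J → VertexTooth τ P y
        P⊆U   : ∀ i → i ≤ N P → U (sp P i)
        Λ⊆U   : ∀ y (p : y ∈ J) v → VertexTooth.Λ (teeth y p) v → U v
        apart : ∀ y y′ (p : y ∈ J) (q : y′ ∈ J) → y ≢ y′ → Anti (VertexTooth.Λ (teeth y p)) (VertexTooth.Λ (teeth y′ q))

    -- Positions are distinct here and may repeat in a vertex comb, just as the `z` of a generalized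
    -- pyramid may coincide while its edges on `P` may not.
    record EdgeComb (τ : V → V) (U : VSet) (J : List V) : Set₁ where
      field
        P     : Spine
        teeth : ∀ y → y ∈ J → EdgeTooth τ P y
        P⊆U   : ∀ i → i ≤ N P → U (sp P i)
        Λ⊆U   : ∀ y (p : y ∈ J) v → EdgeTooth.Λ (teeth y p) v → U v
        apart : ∀ y y′ (p : y ∈ J) (q : y′ ∈ J) → y ≢ y′ → Anti (EdgeTooth.Λ (teeth y p)) (EdgeTooth.Λ (teeth y′ q))
        pos-≢ : ∀ y y′ (p : y ∈ J) (q : y′ ∈ J) → y ≢ y′ → EdgeTooth.pos (teeth y p) ≢ EdgeTooth.pos (teeth y′ q)

    shift-vertex : ∀ {τ U U′ J} (C : VertexComb τ U J) (s : V) → (∀ v → U v → U′ v) → U′ s →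
      s ~ sp (VertexComb.P C) 0 → (∀ v → U v → s ≢ v × (s ~ v → v ≡ sp (VertexComb.P C) 0)) →
      Σ[ C′ ∈ VertexComb τ U′ J ] sp (VertexComb.P C′) 0 ≡ s
    shift-vertex {J = J} C s U⊆ U′s e only = record
        { P = P′ ; teeth = tooth ; P⊆U = λ { zero _ → U′s ; (suc i) (s≤s le) → U⊆ _ (C.P⊆U i le) }
        ; Λ⊆U = λ y p v l → U⊆ v (C.Λ⊆U y p v l) ; apart = C.apart } , refl
      where
      module C = VertexComb C
      P′ : Spine
      P′ = consSpine s C.P e λ i le → proj₁ (only _ (C.P⊆U i le)) , λ a → spJ C.P i 0 le z≤n (proj₂ (only _ (C.P⊆U i le)) a)
      tooth : ∀ y → y ∈ J → VertexTooth _ P′ y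
      tooth y p = record { pos = suc T.pos ; Λ = T.Λ ; pos≤ = s≤s T.pos≤ ; leg = T.leg
        ; sees = λ { u zero l _ → (λ r → proj₁ (only u (C.Λ⊆U y p u l)) (sym r)) ,
                        λ a → contradiction (proj₂ (only u (C.Λ⊆U y p u l)) (~-sym a)) (proj₁ (T.sees u 0 l z≤n))
                   ; u (suc i) l (s≤s le) → proj₁ (T.sees u i l le) , λ a → cong suc (proj₂ (T.sees u i l le) a) } }
        where module T = VertexTooth (C.teeth y p)

    -- The additional conclusions are what hanging a new tooth on the edge from `s` to the old first
    -- vertex requires: position 0 is free, and all old legs stay below and avoid the old first
    -- vertex.
    shift-edge : ∀ {τ U U′ J} (C : EdgeComb τ U J) (s : V) → (∀ v → U v → U′ v) → U′ s →
      s ~ sp (EdgeComb.P C) 0 → (∀ v → U v → s ≢ v × (s ~ v → v ≡ sp (EdgeComb.P C) 0)) →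
      Σ[ C′ ∈ EdgeComb τ U′ J ] sp (EdgeComb.P C′) 0 ≡ s × sp (EdgeComb.P C′) 1 ≡ sp (EdgeComb.P C) 0 × 1 ≤ N (EdgeComb.P C′) ×
        (∀ i → i < N (EdgeComb.P C′) → U (sp (EdgeComb.P C′) (suc i))) ×
        (∀ y (p : y ∈ J) → EdgeTooth.pos (EdgeComb.teeth C′ y p) ≢ 0 × (∀ v → EdgeTooth.Λ (EdgeComb.teeth C′ y p) v → U v × v ≢ sp (EdgeComb.P C) 0))
    shift-edge {J = J} C s U⊆ U′s e only = record
        { P = P′ ; teeth = tooth ; P⊆U = λ { zero _ → U′s ; (suc i) (s≤s le) → U⊆ _ (C.P⊆U i le) }
        ; Λ⊆U = λ y p v l → U⊆ v (C.Λ⊆U y p v l) ; apart = C.apart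
        ; pos-≢ = λ y y′ p q ne r → C.pos-≢ y y′ p q ne (suc-injective r) } , refl , refl , s≤s z≤n ,
        (λ { i (s≤s le) → C.P⊆U i le }) ,
        λ y p → (λ ()) , λ v l → C.Λ⊆U y p v l , proj₁ (EdgeTooth.sees (C.teeth y p) v 0 l z≤n)
      where
      module C = EdgeComb C
      P′ : Spine
      P′ = consSpine s C.P e λ i le → proj₁ (only _ (C.P⊆U i le)) , λ a → spJ C.P i 0 le z≤n (proj₂ (only _ (C.P⊆U i le)) a)
      tooth : ∀ y → y ∈ J → EdgeTooth _ P′ y
      tooth y p = record { pos = suc T.pos ; Λ = T.Λ ; r = T.r ; pos< = s≤s T.pos< ; r~ = T.r~ ; leg = T.leg
        ; sees = λ { u zero l _ → (λ r → proj₁ (only u (C.Λ⊆U y p u l)) (sym r)) ,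
                        λ a → contradiction (proj₂ (only u (C.Λ⊆U y p u l)) (~-sym a)) (proj₁ (T.sees u 0 l z≤n))
                   ; u (suc i) l (s≤s le) → proj₁ (T.sees u i l le) ,
                        λ a → proj₁ (proj₂ (T.sees u i l le) a) , Sum.map (cong suc) (cong suc) (proj₂ (proj₂ (T.sees u i l le) a)) } }
        where module T = EdgeTooth (C.teeth y p)

    add-vertex : ∀ {τ U U′ J} (C : VertexComb τ U J) → (∀ v → U v → U′ v) → (y : V) (Λ : VSet) → (∀ v → Λ v → U′ v) →
      Walk (λ v → v ≡ sp (VertexComb.P C) 0 ⊎ Λ v) (sp (VertexComb.P C) 0) (τ y) →
      (∀ u v → Λ u → U v → u ≢ v × (u ~ v → v ≡ sp (VertexComb.P C) 0)) → VertexComb τ U′ (y ∷ J)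
    add-vertex {J = J} C U⊆ y Λ Λ⊆ lg sees = record
        { P = C.P ; teeth = tooth ; P⊆U = λ i le → U⊆ _ (C.P⊆U i le)
        ; Λ⊆U = λ { _ (here refl) → Λ⊆ ; y′ (there p) v l → U⊆ v (C.Λ⊆U y′ p v l) }
        ; apart = λ { _ _ (here refl) (here refl) ne → contradiction refl ne
                    ; _ y′ (here refl) (there q) ne → new-old y′ q
                    ; y′ _ (there p) (here refl) ne → Anti-sym (new-old y′ p)
                    ; y₁ y₂ (there p) (there q) ne → C.apart y₁ y₂ p q ne } }
      where
      module C = VertexComb C
      tooth : ∀ y′ → y′ ∈ y ∷ J → VertexTooth _ C.P y′
      tooth _ (here refl) = record { pos = 0 ; Λ = Λ ; pos≤ = z≤n ; leg = lg
        ; sees = λ u i l le → proj₁ (sees u _ l (C.P⊆U i le)) , λ a → spJ C.P i 0 le z≤n (proj₂ (sees u _ l (C.P⊆U i le)) a) }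
      tooth y′ (there p) = C.teeth y′ p
      new-old : ∀ y′ (q : y′ ∈ J) → Anti Λ (VertexTooth.Λ (C.teeth y′ q))
      new-old y′ q u v l l′ = proj₁ (sees u v l (C.Λ⊆U y′ q v l′)) ,
        λ a → proj₁ (VertexTooth.sees (C.teeth y′ q) v 0 l′ z≤n) (proj₂ (sees u v l (C.Λ⊆U y′ q v l′)) a)

  module VertexCombs {S : Fin n → Set} {ws : List (Fin n)} {s₀ : Fin n} (C : Critical.CriticalSet S ws s₀)
    (x : Fin n → Fin n) (attached : ∀ y → y ∈ ws → ∀ w → S w → Edge G y w → w ≡ x y)
    (no-hole : ∀ {h a b l} → IPath a b l → 3 ≤ length l → (∀ z → z ∈ l → h ≢ z × (Edge G h z → z ≡ a ⊎ z ≡ b)) →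
      Edge G h a → Edge G h b → (∀ z → z ∈ h ∷ l → Critical.CriticalSet.X C z) → ⊥)
    (net-free : ∀ i j → i ∈ ws → j ∈ ws → i ≢ j → ¬ Tripods.Net S (three s₀ (x i) (x j))) where
    open Combs
    open RootedSide C x attached no-hole
    open NetFreeSide net-free

    Region : V → List V → VSet
    Region s ys v = v ≡ s ⊎ (Σ[ y ∈ V ] y ∈ ys × Leg s y v)

    Result : ℕ → V → List V → Set₁
    Result m s ys = Σ[ J ∈ List V ] J ⊑ ys × AllPairs _≢_ J × length J ≡ m ×
      (Σ[ K ∈ VertexComb x (Region s ys) J ] sp (VertexComb.P K) 0 ≡ s)

    private
      leg≢ : ∀ {s y v} → Leg s y v → v ≢ s
      leg≢ (k , c , _ , d) = child≢ c d

      legs-apart : ∀ {s y y′} → (∀ k → Child s k → W k (x y) → W k (x y′) → ⊥) → Anti (Leg s y) (Leg s y′)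
      legs-apart diff u w (k , c , d , e) (k′ , c′ , d′ , e′) with k ≟ k′
      ... | yes refl = ⊥-elim (diff k c d d′)
      ... | no ne = proj₁ (siblings-separate c c′ ne u w e e′) ,
            λ a → children-apart c c′ ne (subst₂ _~_ (proj₁ (proj₂ (siblings-separate c c′ ne u w e e′) a)) (proj₂ (proj₂ (siblings-separate c c′ ne u w e e′) a)) a)

      same-child : ∀ {s k k′ v} → Child s k → Child s k′ → W k v → W k′ v → k′ ≡ k
      same-child {s} {k} {k′} c c′ d d′ with k′ ≟ k
      ... | yes e = e
      ... | no ne = contradiction refl (proj₁ (siblings-separate c′ c ne _ _ d′ d))

      weaken : ∀ {m s ys ys′} → ys ⊑ ys′ → Result m s ys → Result m s ys′
      weaken sub (J , J⊑ , u , len , K , e) = J , (λ z z∈ → sub z (J⊑ z z∈)) , u , len , record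
          { P = K.P ; teeth = K.teeth ; P⊆U = λ i le → up _ (K.P⊆U i le) ; Λ⊆U = λ y p v l → up v (K.Λ⊆U y p v l) ; apart = K.apart } , e
        where
        module K = VertexComb K
        up : ∀ v → Region _ _ v → Region _ _ v
        up v (inj₁ r) = inj₁ r
        up v (inj₂ (y , y∈ , l)) = inj₂ (y , sub y y∈ , l)

      add : ∀ {m s ys} y → W s (x y) → (∀ z → z ∈ ys → y ≢ z) → (∀ z → z ∈ ys → ∀ k → Child s k → W k (x y) → W k (x z) → ⊥) →
        Result m s ys → Result (suc m) s (y ∷ ys)
      add {m} {s} {ys} y w fresh diff (J , J⊑ , u , len , K , e) = y ∷ J ,
          (λ { z (here r) → here r ; z (there z∈) → there (J⊑ z z∈) }) , All.tabulate (λ z∈ → fresh _ (J⊑ _ z∈)) ∷ u , cong suc len ,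
          add-vertex K (λ { v (inj₁ r) → inj₁ r ; v (inj₂ (z , z∈ , l)) → inj₂ (z , there z∈ , l) }) y (Leg s y) (λ v l → inj₂ (y , here refl , l))
            (subst (λ q → Walk (λ v → v ≡ q ⊎ Leg s y v) q (x y)) (sym e) (leg-walk has-children s y w)) sees , e
        where
        sees : ∀ u v → Leg s y u → Region s ys v → u ≢ v × (u ~ v → v ≡ sp (VertexComb.P K) 0)
        sees u v l (inj₁ refl) = leg≢ {y = y} l , λ _ → sym e
        sees u v l (inj₂ (z , z∈ , l′)) with legs-apart {y = y} {y′ = z} (diff z z∈) u v l l′
        ... | ne , na = ne , λ a → contradiction a na

      shift : ∀ {m s k ys} y → Child s k → W k (x y) → Result m k ys → Result m s (y ∷ ys)
      shift {m} {s} {k} {ys} y c wy (J , J⊑ , u , len , K , e) = J , (λ z z∈ → there (J⊑ z z∈)) , u , len ,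
          shift-vertex K s (λ v r → inj₂ (y , here refl , k , c , wy , under v r)) (inj₁ refl) (subst (s ~_) (sym e) (proj₁ c))
            λ v r → (λ q → child≢ c (under v r) (sym q)) , λ a → trans (only-child c (under v r) a) (sym e)
        where
        under : ∀ v → Region k ys v → W k v
        under v (inj₁ refl) = dom-refl k (proj₁ (proj₂ (proj₂ c)))
        under v (inj₂ (z , _ , k₂ , c₂ , _ , d)) = dom-trans (proj₂ c₂) d

    -- The first label determines a child `k`. If enough other labels lie outside `W k`, its leg
    -- becomes a tooth at `s` and the construction stays at `s`. Otherwise it moves down to `k`,
    -- with a tooth at `s` for some label outside `W k` if there is one. Children are pairwise
    -- nonadjacent, so legs below different children are anticomplete. The fuel bounds the size of
    -- the current subtree.
    vertex-comb : ∀ fuel m s → X s → size (W? s) ≤ fuel → ∀ ys → AllPairs _≢_ ys → (∀ y → y ∈ ys → W s (x y)) →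
      vertexBound m ≤ length ys → Result m s ys
    vertex-comb fuel zero s xs _ ys _ _ _ = [] , (λ z ()) , [] , refl , record
      { P = trivialSpine s ; teeth = λ y () ; P⊆U = λ _ _ → inj₁ refl ; Λ⊆U = λ y () ; apart = λ y y′ () } , refl
    vertex-comb fuel (suc m) s xs le (y ∷ ys) (y≢ ∷ u) inW (s≤s large) with x y ≟ s
    ... | yes e = add y (inW y (here refl)) (λ z z∈ → All.lookup y≢ z∈) (λ z _ k c d _ → child≢ c d e)
          (vertex-comb fuel m s xs le ys u (λ z z∈ → inW z (there z∈)) (≤-trans (m≤m+n (vertexBound m) (vertexBound m)) large))
    ... | no ne with has-children s (x y) (inW y (here refl)) ne
    ...   | k , c , wk with split-large (λ z → W? k (x z)) ys (vertexBound m) (vertexBound m) large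
    ...     | inj₂ big = weaken (λ { z (here r) → here r ; z (there z∈) → there (filter-∈ out? ys z∈) })
              (add y (inW y (here refl)) (λ z z∈ → All.lookup y≢ (filter-∈ out? ys z∈))
                (λ z z∈ k′ c′ d d′ → filter-holds out? ys z∈ (subst (λ q → W q (x z)) (same-child c c′ wk d) d′))
                (vertex-comb fuel m s xs le (filter out? ys) (AllPairsₚ.filter⁺ out? u) (λ z z∈ → inW z (there (filter-∈ out? ys z∈))) big))
      where out? = λ z → ¬? (W? k (x z))
    vertex-comb zero (suc m) s xs le (y ∷ ys) (y≢ ∷ u) inW (s≤s large) | no ne | k , c , wk | inj₁ big =
      contradiction (subst (_≤ 0) (size-∖ (W? s) s (dom-refl s xs)) le) λ ()
    vertex-comb (suc fuel) (suc m) s xs le (y ∷ ys) (y≢ ∷ u) inW (s≤s large) | no ne | k , c , wk | inj₁ big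
      with forall∈? (λ z → W? k (x z)) ys
    ... | inj₁ all = weaken (λ { z (here refl) → here refl ; z (there z∈) → z∈ })
          (shift y c wk (vertex-comb fuel (suc m) k (proj₁ wk) smaller (y ∷ ys) (y≢ ∷ u) (λ { z (here refl) → wk ; z (there z∈) → all z z∈ }) (s≤s large)))
      where
      smaller : size (W? k) ≤ fuel
      smaller = s≤s⁻¹ (≤-trans (size-< (W? k) (W? s) s (λ v → dom-trans (proj₂ c)) (child-up c) (dom-refl s xs)) le)
    ... | inj₂ (y′ , y′∈ , ¬w) = weaken (λ { z (here refl) → there y′∈ ; z (there (here refl)) → here refl ; z (there (there z∈)) → there (filter-∈ in? ys z∈) })
          (add y′ (inW y′ (there y′∈)) (λ z z∈ r → ¬w (subst (λ q → W k (x q)) (sym r) (near z z∈)))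
            (λ z z∈ k′ c′ d d′ → ¬w (subst (λ q → W q (x y′)) (same-child c c′ (near z z∈) d′) d))
            (shift y c wk (vertex-comb fuel m k (proj₁ wk) smaller (filter in? ys) (AllPairsₚ.filter⁺ in? u) (λ z z∈ → filter-holds in? ys z∈) big)))
      where
      in? = λ z → W? k (x z)
      near : ∀ z → z ∈ y ∷ filter in? ys → W k (x z)
      near z (here refl) = wk
      near z (there z∈) = filter-holds in? ys z∈
      smaller : size (W? k) ≤ fuel
      smaller = s≤s⁻¹ (≤-trans (size-< (W? k) (W? s) s (λ v → dom-trans (proj₂ c)) (child-up c) (dom-refl s xs)) le)

  module EdgeCombs {S : Fin n → Set} {ws : List (Fin n)} {s₀ : Fin n} (C : Critical.CriticalSet S ws s₀)
    (x : Fin n → Fin n) (attached : ∀ y → y ∈ ws → ∀ w → S w → Edge G y w → w ≡ x y)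
    (no-hole : ∀ {h a b l} → IPath a b l → 3 ≤ length l → (∀ z → z ∈ l → h ≢ z × (Edge G h z → z ≡ a ⊎ z ≡ b)) →
      Edge G h a → Edge G h b → (∀ z → z ∈ h ∷ l → Critical.CriticalSet.X C z) → ⊥)
    (claw-free : ∀ i j → i ∈ ws → j ∈ ws → i ≢ j → ¬ Tripods.Claw S (three s₀ (x i) (x j)))
    (t′ : ℕ) (no-clique : ∀ (l : List (Fin n)) → AllPairs (Edge G) l → length l ≢ suc t′) where
    open Combs
    open RootedSide C x attached no-hole
    open ClawFreeSide claw-free

    Result : ℕ → V → List V → Set₁
    Result m s ys = Σ[ J ∈ List V ] J ⊑ ys × AllPairs _≢_ J × length J ≡ m ×
      (Σ[ K ∈ EdgeComb x (W s) J ] sp (EdgeComb.P K) 0 ≡ s)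

    private
      childOf : V → V → V
      childOf s y with Fₚ.any? (λ k → Child? s k ×-dec W? k (x y))
      ... | yes (k , _) = k
      ... | no _ = s

      childOf-spec : ∀ s y → W s (x y) → x y ≢ s → Child s (childOf s y) × W (childOf s y) (x y)
      childOf-spec s y w ne with Fₚ.any? (λ k → Child? s k ×-dec W? k (x y))
      ... | yes (k , r) = r
      ... | no none = contradiction (has-children s (x y) w ne) none

      seesBelow : ∀ {s k} → Child s k → ∀ v → W k v → s ≢ v × (s ~ v → v ≡ k)
      seesBelow c v w = child≢ c w ∘ sym , only-child c w

      shift : ∀ {m s k ys} → Child s k → Result m k ys → Result m s ys
      shift {s = s} c (J , J⊑ , u , len , K , e) = J , J⊑ , u , len , proj₁ r , proj₁ (proj₂ r)
        where r = shift-edge K s (λ v → dom-trans (proj₂ c)) (dom-refl s (proj₁ (proj₂ c))) (subst (s ~_) (sym e) (proj₁ c))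
                    (λ v w → proj₁ (seesBelow c v w) , λ a → trans (proj₂ (seesBelow c v w) a) (sym e))

      shift-add : ∀ {m s k k′ ys} y → Child s k → Child s k′ → k′ ≢ k → W k′ (x y) → (∀ z → z ∈ ys → y ≢ z) →
        Result m k ys → Result (suc m) s (y ∷ ys)
      shift-add {m} {s} {k} {k′} y c c′ k′≢k wy fresh (J , J⊑ , u , len , K , e) = y ∷ J ,
          (λ { z (here r) → here r ; z (there z∈) → there (J⊑ z z∈) }) , All.tabulate (λ z∈ → fresh _ (J⊑ _ z∈)) ∷ u , cong suc len , record
          { P = P ; teeth = tooth ; P⊆U = C′.P⊆U
          ; Λ⊆U = λ { _ (here refl) v l → dom-trans (proj₂ c′) l ; z (there p) → C′.Λ⊆U z p }
          ; apart = λ { _ _ (here refl) (here refl) ne → contradiction refl ne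
                      ; _ z (here refl) (there q) ne → new-old z q
                      ; z _ (there p) (here refl) ne → Anti-sym (new-old z p)
                      ; z z′ (there p) (there q) ne → C′.apart z z′ p q ne }
          ; pos-≢ = λ { _ _ (here refl) (here refl) ne _ → ne refl
                      ; _ z (here refl) (there q) ne r → proj₁ (old z q) (sym r)
                      ; z _ (there p) (here refl) ne r → proj₁ (old z p) r
                      ; z z′ (there p) (there q) ne → C′.pos-≢ z z′ p q ne } } , P0
        where
        shifted = shift-edge K s (λ v → dom-trans (proj₂ c)) (dom-refl s (proj₁ (proj₂ c))) (subst (s ~_) (sym e) (proj₁ c))
                    (λ v w → proj₁ (seesBelow c v w) , λ a → trans (proj₂ (seesBelow c v w) a) (sym e))
        module C′ = EdgeComb (proj₁ shifted)
        P : Spine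
        P = C′.P
        P0 : sp P 0 ≡ s
        P0 = proj₁ (proj₂ shifted)
        P1 : sp P 1 ≡ k
        P1 = trans (proj₁ (proj₂ (proj₂ shifted))) e
        1≤N : 1 ≤ N P
        1≤N = proj₁ (proj₂ (proj₂ (proj₂ shifted)))
        low : ∀ i → i < N P → W k (sp P (suc i))
        low = proj₁ (proj₂ (proj₂ (proj₂ (proj₂ shifted))))
        old : ∀ z (p : z ∈ J) → EdgeTooth.pos (C′.teeth z p) ≢ 0 × (∀ v → EdgeTooth.Λ (C′.teeth z p) v → W k v × v ≢ sp (EdgeComb.P K) 0)
        old = proj₂ (proj₂ (proj₂ (proj₂ (proj₂ shifted))))
        sep = siblings-separate c′ c k′≢k
        tooth : ∀ z → z ∈ y ∷ J → EdgeTooth x P z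
        tooth _ (here refl) = record { pos = 0 ; Λ = W k′ ; r = k′ ; pos< = 1≤N
          ; r~ = subst (k′ ~_) (sym P0) (~-sym (proj₁ c′)) , subst (k′ ~_) (sym P1) (children-adjacent c′ c k′≢k)
          ; leg = inside wy ; sees = sees }
          where
          sees : ∀ u i → W k′ u → i ≤ N P → u ≢ sp P i × (u ~ sp P i → u ≡ k′ × (i ≡ 0 ⊎ i ≡ 1))
          sees u zero l _ = (λ r → child≢ c′ l (trans r P0)) , λ a → only-child c′ l (~-sym (subst (u ~_) P0 a)) , inj₁ refl
          sees u (suc i) l le = proj₁ (sep u _ l (low i le)) , λ a → proj₁ (proj₂ (sep u _ l (low i le)) a) ,
              inj₂ (spJ P (suc i) 1 le 1≤N (trans (proj₂ (proj₂ (sep u _ l (low i le)) a)) (sym P1)))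
        tooth z (there p) = C′.teeth z p
        new-old : ∀ z (q : z ∈ J) → Anti (W k′) (EdgeTooth.Λ (C′.teeth z q))
        new-old z q u v l l′ with old z q
        ... | _ , inside′ = proj₁ (sep u v l (proj₁ (inside′ v l′))) , λ a → proj₂ (inside′ v l′) (trans (proj₂ (proj₂ (sep u v l (proj₁ (inside′ v l′))) a)) (sym e))

      weaken : ∀ {m s ys ys′} → ys ⊑ ys′ → Result m s ys → Result m s ys′
      weaken sub (J , J⊑ , r) = J , (λ z z∈ → sub z (J⊑ z z∈)) , r

      cliqueOf : ∀ {s} ys → AllPairs (λ a b → a ≢ b × childOf s a ≢ childOf s b) ys → (∀ y → y ∈ ys → Child s (childOf s y)) →
        AllPairs _~_ (map (childOf s) ys)
      cliqueOf [] _ _ = []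
      cliqueOf {s} (y ∷ ys) (d ∷ ds) c = All.tabulate edge ∷ cliqueOf ys ds (λ z z∈ → c z (there z∈))
        where
        edge : ∀ {v} → v ∈ map (childOf s) ys → childOf s y ~ v
        edge v∈ with ∈ₚ.∈-map⁻ (childOf s) v∈
        ... | z , z∈ , refl = children-adjacent (c y (here refl)) (c z (there z∈)) (proj₂ (All.lookup d z∈))

    -- Labels are sorted by the child above their neighbour. Distinct children are adjacent, so at
    -- most `t′` occur and one child `k` collects enough labels for the recursion. If all labels lie
    -- below `k`, the spine just moves on to `k`; otherwise a label below another child `k′`
    -- supplies the next tooth, as `k′` sees both ends of the edge from `s` to `k`.
    edge-comb : ∀ fuel m s → X s → size (W? s) ≤ fuel → ∀ ys → AllPairs _≢_ ys → ys ⊑ ws → (∀ y → y ∈ ys → W s (x y)) →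
      edgeBound t′ m ≤ length ys → Result m s ys
    edge-comb fuel zero s xs _ ys _ _ _ _ = [] , (λ z ()) , [] , refl , record
      { P = trivialSpine s ; teeth = λ y () ; P⊆U = λ _ _ → dom-refl s xs ; Λ⊆U = λ y () ; apart = λ y y′ () ; pos-≢ = λ y y′ () } , refl
    edge-comb fuel (suc m) s xs le (_ ∷ []) u sub inW (s≤s ())
    edge-comb zero (suc m) s xs le ys u sub inW large = contradiction (subst (_≤ 0) (size-∖ (W? s) s (dom-refl s xs)) le) λ ()
    edge-comb (suc fuel) (suc m) s xs le ys@(a ∷ b ∷ _) u@((a≢b ∷ _) ∷ _) sub inW large
      with pigeonhole _≟_ (childOf s) t′ (edgeBound t′ m) ys u (≤-trans (n≤1+n _) large)
    ... | inj₂ (zs , zs⊑ , d , len) = contradiction (trans (Listₚ.length-map (childOf s) zs) len)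
          (no-clique _ (cliqueOf zs d λ y y∈ → proj₁ (children y (zs⊑ y y∈))))
      where
      children : ∀ y → y ∈ ys → Child s (childOf s y) × W (childOf s y) (x y)
      children y y∈ = childOf-spec s y (inW y y∈) alone
        where
        alone : x y ≢ s
        alone e with y ≟ a
        ... | yes refl = terminal-alone y b (sub y y∈) (sub b (there (here refl))) a≢b e (inW b (there (here refl)))
        ... | no ne = terminal-alone y a (sub y y∈) (sub a (here refl)) ne e (inW a (here refl))
    ... | inj₁ (k , zs , zs-in , uz , big) = descend
      where
      children : ∀ y → y ∈ ys → Child s (childOf s y) × W (childOf s y) (x y)
      children y y∈ = childOf-spec s y (inW y y∈) alone
        where
        alone : x y ≢ s
        alone e with y ≟ a
        ... | yes refl = terminal-alone y b (sub y y∈) (sub b (there (here refl))) a≢b e (inW b (there (here refl)))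
        ... | no ne = terminal-alone y a (sub y y∈) (sub a (here refl)) ne e (inW a (here refl))
      under : ∀ z → z ∈ ys → childOf s z ≡ k → W k (x z)
      under z z∈ e = subst (λ q → W q (x z)) e (proj₂ (children z z∈))
      c : Child s k
      c = first zs big zs-in
        where
        first : ∀ zs → edgeBound t′ m < length zs → (∀ z → z ∈ zs → z ∈ ys × childOf s z ≡ k) → Child s k
        first (z ∷ _) _ h = subst (Child s) (proj₂ (h z (here refl))) (proj₁ (children z (proj₁ (h z (here refl)))))
      smaller : size (W? k) ≤ fuel
      smaller = s≤s⁻¹ (≤-trans (size-< (W? k) (W? s) s (λ v → dom-trans (proj₂ c)) (child-up c) (dom-refl s xs)) le)
      xk = proj₁ (proj₂ (proj₂ c))
      descend : Result (suc m) s ys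
      descend with forall∈? (λ z → childOf s z ≟ k) ys
      ... | inj₁ all = shift c (edge-comb fuel (suc m) k xk smaller ys u sub (λ z z∈ → under z z∈ (all z z∈)) large)
      ... | inj₂ (y , y∈ , ne) = weaken (λ { z (here refl) → y∈ ; z (there z∈) → proj₁ (zs-in z z∈) })
            (shift-add y c (proj₁ (children y y∈)) ne (proj₂ (children y y∈)) (λ { z z∈ refl → ne (proj₂ (zs-in z z∈)) })
              (edge-comb fuel m k xk smaller zs uz (λ z z∈ → sub z (proj₁ (zs-in z z∈))) (λ z z∈ → under z (proj₁ (zs-in z z∈)) (proj₂ (zs-in z z∈))) (<⇒≤ big)))

  -- Two combs over the same labels form a generalized pyramid.

  module Assembly where
    open OnSpine

    -- A stretch of a spine, prolonged at both ends by the legs of the extreme labels: these are the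
    -- paths `P` and `Q` of the pyramid. `offset` is the length of the first leg, which `at` uses to
    -- locate spine vertices on the new path.
    module Extended (s : Spine) (a b : ℕ) (a≤b : a ≤ b) (b≤N : b ≤ N s) (Λ₁ Λ₂ : VSet) {β₁ β₂ : V}
      (leg₁ : Walk (λ v → v ≡ sp s a ⊎ Λ₁ v) (sp s a) β₁) (leg₂ : Walk (λ v → v ≡ sp s b ⊎ Λ₂ v) (sp s b) β₂)
      (sees₁ : ∀ u i → Λ₁ u → a ≤ i → i ≤ b → u ≢ sp s i × (u ~ sp s i → i ≡ a))
      (sees₂ : ∀ u i → Λ₂ u → a ≤ i → i ≤ b → u ≢ sp s i × (u ~ sp s i → i ≡ b))
      (apart : Anti Λ₁ Λ₂) where

      private
        tail-of : ∀ {c β} {Λ : VSet} → Walk (λ v → v ≡ c ⊎ Λ v) c β → Σ[ l ∈ List V ] IPath c β (c ∷ l) × (∀ v → v ∈ l → Λ v)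
        tail-of {c} {β} {Λ} w with walk→path w
        ... | _ , [-] , _ = [] , [-] , λ v ()
        ... | _ , cons {l = l} e ind p , inΛ = l , cons e ind p , λ v v∈ → [ (λ r → contradiction (sym r) (proj₁ (ind v v∈))) , id ]′ (inΛ v (there v∈))

        l₁ = proj₁ (tail-of leg₁)
        l₂ = proj₁ (tail-of leg₂)
        l₁⊆ = proj₂ (proj₂ (tail-of leg₁))
        l₂⊆ = proj₂ (proj₂ (tail-of leg₂))
        m : ℕ
        m = b ∸ a
        am : a + m ≡ b
        am = m+[n∸m]≡n a≤b
        S : List V
        S = segList s a m
        seg : IPath (sp s a) (sp s b) S
        seg = subst (λ k → IPath (sp s a) (sp s k) S) am (seg-path s a m (subst (_≤ N s) (sym am) b≤N))
        inS : ∀ {v} → v ∈ S → Σ[ i ∈ ℕ ] a ≤ i × i ≤ b × sp s i ≡ v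
        inS v∈ with ∈-segList⁻ s a m v∈
        ... | i , lo , hi , e = i , lo , subst (i ≤_) am hi , e

        right : ∀ {l β} → IPath (sp s b) β (sp s b ∷ l) → (∀ v → v ∈ l → Λ₂ v) → IPath (sp s a) β (S ++ l)
        right [-] _ = subst (IPath (sp s a) (sp s b)) (sym (Listₚ.++-identityʳ S)) seg
        right {l} (cons e ind p) l⊆ = path-++ seg p e cross
          where
          cross : ∀ u w → u ∈ S → w ∈ l → u ≢ w × (u ~ w → u ≡ sp s b × w ≡ _)
          cross u w u∈ w∈ with inS u∈
          ... | i , lo , hi , refl with sees₂ w i (l⊆ w w∈) lo hi
          ...   | ne , only = ne ∘ sym , λ a → cong (sp s) (only (~-sym a)) , proj₂ (ind w w∈) (subst (λ k → sp s k ~ w) (only (~-sym a)) a)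

        middle : IPath (sp s a) β₂ (S ++ l₂)
        middle = right (proj₁ (proj₂ (tail-of leg₂))) l₂⊆

        left : ∀ {l β} → IPath (sp s a) β (sp s a ∷ l) → (∀ v → v ∈ l → Λ₁ v) → IPath β β₂ (reverse l ++ (S ++ l₂))
        left [-] _ = middle
        left {l} (cons e ind p) l⊆ = path-++ (path-reverse p) middle (~-sym e) cross
          where
          cross : ∀ u w → u ∈ reverse l → w ∈ S ++ l₂ → u ≢ w × (u ~ w → u ≡ _ × w ≡ sp s a)
          cross u w u∈′ w∈ with ∈-reverse⁻ l u∈′ | ∈ₚ.∈-++⁻ S w∈
          ... | u∈ | inj₂ w∈l with apart u w (l⊆ u u∈) (l₂⊆ w w∈l)
          ...   | ne , na = ne , λ e → contradiction e na
          cross u w u∈′ w∈ | u∈ | inj₁ w∈S with inS w∈S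
          ... | i , lo , hi , refl with sees₁ u i (l⊆ u u∈) lo hi
          ...   | ne , only = ne , λ a → proj₂ (ind u u∈) (subst (λ k → sp s k ~ u) (only a) (~-sym a)) , cong (sp s) (only a)

      list : List V
      list = reverse l₁ ++ (S ++ l₂)

      path : IPath β₁ β₂ list
      path = left (proj₁ (proj₂ (tail-of leg₁))) l₁⊆

      offset : ℕ
      offset = length (reverse l₁)

      content : ∀ v → v ∈ list → Λ₁ v ⊎ (Σ[ i ∈ ℕ ] a ≤ i × i ≤ b × sp s i ≡ v) ⊎ Λ₂ v
      content v v∈ with ∈ₚ.∈-++⁻ (reverse l₁) v∈
      ... | inj₁ v∈₁ = inj₁ (l₁⊆ v (∈-reverse⁻ l₁ v∈₁))
      ... | inj₂ v∈₂ with ∈ₚ.∈-++⁻ S v∈₂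
      ...   | inj₁ v∈S = inj₂ (inj₁ (inS v∈S))
      ...   | inj₂ v∈l = inj₂ (inj₂ (l₂⊆ v v∈l))

      private
        total : length list ≡ offset + (suc m + length l₂)
        total = trans (Listₚ.length-++ (reverse l₁)) (cong (offset +_) (trans (Listₚ.length-++ S) (cong (_+ length l₂) (length-segList s a m))))

      at : ∀ d i → a ≤ i → i ≤ b → nth d list (offset + (i ∸ a)) ≡ sp s i
      at d i lo hi = trans (nth-++ʳ d (reverse l₁) (S ++ l₂) (i ∸ a))
        (trans (nth-++ˡ d S l₂ (i ∸ a) (subst (i ∸ a <_) (sym (length-segList s a m)) (s≤s (∸-monoˡ-≤ a hi))))
          (trans (nth-segList d s a m (i ∸ a) (∸-monoˡ-≤ a hi)) (cong (sp s) (m+[n∸m]≡n lo))))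

      at< : ∀ i → i ≤ b → offset + (i ∸ a) < length list
      at< i hi = subst (offset + (i ∸ a) <_) (sym total) (+-monoʳ-< offset (≤-trans (s≤s (∸-monoˡ-≤ a hi)) (m≤m+n (suc m) (length l₂))))

      offset>0 : β₁ ≢ sp s a → 0 < offset
      offset>0 ne = subst (0 <_) (sym (Listₚ.length-reverse l₁)) (nonempty (proj₁ (proj₂ (tail-of leg₁))))
        where
        nonempty : ∀ {l} → IPath (sp s a) β₁ (sp s a ∷ l) → 0 < length l
        nonempty [-] = contradiction refl ne
        nonempty (cons _ _ p) = subst (0 <_) (sym (length-path p)) (s≤s z≤n)

      at-inner : β₂ ≢ sp s b → ∀ i → i ≤ b → suc (offset + (i ∸ a)) < length list
      at-inner ne i hi = subst (suc (offset + (i ∸ a)) <_) (sym total) (≤-trans (s≤s (≤-reflexive (sym (+-suc offset (i ∸ a)))))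
          (≤-trans (≤-reflexive (sym (+-suc offset (suc (i ∸ a))))) (+-monoʳ-≤ offset (≤-trans (s≤s (s≤s (∸-monoˡ-≤ a hi)))
            (≤-trans (≤-reflexive (ℕₚ.+-comm 1 (suc m))) (+-monoʳ-≤ (suc m) (nonempty (proj₁ (proj₂ (tail-of leg₂))))))))))
        where
        nonempty : ∀ {l} → IPath (sp s b) β₂ (sp s b ∷ l) → 0 < length l
        nonempty [-] = contradiction refl ne
        nonempty (cons _ _ p) = subst (0 <_) (sym (length-path p)) (s≤s z≤n)

    Body : Spine → (V → VSet) → List V → VSet
    Body s Λ J u = (Σ[ i ∈ ℕ ] i ≤ N s × sp s i ≡ u) ⊎ (Σ[ y ∈ V ] y ∈ J × Λ y u)

    -- `A` carries the edge teeth and will give `P`, `B` carries the vertex teeth and will give `Q`.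
    -- By `cross`, a label contributes just one possible edge between the two combs, that from `α`
    -- to `β`.
    record CombPair (J : List V) : Set₁ where
      field
        A B : Spine
        α β : V → V
        r   : V → V
        p q : V → ℕ
        Λ M : V → VSet
        p<  : ∀ y → y ∈ J → p y < N A
        r~₀ : ∀ y → y ∈ J → r y ~ sp A (p y)
        r~₁ : ∀ y → y ∈ J → r y ~ sp A (suc (p y))
        legA : ∀ y → y ∈ J → Walk (Λ y) (r y) (α y)
        seesA : ∀ y → y ∈ J → ∀ u i → Λ y u → i ≤ N A → u ≢ sp A i × (u ~ sp A i → u ≡ r y × (i ≡ p y ⊎ i ≡ suc (p y)))
        apartA : ∀ y y′ → y ∈ J → y′ ∈ J → y ≢ y′ → Anti (Λ y) (Λ y′)
        p-≢ : ∀ y y′ → y ∈ J → y′ ∈ J → y ≢ y′ → p y ≢ p y′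
        q≤  : ∀ y → y ∈ J → q y ≤ N B
        legB : ∀ y → y ∈ J → Walk (λ v → v ≡ sp B (q y) ⊎ M y v) (sp B (q y)) (β y)
        seesB : ∀ y → y ∈ J → ∀ u i → M y u → i ≤ N B → u ≢ sp B i × (u ~ sp B i → i ≡ q y)
        apartB : ∀ y y′ → y ∈ J → y′ ∈ J → y ≢ y′ → Anti (M y) (M y′)
        α~β : ∀ y → y ∈ J → α y ~ β y

        cross : ∀ u w → Body A Λ J u → Body B M J w → u ≢ w × (u ~ w → Σ[ y ∈ V ] y ∈ J × u ≡ α y × w ≡ β y)

    -- `e₁` and `e₂` are the extreme labels along `A`. The same two labels, named `d₁` and `d₂`, are
    -- extreme along `B`, possibly in the opposite order.
    module Pyramid {J : List V} (CP : CombPair J) (t : ℕ) (e₁ e₂ : V) (e₁∈ : e₁ ∈ J) (e₂∈ : e₂ ∈ J) (e₁≢e₂ : e₁ ≢ e₂)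
      (mid : Fin t → V) (mid∈ : ∀ i → mid i ∈ J) (e₁≢ : ∀ i → e₁ ≢ mid i) (e₂≢ : ∀ i → e₂ ≢ mid i) (mid-≢ : ∀ i j → i ≢ j → mid i ≢ mid j)
      (p-ends : 2 + CombPair.p CP e₁ ≤ CombPair.p CP e₂)
      (p-low : ∀ i → 2 + CombPair.p CP e₁ ≤ CombPair.p CP (mid i)) (p-high : ∀ i → 2 + CombPair.p CP (mid i) ≤ CombPair.p CP e₂)
      (p-chain : ∀ i j → toℕ j ≡ suc (toℕ i) → 2 + CombPair.p CP (mid i) ≤ CombPair.p CP (mid j))
      (d₁ d₂ : V) (ends : (d₁ ≡ e₁ × d₂ ≡ e₂) ⊎ (d₁ ≡ e₂ × d₂ ≡ e₁))
      (q-ends : CombPair.q CP d₁ ≤ CombPair.q CP d₂)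
      (q-between : ∀ i → CombPair.q CP d₁ ≤ CombPair.q CP (mid i) × CombPair.q CP (mid i) ≤ CombPair.q CP d₂)
      (q-chain : (∀ i j → toℕ j ≡ suc (toℕ i) → CombPair.q CP (mid i) ≤ CombPair.q CP (mid j)) ⊎
                 (∀ i j → toℕ j ≡ suc (toℕ i) → CombPair.q CP (mid j) ≤ CombPair.q CP (mid i))) where
      open CombPair CP

      private
        InA InB : VSet
        InA = Body A Λ J
        InB = Body B M J

        d₁∈ : d₁ ∈ J
        d₁∈ = [ (λ { (refl , _) → e₁∈ }) , (λ { (refl , _) → e₂∈ }) ]′ ends
        d₂∈ : d₂ ∈ J
        d₂∈ = [ (λ { (_ , refl) → e₂∈ }) , (λ { (_ , refl) → e₁∈ }) ]′ ends
        d₁≢d₂ : d₁ ≢ d₂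
        d₁≢d₂ = [ (λ { (refl , refl) → e₁≢e₂ }) , (λ { (refl , refl) → e₁≢e₂ ∘ sym }) ]′ ends
        d₁≢ : ∀ i → d₁ ≢ mid i
        d₁≢ = [ (λ { (refl , _) → e₁≢ }) , (λ { (refl , _) → e₂≢ }) ]′ ends
        d₂≢ : ∀ i → d₂ ≢ mid i
        d₂≢ = [ (λ { (_ , refl) → e₂≢ }) , (λ { (_ , refl) → e₁≢ }) ]′ ends

        -- The tooth of `e₁` sees positions `p e₁` and `suc (p e₁)`, that of `e₂` sees `p e₂` and
        -- `suc (p e₂)`. Keeping only the inner position of each makes `P` induced.
        a b : ℕ
        a = suc (p e₁)
        b = p e₂
        a≤b : a ≤ b
        a≤b = ≤-trans (n≤1+n _) p-ends
        b≤N : b ≤ N A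
        b≤N = <⇒≤ (p< e₂ e₂∈)

        module XP = Extended A a b a≤b b≤N (Λ e₁) (Λ e₂)
          (step (inj₁ refl) (~-sym (r~₁ e₁ e₁∈)) (walk-map (λ _ → inj₂) (legA e₁ e₁∈)))
          (step (inj₁ refl) (~-sym (r~₀ e₂ e₂∈)) (walk-map (λ _ → inj₂) (legA e₂ e₂∈)))
          (λ u i l lo hi → proj₁ (seesA e₁ e₁∈ u i l (≤-trans hi b≤N)) , λ x →
            [ (λ r → contradiction (subst (a ≤_) r lo) 1+n≰n) , id ]′ (proj₂ (proj₂ (seesA e₁ e₁∈ u i l (≤-trans hi b≤N)) x)))
          (λ u i l lo hi → proj₁ (seesA e₂ e₂∈ u i l (≤-trans hi b≤N)) , λ x →
            [ id , (λ r → contradiction (subst (_≤ b) r hi) 1+n≰n) ]′ (proj₂ (proj₂ (seesA e₂ e₂∈ u i l (≤-trans hi b≤N)) x)))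
          (apartA e₁ e₂ e₁∈ e₂∈ e₁≢e₂)

        module XQ = Extended B (q d₁) (q d₂) q-ends (q≤ d₂ d₂∈) (M d₁) (M d₂) (legB d₁ d₁∈) (legB d₂ d₂∈)
          (λ u i l lo hi → seesB d₁ d₁∈ u i l (≤-trans hi (q≤ d₂ d₂∈)))
          (λ u i l lo hi → seesB d₂ d₂∈ u i l (≤-trans hi (q≤ d₂ d₂∈)))
          (apartB d₁ d₂ d₁∈ d₂∈ d₁≢d₂)

        lP lQ : List V
        lP = XP.list
        lQ = XQ.list
        sP sQ : Spine
        sP = toSpine XP.path
        sQ = toSpine XQ.path

        α∈Λ : ∀ y → y ∈ J → Λ y (α y)
        α∈Λ y y∈ = walk-end (legA y y∈)

        A-own : ∀ {y y′ u} → y ∈ J → y′ ∈ J → Λ y u → Λ y′ u → y ≡ y′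
        A-own {y} {y′} y∈ y′∈ l l′ with y ≟ y′
        ... | yes e = e
        ... | no ne = contradiction refl (proj₁ (apartA y y′ y∈ y′∈ ne _ _ l l′))

        B-own : ∀ {y y′ u} → y ∈ J → y′ ∈ J → M y u → M y′ u → y ≡ y′
        B-own {y} {y′} y∈ y′∈ l l′ with y ≟ y′
        ... | yes e = e
        ... | no ne = contradiction refl (proj₁ (apartB y y′ y∈ y′∈ ne _ _ l l′))

        across : ∀ {y u w} → y ∈ J → Λ y u → InB w → u ≢ w × (u ~ w → u ≡ α y × w ≡ β y)
        across {y} {u} {w} y∈ l inB with cross u w (inj₂ (y , y∈ , l)) inB
        ... | ne , c = ne , λ e → case c e of λ { (y′ , y′∈ , refl , refl) → case A-own y∈ y′∈ l (α∈Λ y′ y′∈) of λ { refl → refl , refl } }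

        spine-across : ∀ {i w} → i ≤ N A → InB w → sp A i ≢ w × ¬ (sp A i ~ w)
        spine-across {i} le inB with cross _ _ (inj₁ (i , le , refl)) inB
        ... | ne , c = ne , λ e → case c e of λ { (y , y∈ , r , _) → proj₁ (seesA y y∈ (α y) i (α∈Λ y y∈) le) (sym r) }

        across-leg : ∀ {y y′ u w} → y ∈ J → y′ ∈ J → Λ y u → M y′ w → y ≢ y′ → u ≢ w × ¬ (u ~ w)
        across-leg {y} {y′} {u} {w} y∈ y′∈ l m ne with across y∈ l (inj₂ (y′ , y′∈ , m))
        ... | u≢w , c = u≢w , λ e → clash (c e)
          where
          clash : ¬ (u ≡ α y × w ≡ β y)
          clash (_ , refl) with walk-end (legB y y∈)
          ... | inj₁ r = proj₁ (seesB y′ y′∈ (β y) (q y) m (q≤ y y∈)) r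
          ... | inj₂ m′ = ne (B-own y∈ y′∈ m′ m)

        data OnP (v : V) : Set where
          legP : ∀ {y} → (y ≡ e₁ ⊎ y ≡ e₂) → Λ y v → OnP v
          spineP : ∀ i → a ≤ i → i ≤ b → sp A i ≡ v → OnP v

        data OnQ (v : V) : Set where
          legQ : ∀ {y} → (y ≡ d₁ ⊎ y ≡ d₂) → M y v → OnQ v
          spineQ : ∀ i → q d₁ ≤ i → i ≤ q d₂ → sp B i ≡ v → OnQ v

        onP : ∀ {v} → v ∈ lP → OnP v
        onP {v} v∈ with XP.content v v∈
        ... | inj₁ l = legP (inj₁ refl) l
        ... | inj₂ (inj₁ (i , lo , hi , e)) = spineP i lo hi e
        ... | inj₂ (inj₂ l) = legP (inj₂ refl) l

        onQ : ∀ {v} → v ∈ lQ → OnQ v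
        onQ {v} v∈ with XQ.content v v∈
        ... | inj₁ l = legQ (inj₁ refl) l
        ... | inj₂ (inj₁ (i , lo , hi , e)) = spineQ i lo hi e
        ... | inj₂ (inj₂ l) = legQ (inj₂ refl) l

        e∈ : ∀ {y} → y ≡ e₁ ⊎ y ≡ e₂ → y ∈ J
        e∈ (inj₁ refl) = e₁∈
        e∈ (inj₂ refl) = e₂∈
        d∈ : ∀ {y} → y ≡ d₁ ⊎ y ≡ d₂ → y ∈ J
        d∈ (inj₁ refl) = d₁∈
        d∈ (inj₂ refl) = d₂∈

        inA : ∀ {v} → OnP v → InA v
        inA (legP e l) = inj₂ (_ , e∈ e , l)
        inA (spineP i lo hi e) = inj₁ (i , ≤-trans hi b≤N , e)

        inB : ∀ {v} → OnQ v → InB v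
        inB (legQ e l) = inj₂ (_ , d∈ e , l)
        inB (spineQ i lo hi e) = inj₁ (i , ≤-trans hi (q≤ d₂ d₂∈) , e)

        PQ-cross : ∀ {u w} → OnP u → OnQ w → u ≢ w × (u ~ w → Σ[ y ∈ V ] (y ≡ e₁ ⊎ y ≡ e₂) × u ≡ α y × w ≡ β y)
        PQ-cross (legP e l) w with across (e∈ e) l (inB w)
        ... | ne , c = ne , λ x → _ , e , c x
        PQ-cross (spineP i lo hi refl) w with spine-across (≤-trans hi b≤N) (inB w)
        ... | ne , na = ne , λ x → contradiction x na

        -- The hole follows `P` from `e₁` to `e₂` and returns from `e₂` to `e₁`; whether `Q` must be
        -- reversed depends on which of them comes first along `B`.
        Qh : Σ[ l ∈ List V ] IPath (β e₂) (β e₁) l × (∀ v → v ∈ l → v ∈ lQ) × (∀ v → v ∈ lQ → v ∈ l)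
        Qh = oriented ends XQ.path
          where
          oriented : (d₁ ≡ e₁ × d₂ ≡ e₂) ⊎ (d₁ ≡ e₂ × d₂ ≡ e₁) → IPath (β d₁) (β d₂) lQ → _
          oriented (inj₁ (refl , refl)) pa = reverse lQ , path-reverse pa , (λ v → ∈-reverse⁻ lQ) , λ v → Anyₚ.reverse⁺
          oriented (inj₂ (refl , refl)) pa = lQ , pa , (λ v z → z) , λ v z → z

        αe≢spine : ∀ y → y ∈ J → ∀ i → i ≤ N A → α y ≢ sp A i
        αe≢spine y y∈ i le = proj₁ (seesA y y∈ (α y) i (α∈Λ y y∈) le)

        offset>0 : 0 < XP.offset
        offset>0 = XP.offset>0 (αe≢spine e₁ e₁∈ a (≤-trans a≤b b≤N))

        inner : ∀ i → i ≤ b → suc (XP.offset + (i ∸ a)) < length lP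
        inner = XP.at-inner (αe≢spine e₂ e₂∈ b b≤N)

        hole : Σ[ H ∈ Hole G ] (∀ v → OnHole H v ⇔ (v ∈ lP ⊎ v ∈ lQ))
        hole = close XP.path refl refl (≤-trans (s≤s (s≤s (≤-trans offset>0 (m≤m+n XP.offset _)))) (inner a a≤b)) (λ v → onP)
          where
          lh = proj₁ Qh
          close : ∀ {x₁ x₂ l} → IPath x₁ x₂ l → x₁ ≡ α e₁ → x₂ ≡ α e₂ → 3 ≤ length l → (∀ v → v ∈ l → OnP v) → Σ[ H ∈ Hole G ] (∀ v → OnHole H v ⇔ (v ∈ l ⊎ v ∈ lQ))
          close [-] _ _ (s≤s ()) _
          close (cons {w = w} {l = l} e ind pa) refl refl (s≤s 2≤) on = proj₁ closed , λ v → mk⇔ (λ o → to v (Equivalence.to (proj₂ closed v) o)) λ o → Equivalence.from (proj₂ closed v) (from v o)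
            where
            onQh : ∀ {v} → v ∈ lh → OnQ v
            onQh v∈ = onQ (proj₁ (proj₂ (proj₂ Qh)) _ v∈)
            cross′ : ∀ u v → u ∈ l → v ∈ lh → u ≢ v × (u ~ v → u ≡ α e₂ × v ≡ β e₂)
            cross′ u v u∈ v∈ with PQ-cross (on u (there u∈)) (onQh v∈)
            ... | ne , c = ne , λ x → case c x of λ { (_ , inj₁ refl , refl , _) → contradiction refl (proj₁ (ind u u∈)) ; (_ , inj₂ refl , r , s) → r , s }
            out : ∀ z → z ∈ l ++ lh → α e₁ ≢ z × (α e₁ ~ z → z ≡ w ⊎ z ≡ β e₁)
            out z z∈ with ∈ₚ.∈-++⁻ l z∈
            ... | inj₁ z∈l = proj₁ (ind z z∈l) , λ x → inj₁ (proj₂ (ind z z∈l) x)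
            ... | inj₂ z∈h with across e₁∈ (α∈Λ e₁ e₁∈) (inB (onQh z∈h))
            ...   | ne , c = ne , λ x → inj₂ (proj₂ (c x))
            nonempty : ∀ {u v l} → IPath u v l → 1 ≤ length l
            nonempty [-] = s≤s z≤n
            nonempty (cons _ _ _) = s≤s z≤n
            closed = closeHole (α e₁) (path-++ pa (proj₁ (proj₂ Qh)) (α~β e₂ e₂∈) cross′)
              (subst (3 ≤_) (sym (Listₚ.length-++ l)) (+-mono-≤ 2≤ (nonempty (proj₁ (proj₂ Qh))))) out e (α~β e₁ e₁∈)
            to : ∀ v → v ∈ α e₁ ∷ l ++ lh → v ∈ α e₁ ∷ l ⊎ v ∈ lQ
            to v v∈ with ∈ₚ.∈-++⁻ (α e₁ ∷ l) v∈
            ... | inj₁ x = inj₁ x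
            ... | inj₂ x = inj₂ (proj₁ (proj₂ (proj₂ Qh)) v x)
            from : ∀ v → v ∈ α e₁ ∷ l ⊎ v ∈ lQ → v ∈ α e₁ ∷ l ++ lh
            from v (inj₁ x) = ∈ₚ.∈-++⁺ˡ x
            from v (inj₂ x) = ∈ₚ.∈-++⁺ʳ (α e₁ ∷ l) (proj₂ (proj₂ (proj₂ Qh)) v x)

        path∈ : ∀ {u v l} (pa : IPath u v l) w → OnPath (toPath (toSpine pa)) w → w ∈ l
        path∈ {u} {l = l} pa w (j , refl) = nth-∈ u l (toℕ j) (≤pred pa (Fₚ.toℕ≤pred[n] j))

        ∈path : ∀ {u v l} (pa : IPath u v l) w → w ∈ l → OnPath (toPath (toSpine pa)) w
        ∈path {u} {l = l} pa w w∈ with ∈-nth u l w∈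
        ... | i , lt , e = fromℕ< (s≤s (<length pa lt)) , trans (cong (nth u l) (Fₚ.toℕ-fromℕ< (s≤s (<length pa lt)))) e

        -- A rung is built as an induced path ending on `Q`; its last vertex `z` has to be dropped,
        -- and the vertex before it is then the only one that sees `z`.
        init : ∀ {u z l} → IPath u z l → u ≢ z → Σ[ b ∈ V ] Σ[ l′ ∈ List V ] IPath u b l′ × b ~ z × l′ ⊑ l × (∀ v → v ∈ l′ → v ≢ z × (v ~ z → v ≡ b))
        init [-] ne = contradiction refl ne
        init {u} (cons e ind [-]) ne = u , _ , [-] , e , (λ { v (here r) → here r }) , λ { v (here refl) → ne , λ _ → refl }
        init {u} {z} (cons {w = w} e ind pa@(cons _ ind′ pb)) ne with init pa (λ r → proj₁ (ind′ z (last∈ pb)) r)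
        ... | b , l′ , pi , bz , sub , only = b , u ∷ l′ , cons e (λ v v∈ → ind v (sub v v∈)) pi , bz ,
            (λ { v (here r) → here r ; v (there v∈) → there (sub v v∈) }) ,
            λ { v (here refl) → ne , (λ x → contradiction (sym (proj₂ (ind z (there (last∈ pb))) x)) (proj₁ (ind′ z (last∈ pb))))
              ; v (there v∈) → only v v∈ }

        -- The rung of a label consists of its tooth on `A` and its tooth on `B`. The latter may be
        -- empty, so the end of the rung is found by taking a path to `z` and cutting off `z`.
        module Rung (i : Fin t) where
          y = mid i
          y∈ = mid∈ i
          z = sp B (q y)
          Rset : VSet
          Rset v = Λ y v ⊎ M y v
          zB : InB z
          zB = inj₁ (q y , q≤ y y∈ , refl)
          raw : Walk (λ v → v ≡ z ⊎ Rset v) (r y) z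
          raw = walk-trans (walk-map (λ _ l → inj₂ (inj₁ l)) (legA y y∈))
            (step (inj₂ (inj₁ (α∈Λ y y∈))) (α~β y y∈) (walk-reverse (walk-map (λ { v (inj₁ e) → inj₁ e ; v (inj₂ l) → inj₂ (inj₂ l) }) (legB y y∈))))
          ex = walk→path raw
          ini = init (proj₁ (proj₂ ex)) (proj₁ (across y∈ (walk-start (legA y y∈)) zB))
          bot = proj₁ ini
          l = proj₁ (proj₂ ini)
          pa : IPath (r y) bot l
          pa = proj₁ (proj₂ (proj₂ ini))
          bot~z : bot ~ z
          bot~z = proj₁ (proj₂ (proj₂ (proj₂ ini)))
          only-z : ∀ v → v ∈ l → v ≢ z × (v ~ z → v ≡ bot)
          only-z = proj₂ (proj₂ (proj₂ (proj₂ (proj₂ ini))))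
          inR : ∀ v → v ∈ l → Rset v
          inR v v∈ = [ (λ e → contradiction e (proj₁ (only-z v v∈))) , id ]′ (proj₂ (proj₂ ex) v (proj₁ (proj₂ (proj₂ (proj₂ (proj₂ ini)))) v v∈))

          y≢e : ∀ {y′} → y′ ≡ e₁ ⊎ y′ ≡ e₂ → y ≢ y′
          y≢e (inj₁ refl) = e₁≢ i ∘ sym
          y≢e (inj₂ refl) = e₂≢ i ∘ sym
          y≢d : ∀ {y′} → y′ ≡ d₁ ⊎ y′ ≡ d₂ → y ≢ y′
          y≢d (inj₁ refl) = d₁≢ i ∘ sym
          y≢d (inj₂ refl) = d₂≢ i ∘ sym

          sees-P : ∀ {v u} → Rset v → OnP u → v ≢ u × (v ~ u → v ≡ r y × (u ≡ sp A (p y) ⊎ u ≡ sp A (suc (p y))))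
          sees-P (inj₁ lv) (legP e l) with apartA _ _ y∈ (e∈ e) (y≢e e) _ _ lv l
          ... | ne , na = ne , λ x → contradiction x na
          sees-P (inj₁ lv) (spineP k lo hi refl) with seesA y y∈ _ k lv (≤-trans hi b≤N)
          ... | ne , c = ne , λ x → proj₁ (c x) , Sum.map (cong (sp A)) (cong (sp A)) (proj₂ (c x))
          sees-P (inj₂ mv) (legP e l) with across-leg (e∈ e) y∈ l mv (λ r → y≢e e (sym r))
          ... | ne , na = ne ∘ sym , λ x → contradiction (~-sym x) na
          sees-P (inj₂ mv) (spineP k lo hi refl) with spine-across (≤-trans hi b≤N) (inj₂ (y , y∈ , mv))
          ... | ne , na = ne ∘ sym , λ x → contradiction (~-sym x) na

          sees-Q : ∀ {v w} → Rset v → OnQ w → v ≢ w × (v ~ w → w ≡ z)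
          sees-Q (inj₁ lv) (legQ e l) with across-leg y∈ (d∈ e) lv l (y≢d e)
          ... | ne , na = ne , λ x → contradiction x na
          sees-Q (inj₁ lv) (spineQ k lo hi refl) with across y∈ lv (inj₁ (k , ≤-trans hi (q≤ d₂ d₂∈) , refl))
          ... | ne , c = ne , λ x → β-on-spine (proj₂ (c x))
            where
            β-on-spine : sp B k ≡ β y → sp B k ≡ z
            β-on-spine r with walk-end (legB y y∈)
            ... | inj₁ r′ = trans r r′
            ... | inj₂ m = contradiction (sym r) (proj₁ (seesB y y∈ (β y) k m (≤-trans hi (q≤ d₂ d₂∈))))
          sees-Q (inj₂ mv) (legQ e l) with apartB _ _ y∈ (d∈ e) (y≢d e) _ _ mv l
          ... | ne , na = ne , λ x → contradiction x na
          sees-Q (inj₂ mv) (spineQ k lo hi refl) with seesB y y∈ _ k mv (≤-trans hi (q≤ d₂ d₂∈))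
          ... | ne , c = ne , λ x → cong (sp B) (c x)

          Rpath : Path G
          Rpath = toPath (toSpine pa)
          end≡ : end Rpath ≡ bot
          end≡ = trans (end-toPath (toSpine pa)) (nth-last pa)

          a≤p : a ≤ p y
          a≤p = ≤-trans (n≤1+n _) (p-low i)
          p≤b : suc (p y) ≤ b
          p≤b = ≤-trans (n≤1+n _) (p-high i)
          a≤sp : a ≤ suc (p y)
          a≤sp = ≤-trans a≤p (n≤1+n _)
          p≤b′ : p y ≤ b
          p≤b′ = ≤-trans (n≤1+n _) p≤b

        rungs-apart : ∀ i j → i ≢ j → ∀ u w → Rung.Rset i u → Rung.Rset j w → u ≢ w × ¬ (u ~ w)
        rungs-apart i j ne u w (inj₁ a) (inj₁ b) = apartA _ _ (mid∈ i) (mid∈ j) (mid-≢ i j ne) u w a b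
        rungs-apart i j ne u w (inj₁ a) (inj₂ b) = across-leg (mid∈ i) (mid∈ j) a b (mid-≢ i j ne)
        rungs-apart i j ne u w (inj₂ a) (inj₁ b) with across-leg (mid∈ j) (mid∈ i) b a (mid-≢ j i (ne ∘ sym))
        ... | x , y = x ∘ sym , y ∘ ~-sym
        rungs-apart i j ne u w (inj₂ a) (inj₂ b) = apartB _ _ (mid∈ i) (mid∈ j) (mid-≢ i j ne) u w a b

        posP : ℕ → ℕ
        posP k = XP.offset + (k ∸ a)
        idxP : ∀ k → k ≤ b → Fin (suc (N sP))
        idxP k hi = fromℕ< (s≤s (<length XP.path (XP.at< k hi)))
        toℕ-idxP : ∀ k hi → toℕ (idxP k hi) ≡ posP k
        toℕ-idxP k hi = Fₚ.toℕ-fromℕ< (s≤s (<length XP.path (XP.at< k hi)))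
        vertP : ∀ k (lo : a ≤ k) hi → Path.vert (toPath sP) (idxP k hi) ≡ sp A k
        vertP k lo hi = trans (cong (sp sP) (toℕ-idxP k hi)) (XP.at _ k lo hi)
        posQ : ℕ → ℕ
        posQ k = XQ.offset + (k ∸ q d₁)
        idxQ : ∀ k → k ≤ q d₂ → Fin (suc (N sQ))
        idxQ k hi = fromℕ< (s≤s (<length XQ.path (XQ.at< k hi)))
        toℕ-idxQ : ∀ k hi → toℕ (idxQ k hi) ≡ posQ k
        toℕ-idxQ k hi = Fₚ.toℕ-fromℕ< (s≤s (<length XQ.path (XQ.at< k hi)))
        vertQ : ∀ k (lo : q d₁ ≤ k) hi → Path.vert (toPath sQ) (idxQ k hi) ≡ sp B k
        vertQ k lo hi = trans (cong (sp sQ) (toℕ-idxQ k hi)) (XQ.at _ k lo hi)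

        interior : ∀ k hi → Interior (toPath sP) (idxP k hi)
        interior k hi = subst (0 <_) (sym (toℕ-idxP k hi)) (≤-trans offset>0 (m≤m+n XP.offset _)) ,
          subst (_< N sP) (sym (toℕ-idxP k hi)) (s≤s⁻¹ (subst (suc (suc (posP k)) ≤_) (length-path XP.path) (inner k hi)))

        posP-mono : ∀ {k l} → k ≤ l → posP k ≤ posP l
        posP-mono le = +-monoʳ-≤ XP.offset (∸-monoˡ-≤ a le)
        posP-inj : ∀ {k l} → a ≤ k → a ≤ l → posP k ≡ posP l → k ≡ l
        posP-inj ak al e = trans (sym (m+[n∸m]≡n ak)) (trans (cong (a +_) (+-cancelˡ-≡ XP.offset _ _ e)) (m+[n∸m]≡n al))
        posQ-mono : ∀ {k l} → k ≤ l → posQ k ≤ posQ l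
        posQ-mono le = +-monoʳ-≤ XQ.offset (∸-monoˡ-≤ (q d₁) le)

        xi yi : Fin t → Fin (suc (N sP))
        xi i = idxP (p (mid i)) (Rung.p≤b′ i)
        yi i = idxP (suc (p (mid i))) (Rung.p≤b i)
        zi : Fin t → Fin (suc (N sQ))
        zi i = idxQ (q (mid i)) (proj₂ (q-between i))

        z-chain : Chain _≤_ zi ⊎ Chain _≥_ zi
        z-chain = Sum.map
          (λ c i j e → subst₂ _≤_ (sym (toℕ-idxQ _ (proj₂ (q-between i)))) (sym (toℕ-idxQ _ (proj₂ (q-between j)))) (posQ-mono (c i j e)))
          (λ c i j e → subst₂ _≤_ (sym (toℕ-idxQ _ (proj₂ (q-between j)))) (sym (toℕ-idxQ _ (proj₂ (q-between i)))) (posQ-mono (c i j e))) q-chain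

      pyramid : GenPyramid G t
      pyramid = record
        { P = toPath sP ; Q = toPath sQ
        ; PQ-disj = λ u u∈P u∈Q → proj₁ (PQ-cross (onP (path∈ XP.path u u∈P)) (onQ (path∈ XQ.path u u∈Q))) refl
        ; H = proj₁ hole
        ; H-vs = λ v → mk⇔ (λ o → Sum.map (∈path XP.path v) (∈path XQ.path v) (Equivalence.to (proj₂ hole v) o))
                           (λ o → Equivalence.from (proj₂ hole v) (Sum.map (path∈ XP.path v) (path∈ XQ.path v) o))
        ; R = Rung.Rpath
        ; RP-disj = λ i u u∈R u∈P → proj₁ (Rung.sees-P i (inR i u u∈R) (onP (path∈ XP.path u u∈P))) refl
        ; RQ-disj = λ i u u∈R u∈Q → proj₁ (Rung.sees-Q i (inR i u u∈R) (onQ (path∈ XQ.path u u∈Q))) refl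
        ; RR-disj = λ i j ne u u∈ u∈′ → proj₁ (rungs-apart i j ne u u (inR i u u∈) (inR j u u∈′)) refl
        ; x = xi ; y = yi ; z = zi
        ; a-nbrs = λ i j → mk⇔ (a-to i j) (a-from i j)
        ; xy-int = λ i → interior _ (Rung.p≤b′ i) , interior _ (Rung.p≤b i)
        ; xy-adj = λ i → subst₂ _~_ (sym (vertP _ (Rung.a≤p i) (Rung.p≤b′ i))) (sym (vertP _ (Rung.a≤sp i) (Rung.p≤b i))) (spE A _ (p< (mid i) (mid∈ i)))
        ; b-nbr = λ i j → mk⇔ (b-to i j) (b-from i j)
        ; R-int = λ i l int v → [ (λ v∈P e → r-int-P i l int v (onP (path∈ XP.path v v∈P)) e) , (λ v∈Q e → r-int-Q i l int v (onQ (path∈ XQ.path v v∈Q)) e) ]′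
        ; R-anti = λ i j ne u w u∈ w∈ → proj₂ (rungs-apart i j ne u w (inR i u u∈) (inR j w w∈))
        ; P-order = inj₁ ((λ i → subst₂ _≤_ (sym (toℕ-idxP _ (Rung.p≤b′ i))) (sym (toℕ-idxP _ (Rung.p≤b i))) (posP-mono (n≤1+n _))) ,
                          λ i j e → subst₂ _≤_ (sym (toℕ-idxP _ (Rung.p≤b i))) (sym (toℕ-idxP _ (Rung.p≤b′ j))) (posP-mono (≤-trans (n≤1+n _) (p-chain i j e))))
        ; Q-order = z-chain
        ; y≢x = λ i j e r → 1+n≰n (≤-trans (p-chain i j e) (≤-reflexive (sym (posP-inj (Rung.a≤sp i) (Rung.a≤p j)
                  (trans (sym (toℕ-idxP _ (Rung.p≤b i))) (trans (cong toℕ r) (toℕ-idxP _ (Rung.p≤b′ j)))))))) }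
        where
        inR : ∀ i u → OnPath (Rung.Rpath i) u → Rung.Rset i u
        inR i u u∈ = Rung.inR i u (path∈ (Rung.pa i) u u∈)
        vP : Fin (suc (N sP)) → V
        vP = Path.vert (toPath sP)
        vQ : Fin (suc (N sQ)) → V
        vQ = Path.vert (toPath sQ)
        first≡ : ∀ i → start (Rung.Rpath i) ≡ r (mid i)
        first≡ i = nth-first (Rung.pa i)
        rΛ : ∀ i → Rung.Rset i (r (mid i))
        rΛ i = inj₁ (walk-start (legA (mid i) (mid∈ i)))
        a-to : ∀ i j → start (Rung.Rpath i) ~ vP j → j ≡ xi i ⊎ j ≡ yi i
        a-to i j e = Sum.map (λ r → Path.inj (toPath sP) (trans r (sym (vertP _ (Rung.a≤p i) (Rung.p≤b′ i)))))
                             (λ r → Path.inj (toPath sP) (trans r (sym (vertP _ (Rung.a≤sp i) (Rung.p≤b i)))))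
          (proj₂ (proj₂ (Rung.sees-P i (rΛ i) (onP (path∈ XP.path (vP j) (j , refl)))) (subst (_~ vP j) (first≡ i) e)))
        a-from : ∀ i j → j ≡ xi i ⊎ j ≡ yi i → start (Rung.Rpath i) ~ vP j
        a-from i j (inj₁ refl) = subst₂ _~_ (sym (first≡ i)) (sym (vertP _ (Rung.a≤p i) (Rung.p≤b′ i))) (r~₀ (mid i) (mid∈ i))
        a-from i j (inj₂ refl) = subst₂ _~_ (sym (first≡ i)) (sym (vertP _ (Rung.a≤sp i) (Rung.p≤b i))) (r~₁ (mid i) (mid∈ i))
        z-vert : ∀ i → vQ (zi i) ≡ Rung.z i
        z-vert i = vertQ _ (proj₁ (q-between i)) (proj₂ (q-between i))
        b-to : ∀ i j → end (Rung.Rpath i) ~ vQ j → j ≡ zi i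
        b-to i j e = Path.inj (toPath sQ) (trans (proj₂ (Rung.sees-Q i (Rung.inR i _ (last∈ (Rung.pa i))) (onQ (path∈ XQ.path (vQ j) (j , refl))))
          (subst (_~ vQ j) (Rung.end≡ i) e)) (sym (z-vert i)))
        b-from : ∀ i j → j ≡ zi i → end (Rung.Rpath i) ~ vQ j
        b-from i j refl = subst₂ _~_ (sym (Rung.end≡ i)) (sym (z-vert i)) (Rung.bot~z i)
        r-int-P : ∀ i l → Interior (Rung.Rpath i) l → ∀ v → OnP v → ¬ (Path.vert (Rung.Rpath i) l ~ v)
        r-int-P i l (0<l , _) v v∈ e = <-irrefl (sym (spJ (toSpine (Rung.pa i)) (toℕ l) 0 (Fₚ.toℕ≤pred[n] l) z≤n
          (trans (proj₁ (proj₂ (Rung.sees-P i (inR i _ (l , refl)) v∈) e)) (sym (first≡ i))))) 0<l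
        r-int-Q : ∀ i l → Interior (Rung.Rpath i) l → ∀ v → OnQ v → ¬ (Path.vert (Rung.Rpath i) l ~ v)
        r-int-Q i l (_ , l<) v v∈ e = <-irrefl (spJ (toSpine (Rung.pa i)) (toℕ l) _ (Fₚ.toℕ≤pred[n] l) ≤-refl
          (trans (proj₂ (Rung.only-z i _ (path∈ (Rung.pa i) _ (l , refl))) (subst (_ ~_) (proj₂ (Rung.sees-Q i (inR i _ (l , refl)) v∈) e) e)) (sym (nth-last (Rung.pa i))))) l<

  -- Choosing labels in monotone position.

  module Selection {J : List (Fin n)} (CP : Assembly.CombPair J) (unique : AllPairs _≢_ J) (t : ℕ) where
    open Assembly
    open CombPair CP using (p; q; p-≢)

    Gap : V → V → Set
    Gap y y′ = y ≢ y′ × 2 + p y ≤ p y′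

    private
      module FromList (L : List V) (sub : L ⊑ J) (gaps : AllPairs Gap L) (len : length L ≡ 2 + t) where
        lab : Fin (2 + t) → V
        lab i = lookup L (F.cast (sym len) i)
        lab∈ : ∀ i → lab i ∈ J
        lab∈ i = sub _ (∈ₚ.∈-lookup (F.cast (sym len) i))
        pairs : ∀ {R : V → V → Set} → AllPairs R L → ∀ i j → toℕ i < toℕ j → R (lab i) (lab j)
        pairs rs i j lt = AllPairs-lookup rs _ _ (subst₂ _<_ (sym (Fₚ.toℕ-cast (sym len) i)) (sym (Fₚ.toℕ-cast (sym len) j)) lt)
        first last : Fin (2 + t)
        first = F.zero
        last = fromℕ (suc t)
        inner : Fin t → Fin (2 + t)
        inner i = F.suc (F.inject₁ i)
        toℕ-inner : ∀ i → toℕ (inner i) ≡ suc (toℕ i)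
        toℕ-inner i = cong suc (Fₚ.toℕ-inject₁ i)
        first<inner : ∀ i → toℕ first < toℕ (inner i)
        first<inner i = s≤s z≤n
        inner<last : ∀ i → toℕ (inner i) < toℕ last
        inner<last i = subst₂ _<_ (sym (toℕ-inner i)) (sym (Fₚ.toℕ-fromℕ (suc t))) (s≤s (Fₚ.toℕ<n i))
        first<last : toℕ first < toℕ last
        first<last = s≤s z≤n
        inner-next : ∀ i j → toℕ j ≡ suc (toℕ i) → toℕ (inner i) < toℕ (inner j)
        inner-next i j e = subst₂ _<_ (sym (toℕ-inner i)) (sym (trans (toℕ-inner j) (cong suc e))) ≤-refl
        inner-≢ : ∀ i j → i ≢ j → lab (inner i) ≢ lab (inner j)
        inner-≢ i j ne e with <-cmp (toℕ i) (toℕ j)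
        ... | tri< lt _ _ = proj₁ (pairs gaps (inner i) (inner j) (subst₂ _<_ (sym (toℕ-inner i)) (sym (toℕ-inner j)) (s≤s lt))) e
        ... | tri≈ _ r _ = ne (Fₚ.toℕ-injective r)
        ... | tri> _ _ gt = proj₁ (pairs gaps (inner j) (inner i) (subst₂ _<_ (sym (toℕ-inner j)) (sym (toℕ-inner i)) (s≤s gt))) (sym e)

        build : ∀ d₁ d₂ → _ → _ → _ → _ → GenPyramid G t
        build d₁ d₂ ends qe qb qc = Pyramid.pyramid CP t (lab first) (lab last) (lab∈ first) (lab∈ last) (proj₁ (pairs gaps first last first<last))
          (λ i → lab (inner i)) (λ i → lab∈ (inner i)) (λ i → proj₁ (pairs gaps first (inner i) (first<inner i)))
          (λ i e → proj₁ (pairs gaps (inner i) last (inner<last i)) (sym e)) inner-≢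
          (proj₂ (pairs gaps first last first<last)) (λ i → proj₂ (pairs gaps first (inner i) (first<inner i)))
          (λ i → proj₂ (pairs gaps (inner i) last (inner<last i))) (λ i j e → proj₂ (pairs gaps (inner i) (inner j) (inner-next i j e)))
          d₁ d₂ ends qe qb qc

        increasing : AllPairs (λ y y′ → q y ≤ q y′) L → GenPyramid G t
        increasing rs = build (lab first) (lab last) (inj₁ (refl , refl)) (pairs rs first last first<last)
          (λ i → pairs rs first (inner i) (first<inner i) , pairs rs (inner i) last (inner<last i))
          (inj₁ λ i j e → pairs rs (inner i) (inner j) (inner-next i j e))

        decreasing : AllPairs (λ y y′ → ¬ (q y ≤ q y′)) L → GenPyramid G t
        decreasing rs = build (lab last) (lab first) (inj₂ (refl , refl)) (down first last first<last)
          (λ i → down (inner i) last (inner<last i) , down first (inner i) (first<inner i))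
          (inj₂ λ i j e → down (inner i) (inner j) (inner-next i j e))
          where
          down : ∀ i j → toℕ i < toℕ j → q (lab j) ≤ q (lab i)
          down i j lt = <⇒≤ (≰⇒> (pairs rs i j lt))

      r₂ : ℕ
      r₂ = ramseyBound (2 + t) (2 + t)

      -- Distinct positions along `A` are first made increasing, with gaps by parity. Ramsey's
      -- theorem then makes the positions along `B` weakly increasing or strictly decreasing, which
      -- are the two directions allowed for `Q`.
      same-parity : ∀ (c : Bool) L → L ⊑ J → AllPairs _≢_ L → (∀ y → y ∈ L → parity (p y) ≡ c) → ramseyBound r₂ r₂ ≤ length L → GenPyramid G t
      same-parity c L sub u par le with monotone (λ y y′ → p y <? p y′) L u total r₂ le
        where
        total : ∀ x y → x ∈ L → y ∈ L → x ≢ y → p x < p y ⊎ p y < p x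
        total x y x∈ y∈ ne with <-cmp (p x) (p y)
        ... | tri< lt _ _ = inj₁ lt
        ... | tri≈ _ e _ = contradiction e (p-≢ x y (sub x x∈) (sub y y∈) ne)
        ... | tri> _ _ gt = inj₂ gt
      ... | L₂ , sub₂ , inc , len₂ = choose (ramsey (λ y y′ → q y ≤? q y′) (2 + t) (2 + t) L₂ (gaps L₂ sub₂ inc) (≤-reflexive (sym len₂)))
        where
        gaps : ∀ L₂ → L₂ ⊑ L → AllPairs (λ x y → x ≢ y × p x < p y) L₂ → AllPairs Gap L₂
        gaps [] _ [] = []
        gaps (y ∷ L₂) s (r ∷ rs) = All.tabulate (λ {z} z∈ → proj₁ (All.lookup r z∈) ,
            parity-gap (trans (par y (s y (here refl))) (sym (par z (s z (there z∈))))) (proj₂ (All.lookup r z∈)))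
          ∷ gaps L₂ (λ z z∈ → s z (there z∈)) rs
        choose : _ → GenPyramid G t
        choose (L₃ , sub₃ , g , inj₁ (len , rs)) = FromList.increasing L₃ (λ z z∈ → sub z (sub₂ z (sub₃ z z∈))) g len rs
        choose (L₃ , sub₃ , g , inj₂ (len , rs)) = FromList.decreasing L₃ (λ z z∈ → sub z (sub₂ z (sub₃ z z∈))) g len rs

    select : selectBound t ≤ length J → GenPyramid G t
    select le with split-large (λ y → parity (p y) Bool.≟ true) J (ramseyBound r₂ r₂) (ramseyBound r₂ r₂) le
    ... | inj₁ big = same-parity true _ (λ z → filter-∈ E? J) (AllPairsₚ.filter⁺ E? unique) (λ z → filter-holds E? J) big
      where E? = λ y → parity (p y) Bool.≟ true
    ... | inj₂ big = same-parity false _ (λ z → filter-∈ O? J) (AllPairsₚ.filter⁺ O? unique) (λ z z∈ → odd (filter-holds O? J z∈)) big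
      where
      O? = λ y → ¬? (parity (p y) Bool.≟ true)
      odd : ∀ {c} → c ≢ true → c ≡ false
      odd {true} ne = contradiction refl ne
      odd {false} _ = refl

  -- Combs over claw-free or net-free labels, and the pairs they form.

  module PureCombs (no-theta : ¬ Theta G) {ys zs : List (Fin n)} (TS : TwoSides ys)
    (zs⊑ : zs ⊑ ys) (SS : SingleSide (TwoSides.D TS) zs)
    (y₀ : Fin n) (y₀∈ : y₀ ∈ zs) (ws : List (Fin n)) (ws⊑ : ws ⊑ zs) (unique-ws : AllPairs _≢_ ws) where
    open Critical
    open Combs
    open SingleLabels SS

    private
      module TS = TwoSides TS
      up : ∀ {y} → y ∈ ws → y ∈ ys
      up y∈ = zs⊑ _ (ws⊑ _ y∈)

      -- The first side shrinks to `S`, where labels have unique neighbours, and the critical set is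
      -- taken there; the other side remains available for closing thetas in `NoHole`.
      sub-sides : TwoSides ws
      sub-sides = record
        { D = S ; E = TS.E ; D? = S? ; E? = TS.E? ; D-conn = conn ; E-conn = TS.E-conn
        ; D-E = λ u w su ew → TS.D-E u w (S⊆D u su) ew ; unique = unique-ws
        ; stable = λ u v u∈ v∈ → TS.stable u v (up u∈) (up v∈)
        ; off-D = λ y y∈ s → TS.off-D y (up y∈) (S⊆D y s) ; off-E = λ y y∈ → TS.off-E y (up y∈)
        ; att-D = λ y y∈ → x y , proj₁ (x-spec y (ws⊑ y y∈)) , proj₁ (proj₂ (x-spec y (ws⊑ y y∈)))
        ; att-E = λ y y∈ → TS.att-E y (up y∈) }

      attached : ∀ y → y ∈ ws → ∀ w → S w → y ~ w → w ≡ x y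
      attached y y∈ = proj₂ (proj₂ (x-spec y (ws⊑ y y∈)))

      crit : CriticalSet S ws (x y₀)
      crit = critical S? ws (x y₀) (proj₁ (x-spec y₀ y₀∈)) λ y y∈ →
        x y , proj₁ (proj₂ (x-spec y (ws⊑ y y∈))) , conn (x y₀) (x y) (proj₁ (x-spec y₀ y₀∈)) (proj₁ (x-spec y (ws⊑ y y∈)))

      module WithCritical (C : CriticalSet S ws (x y₀)) where
        no-hole : ∀ {h a b l} → IPath a b l → 3 ≤ length l → (∀ z → z ∈ l → h ≢ z × (h ~ z → z ≡ a ⊎ z ≡ b)) →
          h ~ a → h ~ b → (∀ z → z ∈ h ∷ l → CriticalSet.X C z) → ⊥
        no-hole = NoHole.no-hole no-theta sub-sides C

        open RootedSide C x attached no-hole using (W; W?; dom-s₀; x∈X; s∈X; X⊆D)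

        edges : ∀ t′ → (∀ (l : List V) → AllPairs _~_ l → length l ≢ suc t′) → ClawFree y₀ ws → ∀ m → edgeBound t′ m ≤ length ws →
          Σ[ J ∈ List V ] J ⊑ ws × AllPairs _≢_ J × length J ≡ m × EdgeComb x S J
        edges t′ nc cf m le with EdgeCombs.edge-comb C x attached no-hole cf t′ nc _ m (x y₀) s∈X ≤-refl ws unique-ws (λ _ z → z)
            (λ y y∈ → dom-s₀ _ (x∈X y∈)) le
        ... | J , sub , u , len , K , _ = J , sub , u , len , record
          { P = K.P ; teeth = K.teeth ; P⊆U = λ i i≤ → X⊆D _ (proj₁ (proj₂ (K.P⊆U i i≤))) ; Λ⊆U = λ y p v l → X⊆D _ (proj₁ (proj₂ (K.Λ⊆U y p v l)))
          ; apart = K.apart ; pos-≢ = K.pos-≢ }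
          where module K = EdgeComb K

        vertices : NetFree y₀ ws → ∀ m → vertexBound m ≤ length ws →
          Σ[ J ∈ List V ] J ⊑ ws × AllPairs _≢_ J × length J ≡ m × VertexComb x S J
        vertices nf m le with VertexCombs.vertex-comb C x attached no-hole nf _ m (x y₀) s∈X ≤-refl ws unique-ws (λ y y∈ → dom-s₀ _ (x∈X y∈)) le
        ... | J , sub , u , len , K , _ = J , sub , u , len , record
          { P = K.P ; teeth = K.teeth ; P⊆U = λ i i≤ → inS _ (K.P⊆U i i≤) ; Λ⊆U = λ y p v l → inS v (K.Λ⊆U y p v l) ; apart = K.apart }
          where
          module K = VertexComb K
          inS : ∀ v → VertexCombs.Region C x attached no-hole nf (x y₀) ws v → S v
          inS v (inj₁ refl) = X⊆D _ s∈X
          inS v (inj₂ (_ , _ , k , _ , _ , d)) = X⊆D v (proj₁ (proj₂ d))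

    open WithCritical crit public using (edges; vertices)

  -- The teeth of a comb depend on a membership proof, whereas `CombPair` takes functions on all
  -- vertices. Deciding `y ∈? J` fixes one proof per label, with placeholders elsewhere.
  module TotalTeeth where
    open Combs

    module EdgeData {τ : V → V} {U : VSet} {J : List V} (K : EdgeComb τ U J) where
      open EdgeComb K public using (P; P⊆U)
      private module K = EdgeComb K

      posOf : ∀ {y} → Dec (y ∈ J) → ℕ
      posOf (yes p) = EdgeTooth.pos (K.teeth _ p)
      posOf (no _) = 0
      rOf : ∀ {y} → Dec (y ∈ J) → V
      rOf (yes p) = EdgeTooth.r (K.teeth _ p)
      rOf {y} (no _) = y
      ΛOf : ∀ {y} → Dec (y ∈ J) → VSet
      ΛOf (yes p) = EdgeTooth.Λ (K.teeth _ p)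
      ΛOf (no _) v = ⊥

      pos : V → ℕ
      pos y = posOf (y ∈? J)
      r : V → V
      r y = rOf (y ∈? J)
      Λ : V → VSet
      Λ y = ΛOf (y ∈? J)

      tooth : ∀ y → y ∈ J → Σ[ T ∈ EdgeTooth τ P y ] pos y ≡ EdgeTooth.pos T × r y ≡ EdgeTooth.r T × Λ y ≡ EdgeTooth.Λ T
      tooth y y∈ with y ∈? J
      ... | yes p = K.teeth y p , refl , refl , refl
      ... | no y∉ = contradiction y∈ y∉

      apart : ∀ y y′ → y ∈ J → y′ ∈ J → y ≢ y′ → Anti (Λ y) (Λ y′)
      apart y y′ y∈ y′∈ ne with y ∈? J | y′ ∈? J
      ... | yes p | yes p′ = K.apart y y′ p p′ ne
      ... | no y∉ | _ = contradiction y∈ y∉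
      ... | yes _ | no y∉ = contradiction y′∈ y∉

      pos-≢ : ∀ y y′ → y ∈ J → y′ ∈ J → y ≢ y′ → pos y ≢ pos y′
      pos-≢ y y′ y∈ y′∈ ne with y ∈? J | y′ ∈? J
      ... | yes p | yes p′ = K.pos-≢ y y′ p p′ ne
      ... | no y∉ | _ = contradiction y∈ y∉
      ... | yes _ | no y∉ = contradiction y′∈ y∉

      Λ⊆U : ∀ y → y ∈ J → ∀ v → Λ y v → U v
      Λ⊆U y y∈ v l with y ∈? J
      ... | yes p = K.Λ⊆U y p v l
      ... | no y∉ = contradiction y∈ y∉

      module _ (y : V) (y∈ : y ∈ J) where
        private
          T = proj₁ (tooth y y∈)
          e₁ = proj₁ (proj₂ (tooth y y∈))
          e₂ = proj₁ (proj₂ (proj₂ (tooth y y∈)))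
          e₃ = proj₂ (proj₂ (proj₂ (tooth y y∈)))
        pos< : pos y < N P
        pos< rewrite e₁ = EdgeTooth.pos< T
        r~₀ : r y ~ sp P (pos y)
        r~₀ rewrite e₁ | e₂ = proj₁ (EdgeTooth.r~ T)
        r~₁ : r y ~ sp P (suc (pos y))
        r~₁ rewrite e₁ | e₂ = proj₂ (EdgeTooth.r~ T)
        leg : Walk (Λ y) (r y) (τ y)
        leg rewrite e₂ | e₃ = EdgeTooth.leg T
        sees : ∀ u i → Λ y u → i ≤ N P → u ≢ sp P i × (u ~ sp P i → u ≡ r y × (i ≡ pos y ⊎ i ≡ suc (pos y)))
        sees rewrite e₁ | e₂ | e₃ = EdgeTooth.sees T

    module VertexData {τ : V → V} {U : VSet} {J : List V} (K : VertexComb τ U J) where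
      open VertexComb K public using (P; P⊆U)
      private module K = VertexComb K

      posOf : ∀ {y} → Dec (y ∈ J) → ℕ
      posOf (yes p) = VertexTooth.pos (K.teeth _ p)
      posOf (no _) = 0
      ΛOf : ∀ {y} → Dec (y ∈ J) → VSet
      ΛOf (yes p) = VertexTooth.Λ (K.teeth _ p)
      ΛOf (no _) v = ⊥

      pos : V → ℕ
      pos y = posOf (y ∈? J)
      Λ : V → VSet
      Λ y = ΛOf (y ∈? J)

      tooth : ∀ y → y ∈ J → Σ[ T ∈ VertexTooth τ P y ] pos y ≡ VertexTooth.pos T × Λ y ≡ VertexTooth.Λ T
      tooth y y∈ with y ∈? J
      ... | yes p = K.teeth y p , refl , refl
      ... | no y∉ = contradiction y∈ y∉

      apart : ∀ y y′ → y ∈ J → y′ ∈ J → y ≢ y′ → Anti (Λ y) (Λ y′)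
      apart y y′ y∈ y′∈ ne with y ∈? J | y′ ∈? J
      ... | yes p | yes p′ = K.apart y y′ p p′ ne
      ... | no y∉ | _ = contradiction y∈ y∉
      ... | yes _ | no y∉ = contradiction y′∈ y∉

      Λ⊆U : ∀ y → y ∈ J → ∀ v → Λ y v → U v
      Λ⊆U y y∈ v l with y ∈? J
      ... | yes p = K.Λ⊆U y p v l
      ... | no y∉ = contradiction y∈ y∉

      module _ (y : V) (y∈ : y ∈ J) where
        private
          T = proj₁ (tooth y y∈)
          e₁ = proj₁ (proj₂ (tooth y y∈))
          e₃ = proj₂ (proj₂ (tooth y y∈))
        pos≤ : pos y ≤ N P
        pos≤ rewrite e₁ = VertexTooth.pos≤ T
        leg : Walk (λ v → v ≡ sp P (pos y) ⊎ Λ y v) (sp P (pos y)) (τ y)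
        leg rewrite e₁ | e₃ = VertexTooth.leg T
        sees : ∀ u i → Λ y u → i ≤ N P → u ≢ sp P i × (u ~ sp P i → i ≡ pos y)
        sees rewrite e₁ | e₃ = VertexTooth.sees T

  module Pairings {ys : List (Fin n)} (TS : TwoSides ys) where
    open Combs
    open TotalTeeth
    open Assembly
    open TwoSides TS

    -- The label itself is appended to its leg on the first side.
    both-single : ∀ {zs zs′} → zs ⊑ ys → zs′ ⊑ ys → (S₁ : SingleSide D zs) (S₂ : SingleSide E zs′) {J J′ : List V} → J ⊑ zs → J′ ⊑ J → J′ ⊑ zs′ →
      EdgeComb (SingleLabels.x S₁) (SingleSide.S S₁) J → VertexComb (SingleLabels.x S₂) (SingleSide.S S₂) J′ → CombPair J′
    both-single {zs} {zs′} zs⊑ zs′⊑ S₁ S₂ {J} {J′} J⊑ J′⊑ J′⊑′ K L = record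
        { A = K.P ; B = L.P ; α = id ; β = S₂.x ; r = K.r ; p = K.pos ; q = L.pos
        ; Λ = λ y v → K.Λ y v ⊎ v ≡ y ; M = L.Λ
        ; p< = λ y y∈ → K.pos< y (J′⊑ y y∈) ; r~₀ = λ y y∈ → K.r~₀ y (J′⊑ y y∈) ; r~₁ = λ y y∈ → K.r~₁ y (J′⊑ y y∈)
        ; legA = λ y y∈ → walk-snoc (walk-map (λ _ → inj₁) (K.leg y (J′⊑ y y∈))) (~-sym (proj₁ (proj₂ (spec₁ y∈)))) (inj₂ refl)
        ; seesA = λ { y y∈ u i (inj₁ l) le → K.sees y (J′⊑ y y∈) u i l le
                    ; y y∈ u i (inj₂ refl) le → (λ { r → offD y∈ (subst S₁.S (sym r) (K.P⊆U i le)) }) ,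
                        λ e → contradiction (sym (proj₂ (proj₂ (spec₁ y∈)) _ (K.P⊆U i le) e))
                          (proj₁ (K.sees y (J′⊑ y y∈) _ i (walk-end (K.leg y (J′⊑ y y∈))) le)) }
        ; apartA = λ { y y′ y∈ y′∈ ne u w (inj₁ l) (inj₁ l′) → K.apart y y′ (J′⊑ y y∈) (J′⊑ y′ y′∈) ne u w l l′
                     ; y y′ y∈ y′∈ ne u w (inj₁ l) (inj₂ refl) → leg-label y∈ y′∈ ne u l
                     ; y y′ y∈ y′∈ ne u w (inj₂ refl) (inj₁ l) → Anti-sym {S = K.Λ y′} {T = _≡ y} (λ { u w a refl → leg-label y′∈ y∈ (ne ∘ sym) u a }) u w refl l
                     ; y y′ y∈ y′∈ ne u w (inj₂ refl) (inj₂ refl) → ne , stable u w (up y∈) (up y′∈) }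
        ; p-≢ = λ y y′ y∈ y′∈ → K.pos-≢ y y′ (J′⊑ y y∈) (J′⊑ y′ y′∈)
        ; q≤ = L.pos≤ ; legB = L.leg ; seesB = L.sees ; apartB = L.apart
        ; α~β = λ y y∈ → proj₁ (proj₂ (spec₂ y∈))
        ; cross = λ { u w (inj₁ (i , le , refl)) b → far (S₁.S⊆D _ (K.P⊆U i le)) (inE b)
                    ; u w (inj₂ (y , y∈ , inj₁ l)) b → far (S₁.S⊆D _ (K.Λ⊆U y (J′⊑ y y∈) u l)) (inE b)
                    ; u w (inj₂ (y , y∈ , inj₂ refl)) b → (λ r → off-E u (up y∈) (subst E (sym r) (S₂.S⊆D w (inE b)))) ,
                        λ e → u , y∈ , refl , proj₂ (proj₂ (spec₂ y∈)) w (inE b) e } }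
      where
      module S₁ = SingleLabels S₁
      module S₂ = SingleLabels S₂
      module K = EdgeData K
      module L = VertexData L
      spec₁ = λ {y} (y∈ : y ∈ J′) → S₁.x-spec y (J⊑ y (J′⊑ y y∈))
      spec₂ = λ {y} (y∈ : y ∈ J′) → S₂.x-spec y (J′⊑′ y y∈)
      up : ∀ {y} → y ∈ J′ → y ∈ ys
      up y∈ = zs⊑ _ (J⊑ _ (J′⊑ _ y∈))
      offD : ∀ {y} → y ∈ J′ → ¬ S₁.S y
      offD y∈ s = off-D _ (up y∈) (S₁.S⊆D _ s)
      leg-label : ∀ {y y′} → y ∈ J′ → y′ ∈ J′ → y ≢ y′ → ∀ u → K.Λ y u → u ≢ y′ × ¬ (u ~ y′)
      leg-label {y} {y′} y∈ y′∈ ne u l = (λ { refl → offD y′∈ (K.Λ⊆U y (J′⊑ y y∈) u l) }) ,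
        λ e → proj₁ (K.apart y y′ (J′⊑ y y∈) (J′⊑ y′ y′∈) ne u u l (subst (K.Λ y′) (sym (proj₂ (proj₂ (spec₁ y′∈)) u (K.Λ⊆U y (J′⊑ y y∈) u l) (~-sym e)))
          (walk-end (K.leg y′ (J′⊑ y′ y′∈))))) refl
      inE : ∀ {w} → Body L.P L.Λ J′ w → S₂.S w
      inE (inj₁ (i , le , refl)) = L.P⊆U i le
      inE (inj₂ (y , y∈ , l)) = L.Λ⊆U y y∈ _ l
      far : ∀ {u w} {R : Set} → D u → S₂.S w → u ≢ w × (u ~ w → R)
      far du sw with D-E _ _ du (S₂.S⊆D _ sw)
      ... | ne , na = ne , λ e → contradiction e na

    module _ {zs vs : List V} (zs⊑ : zs ⊑ ys) (vs⊑ : vs ⊑ zs) (S₁ : SingleSide D zs) (H₂ : HullSide E vs) where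
      private
        module S₁ = SingleLabels S₁
        module H₂ = Hulls H₂
        up : ∀ {y} → y ∈ vs → y ∈ ys
        up y∈ = zs⊑ _ (vs⊑ _ y∈)
        spec = λ {y} (y∈ : y ∈ vs) → S₁.x-spec y (vs⊑ y y∈)

      -- Labels with exactly two consecutive neighbours on the path are teeth on their own.
      short-hulls : {J : List V} → J ⊑ vs → (∀ y → y ∈ J → H₂.g y ≡ suc (H₂.f y)) → VertexComb S₁.x S₁.S J → CombPair J
      short-hulls {J} J⊑ short L = record
        { A = H₂.P ; B = L.P ; α = id ; β = S₁.x ; r = id ; p = H₂.f ; q = L.pos ; Λ = λ y → _≡ y ; M = L.Λ
        ; p< = λ y y∈ → subst (_≤ N H₂.P) (short y y∈) (H₂.g≤N y (J⊑ y y∈))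
        ; r~₀ = λ y y∈ → H₂.y~f y (J⊑ y y∈) ; r~₁ = λ y y∈ → subst (λ k → y ~ sp H₂.P k) (short y y∈) (H₂.y~g y (J⊑ y y∈))
        ; legA = λ y y∈ → here refl
        ; seesA = λ { y y∈ u i refl le → (λ { r → off-E y (up (J⊑ y y∈)) (subst E (sym r) (H₂.P⊆D i le)) }) ,
              λ e → refl , between (H₂.f≤ y (J⊑ y y∈) i le e) (subst (i ≤_) (short y y∈) (H₂.≤g y (J⊑ y y∈) i le e)) }
        ; apartA = λ { y y′ y∈ y′∈ ne u w refl refl → ne , stable y y′ (up (J⊑ y y∈)) (up (J⊑ y′ y′∈)) }
        ; p-≢ = λ y y′ y∈ y′∈ ne e → [ (λ b → <-irrefl e (<-trans (H₂.f<g y (J⊑ y y∈)) b)) ,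
                                       (λ b → <-irrefl (sym e) (<-trans (H₂.f<g y′ (J⊑ y′ y′∈)) b)) ]′ (H₂.before-total (J⊑ y y∈) (J⊑ y′ y′∈) ne)
        ; q≤ = L.pos≤ ; legB = L.leg ; seesB = L.sees ; apartB = L.apart
        ; α~β = λ y y∈ → proj₁ (proj₂ (spec (J⊑ y y∈)))
        ; cross = λ { u w (inj₁ (i , le , refl)) b → case D-E w _ (S₁.S⊆D w (inS b)) (H₂.P⊆D i le) of λ { (ne , na) → (ne ∘ sym) , λ e → contradiction (~-sym e) na }
                    ; u w (inj₂ (y , y∈ , refl)) b → (λ r → off-D u (up (J⊑ u y∈)) (subst D (sym r) (S₁.S⊆D w (inS b)))) ,
                        λ e → u , y∈ , refl , proj₂ (proj₂ (spec (J⊑ u y∈))) w (inS b) e } }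
        where
        module L = VertexData L
        inS : ∀ {w} → Body L.P L.Λ J w → S₁.S w
        inS (inj₁ (i , le , refl)) = L.P⊆U i le
        inS (inj₂ (y , y∈ , l)) = L.Λ⊆U y y∈ _ l
        between : ∀ {f i} → f ≤ i → i ≤ suc f → i ≡ f ⊎ i ≡ suc f
        between lo hi with m≤n⇒m<n∨m≡n lo
        ... | inj₁ lt = inj₂ (≤-antisym hi lt)
        ... | inj₂ e = inj₁ (sym e)

      Ordered : List V → Set
      Ordered = AllPairs (λ y y′ → y ≢ y′ × H₂.Before y y′)

      private
        -- The path of H₂ with the hull of every label in the list replaced by the label.
        Through : V → List V → Set
        Through y js = Σ[ l ∈ List V ] Σ[ e ∈ V ] IPath y e l × (∀ v → v ∈ l → v ∈ y ∷ js ⊎ (Σ[ i ∈ ℕ ] H₂.g y ≤ i × i ≤ N H₂.P × sp H₂.P i ≡ v)) ×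
          (∀ v → v ∈ y ∷ js → v ∈ l)

        through : ∀ y js → y ∷ js ⊑ vs → Ordered (y ∷ js) → (∀ v → v ∈ y ∷ js → suc (H₂.f v) < H₂.g v) → Through y js
        through y [] _ _ _ = y ∷ [] , y , [-] , (λ v → inj₁) , λ v z → z
        through y (y′ ∷ js) sub (before ∷ ordered) long = extend (through y′ js (λ v v∈ → sub v (there v∈)) ordered (λ v v∈ → long v (there v∈)))
          where
          y∈ = sub y (here refl)
          y′∈ = sub y′ (there (here refl))
          b : H₂.Before y y′
          b = proj₂ (All.lookup before (here refl))
          m = H₂.f y′ ∸ H₂.g y
          em : H₂.g y + m ≡ H₂.f y′
          em = m+[n∸m]≡n (<⇒≤ b)
          fN = H₂.f≤N y′ y′∈
          S = segList H₂.P (H₂.g y) m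
          seg : IPath (sp H₂.P (H₂.g y)) (sp H₂.P (H₂.f y′)) S
          seg = subst (λ k → IPath _ (sp H₂.P k) S) em (seg-path H₂.P (H₂.g y) m (subst (_≤ N H₂.P) (sym em) fN))
          inS : ∀ {v} → v ∈ S → Σ[ i ∈ ℕ ] H₂.g y ≤ i × i ≤ H₂.f y′ × sp H₂.P i ≡ v
          inS v∈ with ∈-segList⁻ H₂.P (H₂.g y) m v∈
          ... | i , lo , hi , e = i , lo , subst (i ≤_) em hi , e
          y≢p : ∀ {v} → v ∈ vs → ∀ i → i ≤ N H₂.P → v ≢ sp H₂.P i
          y≢p v∈ i le refl = off-E _ (up v∈) (H₂.P⊆D i le)
          extend : Through y′ js → Through y (y′ ∷ js)
          extend (l , e , p , content , has) = y ∷ (S ++ l) , e , cons (H₂.y~g y y∈) first-sees (path-++ seg p (~-sym (H₂.y~f y′ y′∈)) cross) ,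
              content′ , λ { v (here r) → here r ; v (there v∈) → there (∈ₚ.∈-++⁺ʳ S (has v v∈)) }
            where
            cross : ∀ u w → u ∈ S → w ∈ l → u ≢ w × (u ~ w → u ≡ sp H₂.P (H₂.f y′) × w ≡ y′)
            cross u w u∈ w∈ with inS u∈ | content w w∈
            ... | i , lo , hi , refl | inj₁ (here refl) = (λ r → y≢p y′∈ i (≤-trans hi fN) (sym r)) ,
                  λ a → cong (sp H₂.P) (≤-antisym hi (H₂.f≤ y′ y′∈ i (≤-trans hi fN) (~-sym a))) , refl
            ... | i , lo , hi , refl | inj₁ (there w∈js) = (λ r → y≢p (sub w (there (there w∈js))) i (≤-trans hi fN) (sym r)) ,
                  λ a → contradiction (H₂.f≤ w (sub w (there (there w∈js))) i (≤-trans hi fN) (~-sym a)) (<⇒≱ (≤-<-trans hi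
                    (<-trans (H₂.f<g y′ y′∈) (after ordered w∈js))))
              where
              after : Ordered (y′ ∷ js) → w ∈ js → H₂.Before y′ w
              after (r ∷ _) w∈ = proj₂ (All.lookup r w∈)
            ... | i , lo , hi , refl | inj₂ (k , klo , khi , refl) = (λ r → <-irrefl (spJ H₂.P i k (≤-trans hi fN) khi r) i<k) ,
                  λ a → contradiction (spI H₂.P i k (≤-trans hi fN) khi a) λ { (inj₁ r) → <-irrefl (sym r) si<k ; (inj₂ r) → <-irrefl r (m<n⇒m<1+n i<k) }
              where
              -- Here the hulls must be long: were `g` the successor of `f`, the path vertices on
              -- either side of the inserted label would be adjacent.
              si<k : suc i < k
              si<k = ≤-trans (s≤s (s≤s hi)) (≤-trans (long y′ (there (here refl))) klo)
              i<k = <-trans (n<1+n i) si<k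
            first-sees : ∀ z → z ∈ S ++ l → y ≢ z × (y ~ z → z ≡ sp H₂.P (H₂.g y))
            first-sees z z∈ with ∈ₚ.∈-++⁻ S z∈
            ... | inj₁ z∈S with inS z∈S
            ...   | i , lo , hi , refl = y≢p y∈ i (≤-trans hi fN) , λ a → cong (sp H₂.P) (≤-antisym (H₂.≤g y y∈ i (≤-trans hi fN) a) lo)
            first-sees z z∈ | inj₂ z∈l with content z z∈l
            ...   | inj₁ z∈js = proj₁ (All.lookup before z∈js) , λ a → contradiction a (stable y z (up y∈) (up (sub z (there z∈js))))
            ...   | inj₂ (k , klo , khi , refl) = y≢p y∈ k khi ,
                    λ a → contradiction (H₂.≤g y y∈ k khi a) (<⇒≱ (≤-trans (<-trans b (H₂.f<g y′ y′∈)) klo))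
            content′ : ∀ v → v ∈ y ∷ (S ++ l) → v ∈ y ∷ y′ ∷ js ⊎ (Σ[ i ∈ ℕ ] H₂.g y ≤ i × i ≤ N H₂.P × sp H₂.P i ≡ v)
            content′ v (here r) = inj₁ (here r)
            content′ v (there v∈) with ∈ₚ.∈-++⁻ S v∈
            ... | inj₁ v∈S with inS v∈S
            ...   | i , lo , hi , r = inj₂ (i , lo , ≤-trans hi fN , r)
            content′ v (there v∈) | inj₂ v∈l with content v v∈l
            ...   | inj₁ r = inj₁ (there r)
            ...   | inj₂ (k , klo , khi , r) = inj₂ (k , ≤-trans (<⇒≤ (<-trans b (H₂.f<g y′ y′∈))) klo , khi , r)

      -- The second spine passes through the labels themselves in place of their hulls. Every label
      -- is then a spine vertex, so all vertex teeth are empty and the edge from `α` to `β` is that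
      -- from its neighbour to the label.
      long-hulls : {J J′ : List V} → J ⊑ vs → J′ ⊑ J → Ordered J′ → 1 ≤ length J′ → (∀ y → y ∈ J′ → suc (H₂.f y) < H₂.g y) → EdgeComb S₁.x S₁.S J → CombPair J′
      long-hulls {J′ = []} _ _ _ () _ _
      long-hulls {J} {y₁ ∷ js} J⊑ J′⊑ ordered _ long K = pair (through y₁ js (λ v v∈ → J⊑ v (J′⊑ v v∈)) ordered long)
        where
        module K = EdgeData K
        J′ = y₁ ∷ js
        in-vs : ∀ {y} → y ∈ J′ → y ∈ vs
        in-vs y∈ = J⊑ _ (J′⊑ _ y∈)
        pair : Through y₁ js → CombPair J′
        pair (l , e , path , content , has) = record
          { A = K.P ; B = B ; α = S₁.x ; β = id ; r = K.r ; p = K.pos ; q = index ; Λ = K.Λ ; M = λ _ _ → ⊥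
          ; p< = λ y y∈ → K.pos< y (J′⊑ y y∈) ; r~₀ = λ y y∈ → K.r~₀ y (J′⊑ y y∈) ; r~₁ = λ y y∈ → K.r~₁ y (J′⊑ y y∈)
          ; legA = λ y y∈ → K.leg y (J′⊑ y y∈) ; seesA = λ y y∈ → K.sees y (J′⊑ y y∈)
          ; apartA = λ y y′ y∈ y′∈ → K.apart y y′ (J′⊑ y y∈) (J′⊑ y′ y′∈) ; p-≢ = λ y y′ y∈ y′∈ → K.pos-≢ y y′ (J′⊑ y y∈) (J′⊑ y′ y′∈)
          ; q≤ = λ y y∈ → proj₁ (index-spec y y∈)
          ; legB = λ y y∈ → subst (Walk _ (sp B (index y))) (proj₂ (index-spec y y∈)) (here (inj₁ refl))
          ; seesB = λ y y∈ u i () ; apartB = λ y y′ y∈ y′∈ ne u w ()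
          ; α~β = λ y y∈ → ~-sym (proj₁ (proj₂ (spec (in-vs y∈))))
          ; cross = λ { u w a (inj₁ (i , le , refl)) → cross u _ (inS a) (content _ (nth-∈ y₁ l i (≤pred path le))) ; u w a (inj₂ (_ , _ , ())) } }
          where
          B : Spine
          B = toSpine path
          index : V → ℕ
          index y with y ∈? l
          ... | yes y∈ = proj₁ (∈-nth y₁ l y∈)
          ... | no _ = 0
          index-spec : ∀ y → y ∈ J′ → index y ≤ N B × sp B (index y) ≡ y
          index-spec y y∈ with y ∈? l
          ... | yes y∈l = <length path (proj₁ (proj₂ (∈-nth y₁ l y∈l))) , proj₂ (proj₂ (∈-nth y₁ l y∈l))
          ... | no y∉ = contradiction (has y y∈) y∉
          inS : ∀ {u} → Body K.P K.Λ J′ u → S₁.S u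
          inS (inj₁ (i , le , refl)) = K.P⊆U i le
          inS (inj₂ (y , y∈ , m)) = K.Λ⊆U y (J′⊑ y y∈) _ m
          cross : ∀ u w → S₁.S u → w ∈ J′ ⊎ (Σ[ i ∈ ℕ ] H₂.g y₁ ≤ i × i ≤ N H₂.P × sp H₂.P i ≡ w) → u ≢ w × (u ~ w → Σ[ y ∈ V ] y ∈ J′ × u ≡ S₁.x y × w ≡ y)
          cross u w su (inj₁ w∈) = (λ { refl → off-D u (up (in-vs w∈)) (S₁.S⊆D u su) }) ,
            λ a → w , w∈ , proj₂ (proj₂ (spec (in-vs w∈))) u su (~-sym a) , refl
          cross u w su (inj₂ (i , _ , le , refl)) with D-E u _ (S₁.S⊆D u su) (H₂.P⊆D i le)
          ... | ne , na = ne , λ a → contradiction a na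

  restrict-sides : ∀ {ys zs : List (Fin n)} → TwoSides ys → zs ⊑ ys → AllPairs _≢_ zs → TwoSides zs
  restrict-sides TS sub u = record
    { D = D ; E = E ; D? = D? ; E? = E? ; D-conn = D-conn ; E-conn = E-conn ; D-E = D-E ; unique = u
    ; stable = λ x y x∈ y∈ → stable x y (sub x x∈) (sub y y∈)
    ; off-D = λ y y∈ → off-D y (sub y y∈) ; off-E = λ y y∈ → off-E y (sub y y∈)
    ; att-D = λ y y∈ → att-D y (sub y y∈) ; att-E = λ y y∈ → att-E y (sub y y∈) }
    where open TwoSides TS

  restrict-single : ∀ {D : Fin n → Set} {ys zs : List (Fin n)} → SingleSide D ys → zs ⊑ ys → SingleSide D zs
  restrict-single SS sub = record { S = S ; S? = S? ; S⊆D = S⊆D ; conn = conn ; nb = λ y y∈ → nb y (sub y y∈) }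
    where open SingleSide SS

  restrict-hulls : ∀ {D : Fin n → Set} {ys zs : List (Fin n)} (H : HullSide D ys) → zs ⊑ ys →
    AllPairs (λ y y′ → HullSide.g H y < HullSide.f H y′) zs → HullSide D zs
  restrict-hulls H sub hulls′ = record
    { P = P ; P⊆D = P⊆D ; f = f ; g = g ; f<g = λ y y∈ → f<g y (sub y y∈) ; g≤N = λ y y∈ → g≤N y (sub y y∈)
    ; y~f = λ y y∈ → y~f y (sub y y∈) ; y~g = λ y y∈ → y~g y (sub y y∈)
    ; f≤ = λ y y∈ → f≤ y (sub y y∈) ; ≤g = λ y y∈ → ≤g y (sub y y∈) ; hulls = hulls′ }
    where open HullSide H

  -- Combining the two sides.

  module Core (t′ : ℕ) (no-theta : ¬ Theta G) (no-prism : ¬ Prism G)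
    (clique-free : ¬ Clique G (suc t′)) (K : ℕ)
    (pyramid-of : ∀ {J} → Assembly.CombPair J → AllPairs _≢_ J → K ≤ length J → ⊥) where
    open Combs using (EdgeComb; VertexComb)

    private
      no-clique : ∀ (l : List V) → AllPairs _~_ l → length l ≢ suc t′
      no-clique l pairs len = clique-free (f , f-injective , λ i j ne → adjacent i j ne)
        where
        f : Fin (suc t′) → V
        f i = lookup l (F.cast (sym len) i)
        pair : ∀ i j → toℕ i < toℕ j → f i ~ f j
        pair i j lt = AllPairs-lookup pairs _ _ (subst₂ _<_ (sym (Fₚ.toℕ-cast (sym len) i)) (sym (Fₚ.toℕ-cast (sym len) j)) lt)
        adjacent : ∀ i j → i ≢ j → f i ~ f j
        adjacent i j ne with <-cmp (toℕ i) (toℕ j)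
        ... | tri< lt _ _ = pair i j lt
        ... | tri≈ _ e _ = contradiction (Fₚ.toℕ-injective e) ne
        ... | tri> _ _ gt = ~-sym (pair j i gt)
        f-injective : ∀ {i j} → f i ≡ f j → i ≡ j
        f-injective {i} {j} e with i Fₚ.≟ j
        ... | yes r = r
        ... | no ne = contradiction e (~-irr (adjacent i j ne))

    module _ {ys : List V} (TS : TwoSides ys) (non-hub : ∀ y → y ∈ ys → ¬ Hub G y) where
      open TwoSides TS

      -- The edge comb is built first, with enough teeth that a vertex comb on the other side can be
      -- extracted from its labels alone. Restricting an edge comb to fewer labels is harmless.
      pure-pair : ∀ {zs} → zs ⊑ ys → (S₁ : SingleSide D zs) (S₂ : SingleSide E zs) → ∀ y₀ ws → y₀ ∈ zs → ws ⊑ zs → AllPairs _≢_ ws →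
        edgeLabels t′ K ≤ length ws → SingleLabels.ClawFree S₁ y₀ ws → SingleLabels.NetFree S₂ y₀ ws → ⊥
      pure-pair {zs} zs⊑ S₁ S₂ y₀ ws y₀∈ ws⊑ u le cf nf = run (PureCombs.edges no-theta TS zs⊑ S₁ y₀ y₀∈ ws ws⊑ u t′ no-clique cf (teethBound K) le)
        where
        run : _ → ⊥
        run (J , J⊑ , uJ , lenJ , EC) = finish (PureCombs.vertices no-theta (flip-sides TS) zs⊑ S₂ y₀ y₀∈ J (λ v v∈ → ws⊑ v (J⊑ v v∈)) uJ
            (λ i j i∈ j∈ → nf i j (J⊑ i i∈) (J⊑ j j∈)) K (≤-trans (m≤m+n _ _) (≤-reflexive (sym lenJ))))
          where
          finish : _ → ⊥
          finish (J′ , J′⊑ , uJ′ , lenJ′ , VC) = pyramid-of (Pairings.both-single TS zs⊑ zs⊑ S₁ S₂ (λ v v∈ → ws⊑ v (J⊑ v v∈)) J′⊑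
            (λ v v∈ → ws⊑ v (J⊑ v (J′⊑ v v∈))) EC VC) uJ′ (≤-reflexive (sym lenJ′))

      single-hull : ∀ {zs ws} → zs ⊑ ys → ws ⊑ zs → AllPairs _≢_ ws → (S₁ : SingleSide D zs) → HullSide E ws → hullCount t′ K ≤ length ws → ⊥
      single-hull {zs} {ws} zs⊑ ws⊑ u S₁ H₂ le = run (SH.pure-hulls (hullLabels t′ K) le u)
        where
        module SH = SingleHull no-theta no-prism TS non-hub zs⊑ ws⊑ S₁ H₂
        module H₂ = Hulls H₂
        run : SH.PureHulls (hullLabels t′ K) → ⊥
        run (y₀ , vs , y₀∈ , vs⊑ , ordered , _ , big , inj₁ (cf , long)) =
            finish (PureCombs.edges no-theta TS zs⊑ S₁ y₀ (ws⊑ y₀ y₀∈) vs (λ v v∈ → ws⊑ v (vs⊑ v v∈)) (AllPairs.map proj₁ ordered) t′ no-clique cf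
              (teethBound K) (≤-trans (m≤m+n _ _) big))
          where
          finish : _ → ⊥
          -- The comb returns its labels without regard to the path of hulls; they are reordered
          -- along it before the labels are threaded into that path.
          finish (J , J⊑ , uJ , lenJ , EC) with monotone (λ y y′ → H₂.g y <? H₂.f y′) J uJ
              (λ x y x∈ y∈ → H₂.before-total (vs⊑ x (J⊑ x x∈)) (vs⊑ y (J⊑ y y∈))) (suc K) (≤-trans (m≤n+m _ (vertexBound K)) (≤-reflexive (sym lenJ)))
          ... | J′ , J′⊑ , ord , lenJ′ = pyramid-of (Pairings.long-hulls TS zs⊑ ws⊑ S₁ H₂ (λ v v∈ → vs⊑ v (J⊑ v v∈)) J′⊑ ord
                (≤-trans (s≤s z≤n) (≤-reflexive (sym lenJ′))) (λ y y∈ → long y (J⊑ y (J′⊑ y y∈))) EC) (AllPairs.map proj₁ ord) (≤-trans (n≤1+n K) (≤-reflexive (sym lenJ′)))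
        run (y₀ , vs , y₀∈ , vs⊑ , ordered , _ , big , inj₂ (nf , short)) =
            finish (PureCombs.vertices no-theta TS zs⊑ S₁ y₀ (ws⊑ y₀ y₀∈) vs (λ v v∈ → ws⊑ v (vs⊑ v v∈)) (AllPairs.map proj₁ ordered) nf K
              (≤-trans (m≤n+m _ (edgeLabels t′ K)) big))
          where
          finish : _ → ⊥
          finish (J , J⊑ , uJ , lenJ , VC) = pyramid-of (Pairings.short-hulls TS zs⊑ ws⊑ S₁ H₂ (λ v v∈ → vs⊑ v (J⊑ v v∈)) (λ y y∈ → short y (J⊑ y y∈)) VC)
            uJ (≤-reflexive (sym lenJ))

    too-many : ∀ {ys} (TS : TwoSides ys) → (∀ y → y ∈ ys → ¬ Hub G y) → sideBound (sideBound (secondSide t′ K)) ≤ length ys → ⊥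
    too-many {ys} TS non-hub le = first (SideLemma.side no-theta TS (sideBound (secondSide t′ K)) le)
      where
      open TwoSides TS
      e = edgeLabels t′ K
      h = hullCount t′ K
      first : SideResult D ys (sideBound (secondSide t′ K)) → ⊥
      first (zs , zs⊑ , uz , le₁ , one) = second (SideLemma.side no-theta (flip-sides (restrict-sides TS zs⊑ uz)) (secondSide t′ K) le₁)
        where
        second : SideResult E zs (secondSide t′ K) → ⊥
        second (ws , ws⊑ , uw , le₂ , two) = combine one two
          where
          up : ws ⊑ ys
          up v v∈ = zs⊑ v (ws⊑ v v∈)
          le-e : ramseyBound e e < length ws
          le-e = ≤-trans (m≤m+n _ _) le₂
          le-r : ramseyBound h h + (h + ramseyBound 3 3) ≤ length ws
          le-r = ≤-trans (m≤n+m _ (suc (ramseyBound e e))) le₂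
          combine : SingleSide D zs ⊎ HullSide D zs → SingleSide E ws ⊎ HullSide E ws → ⊥
          combine (inj₁ S₁) (inj₁ S₂) = pure (BothSingle.pure-sides no-theta no-prism TS up (restrict-single S₁ ws⊑) S₂ e ws (λ _ z → z) uw le-e)
            where
            pure : _ → ⊥
            pure (y₀ , vs , y₀∈ , vs⊑ , uv , _ , len , inj₁ (cf , nf)) = pure-pair TS non-hub up (restrict-single S₁ ws⊑) S₂ y₀ vs y₀∈ vs⊑ uv (≤-reflexive (sym len)) cf nf
            pure (y₀ , vs , y₀∈ , vs⊑ , uv , _ , len , inj₂ (nf , cf)) = pure-pair (flip-sides TS) non-hub up S₂ (restrict-single S₁ ws⊑) y₀ vs y₀∈ vs⊑ uv (≤-reflexive (sym len)) cf nf
          combine (inj₁ S₁) (inj₂ H₂) = single-hull TS non-hub zs⊑ ws⊑ uw S₁ H₂ (≤-trans (≤-trans (m≤m+n h _) (m≤n+m _ (ramseyBound h h))) le-r)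
          combine (inj₂ H₁) (inj₁ S₂) with monotone (λ y y′ → HullSide.g H₁ y <? HullSide.f H₁ y′) ws uw
              (λ x y x∈ y∈ → Hulls.before-total H₁ (ws⊑ x x∈) (ws⊑ y y∈)) h (≤-trans (m≤m+n _ _) le-r)
          ... | vs , vs⊑ , ord , len = single-hull (flip-sides TS) non-hub up vs⊑ (AllPairs.map proj₁ ord) S₂
                (restrict-hulls H₁ (λ v v∈ → ws⊑ v (vs⊑ v v∈)) (AllPairs.map proj₂ ord)) (≤-reflexive (sym len))
          combine (inj₂ H₁) (inj₂ H₂) = TwoHullSides.contradictory TS non-hub zs⊑ ws⊑ H₁ H₂ uw
            (≤-trans (≤-trans (m≤n+m _ h) (m≤n+m _ (ramseyBound h h))) le-r)

  two-sided-bound : ∀ t → InCtt G t → ∀ {ys} → TwoSides ys → (∀ y → y ∈ ys → ¬ Hub G y) → length ys ≤ coreBound t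
  -- The empty clique is present in every graph, so there is nothing to bound for `t = 0`.
  two-sided-bound zero ((_ , no-clique) , _) TS non-hub = contradiction ((λ ()) , (λ { {()} }) , λ ()) no-clique
  two-sided-bound (suc t′) (((_ , no-theta , no-prism , _) , no-clique) , no-pyramid) {ys} TS non-hub =
    decidable-stable (length ys ≤? coreBound (suc t′)) λ ¬le → Core.too-many t′ no-theta no-prism no-clique (selectBound (suc t′))
      (λ CP u le → no-pyramid (Selection.select CP u (suc t′) le)) TS non-hub (<⇒≤ (≰⇒> ¬le))

-- From subsets to lists, and the theorem.

elements : ∀ {n} → Subset n → List (Fin n)
elements [] = []
elements (true ∷ Y) = F.zero ∷ map F.suc (elements Y)
elements (false ∷ Y) = map F.suc (elements Y)

length-elements : ∀ {n} (Y : Subset n) → length (elements Y) ≡ ∣ Y ∣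
length-elements [] = refl
length-elements (true ∷ Y) = cong suc (trans (Listₚ.length-map F.suc (elements Y)) (length-elements Y))
length-elements (false ∷ Y) = trans (Listₚ.length-map F.suc (elements Y)) (length-elements Y)

elements-sound : ∀ {n} (Y : Subset n) y → y ∈ elements Y → y ∈ₛ Y
elements-sound (true ∷ Y) _ (here refl) = Vec.here
elements-sound (true ∷ Y) y (there y∈) with ∈ₚ.∈-map⁻ F.suc y∈
... | z , z∈ , refl = Vec.there (elements-sound Y z z∈)
elements-sound (false ∷ Y) y y∈ with ∈ₚ.∈-map⁻ F.suc y∈
... | z , z∈ , refl = Vec.there (elements-sound Y z z∈)

elements-unique : ∀ {n} (Y : Subset n) → AllPairs _≢_ (elements Y)
elements-unique [] = []
elements-unique (true ∷ Y) = All.tabulate (λ y∈ e → zero∉ (subst (_∈ _) (sym e) y∈)) ∷ AllPairsₚ.map⁺ (AllPairs.map (λ ne e → ne (Fₚ.suc-injective e)) (elements-unique Y))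
  where
  zero∉ : F.zero ∉ map F.suc (elements Y)
  zero∉ z∈ with ∈ₚ.∈-map⁻ F.suc z∈
  ... | _ , _ , ()
elements-unique (false ∷ Y) = AllPairsₚ.map⁺ (AllPairs.map (λ ne e → ne (Fₚ.suc-injective e)) (elements-unique Y))

theorem6p3 : ∀ (t : ℕ) → ∃ λ (τ : ℕ) →
    ∀ {n m : ℕ} (G : Graph n) → InCtt G t →
    (T : Graph m) (χ : Fin m → Subset n) → StructuredTD G T χ →
    (v : Fin m) (Y : Subset n) → Y ⊆ χ v → Stable G Y →
    (∀ y → y ∈ₛ Y → ¬ Hub G y) →
    ∣ Y ∣ ≤ 4 * τ
-- `coreBound t` bounds the labels attached to one component. The successor ensures that a larger
-- set has two distinct labels to start from even if this bound is 0.
theorem6p3 t = suc (coreBound t) , λ G inC T χ (_ , pmc) v Y Y⊆ stable non-hub →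
  subst (_≤ 4 * suc (coreBound t)) (length-elements Y)
    (OneGraph.StableSetInPMC.stable-bound G (proj₁ (proj₂ (proj₁ (proj₁ inC)))) (χ v) (pmc v) (elements Y) (elements-unique Y)
      (λ y y∈ → Y⊆ (elements-sound Y y y∈)) (λ x y x∈ y∈ → stable x y (elements-sound Y x x∈) (elements-sound Y y y∈)) (coreBound t)
      λ zs sub TS → OneGraph.two-sided-bound G t inC TS λ y y∈ → non-hub y (elements-sound Y y (sub y y∈)))
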